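{- For every fixed integer $d \geq 3$, the Generalized Regret-Minimizing Representative (GRMR) problem in $\mathbb{R}^d$ is NP-hard: given a finite point set $P \subset \mathbb{R}^d$ satisfying the standing condition below and a real number $\varepsilon \in (0,1)$, it is NP-hard to compute a minimum-cardinality $\varepsilon$-regret set of $P$.
   Context: A database is a finite set $P \subset \mathbb{R}^d$ of $n$ points (tuples) whose coordinates are normalized to $[-1,1]$. For a unit vector $x \in \mathbb{S}^{d-1} = \{x \in \mathbb{R}^d : \|x\| = 1\}$ and a finite set $Q$, let $\omega(x,Q) = \max_{p \in Q} \langle p, x\rangle$. Standing condition: $\omega(x,P) > 0$ for every $x \in \mathbb{S}^{d-1}$ (equivalently, the origin is an interior point of the convex hull of $P$). For $Q \subseteq P$, the regret ratio w.r.t. $x$ is $l_x(Q) = 1 - \omega(x,Q)/\omega(x,P)$, and the maximum regret ratio is $l(Q) = \max_{x \in \mathbb{S}^{d-1}} l_x(Q)$. A subset $Q \subseteq P$ is an $\varepsilon$-regret set of $P$ if $l(Q) \leq \varepsilon$. GRMR asks, given $P$ and $\varepsilon \in (0,1)$, for an $\varepsilon$-regret set of $P$ of minimum cardinality. -}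

module Defs where

open import Data.Bool.Base using (Bool; true; false)
open import Data.Empty using (⊥; ⊥-elim)
open import Data.Fin.Base using (Fin)
open import Data.Integer.Base as ℤ using (ℤ; -[1+_])
open import Data.List.Base as List using (List; []; _∷_; _++_)
open import Data.List.Membership.Propositional using (_∈_)
open import Data.List.NonEmpty.Base as List⁺ using (List⁺; _∷_; toList)
open import Data.List.Relation.Binary.Subset.Propositional using (_⊆_)
open import Data.List.Relation.Unary.Unique.Propositional using (Unique)
open import Data.Maybe.Base using (Maybe; just; nothing)
open import Data.Nat.Base as ℕ using (ℕ; zero; suc)
import Data.Nat.Properties as ℕ
open import Data.Nat.Binary.Base using (ℕᵇ; 2[1+_]; 1+[2_]; fromℕ)
open import Data.Product using (Σ; _×_; _,_; proj₁; proj₂; ∃-syntax)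
open import Data.Rational.Base as ℚ
  using (ℚ; 0ℚ; 1ℚ; _≤_; _<_; _+_; _*_; _-_; -_; _⊔_; ∣_∣; 1/_; Positive)
import Data.Rational.Properties as ℚ
open import Data.Rational.Solver using (module +-*-Solver)
open import Data.Sum.Base using (inj₁; inj₂)
open import Data.Unit.Base using (⊤)
open import Data.Vec.Base as Vec using (Vec; []; _∷_)
open import Data.Vec.Relation.Unary.All using (All)
open import Function.Base using (_∘_)
open import Function.Bundles using (_⇔_)
open import Level using (0ℓ)
open import Relation.Binary.PropositionalEquality
open import Relation.Unary using (Pred)

IsCauchy : (ℕ → ℚ) → Set
IsCauchy x = ∀ ε → 0ℚ < ε →
  ∃[ N ] (∀ m n → N ℕ.≤ m → N ℕ.≤ n → ∣ x m - x n ∣ ≤ ε)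

-- Cauchy sequences; equality of real numbers is _≈ᴿ_.
record ℝ : Set where
  field
    seq    : ℕ → ℚ
    cauchy : IsCauchy seq

open ℝ

infix 4 _≤ᴿ_ _<ᴿ_ _≈ᴿ_

_≤ᴿ_ _<ᴿ_ _≈ᴿ_ : ℝ → ℝ → Set
x ≤ᴿ y = ∀ δ → 0ℚ < δ → ∃[ N ] (∀ n → N ℕ.≤ n → seq x n ≤ seq y n + δ)
x <ᴿ y = ∃[ δ ] 0ℚ < δ × ∃[ N ] (∀ n → N ℕ.≤ n → seq x n + δ ≤ seq y n)
x ≈ᴿ y = x ≤ᴿ y × y ≤ᴿ x

module _ where
  open ℚ.≤-Reasoning
  open +-*-Solver

  p≤∣p∣ : ∀ p → p ≤ ∣ p ∣
  p≤∣p∣ p with ℚ.≤-total 0ℚ p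
  ... | inj₁ 0≤p = ℚ.≤-reflexive (sym (ℚ.0≤p⇒∣p∣≡p 0≤p))
  ... | inj₂ p≤0 = ℚ.≤-trans p≤0 (ℚ.0≤∣p∣ p)

  ∣-∣-intro : ∀ p q e → p ≤ q + e → q ≤ p + e → ∣ p - q ∣ ≤ e
  ∣-∣-intro p q e p≤ q≤ with ℚ.∣p∣≡p∨∣p∣≡-p (p - q)
  ... | inj₁ eq = begin
    ∣ p - q ∣  ≡⟨ eq ⟩
    p - q      ≤⟨ ℚ.+-monoˡ-≤ (- q) p≤ ⟩
    q + e - q  ≡⟨ solve 2 (λ q e → q :+ e :- q := e) refl q e ⟩
    e          ∎
  ... | inj₂ eq = begin
    ∣ p - q ∣  ≡⟨ eq ⟩
    - (p - q)  ≡⟨ solve 2 (λ p q → :- (p :- q) := q :- p) refl p q ⟩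
    q - p      ≤⟨ ℚ.+-monoˡ-≤ (- p) q≤ ⟩
    p + e - p  ≡⟨ solve 2 (λ q e → q :+ e :- q := e) refl p e ⟩
    e          ∎

  ∣-∣-elim : ∀ p q e → ∣ p - q ∣ ≤ e → p ≤ q + e
  ∣-∣-elim p q e h = begin
    p            ≡⟨ solve 2 (λ p q → p := q :+ (p :- q)) refl p q ⟩
    q + (p - q)  ≤⟨ ℚ.+-monoʳ-≤ q (ℚ.≤-trans (p≤∣p∣ (p - q)) h) ⟩
    q + e        ∎

  ∣-∣-+ : ∀ a b c d e → ∣ a - c ∣ ≤ e → ∣ b - d ∣ ≤ e →
    ∣ (a + b) - (c + d) ∣ ≤ (1ℚ + 1ℚ) * e
  ∣-∣-+ a b c d e a-c≤e b-d≤e = begin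
    ∣ (a + b) - (c + d) ∣  ≡⟨ cong ∣_∣ (lemma a b c d) ⟩
    ∣ (a - c) + (b - d) ∣  ≤⟨ ℚ.∣p+q∣≤∣p∣+∣q∣ (a - c) (b - d) ⟩
    ∣ a - c ∣ + ∣ b - d ∣  ≤⟨ ℚ.+-mono-≤ a-c≤e b-d≤e ⟩
    e + e                  ≡⟨ cong₂ _+_ (ℚ.*-identityˡ e) (ℚ.*-identityˡ e) ⟨
    1ℚ * e + 1ℚ * e        ≡⟨ ℚ.*-distribʳ-+ e 1ℚ 1ℚ ⟨
    (1ℚ + 1ℚ) * e          ∎
    where
    lemma : ∀ a b c d → (a + b) - (c + d) ≡ (a - c) + (b - d)
    lemma = solve 4 (λ a b c d → (a :+ b) :- (c :+ d) := (a :- c) :+ (b :- d)) refl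

  ∣-∣-neg : ∀ a b → ∣ - a - - b ∣ ≡ ∣ b - a ∣
  ∣-∣-neg a b = cong ∣_∣ (solve 2 (λ a b → :- a :- :- b := b :- a) refl a b)

  ⊔-bound : ∀ a b c d e → a ≤ c + e → b ≤ d + e → a ⊔ b ≤ (c ⊔ d) + e
  ⊔-bound a b c d e a≤ b≤ = ℚ.⊔-lub
    (ℚ.≤-trans a≤ (ℚ.+-monoˡ-≤ e (ℚ.p≤p⊔q c d)))
    (ℚ.≤-trans b≤ (ℚ.+-monoˡ-≤ e (ℚ.p≤q⊔p c d)))

  ∣-∣-sym : ∀ p q → ∣ p - q ∣ ≡ ∣ q - p ∣
  ∣-∣-sym p q = trans (sym (ℚ.∣-p∣≡∣p∣ (p - q)))
    (cong ∣_∣ (solve 2 (λ p q → :- (p :- q) := q :- p) refl p q))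

  ∣-∣-⊔ : ∀ a b c d e → ∣ a - c ∣ ≤ e → ∣ b - d ∣ ≤ e → ∣ (a ⊔ b) - (c ⊔ d) ∣ ≤ e
  ∣-∣-⊔ a b c d e ac bd = ∣-∣-intro (a ⊔ b) (c ⊔ d) e
    (⊔-bound a b c d e (∣-∣-elim a c e ac) (∣-∣-elim b d e bd))
    (⊔-bound c d a b e
      (∣-∣-elim c a e (subst (_≤ e) (∣-∣-sym a c) ac))
      (∣-∣-elim d b e (subst (_≤ e) (∣-∣-sym b d) bd)))

  ∣*∣-bound : ∀ a b A B → ∣ a ∣ ≤ A → ∣ b ∣ ≤ B → ∣ a * b ∣ ≤ A * B
  ∣*∣-bound a b A B a≤A b≤B = begin
    ∣ a * b ∣      ≡⟨ ℚ.∣p*q∣≡∣p∣*∣q∣ a b ⟩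
    ∣ a ∣ * ∣ b ∣  ≤⟨ ℚ.*-monoʳ-≤-nonNeg ∣ b ∣ {{ℚ.∣-∣-nonNeg b}} a≤A ⟩
    A * ∣ b ∣      ≤⟨ ℚ.*-monoˡ-≤-nonNeg A {{ℚ.nonNegative (ℚ.≤-trans (ℚ.0≤∣p∣ a) a≤A)}} b≤B ⟩
    A * B          ∎

  ∣-∣-* : ∀ a b c d A B e → ∣ a ∣ ≤ A → ∣ d ∣ ≤ B → ∣ a - c ∣ ≤ e → ∣ b - d ∣ ≤ e →
    ∣ a * b - c * d ∣ ≤ (A + B) * e
  ∣-∣-* a b c d A B e a≤A d≤B a-c≤e b-d≤e = begin
    ∣ a * b - c * d ∣                  ≡⟨ cong ∣_∣ (lemma a b c d) ⟩
    ∣ a * (b - d) + d * (a - c) ∣      ≤⟨ ℚ.∣p+q∣≤∣p∣+∣q∣ (a * (b - d)) (d * (a - c)) ⟩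
    ∣ a * (b - d) ∣ + ∣ d * (a - c) ∣  ≤⟨ ℚ.+-mono-≤ (∣*∣-bound a (b - d) A e a≤A b-d≤e)
                                                     (∣*∣-bound d (a - c) B e d≤B a-c≤e) ⟩
    A * e + B * e                      ≡⟨ ℚ.*-distribʳ-+ e A B ⟨
    (A + B) * e                        ∎
    where
    lemma : ∀ a b c d → a * b - c * d ≡ a * (b - d) + d * (a - c)
    lemma = solve 4 (λ a b c d → a :* b :- c :* d := a :* (b :- d) :+ d :* (a :- c)) refl

  -- It suffices to bound the oscillation by a constant multiple of e.
  scaled : ∀ x C .{{_ : Positive C}} →
    (∀ e → 0ℚ < e → ∃[ N ] (∀ m n → N ℕ.≤ m → N ℕ.≤ n → ∣ x m - x n ∣ ≤ C * e)) →
    IsCauchy x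
  scaled x C h ε 0<ε = proj₁ h′ , λ m n N≤m N≤n → begin
      ∣ x m - x n ∣   ≤⟨ proj₂ h′ m n N≤m N≤n ⟩
      C * (1/C * ε)   ≡⟨ ℚ.*-assoc C 1/C ε ⟨
      C * 1/C * ε     ≡⟨ cong (_* ε) (ℚ.*-inverseʳ C {{ℚ.pos⇒nonZero C}}) ⟩
      1ℚ * ε          ≡⟨ ℚ.*-identityˡ ε ⟩
      ε               ∎
    where
    1/C : ℚ
    1/C = (1/ C) {{ℚ.pos⇒nonZero C}}
    h′ : ∃[ N ] (∀ m n → N ℕ.≤ m → N ℕ.≤ n → ∣ x m - x n ∣ ≤ C * (1/C * ε))
    h′ = h (1/C * ε) (ℚ.positive⁻¹ (1/C * ε)
           {{ℚ.pos*pos⇒pos 1/C {{ℚ.1/pos⇒pos C}} ε {{ℚ.positive 0<ε}}}})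

  +-cauchy : ∀ x y → IsCauchy x → IsCauchy y → IsCauchy (λ n → x n + y n)
  +-cauchy x y cx cy = scaled (λ n → x n + y n) (1ℚ + 1ℚ) bound
    where
    bound : ∀ e → 0ℚ < e → ∃[ N ] (∀ m n → N ℕ.≤ m → N ℕ.≤ n →
      ∣ (x m + y m) - (x n + y n) ∣ ≤ (1ℚ + 1ℚ) * e)
    bound e 0<e with cx e 0<e | cy e 0<e
    ... | M , hx | N , hy = M ℕ.⊔ N , λ m n ≤m ≤n →
      ∣-∣-+ (x m) (y m) (x n) (y n) e
        (hx m n (ℕ.m⊔n≤o⇒m≤o M N ≤m) (ℕ.m⊔n≤o⇒m≤o M N ≤n))
        (hy m n (ℕ.m⊔n≤o⇒n≤o M N ≤m) (ℕ.m⊔n≤o⇒n≤o M N ≤n))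

  neg-cauchy : ∀ x → IsCauchy x → IsCauchy (λ n → - x n)
  neg-cauchy x cx ε 0<ε with cx ε 0<ε
  ... | N , hx = N , λ m n ≤m ≤n →
    subst (_≤ ε) (sym (∣-∣-neg (x m) (x n))) (hx n m ≤n ≤m)

  ⊔-cauchy : ∀ x y → IsCauchy x → IsCauchy y → IsCauchy (λ n → x n ⊔ y n)
  ⊔-cauchy x y cx cy ε 0<ε with cx ε 0<ε | cy ε 0<ε
  ... | M , hx | N , hy = M ℕ.⊔ N , λ m n ≤m ≤n →
    ∣-∣-⊔ (x m) (y m) (x n) (y n) ε
      (hx m n (ℕ.m⊔n≤o⇒m≤o M N ≤m) (ℕ.m⊔n≤o⇒m≤o M N ≤n))
      (hy m n (ℕ.m⊔n≤o⇒n≤o M N ≤m) (ℕ.m⊔n≤o⇒n≤o M N ≤n))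

  EventuallyBounded : (ℕ → ℚ) → ℚ → Set
  EventuallyBounded x B = ∃[ N ] (∀ n → N ℕ.≤ n → ∣ x n ∣ ≤ B)

  bounded : ∀ x → IsCauchy x → Σ ℚ λ B → Positive B × EventuallyBounded x B
  bounded x cx with cx 1ℚ (ℚ.positive⁻¹ 1ℚ)
  ... | N , hx = (∣ x N ∣ + 1ℚ)
    , ℚ.nonNeg+pos⇒pos ∣ x N ∣ {{ℚ.∣-∣-nonNeg (x N)}} 1ℚ
    , N , λ n N≤n → begin
      ∣ x n ∣                ≡⟨ cong ∣_∣ (lemma (x n) (x N)) ⟩
      ∣ x N + (x n - x N) ∣  ≤⟨ ℚ.∣p+q∣≤∣p∣+∣q∣ (x N) (x n - x N) ⟩
      ∣ x N ∣ + ∣ x n - x N ∣  ≤⟨ ℚ.+-monoʳ-≤ ∣ x N ∣ (hx n N N≤n ℕ.≤-refl) ⟩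
      ∣ x N ∣ + 1ℚ           ∎
    where
    lemma : ∀ a b → a ≡ b + (a - b)
    lemma = solve 2 (λ a b → a := b :+ (a :- b)) refl

  bounded*-cauchy : ∀ x y → IsCauchy x → IsCauchy y →
    ∀ A .{{_ : Positive A}} B .{{_ : Positive B}} →
    EventuallyBounded x A → EventuallyBounded y B → IsCauchy (λ n → x n * y n)
  bounded*-cauchy x y cx cy A B (K , x≤A) (L , y≤B) =
    scaled (λ n → x n * y n) (A + B) {{ℚ.pos+pos⇒pos A B}} bound
    where
    bound : ∀ e → 0ℚ < e → ∃[ N ] (∀ m n → N ℕ.≤ m → N ℕ.≤ n →
      ∣ x m * y m - x n * y n ∣ ≤ (A + B) * e)
    bound e 0<e with cx e 0<e | cy e 0<e
    ... | M , hx | N , hy = (K ℕ.⊔ L) ℕ.⊔ (M ℕ.⊔ N) , λ m n ≤m ≤n →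
      let KL≤m = ℕ.m⊔n≤o⇒m≤o (K ℕ.⊔ L) (M ℕ.⊔ N) ≤m
          KL≤n = ℕ.m⊔n≤o⇒m≤o (K ℕ.⊔ L) (M ℕ.⊔ N) ≤n
          MN≤m = ℕ.m⊔n≤o⇒n≤o (K ℕ.⊔ L) (M ℕ.⊔ N) ≤m
          MN≤n = ℕ.m⊔n≤o⇒n≤o (K ℕ.⊔ L) (M ℕ.⊔ N) ≤n
      in ∣-∣-* (x m) (y m) (x n) (y n) A B e
        (x≤A m (ℕ.m⊔n≤o⇒m≤o K L KL≤m))
        (y≤B n (ℕ.m⊔n≤o⇒n≤o K L KL≤n))
        (hx m n (ℕ.m⊔n≤o⇒m≤o M N MN≤m) (ℕ.m⊔n≤o⇒m≤o M N MN≤n))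
        (hy m n (ℕ.m⊔n≤o⇒n≤o M N MN≤m) (ℕ.m⊔n≤o⇒n≤o M N MN≤n))

  *-cauchy : ∀ x y → IsCauchy x → IsCauchy y → IsCauchy (λ n → x n * y n)
  *-cauchy x y cx cy =
    let (A , A>0 , x≤A) = bounded x cx
        (B , B>0 , y≤B) = bounded y cy
    in bounded*-cauchy x y cx cy A {{A>0}} B {{B>0}} x≤A y≤B

  module _ (δ : ℚ) .{{δ>0 : Positive δ}} where

    ⊔-pos : ∀ p → Positive (p ⊔ δ)
    ⊔-pos p = ℚ.positive (ℚ.<-≤-trans (ℚ.positive⁻¹ δ) (ℚ.p≤q⊔p p δ))

    -- Agrees with 1 / p as soon as δ ≤ p.
    recip : ℚ → ℚ
    recip p = (1/ (p ⊔ δ)) {{ℚ.pos⇒nonZero (p ⊔ δ) {{⊔-pos p}}}}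

    1/δ : ℚ
    1/δ = (1/ δ) {{ℚ.pos⇒nonZero δ}}

    1/δ-pos : Positive 1/δ
    1/δ-pos = ℚ.1/pos⇒pos δ

    recip-pos : ∀ p → Positive (recip p)
    recip-pos p = ℚ.1/pos⇒pos (p ⊔ δ) {{⊔-pos p}}

    recip-inverse : ∀ p → (p ⊔ δ) * recip p ≡ 1ℚ
    recip-inverse p = ℚ.*-inverseʳ (p ⊔ δ) {{ℚ.pos⇒nonZero (p ⊔ δ) {{⊔-pos p}}}}

    recip-bound : ∀ p → ∣ recip p ∣ ≤ 1/δ
    recip-bound p = begin
      ∣ r ∣                ≡⟨ ℚ.0≤p⇒∣p∣≡p (ℚ.<⇒≤ (ℚ.positive⁻¹ r {{recip-pos p}})) ⟩
      r                    ≡⟨ ℚ.*-identityʳ r ⟨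
      r * 1ℚ               ≡⟨ cong (r *_) (ℚ.*-inverseʳ δ {{ℚ.pos⇒nonZero δ}}) ⟨
      r * (δ * 1/δ)        ≤⟨ ℚ.*-monoˡ-≤-nonNeg r {{ℚ.pos⇒nonNeg r {{recip-pos p}}}}
                              (ℚ.*-monoʳ-≤-nonNeg 1/δ {{ℚ.pos⇒nonNeg 1/δ {{1/δ-pos}}}}
                                (ℚ.p≤q⊔p p δ)) ⟩
      r * ((p ⊔ δ) * 1/δ)  ≡⟨ lemma r (p ⊔ δ) 1/δ ⟩
      (p ⊔ δ) * r * 1/δ    ≡⟨ cong (_* 1/δ) (recip-inverse p) ⟩
      1ℚ * 1/δ             ≡⟨ ℚ.*-identityˡ 1/δ ⟩
      1/δ                  ∎
      where
      r : ℚ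
      r = recip p
      lemma : ∀ r q d → r * (q * d) ≡ q * r * d
      lemma = solve 3 (λ r q d → r :* (q :* d) := q :* r :* d) refl

    recip-difference : ∀ p q →
      recip p - recip q ≡ (recip p * recip q) * ((q ⊔ δ) - (p ⊔ δ))
    recip-difference p q = begin-equality
      r - s                                    ≡⟨ cong₂ _-_ (ℚ.*-identityʳ r) (ℚ.*-identityʳ s) ⟨
      r * 1ℚ - s * 1ℚ                          ≡⟨ cong₂ (λ u v → r * u - s * v)
                                                    (recip-inverse q) (recip-inverse p) ⟨
      r * ((q ⊔ δ) * s) - s * ((p ⊔ δ) * r)    ≡⟨ lemma r s (p ⊔ δ) (q ⊔ δ) ⟩
      (r * s) * ((q ⊔ δ) - (p ⊔ δ))            ∎
      where
      r s : ℚ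
      r = recip p
      s = recip q
      lemma : ∀ r s a b → r * (b * s) - s * (a * r) ≡ (r * s) * (b - a)
      lemma = solve 4 (λ r s a b → r :* (b :* s) :- s :* (a :* r) := (r :* s) :* (b :- a)) refl

    recip-lipschitz : ∀ p q e → 0ℚ < e → ∣ p - q ∣ ≤ e →
      ∣ recip p - recip q ∣ ≤ 1/δ * 1/δ * e
    recip-lipschitz p q e 0<e p-q≤e =
      subst (λ z → ∣ z ∣ ≤ 1/δ * 1/δ * e) (sym (recip-difference p q))
        (∣*∣-bound (recip p * recip q) ((q ⊔ δ) - (p ⊔ δ)) (1/δ * 1/δ) e
          (∣*∣-bound (recip p) (recip q) 1/δ 1/δ (recip-bound p) (recip-bound q))
          (∣-∣-⊔ q δ p δ e (subst (_≤ e) (∣-∣-sym p q) p-q≤e)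
            (subst (_≤ e) (sym (cong ∣_∣ (ℚ.+-inverseʳ δ))) (ℚ.<⇒≤ 0<e))))

    recip-cauchy : ∀ x → IsCauchy x → IsCauchy (λ n → recip (x n))
    recip-cauchy x cx = scaled (λ n → recip (x n)) (1/δ * 1/δ)
      {{ℚ.pos*pos⇒pos 1/δ {{1/δ-pos}} 1/δ {{1/δ-pos}}}} bound
      where
      bound : ∀ e → 0ℚ < e → ∃[ N ] (∀ m n → N ℕ.≤ m → N ℕ.≤ n →
        ∣ recip (x m) - recip (x n) ∣ ≤ 1/δ * 1/δ * e)
      bound e 0<e with cx e 0<e
      ... | N , h = N , λ m n N≤m N≤n → recip-lipschitz (x m) (x n) e 0<e (h m n N≤m N≤n)

fromℚ : ℚ → ℝ
fromℚ q = record
  { seq    = λ _ → q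
  ; cauchy = λ ε 0<ε → 0 , λ _ _ _ _ →
      subst (_≤ ε) (sym (cong ∣_∣ (ℚ.+-inverseʳ q))) (ℚ.<⇒≤ 0<ε)
  }

0ᴿ 1ᴿ : ℝ
0ᴿ = fromℚ 0ℚ
1ᴿ = fromℚ 1ℚ

infixl 7 _*ᴿ_
infixl 6 _+ᴿ_ _-ᴿ_ _⊔ᴿ_

_+ᴿ_ _-ᴿ_ _*ᴿ_ _⊔ᴿ_ : ℝ → ℝ → ℝ
x +ᴿ y = record { seq = λ n → seq x n + seq y n ; cauchy = +-cauchy (seq x) (seq y) (cauchy x) (cauchy y) }
x -ᴿ y = record { seq = λ n → seq x n - seq y n
                ; cauchy = +-cauchy (seq x) (λ n → - seq y n) (cauchy x) (neg-cauchy (seq y) (cauchy y)) }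
x *ᴿ y = record { seq = λ n → seq x n * seq y n ; cauchy = *-cauchy (seq x) (seq y) (cauchy x) (cauchy y) }
x ⊔ᴿ y = record { seq = λ n → seq x n ⊔ seq y n ; cauchy = ⊔-cauchy (seq x) (seq y) (cauchy x) (cauchy y) }

inverse : (x : ℝ) → 0ᴿ <ᴿ x → ℝ
inverse x (δ , 0<δ , _) = record
  { seq    = λ n → recip δ {{ℚ.positive 0<δ}} (seq x n)
  ; cauchy = recip-cauchy δ {{ℚ.positive 0<δ}} (seq x) (cauchy x)
  }

*-inverse : ∀ x (0<x : 0ᴿ <ᴿ x) → x *ᴿ inverse x 0<x ≈ᴿ 1ᴿ
*-inverse x (δ , 0<δ , N , δ≤x) =
    (λ e 0<e → N , λ n N≤n → ℚ.≤-trans (ℚ.≤-reflexive (eq n N≤n)) (weaken e 0<e))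
  , (λ e 0<e → N , λ n N≤n →
      subst (λ z → 1ℚ ≤ z + e) (sym (eq n N≤n)) (weaken e 0<e))
  where
  weaken : ∀ e → 0ℚ < e → 1ℚ ≤ 1ℚ + e
  weaken e 0<e = ℚ.+-monoʳ-≤ 1ℚ (ℚ.<⇒≤ 0<e)
  δ≤ : ∀ n → N ℕ.≤ n → δ ≤ seq x n
  δ≤ n N≤n = subst (_≤ seq x n) (ℚ.+-identityˡ δ) (δ≤x n N≤n)
  eq : ∀ n → N ℕ.≤ n → seq x n * recip δ {{ℚ.positive 0<δ}} (seq x n) ≡ 1ℚ
  eq n N≤n = trans
    (cong (_* recip δ {{ℚ.positive 0<δ}} (seq x n)) (sym (ℚ.p≥q⇒p⊔q≡p (δ≤ n N≤n))))
    (recip-inverse δ {{ℚ.positive 0<δ}} (seq x n))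

Point : ℕ → Set
Point d = Vec ℝ d

⟨_,_⟩ : ∀ {d} → Point d → Point d → ℝ
⟨ p , x ⟩ = Vec.foldr′ _+ᴿ_ 0ᴿ (Vec.zipWith _*ᴿ_ p x)

-- ‖x‖ = 1 is the same condition as ‖x‖² = 1.
record Sphere (d : ℕ) : Set where
  field
    vector : Point d
    unit   : ⟨ vector , vector ⟩ ≈ᴿ 1ᴿ

open Sphere

-- Nonempty lists, since the maximum over the empty set is not a real number.
ω : ∀ {d} → Sphere d → List⁺ (Point d) → ℝ
ω x (p ∷ ps) = List.foldr _⊔ᴿ_ ⟨ p , vector x ⟩ (List.map ⟨_, vector x ⟩ ps)

Standing : ∀ {d} → List⁺ (Point d) → Set
Standing {d} P = (x : Sphere d) → 0ᴿ <ᴿ ω x P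

regretRatio : ∀ {d} (P : List⁺ (Point d)) → Standing P → List⁺ (Point d) → Sphere d → ℝ
regretRatio P standing Q x = 1ᴿ -ᴿ ω x Q *ᴿ inverse (ω x P) (standing x)

-- A maximum is at most ε exactly when all the values are.
MaximumRegretRatio≤ : ∀ {d} (P : List⁺ (Point d)) → Standing P → List⁺ (Point d) → ℝ → Set
MaximumRegretRatio≤ {d} P standing Q ε = (x : Sphere d) → regretRatio P standing Q x ≤ᴿ ε

Word : Set
Word = List Bool

Symbol : Set
Symbol = Maybe Bool

blank : Symbol
blank = nothing

data Direction : Set where
  left stay right : Direction

-- A two-way infinite tape: `before` lists the cells to the left of the head,
-- nearest first, and all cells not listed are blank.
record Tape : Set where
  constructor tape
  field
    before  : List Symbol
    current : Symbol
    after   : List Symbol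

writeWord : Word → Tape
writeWord []      = tape [] blank []
writeWord (b ∷ w) = tape [] (just b) (List.map just w)

-- The word that starts under the head and ends before the first blank.
readWord : Tape → Word
readWord (tape _ c after) = go (c ∷ after)
  where
  go : List Symbol → Word
  go (just b ∷ cs) = b ∷ go cs
  go _             = []

act : Symbol × Direction → Tape → Tape
act (s , stay)  (tape ls _ rs)       = tape ls s rs
act (s , left)  (tape [] _ rs)       = tape [] blank (s ∷ rs)
act (s , left)  (tape (l ∷ ls) _ rs) = tape ls l (s ∷ rs)
act (s , right) (tape ls _ [])       = tape (s ∷ ls) blank []
act (s , right) (tape ls _ (r ∷ rs)) = tape (s ∷ ls) r rs

-- What a machine does in a given state; `I` names the oracles it can query.
data Command (I : Set) (states tapes : ℕ) : Set where
  halt : Bool → Command I states tapes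
  move : (Vec Symbol tapes → Fin states × Vec (Symbol × Direction) tapes) → Command I states tapes
  ask  : I → Fin states → Command I states tapes

-- Tapes 0 and 1 hold the two inputs; tape 1 is also the query tape.
record Machine (I : Set) : Set where
  field
    states workTapes : ℕ
    initial          : Fin states
    command          : Fin states → Command I states (2 ℕ.+ workTapes)

module _ {I : Set} (M : Machine I) (O : I → Word → Word) where
  open Machine M

  Tapes : Set
  Tapes = Vec Tape (2 ℕ.+ workTapes)

  reply : I → Tapes → Tapes
  reply i (t ∷ query ∷ ts) = t ∷ writeWord (O i (readWord query)) ∷ ts

  -- The first argument bounds the number of steps.
  runFrom : ℕ → Fin states → Tapes → Maybe Bool
  runFrom n q ts with command q
  runFrom n       q ts | halt b    = just b
  runFrom zero    q ts | move f    = nothing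
  runFrom zero    q ts | ask i q′  = nothing
  runFrom (suc n) q ts | move f    =
    let (q′ , actions) = f (Vec.map Tape.current ts)
    in runFrom n q′ (Vec.zipWith act actions ts)
  runFrom (suc n) q ts | ask i q′  = runFrom n q′ (reply i ts)

  run : ℕ → Word → Word → Maybe Bool
  run n v w = runFrom n initial
    (writeWord v ∷ writeWord w ∷ Vec.replicate workTapes (writeWord []))

-- The functions poly c are cofinal among the polynomials with coefficients in ℕ.
poly : ℕ → ℕ → ℕ
poly c n = n ℕ.^ c ℕ.+ c

Language : Set₁
Language = Pred Word 0ℓ

-- Certificates y are polynomially bounded in w; the verifier has w on tape 0 and
-- y on tape 1.
record NP (L : Language) : Set where
  field
    verifier     : Machine ⊥
    timeExponent : ℕ
    certExponent : ℕ

  bound : ℕ → ℕ → ℕ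
  bound m n = poly timeExponent (m ℕ.+ n)

  verdict : Word → Word → Maybe Bool
  verdict w y = run verifier ⊥-elim (bound (List.length w) (List.length y)) w y

  field
    halts   : ∀ w y → ∃[ b ] verdict w y ≡ just b
    correct : ∀ w → L w ⇔
      (∃[ y ] List.length y ℕ.≤ poly certExponent (List.length w) × verdict w y ≡ just true)

record SearchProblem : Set₁ where
  field
    Instance       : Set
    Solution       : Set
    IsSolution     : Instance → Solution → Set
    encodeInstance : Instance → Word
    encodeSolution : Solution → Word

-- On words that encode no instance the oracle may answer anything.
Solves : (Word → Word) → SearchProblem → Set
Solves O R = ∀ i → ∃[ s ] IsSolution i s × O (encodeInstance i) ≡ encodeSolution s
  where open SearchProblem R

-- Polynomial-time Turing reductions. One machine and one time bound must work for
-- every oracle that solves R.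
record _≤ᵀ_ (L : Language) (R : SearchProblem) : Set where
  field
    reduction : Machine ⊤
    exponent  : ℕ

  verdict : (Word → Word) → Word → Maybe Bool
  verdict O w = run reduction (λ _ → O) (poly exponent (List.length w)) w []

  field
    halts   : ∀ O → Solves O R → ∀ w → ∃[ b ] verdict O w ≡ just b
    correct : ∀ O → Solves O R → ∀ w → L w ⇔ verdict O w ≡ just true

NPHard : SearchProblem → Set₁
NPHard R = ∀ L → NP L → L ≤ᵀ R

-- Bijective base 2, least significant digit first. Every digit is preceded by true
-- and the end is marked by false, so that codes can be concatenated.
encodeℕᵇ : ℕᵇ → Word
encodeℕᵇ ℕᵇ.zero  = false ∷ []
encodeℕᵇ 2[1+ n ] = true ∷ true ∷ encodeℕᵇ n
encodeℕᵇ 1+[2 n ] = true ∷ false ∷ encodeℕᵇ n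

encodeℤ : ℤ → Word
encodeℤ (ℤ.+ n)  = true ∷ encodeℕᵇ (fromℕ n)
encodeℤ -[1+ n ] = false ∷ encodeℕᵇ (fromℕ n)

encodeℚ : ℚ → Word
encodeℚ q = encodeℤ (ℚ.numerator q) ++ encodeℕᵇ (fromℕ (ℚ.denominator-1 q))

encodeVec : ∀ {d} → Vec ℚ d → Word
encodeVec v = List.concatMap encodeℚ (Vec.toList v)

encodePoints : ∀ {d} → List (Vec ℚ d) → Word
encodePoints []       = false ∷ []
encodePoints (p ∷ ps) = true ∷ encodeVec p ++ encodePoints ps

-- Machines need finite inputs, so points and ε are rational; directions range
-- over the whole real sphere.
embed : ∀ {d} → List⁺ (Vec ℚ d) → List⁺ (Point d)
embed = List⁺.map (Vec.map fromℚ)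

record GRMRInstance (d : ℕ) : Set where
  field
    P          : List⁺ (Vec ℚ d)
    distinct   : Unique (toList P)
    normalized : ∀ {p} → p ∈ toList P → All (λ c → - 1ℚ ≤ c × c ≤ 1ℚ) p
    standing   : Standing (embed P)
    ε          : ℚ
    0<ε        : 0ℚ < ε
    ε<1        : ε < 1ℚ

module _ {d : ℕ} (I : GRMRInstance d) where
  open GRMRInstance I

  -- The empty set is never an ε-regret set, since ε < 1.
  record IsRegretSet (Q : List⁺ (Vec ℚ d)) : Set where
    field
      unique : Unique (toList Q)
      subset : toList Q ⊆ toList P
      regret : MaximumRegretRatio≤ (embed P) standing (embed Q) (fromℚ ε)

  IsMinimumRegretSet : List⁺ (Vec ℚ d) → Set
  IsMinimumRegretSet Q = IsRegretSet Q ×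
    (∀ Q′ → IsRegretSet Q′ → List⁺.length Q ℕ.≤ List⁺.length Q′)

GRMR : ℕ → SearchProblem
GRMR d = record
  { Instance       = GRMRInstance d
  ; Solution       = List⁺ (Vec ℚ d)
  ; IsSolution     = IsMinimumRegretSet
  ; encodeInstance = λ I → encodePoints (toList (GRMRInstance.P I)) ++ encodeℚ (GRMRInstance.ε I)
  ; encodeSolution = encodePoints ∘ toList
  }

-- A computation of an NP verifier is a square tableau of blocks, and a tableau is the same as an
-- assignment satisfying clauses whose literals are all positive or all negative. Given the
-- B positive and the R ∸ B negative clauses in C variables, points are placed on a paraboloid
-- cap along an R × C grid of clauses and variables, with ± unit vectors closing up the hull.
-- Corner, end and axis points cannot be dropped; gap points have to be covered within ε by a
-- neighbour, so each cell needs one of its choice points. A choice covers the gap to the left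
-- or right of the cell in its row and the gap before or after it in its column. Minimum
-- cardinality therefore means one choice per cell: a column propagates the value of its
-- variable, and a row with n cells has n + 1 gaps, so one of its cells must hold a choice that
-- covers both, which exists only for a true literal. The coordinates lie on a lattice of
-- spacing 1/S, where all comparisons become integral, and d > 3 adds only axes.
module Submission where

open import Defs
open import Data.Bool.Base using (Bool; true; false; if_then_else_; not; T)
import Data.Bool.Properties as Bool
open import Data.Empty using (⊥; ⊥-elim)
open import Data.Fin.Base as Fin using (Fin; zero; suc; toℕ)
open import Data.Fin using (#_)
import Data.Fin.Properties as Fin
open import Data.Integer.Base as ℤ using (ℤ; -[1+_])
import Data.Integer.Properties as ℤ
open import Data.List.Base as List using (List; []; _∷_; _++_; length; map; concatMap; reverse; replicate)
import Data.List.Properties as List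
open import Data.List.Membership.Propositional using (_∈_; _∉_)
import Data.List.Membership.Propositional.Properties as ∈
open import Data.List.NonEmpty.Base as List⁺ using (List⁺; _∷_; toList)
open import Data.List.Relation.Unary.All as All using (All; []; _∷_)
import Data.List.Relation.Unary.All.Properties as All
open import Data.List.Relation.Unary.Any as Any using (Any; here; there)
import Data.List.Relation.Unary.Any.Properties as AnyP
open import Data.List.Relation.Unary.AllPairs as AllPairs using (AllPairs; []; _∷_)
open import Data.List.Relation.Unary.Unique.Propositional using (Unique)
import Data.List.Relation.Unary.Unique.Propositional.Properties as Unique
open import Data.List.Relation.Binary.Subset.Propositional using (_⊆_)
open import Data.Maybe.Base as Maybe using (Maybe; just; nothing)
import Data.Maybe.Properties as Maybe
open import Data.Nat.Base using (ℕ; zero; suc; _+_; _*_; _∸_; _^_; _≤_; _<_; _⊔_; z≤n; s≤s; NonZero; _/_; _%_; pred; _<ᵇ_; >-nonZero⁻¹; >-nonZero; _≡ᵇ_)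
import Data.Nat.DivMod as ℕ
import Data.Nat.Divisibility as ℕ
open import Data.Nat.Coprimality using (Coprime; coprime-divisor)
open import Data.Nat.Properties as ℕ using (_≟_; _≤?_; _<?_)
open import Data.Nat.Solver as ℕSolver using ()
open import Data.Nat.Binary.Base using (ℕᵇ; 2[1+_]; 1+[2_]; fromℕ)
import Data.Nat.Binary.Base as ℕᵇ
import Data.Nat.Binary.Properties as ℕᵇ
open import Data.Product using (_×_; _,_; proj₁; proj₂; ∃-syntax; map₂)
open import Data.Rational.Base as ℚ using (ℚ; 0ℚ; 1ℚ; mkℚ)
import Data.Rational.Properties as ℚ
open import Data.Rational.Solver as ℚSolver using ()
open import Data.Integer.Solver as ℤSolver using ()
open import Data.Sum.Base as Sum using (_⊎_; inj₁; inj₂; [_,_]′)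
open import Data.Unit.Base using (⊤; tt)
open import Data.Vec.Base as Vec using (Vec; []; _∷_)
import Data.Vec.Properties as Vec
import Data.Vec.Relation.Unary.All as VecAll
open import Function.Base using (_∘_; id)
open import Function.Bundles using (_⇔_; mk⇔; Equivalence)
open import Relation.Binary.Definitions using (DecidableEquality)
open import Relation.Binary.PropositionalEquality
open import Relation.Nullary using (¬_; Dec; yes; no; contradiction)
open import Relation.Nullary.Decidable as Dec using (does; True; toWitness; _×-dec_; _→-dec_; _⊎-dec_; ¬?)
open import Data.Rational.Unnormalised.Base using (*≡*)
import Data.Rational.Unnormalised.Properties as ℚᵘ

-- An oracle is constrained only on exact encodings of instances, and an encoded rational is in
-- lowest terms. The machine must therefore print reduced fractions without computing common
-- divisors. This is why the cap points and the tolerance are shifted by small multiples of 1/S² or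
-- 1/S⁴: all their numerators become 1 modulo S, over powers of S. The tolerance is about 220/S².
-- Whether a point is covered depends on an integer, its `power`: height minus squared distance from
-- a chosen centre. Covering combinations lose at most 206.25 units of power, while a point that
-- should not cover lies at least 221 units below. With S = 32 M² and M above all positions, the
-- error made by using a rational unit normal is at most a quarter of a unit, so the integers
-- decide. Columns transmit values in one direction only: going down a column, a value may turn from
-- false to true but not back. Hence the clauses of unmixed sign, with the positive ones first: the
-- assignment is read at the last positive row, where true literals from above have survived and
-- false literals from below are already false.

-- Structured programs and their compilation to machines.

Store : Set
Store = ℕ → Tape

setTape : ℕ → Tape → Store → Store
setTape τ t σ i with i ≟ τ
... | yes _ = t
... | no  _ = σ i

setTape-same : ∀ τ t σ → setTape τ t σ τ ≡ t
setTape-same τ t σ with τ ≟ τ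
... | yes _  = refl
... | no τ≢τ = contradiction refl τ≢τ

setTape-other : ∀ τ t σ i → i ≢ τ → setTape τ t σ i ≡ σ i
setTape-other τ t σ i i≢τ with i ≟ τ
... | yes i≡τ = contradiction i≡τ i≢τ
... | no  _   = refl

infixr 5 _⨾_

data Prog : Set where
  step   : ℕ → (Symbol → Symbol × Direction) → Prog
  _⨾_    : Prog → Prog → Prog
  while  : ℕ → (Symbol → Bool) → Prog → Prog
  branch : ℕ → (Symbol → Bool) → Prog → Prog → Prog
  query  : Prog

currentAt : Store → ℕ → Symbol
currentAt σ τ = Tape.current (σ τ)

-- Big-step semantics with exact step counts. A test costs one step of its own because the compiled
-- machine spends a `move` on it that writes every symbol back.
data Exec (O : Word → Word) : Prog → Store → ℕ → Store → Set where
  step : ∀ {τ f σ} → Exec O (step τ f) σ 1 (setTape τ (act (f (currentAt σ τ)) (σ τ)) σ)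
  compose : ∀ {P Q σ σ′ σ″ m n} → Exec O P σ m σ′ → Exec O Q σ′ n σ″ → Exec O (P ⨾ Q) σ (m + n) σ″
  while-false : ∀ {τ b P σ} → b (currentAt σ τ) ≡ false → Exec O (while τ b P) σ 1 σ
  while-true : ∀ {τ b P σ σ′ σ″ m n} → b (currentAt σ τ) ≡ true →
    Exec O P σ m σ′ → Exec O (while τ b P) σ′ n σ″ → Exec O (while τ b P) σ (suc (m + n)) σ″
  branch-true : ∀ {τ b P Q σ σ′ m} → b (currentAt σ τ) ≡ true →
    Exec O P σ m σ′ → Exec O (branch τ b P Q) σ (suc m) σ′
  branch-false : ∀ {τ b P Q σ σ′ m} → b (currentAt σ τ) ≡ false →
    Exec O Q σ m σ′ → Exec O (branch τ b P Q) σ (suc m) σ′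
  query : ∀ {σ} → Exec O query σ 1 (setTape 1 (writeWord (O (readWord (σ 1)))) σ)

tapeCount : Prog → ℕ
tapeCount (step τ _)       = suc τ
tapeCount (P ⨾ Q)          = tapeCount P ⊔ tapeCount Q
tapeCount (while τ _ P)    = suc τ ⊔ tapeCount P
tapeCount (branch τ _ P Q) = suc τ ⊔ (tapeCount P ⊔ tapeCount Q)
tapeCount query            = 2

-- Positions inside a program serve as machine states; `code` and `decode` number them only because
-- a machine wants its states in `Fin`.
State : Prog → Set
State (step _ _)       = ⊤
State (P ⨾ Q)          = State P ⊎ State Q
State (while _ _ P)    = Maybe (State P)
State (branch _ _ P Q) = Maybe (State P ⊎ State Q)
State query            = ⊤

entry : ∀ P → State P
entry (step _ _)       = tt
entry (P ⨾ Q)          = inj₁ (entry P)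
entry (while _ _ _)    = nothing
entry (branch _ _ _ _) = nothing
entry query            = tt

stateCount : Prog → ℕ
stateCount (step _ _)       = 1
stateCount (P ⨾ Q)          = stateCount P + stateCount Q
stateCount (while _ _ P)    = suc (stateCount P)
stateCount (branch _ _ P Q) = suc (stateCount P + stateCount Q)
stateCount query            = 1

code : ∀ P → State P → Fin (stateCount P)
code (step _ _)       _               = zero
code (P ⨾ Q)          (inj₁ s)        = code P s Fin.↑ˡ stateCount Q
code (P ⨾ Q)          (inj₂ s)        = stateCount P Fin.↑ʳ code Q s
code (while _ _ P)    nothing         = zero
code (while _ _ P)    (just s)        = suc (code P s)
code (branch _ _ P Q) nothing         = zero
code (branch _ _ P Q) (just (inj₁ s)) = suc (code P s Fin.↑ˡ stateCount Q)
code (branch _ _ P Q) (just (inj₂ s)) = suc (stateCount P Fin.↑ʳ code Q s)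
code query            _               = zero

decode : ∀ P → Fin (stateCount P) → State P
decode (step _ _)       _       = tt
decode (P ⨾ Q)          i       = Sum.map (decode P) (decode Q) (Fin.splitAt (stateCount P) i)
decode (while _ _ P)    zero    = nothing
decode (while _ _ P)    (suc i) = just (decode P i)
decode (branch _ _ P Q) zero    = nothing
decode (branch _ _ P Q) (suc i) = just (Sum.map (decode P) (decode Q) (Fin.splitAt (stateCount P) i))
decode query            _       = tt

decode-code : ∀ P s → decode P (code P s) ≡ s
decode-code (step _ _)       _ = refl
decode-code (P ⨾ Q)          (inj₁ s)
  rewrite Fin.splitAt-↑ˡ (stateCount P) (code P s) (stateCount Q) = cong inj₁ (decode-code P s)
decode-code (P ⨾ Q)          (inj₂ s)
  rewrite Fin.splitAt-↑ʳ (stateCount P) (stateCount Q) (code Q s) = cong inj₂ (decode-code Q s)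
decode-code (while _ _ P)    nothing  = refl
decode-code (while _ _ P)    (just s) = cong just (decode-code P s)
decode-code (branch _ _ P Q) nothing  = refl
decode-code (branch _ _ P Q) (just (inj₁ s))
  rewrite Fin.splitAt-↑ˡ (stateCount P) (code P s) (stateCount Q) = cong (just ∘ inj₁) (decode-code P s)
decode-code (branch _ _ P Q) (just (inj₂ s))
  rewrite Fin.splitAt-↑ʳ (stateCount P) (stateCount Q) (code Q s) = cong (just ∘ inj₂) (decode-code Q s)
decode-code query            _ = refl

-- Programs name tapes by plain naturals. The truncation never takes effect, since the machine gets
-- at least `tapeCount` tapes.
clamp : ∀ {n} → ℕ → Fin (suc n)
clamp         zero    = zero
clamp {zero}  (suc _) = zero
clamp {suc n} (suc i) = suc (clamp i)

toℕ-clamp : ∀ {n} i → i < suc n → toℕ (clamp {n} i) ≡ i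
toℕ-clamp zero            _         = refl
toℕ-clamp {suc n} (suc i) (s≤s i<n) = cong suc (toℕ-clamp i i<n)

idle : ∀ {k} → Vec Symbol k → Vec (Symbol × Direction) k
idle = Vec.map (_, stay)

actAt : ∀ {k} → Fin k → (Symbol → Symbol × Direction) → Vec Symbol k → Vec (Symbol × Direction) k
actAt zero    f (s ∷ ss) = f s ∷ idle ss
actAt (suc i) f (s ∷ ss) = (s , stay) ∷ actAt i f ss

-- `inj` places the states of a subprogram among those of the whole machine, and `exit` is the state
-- entered when the subprogram is done. A loop is closed by giving its body the loop test as exit.
command : ∀ {n k} P → (State P → Fin n) → Fin n → State P → Command ⊤ n (suc k)
command (step τ f)       inj exit _ = move λ ss → exit , actAt (clamp τ) f ss
command (P ⨾ Q)          inj exit (inj₁ s) = command P (inj ∘ inj₁) (inj (inj₂ (entry Q))) s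
command (P ⨾ Q)          inj exit (inj₂ s) = command Q (inj ∘ inj₂) exit s
command (while τ b P)    inj exit nothing  = move λ ss →
  (if b (Vec.lookup ss (clamp τ)) then inj (just (entry P)) else exit) , idle ss
command (while τ b P)    inj exit (just s) = command P (inj ∘ just) (inj nothing) s
command (branch τ b P Q) inj exit nothing  = move λ ss →
  (if b (Vec.lookup ss (clamp τ)) then inj (just (inj₁ (entry P))) else inj (just (inj₂ (entry Q)))) , idle ss
command (branch τ b P Q) inj exit (just (inj₁ s)) = command P (inj ∘ just ∘ inj₁) exit s
command (branch τ b P Q) inj exit (just (inj₂ s)) = command Q (inj ∘ just ∘ inj₂) exit s
command query            inj exit _ = ask tt exit

_matches_ : ∀ {k} → Vec Tape k → Store → Set
ts matches σ = ∀ i → Vec.lookup ts i ≡ σ (toℕ i)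

idle-act : ∀ {k} (ts : Vec Tape k) → Vec.zipWith act (idle (Vec.map Tape.current ts)) ts ≡ ts
idle-act []       = refl
idle-act (t ∷ ts) = cong (t ∷_) (idle-act ts)

actAt-same : ∀ {k} (i : Fin k) f ts →
  Vec.lookup (Vec.zipWith act (actAt i f (Vec.map Tape.current ts)) ts) i
    ≡ act (f (Tape.current (Vec.lookup ts i))) (Vec.lookup ts i)
actAt-same zero    f (t ∷ ts) = refl
actAt-same (suc i) f (t ∷ ts) = actAt-same i f ts

actAt-other : ∀ {k} (i j : Fin k) f ts → j ≢ i →
  Vec.lookup (Vec.zipWith act (actAt i f (Vec.map Tape.current ts)) ts) j ≡ Vec.lookup ts j
actAt-other zero    zero    f (t ∷ ts) j≢i = contradiction refl j≢i
actAt-other zero    (suc j) f (t ∷ ts) j≢i = cong (λ us → Vec.lookup us j) (idle-act ts)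
actAt-other (suc i) zero    f (t ∷ ts) j≢i = refl
actAt-other (suc i) (suc j) f (t ∷ ts) j≢i = actAt-other i j f ts (j≢i ∘ cong suc)

module Simulation (M : Machine ⊤) (O : Word → Word) where
  open Machine M using (states; workTapes) renaming (command to cmd)

  exec : ℕ → Fin states → Vec Tape (2 + workTapes) → Maybe Bool
  exec = runFrom M (λ _ → O)

  exec-move : ∀ {q f} n ts → cmd q ≡ move f →
    exec (suc n) q ts ≡ exec n (proj₁ (f (Vec.map Tape.current ts)))
                               (Vec.zipWith act (proj₂ (f (Vec.map Tape.current ts))) ts)
  exec-move n ts eq rewrite eq = refl

  exec-ask : ∀ {q q′} n ts → cmd q ≡ ask tt q′ →
    exec (suc n) q ts ≡ exec n q′ (reply M (λ _ → O) tt ts)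
  exec-ask n ts eq rewrite eq = refl

  exec-halt : ∀ {q b} n ts → cmd q ≡ halt b → exec n q ts ≡ just b
  exec-halt zero    ts eq rewrite eq = refl
  exec-halt (suc n) ts eq rewrite eq = refl

  current-clamp : ∀ τ → τ < 2 + workTapes → ∀ ts σ → ts matches σ →
    Vec.lookup (Vec.map Tape.current ts) (clamp τ) ≡ currentAt σ τ
  current-clamp τ τ< ts σ eq = trans (Vec.lookup-map (clamp τ) Tape.current ts)
    (cong Tape.current (trans (eq (clamp τ)) (cong σ (toℕ-clamp τ τ<))))

  record Simulated (q : Fin states) (σ : Store) (m : ℕ) (q′ : Fin states) (σ′ : Store) : Set where
    constructor simulated
    field
      runs : ∀ ts → ts matches σ →
        ∃[ ts′ ] ts′ matches σ′ × (∀ n → exec (m + n) q ts ≡ exec n q′ ts′)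

  open Simulated

  chain : ∀ {q q′ q″ σ σ′ σ″ m n} →
    Simulated q σ m q′ σ′ → Simulated q′ σ′ n q″ σ″ → Simulated q σ (m + n) q″ σ″
  chain {q} {m = m} {n} s₁ s₂ = simulated λ ts eq →
    let (ts′ , eq′ , run₁) = runs s₁ ts eq
        (ts″ , eq″ , run₂) = runs s₂ ts′ eq′
    in ts″ , eq″ , λ r → trans (cong (λ z → exec z q ts) (ℕ.+-assoc m n r)) (trans (run₁ (n + r)) (run₂ r))

  test : ∀ {q q₁ q₂ τ σ b} (β : Symbol → Bool) → τ < 2 + workTapes →
    cmd q ≡ move (λ ss → (if β (Vec.lookup ss (clamp τ)) then q₁ else q₂) , idle ss) →
    β (currentAt σ τ) ≡ b → Simulated q σ 1 (if b then q₁ else q₂) σ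
  test {q₁ = q₁} {q₂} {τ} {σ} β τ< eq refl = simulated λ ts m → ts , m , λ n →
    trans (exec-move n ts eq)
      (cong₂ (exec n) (cong (λ c → if β c then q₁ else q₂) (current-clamp τ τ< ts σ m)) (idle-act ts))

  -- The hypothesis on `cmd` asks only that the machine carry the commands of `P` at the places
  -- given by `inj`. The induction needs this generality: a subprogram runs inside the machine of
  -- the whole program, not in one of its own.
  simulate : ∀ P (inj : State P → Fin states) exit → tapeCount P ≤ 2 + workTapes →
    (∀ s → cmd (inj s) ≡ command P inj exit s) →
    ∀ {σ m σ′} → Exec O P σ m σ′ → Simulated (inj (entry P)) σ m exit σ′
  simulate (step τ f) inj exit τ< eq {σ} step =
    simulated λ ts m → ts′ ts , matches′ ts m , λ n → exec-move n ts (eq tt)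
    where
    ts′ : Vec Tape (2 + workTapes) → Vec Tape (2 + workTapes)
    ts′ ts = Vec.zipWith act (actAt (clamp τ) f (Vec.map Tape.current ts)) ts
    σ′ : Store
    σ′ = setTape τ (act (f (currentAt σ τ)) (σ τ)) σ
    same : toℕ (clamp {suc workTapes} τ) ≡ τ
    same = toℕ-clamp τ τ<
    matches′ : ∀ ts → ts matches σ → ts′ ts matches σ′
    matches′ ts m i with i Fin.≟ clamp τ
    ... | yes refl = trans (actAt-same (clamp τ) f ts)
      (trans (cong (λ t → act (f (Tape.current t)) t) (trans (m (clamp τ)) (cong σ same)))
        (sym (trans (cong σ′ same) (setTape-same τ _ σ))))
    ... | no i≢ = trans (actAt-other (clamp τ) i f ts i≢)
      (trans (m i) (sym (setTape-other τ _ σ (toℕ i)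
        (λ i≡τ → i≢ (Fin.toℕ-injective (trans i≡τ (sym same)))))))
  simulate (P ⨾ Q) inj exit ≤k eq (compose p q) = chain
    (simulate P (inj ∘ inj₁) _ (ℕ.m⊔n≤o⇒m≤o _ (tapeCount Q) ≤k) (eq ∘ inj₁) p)
    (simulate Q (inj ∘ inj₂) exit (ℕ.m⊔n≤o⇒n≤o (tapeCount P) _ ≤k) (eq ∘ inj₂) q)
  simulate (while τ b P) inj exit ≤k eq (while-false βf) =
    test b (ℕ.m⊔n≤o⇒m≤o (suc τ) (tapeCount P) ≤k) (eq nothing) βf
  simulate (while τ b P) inj exit ≤k eq (while-true βt p w) = chain {m = 1}
    (test b (ℕ.m⊔n≤o⇒m≤o (suc τ) (tapeCount P) ≤k) (eq nothing) βt)
    (chain (simulate P (inj ∘ just) _ (ℕ.m⊔n≤o⇒n≤o (suc τ) _ ≤k) (eq ∘ just) p)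
           (simulate (while τ b P) inj exit ≤k eq w))
  simulate (branch τ b P Q) inj exit ≤k eq (branch-true βt p) = chain {m = 1}
    (test b (ℕ.m⊔n≤o⇒m≤o (suc τ) (tapeCount P ⊔ tapeCount Q) ≤k) (eq nothing) βt)
    (simulate P (inj ∘ just ∘ inj₁) exit
      (ℕ.m⊔n≤o⇒m≤o _ (tapeCount Q) (ℕ.m⊔n≤o⇒n≤o (suc τ) (tapeCount P ⊔ tapeCount Q) ≤k)) (eq ∘ just ∘ inj₁) p)
  simulate (branch τ b P Q) inj exit ≤k eq (branch-false βf q) = chain {m = 1}
    (test b (ℕ.m⊔n≤o⇒m≤o (suc τ) (tapeCount P ⊔ tapeCount Q) ≤k) (eq nothing) βf)
    (simulate Q (inj ∘ just ∘ inj₂) exit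
      (ℕ.m⊔n≤o⇒n≤o (tapeCount P) _ (ℕ.m⊔n≤o⇒n≤o (suc τ) (tapeCount P ⊔ tapeCount Q) ≤k)) (eq ∘ just ∘ inj₂) q)
  simulate query inj exit ≤k eq {σ} query = simulated λ ts m →
    reply M (λ _ → O) tt ts , matches′ ts m , λ n → exec-ask n ts (eq tt)
    where
    matches′ : ∀ ts → ts matches σ → reply M (λ _ → O) tt ts matches setTape 1 (writeWord (O (readWord (σ 1)))) σ
    matches′ (t ∷ u ∷ ts) m zero          = trans (m zero) (sym (setTape-other 1 (writeWord (O (readWord (σ 1)))) σ 0 (λ ())))
    matches′ (t ∷ u ∷ ts) m (suc zero)    = trans (cong (writeWord ∘ O ∘ readWord) (m (suc zero))) (sym (setTape-same 1 (writeWord (O (readWord (σ 1)))) σ))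
    matches′ (t ∷ u ∷ ts) m (suc (suc i)) = trans (m (suc (suc i))) (sym (setTape-other 1 (writeWord (O (readWord (σ 1)))) σ (suc (suc (toℕ i))) (λ ())))

-- Runs P, then halts with the answer read off the symbol under head τ.
machine : Prog → ℕ → (Symbol → Bool) → Machine ⊤
machine P τ β = record
  { states    = 3 + stateCount P
  ; workTapes = tapeCount P ⊔ suc τ
  ; initial   = inj (entry P)
  ; command   = cmd
  }
  where
  inj : State P → Fin (3 + stateCount P)
  inj s = suc (suc (suc (code P s)))
  cmd : Fin (3 + stateCount P) → Command ⊤ (3 + stateCount P) (2 + (tapeCount P ⊔ suc τ))
  cmd zero                = halt true
  cmd (suc zero)          = halt false
  cmd (suc (suc zero))    = move λ ss → (if β (Vec.lookup ss (clamp τ)) then zero else suc zero) , idle ss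
  cmd (suc (suc (suc i))) = command P inj (suc (suc zero)) (decode P i)

initialStore : Word → Store
initialStore w zero    = writeWord w
initialStore w (suc _) = writeWord []

machine-runs : ∀ {P τ β O w m σ n} → Exec O P (initialStore w) m σ → m + 1 ≤ n →
  run (machine P τ β) (λ _ → O) n w [] ≡ just (β (currentAt σ τ))
machine-runs {P} {τ} {β} {O} {w} {m} {σ} {n} p m<n =
  subst (λ z → run (machine P τ β) (λ _ → O) z w [] ≡ just (β (currentAt σ τ))) (ℕ.m+[n∸m]≡n m<n)
    (trans (proj₂ (proj₂ result) (n ∸ (m + 1))) (halts (β (currentAt σ τ)) (n ∸ (m + 1))))
  where
  open Simulation (machine P τ β) O
  open Simulated using (runs)
  open Machine (machine P τ β) using (workTapes; states) renaming (command to cmd)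
  inj : State P → Fin states
  inj s = suc (suc (suc (code P s)))
  ts : Vec Tape (2 + workTapes)
  ts = writeWord w ∷ writeWord [] ∷ Vec.replicate workTapes (writeWord [])
  matches₀ : ts matches initialStore w
  matches₀ zero          = refl
  matches₀ (suc zero)    = refl
  matches₀ (suc (suc i)) = Vec.lookup-replicate i _
  fits : tapeCount P ⊔ suc τ ≤ 2 + workTapes
  fits = ℕ.m≤n+m workTapes 2
  result : ∃[ ts′ ] ts′ matches σ × (∀ r → exec (m + 1 + r) (inj (entry P)) ts
    ≡ exec r (if β (currentAt σ τ) then zero else suc zero) ts′)
  exit : Fin states
  exit = suc (suc zero)
  final : Bool → Fin states
  final b = if b then zero else suc zero
  result = runs (chain {q = inj (entry P)} {q′ = exit} {q″ = final (β (currentAt σ τ))} {σ″ = σ} {m = m} {n = 1}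
    (simulate P inj exit (ℕ.m⊔n≤o⇒m≤o (tapeCount P) (suc τ) fits)
      (λ s → cong (command P inj exit) (decode-code P s)) p)
    (test {q = exit} {q₁ = zero} {q₂ = suc zero} {τ = τ} {σ = σ} β (ℕ.m⊔n≤o⇒n≤o (tapeCount P) (suc τ) fits) refl refl))
    ts matches₀
  halts : ∀ b r → exec r (final b) (proj₁ result) ≡ just b
  halts false r = exec-halt {q = suc zero} r (proj₁ result) refl
  halts true  r = exec-halt {q = zero} r (proj₁ result) refl

-- Registers on tapes and the memory of a program.

nth : ℕ → List ℕ → ℕ
nth i       []       = 0
nth zero    (x ∷ _)  = x
nth (suc i) (_ ∷ xs) = nth i xs

update : ℕ → (ℕ → ℕ) → List ℕ → List ℕ
update zero    f []       = f 0 ∷ []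
update (suc i) f []       = 0 ∷ update i f []
update zero    f (x ∷ xs) = f x ∷ xs
update (suc i) f (x ∷ xs) = x ∷ update i f xs

nth-update-same : ∀ i f xs → nth i (update i f xs) ≡ f (nth i xs)
nth-update-same zero    f []       = refl
nth-update-same zero    f (x ∷ xs) = refl
nth-update-same (suc i) f []       = nth-update-same i f []
nth-update-same (suc i) f (x ∷ xs) = nth-update-same i f xs

nth-update-other : ∀ i j f xs → j ≢ i → nth j (update i f xs) ≡ nth j xs
nth-update-other zero    zero    f xs       j≢i = contradiction refl j≢i
nth-update-other zero    (suc j) f []       j≢i = refl
nth-update-other zero    (suc j) f (x ∷ xs) j≢i = refl
nth-update-other (suc i) zero    f []       j≢i = refl
nth-update-other (suc i) (suc j) f []       j≢i = nth-update-other i j f [] (j≢i ∘ cong suc)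
nth-update-other (suc i) zero    f (x ∷ xs) j≢i = refl
nth-update-other (suc i) (suc j) f (x ∷ xs) j≢i = nth-update-other i j f xs (j≢i ∘ cong suc)

nth-++ : ∀ xs j ys → nth (length xs + j) (xs ++ ys) ≡ nth j ys
nth-++ []       j ys = refl
nth-++ (x ∷ xs) j ys = nth-++ xs j ys

nth-++ˡ : ∀ i xs ys → i < length xs → nth i (xs ++ ys) ≡ nth i xs
nth-++ˡ zero    (x ∷ xs) ys i<         = refl
nth-++ˡ (suc i) (x ∷ xs) ys (s≤s i<) = nth-++ˡ i xs ys i<

update-++ : ∀ xs j f ys → update (length xs + j) f (xs ++ ys) ≡ xs ++ update j f ys
update-++ []       j f ys = refl
update-++ (x ∷ xs) j f ys = cong (x ∷_) (update-++ xs j f ys)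

update-++ˡ : ∀ i f xs ys → i < length xs → update i f (xs ++ ys) ≡ update i f xs ++ ys
update-++ˡ zero    f (x ∷ xs) ys i<       = refl
update-++ˡ (suc i) f (x ∷ xs) ys (s≤s i<) = cong (x ∷_) (update-++ˡ i f xs ys i<)

update-update : ∀ i f g h xs → f (g (nth i xs)) ≡ h (nth i xs) → update i f (update i g xs) ≡ update i h xs
update-update zero    f g h []       eq = cong (_∷ []) eq
update-update zero    f g h (x ∷ xs) eq = cong (_∷ xs) eq
update-update (suc i) f g h []       eq = cong (0 ∷_) (update-update i f g h [] eq)
update-update (suc i) f g h (x ∷ xs) eq = cong (x ∷_) (update-update i f g h xs eq)

update-id : ∀ i f xs → i < length xs → f (nth i xs) ≡ nth i xs → update i f xs ≡ xs
update-id zero    f (x ∷ xs) i<       eq = cong (_∷ xs) eq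
update-id (suc i) f (x ∷ xs) (s≤s i<) eq = cong (x ∷_) (update-id i f xs i< eq)

length-update : ∀ i f xs → i < length xs → length (update i f xs) ≡ length xs
length-update zero    f (x ∷ xs) i<       = refl
length-update (suc i) f (x ∷ xs) (s≤s i<) = cong suc (length-update i f xs i<)

mark : Symbol
mark = just true

isMark : Symbol → Bool
isMark nothing  = false
isMark (just _) = true

isTrue : Symbol → Bool
isTrue nothing  = false
isTrue (just b) = b

data Marks : ℕ → List Symbol → Set where
  none : ∀ {ss} → All (_≡ blank) ss → Marks 0 ss
  more : ∀ {v ss} → Marks v ss → Marks (suc v) (mark ∷ ss)

-- A register is a stack of marks with the head on its top cell, so that a blank
-- tape already holds the value 0.
data RegisterTape : ℕ → Tape → Set where
  holds : ∀ {v ls c rs} → Marks v (c ∷ ls) → All (_≡ blank) rs → RegisterTape v (tape ls c rs)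

push-blank : ∀ {v} t → RegisterTape v t →
  RegisterTape (suc v) (act (mark , stay) (act (Tape.current t , right) t))
push-blank (tape ls c [])       (holds m _)        = holds (more m) []
push-blank (tape ls c (r ∷ rs)) (holds m (_ ∷ bs)) = holds (more m) bs

pop-blank : ∀ {v} t → RegisterTape (suc v) t → RegisterTape v (act (blank , left) t)
pop-blank (tape []       .mark rs) (holds (more (none [])) bs) = holds (none (refl ∷ [])) (refl ∷ bs)
pop-blank (tape (l ∷ ls) .mark rs) (holds (more m) bs)         = holds m (refl ∷ bs)

isMark-register : ∀ v t → RegisterTape v t → isMark (Tape.current t) ≡ (0 <ᵇ v)
isMark-register zero    (tape ls c rs)     (holds (none (refl ∷ _)) _) = refl
isMark-register (suc v) (tape ls .mark rs) (holds (more m) _)          = refl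

skip : Prog
skip = step 0 (_, stay)

inc dec : ℕ → Prog
inc r = step (2 + r) (_, right) ⨾ step (2 + r) (λ _ → mark , stay)
dec r = step (2 + r) (λ _ → blank , left)

whilePos : ℕ → Prog → Prog
whilePos r = while (2 + r) isMark

ifPos : ℕ → Prog → Prog → Prog
ifPos r = branch (2 + r) isMark

emitBit : Bool → Prog
emitBit b = step 1 (λ _ → just b , right)

inRight inLeft : Prog
inRight = step 0 (_, right)
inLeft  = step 0 (_, left)

symbolAt : ℕ → Word → Symbol
symbolAt i       []      = blank
symbolAt zero    (b ∷ _) = just b
symbolAt (suc i) (_ ∷ w) = symbolAt i w

-- The tape holds w with the head on cell p.
data InputTape (w : Word) (p : ℕ) : Tape → Set where
  shows : ∀ {ls c rs} → length ls ≡ p → ∀ n →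
    ls List.ʳ++ (c ∷ rs) ≡ map just w ++ replicate n blank → InputTape w p (tape ls c rs)

snoc-blank : ∀ w n → (map just w ++ replicate n blank) ++ blank ∷ [] ≡ map just w ++ replicate (suc n) blank
snoc-blank w n = trans (List.++-assoc (map just w) _ _) (cong (map just w ++_) (aux n))
  where
  aux : ∀ n → replicate n blank ++ blank ∷ [] ≡ replicate {A = Symbol} (suc n) blank
  aux zero    = refl
  aux (suc n) = cong (blank ∷_) (aux n)

input-right : ∀ {w p} t → InputTape w p t → InputTape w (suc p) (act (Tape.current t , right) t)
input-right {w} (tape ls c [])       (shows l n eq) = shows (cong suc l) (suc n) (
  trans (trans (List.ʳ++-defn ls) (sym (List.++-assoc (reverse ls) (c ∷ []) (blank ∷ []))))
    (trans (cong (_++ blank ∷ []) (trans (sym (List.ʳ++-defn ls)) eq)) (snoc-blank w n)))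
input-right (tape ls c (r ∷ rs)) (shows l n eq) = shows (cong suc l) n eq

input-left : ∀ {w p} t → InputTape w (suc p) t → InputTape w p (act (Tape.current t , left) t)
input-left (tape (l ∷ ls) c rs) (shows len n eq) = shows (ℕ.suc-injective len) n eq

input-current : ∀ {w p} t → InputTape w p t → Tape.current t ≡ symbolAt p w
input-current {w} {p} (tape ls c rs) (shows refl n eq) =
  just-injective (trans (sym (at-ʳ++ ls (c ∷ rs))) (trans (cong (at (length ls)) eq) (at-padded (length ls) w n)))
  where
  at : ℕ → List Symbol → Maybe Symbol
  at i       []       = just blank
  at zero    (s ∷ _)  = just s
  at (suc i) (_ ∷ ss) = at i ss
  just-injective : ∀ {s s′ : Symbol} → just s ≡ just s′ → s ≡ s′
  just-injective refl = refl
  at-++ : ∀ xs ys → at (length xs) (xs ++ ys) ≡ at 0 ys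
  at-++ []       ys = refl
  at-++ (x ∷ xs) ys = at-++ xs ys
  at-ʳ++ : ∀ xs ys → at (length xs) (xs List.ʳ++ ys) ≡ at 0 ys
  at-ʳ++ xs ys = trans (cong₂ at (sym (List.length-reverse xs)) (List.ʳ++-defn xs)) (at-++ (reverse xs) ys)
  at-padded : ∀ i w n → at i (map just w ++ replicate n blank) ≡ just (symbolAt i w)
  at-padded i       []      zero    = refl
  at-padded zero    []      (suc n) = refl
  at-padded (suc i) []      (suc n) = at-padded i [] n
  at-padded zero    (b ∷ w) n       = refl
  at-padded (suc i) (b ∷ w) n       = at-padded i w n

outputTape : Word → Tape
outputTape o = tape (map just (reverse o)) blank []

module Memory (w : Word) (O : Word → Word) where

  record Mem : Set where
    constructor ⟪_,_,_⟫
    field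
      position  : ℕ
      registers : List ℕ
      output    : Word

  record _⊨_ (σ : Store) (s : Mem) : Set where
    constructor sat
    open Mem s
    field
      input    : InputTape w position (σ 0)
      written  : σ 1 ≡ outputTape output
      register : ∀ i → RegisterTape (nth i registers) (σ (2 + i))

  -- A triple between exact memory contents. The number n only bounds the steps, so that branches
  -- and rounds of different cost can share one estimate by `within`.
  record Run (P : Prog) (s : Mem) (n : ℕ) (s′ : Mem) : Set where
    constructor running
    field
      result : ∀ σ → σ ⊨ s → ∃[ m ] ∃[ σ′ ] m ≤ n × Exec O P σ m σ′ × σ′ ⊨ s′

  open Run public

  infixr 5 _▹_

  _▹_ : ∀ {P Q s s′ s″ m n} → Run P s m s′ → Run Q s′ n s″ → Run (P ⨾ Q) s (m + n) s″
  p ▹ q = running λ σ h →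
    let (_ , σ′ , m≤ , e , h′) = result p σ h
        (_ , σ″ , n≤ , e′ , h″) = result q σ′ h′
    in _ , σ″ , ℕ.+-mono-≤ m≤ n≤ , compose e e′ , h″

  within : ∀ {P s s′ m n} → m ≤ n → Run P s m s′ → Run P s n s′
  within m≤n p = running λ σ h → let (_ , σ′ , k≤ , e , h′) = result p σ h in _ , σ′ , ℕ.≤-trans k≤ m≤n , e , h′

  adjust : ∀ {P p xs ys o s n} → (∀ i → nth i xs ≡ nth i ys) → Run P s n ⟪ p , xs , o ⟫ → Run P s n ⟪ p , ys , o ⟫
  adjust eq r = running λ σ h →
    let (_ , σ′ , k≤ , e , sat i u g) = result r σ h
    in _ , σ′ , k≤ , e , sat i u λ j → subst (λ v → RegisterTape v (σ′ (2 + j))) (eq j) (g j)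

  exactly : ∀ {P p xs ys o s n} → xs ≡ ys → Run P s n ⟪ p , xs , o ⟫ → Run P s n ⟪ p , ys , o ⟫
  exactly refl r = r

  from : ∀ {P p xs ys o s n} → xs ≡ ys → Run P ⟪ p , xs , o ⟫ n s → Run P ⟪ p , ys , o ⟫ n s
  from refl r = r

  run-skip : ∀ {s} → Run skip s 1 s
  run-skip = running λ σ (sat i u g) → 1 , setTape 0 (act (currentAt σ 0 , stay) (σ 0)) σ , ℕ.≤-refl , step , sat
    (subst (InputTape w _) (sym (setTape-same 0 (act (currentAt σ 0 , stay) (σ 0)) σ)) i)
    (trans (setTape-other 0 (act (currentAt σ 0 , stay) (σ 0)) σ 1 (λ ())) u)
    (λ j → subst (RegisterTape _) (sym (setTape-other 0 (act (currentAt σ 0 , stay) (σ 0)) σ (2 + j) (λ ()))) (g j))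

  run-inRight : ∀ {p xs o} → Run inRight ⟪ p , xs , o ⟫ 1 ⟪ suc p , xs , o ⟫
  run-inRight = running λ σ (sat i u g) → 1 , setTape 0 (act (currentAt σ 0 , right) (σ 0)) σ , ℕ.≤-refl , step , sat
    (subst (InputTape w _) (sym (setTape-same 0 (act (currentAt σ 0 , right) (σ 0)) σ)) (input-right (σ 0) i))
    (trans (setTape-other 0 (act (currentAt σ 0 , right) (σ 0)) σ 1 (λ ())) u)
    (λ j → subst (RegisterTape _) (sym (setTape-other 0 (act (currentAt σ 0 , right) (σ 0)) σ (2 + j) (λ ()))) (g j))

  run-inLeft : ∀ {p xs o} → Run inLeft ⟪ suc p , xs , o ⟫ 1 ⟪ p , xs , o ⟫
  run-inLeft = running λ σ (sat i u g) → 1 , setTape 0 (act (currentAt σ 0 , left) (σ 0)) σ , ℕ.≤-refl , step , sat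
    (subst (InputTape w _) (sym (setTape-same 0 (act (currentAt σ 0 , left) (σ 0)) σ)) (input-left (σ 0) i))
    (trans (setTape-other 0 (act (currentAt σ 0 , left) (σ 0)) σ 1 (λ ())) u)
    (λ j → subst (RegisterTape _) (sym (setTape-other 0 (act (currentAt σ 0 , left) (σ 0)) σ (2 + j) (λ ()))) (g j))

  run-emitBit : ∀ {p xs o} b → Run (emitBit b) ⟪ p , xs , o ⟫ 1 ⟪ p , xs , o ++ b ∷ [] ⟫
  run-emitBit {o = o} b = running λ σ (sat i u g) → 1 , setTape 1 (act (just b , right) (σ 1)) σ , ℕ.≤-refl , step , sat
    (subst (InputTape w _) (sym (setTape-other 1 (act (just b , right) (σ 1)) σ 0 (λ ()))) i)
    (trans (setTape-same 1 (act (just b , right) (σ 1)) σ) (trans (cong (act (just b , right)) u)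
      (cong (λ ls → tape (map just ls) blank []) (sym (List.reverse-++ o (b ∷ []))))))
    (λ j → subst (RegisterTape _) (sym (setTape-other 1 (act (just b , right) (σ 1)) σ (2 + j) (λ ()))) (g j))

  run-update : ∀ {P p xs o n} r f →
    (∀ σ → RegisterTape (nth r xs) (σ (2 + r)) → ∃[ σ′ ] Exec O P σ n σ′
      × RegisterTape (f (nth r xs)) (σ′ (2 + r)) × (∀ i → i ≢ 2 + r → σ′ i ≡ σ i)) →
    Run P ⟪ p , xs , o ⟫ n ⟪ p , update r f xs , o ⟫
  run-update {xs = xs} r f h = running λ σ (sat i u g) →
    let (σ′ , e , t , eq) = h σ (g r) in _ , σ′ , ℕ.≤-refl , e , sat
      (subst (InputTape w _) (sym (eq 0 (λ ()))) i)
      (trans (eq 1 (λ ())) u)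
      (λ j → regs σ σ′ g t eq j (j ≟ r))
    where
    regs : ∀ σ σ′ → (∀ j → RegisterTape (nth j xs) (σ (2 + j))) →
      RegisterTape (f (nth r xs)) (σ′ (2 + r)) → (∀ i → i ≢ 2 + r → σ′ i ≡ σ i) →
      ∀ j → Dec (j ≡ r) → RegisterTape (nth j (update r f xs)) (σ′ (2 + j))
    regs σ σ′ g t eq j (yes refl) = subst (λ v → RegisterTape v _) (sym (nth-update-same r f xs)) t
    regs σ σ′ g t eq j (no j≢r)   = subst₂ RegisterTape (sym (nth-update-other r j f xs j≢r))
      (sym (eq (2 + j) (j≢r ∘ ℕ.+-cancelˡ-≡ 2 j r))) (g j)

  run-inc : ∀ {p xs o} r → Run (inc r) ⟪ p , xs , o ⟫ 2 ⟪ p , update r suc xs , o ⟫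
  run-inc r = run-update r suc λ σ t →
    let τ  = 2 + r
        σ₁ = setTape τ (act (currentAt σ τ , right) (σ τ)) σ
    in _ , compose step step ,
       subst (RegisterTape _) (sym (trans (setTape-same τ _ σ₁) (cong (act (mark , stay)) (setTape-same τ _ σ))))
         (push-blank (σ τ) t) ,
       λ i i≢ → trans (setTape-other τ _ σ₁ i i≢) (setTape-other τ _ σ i i≢)

  run-dec : ∀ {p xs o v} r → nth r xs ≡ suc v → Run (dec r) ⟪ p , xs , o ⟫ 1 ⟪ p , update r pred xs , o ⟫
  run-dec {xs = xs} {v = v} r eq = run-update r pred λ σ t → _ , step ,
    subst₂ RegisterTape (cong pred (sym eq)) (sym (setTape-same (2 + r) _ σ))
      (pop-blank (σ (2 + r)) (subst (λ u → RegisterTape u _) eq t)) ,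
    λ i i≢ → setTape-other (2 + r) _ σ i i≢

  while-stop : ∀ {P p xs o} r → nth r xs ≡ 0 → Run (whilePos r P) ⟪ p , xs , o ⟫ 1 ⟪ p , xs , o ⟫
  while-stop r eq = running λ σ h → 1 , σ , ℕ.≤-refl ,
    while-false (isMark-register 0 (σ (2 + r)) (subst (λ u → RegisterTape u _) eq (_⊨_.register h r))) , h

  while-next : ∀ {P p xs o v s s′ m n} r → nth r xs ≡ suc v →
    Run P ⟪ p , xs , o ⟫ m s → Run (whilePos r P) s n s′ → Run (whilePos r P) ⟪ p , xs , o ⟫ (suc (m + n)) s′
  while-next {v = v} r eq body rest = running λ σ h →
    let (_ , σ′ , m≤ , e , h′) = result body σ h
        (_ , σ″ , n≤ , e′ , h″) = result rest σ′ h′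
    in _ , σ″ , s≤s (ℕ.+-mono-≤ m≤ n≤) , while-true
      (isMark-register (suc v) (σ (2 + r)) (subst (λ u → RegisterTape u _) eq (_⊨_.register h r))) e e′ , h″

  if-pos : ∀ {P Q p xs o v s n} r → nth r xs ≡ suc v → Run P ⟪ p , xs , o ⟫ n s → Run (ifPos r P Q) ⟪ p , xs , o ⟫ (suc n) s
  if-pos {v = v} r eq body = running λ σ h →
    let (_ , σ′ , m≤ , e , h′) = result body σ h
    in _ , σ′ , s≤s m≤ , branch-true
      (isMark-register (suc v) (σ (2 + r)) (subst (λ u → RegisterTape u _) eq (_⊨_.register h r))) e , h′

  if-zero : ∀ {P Q p xs o s n} r → nth r xs ≡ 0 → Run Q ⟪ p , xs , o ⟫ n s → Run (ifPos r P Q) ⟪ p , xs , o ⟫ (suc n) s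
  if-zero r eq body = running λ σ h →
    let (_ , σ′ , m≤ , e , h′) = result body σ h
    in _ , σ′ , s≤s m≤ , branch-false
      (isMark-register 0 (σ (2 + r)) (subst (λ u → RegisterTape u _) eq (_⊨_.register h r))) e , h′

  branch-input : ∀ {P Q p xs o s n} β → Run (if β (symbolAt p w) then P else Q) ⟪ p , xs , o ⟫ n s →
    Run (branch 0 β P Q) ⟪ p , xs , o ⟫ (suc n) s
  branch-input {P} {Q} {p} β body = running λ σ h →
    let (m , σ′ , m≤ , e , h′) = result body σ h
    in _ , σ′ , s≤s m≤ , chosen σ (β (symbolAt p w)) (cong β (input-current (σ 0) (_⊨_.input h))) e , h′
    where
    chosen : ∀ σ {m σ′} b → β (currentAt σ 0) ≡ b → Exec O (if b then P else Q) σ m σ′ →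
      Exec O (branch 0 β P Q) σ (suc m) σ′
    chosen σ true  eq e = branch-true eq e
    chosen σ false eq e = branch-false eq e

  while-input-stop : ∀ {P p xs o} → symbolAt p w ≡ blank → Run (while 0 isMark P) ⟪ p , xs , o ⟫ 1 ⟪ p , xs , o ⟫
  while-input-stop eq = running λ σ h → 1 , σ , ℕ.≤-refl ,
    while-false (cong isMark (trans (input-current (σ 0) (_⊨_.input h)) eq)) , h

  while-input-next : ∀ {P p xs o b s s′ m n} → symbolAt p w ≡ just b →
    Run P ⟪ p , xs , o ⟫ m s → Run (while 0 isMark P) s n s′ → Run (while 0 isMark P) ⟪ p , xs , o ⟫ (suc (m + n)) s′
  while-input-next eq body rest = running λ σ h →
    let (_ , σ′ , m≤ , e , h′) = result body σ h
        (_ , σ″ , n≤ , e′ , h″) = result rest σ′ h′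
    in _ , σ″ , s≤s (ℕ.+-mono-≤ m≤ n≤) , while-true
      (cong isMark (trans (input-current (σ 0) (_⊨_.input h)) eq)) e e′ , h″

  -- The family S k j describes the memory when j rounds are done and k are left.
  countdown : ∀ {P c} r (S : ℕ → ℕ → Mem) → (∀ k j → nth r (Mem.registers (S k j)) ≡ k) →
    (∀ k j → Run P (S (suc k) j) c (S k (suc j))) →
    ∀ V k j → k ≤ V → Run (whilePos r P) (S k j) (V * suc c + 1) (S 0 (k + j))
  countdown {P} {c} r S reg body V k j k≤V = within (ℕ.+-monoˡ-≤ 1 (ℕ.*-monoˡ-≤ (suc c) k≤V)) (go k j)
    where
    go : ∀ k j → Run (whilePos r P) (S k j) (k * suc c + 1) (S 0 (k + j))
    go zero    j = while-stop r (reg 0 j)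
    go (suc k) j = within (ℕ.≤-reflexive (cong suc (sym (ℕ.+-assoc c (k * suc c) 1))))
      (subst (λ z → Run (whilePos r P) (S (suc k) j) (suc (c + (k * suc c + 1))) (S 0 z)) (ℕ.+-suc k j)
        (while-next r (reg (suc k) j) (body k j) (go k (suc j))))

  countdown₀ : ∀ {P c} r (S : ℕ → ℕ → Mem) → (∀ k j → nth r (Mem.registers (S k j)) ≡ k) →
    (∀ k j → Run P (S (suc k) j) c (S k (suc j))) →
    ∀ V k → k ≤ V → Run (whilePos r P) (S k 0) (V * suc c + 1) (S 0 k)
  countdown₀ {P} {c} r S reg body V k k≤V =
    subst (λ z → Run (whilePos r P) (S k 0) (V * suc c + 1) (S 0 z)) (ℕ.+-identityʳ k) (countdown r S reg body V k 0 k≤V)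

  -- Registers beyond the list read as 0, so trailing zeros can be added to or dropped from a
  -- description. With `padded`, `trim` and `widen` each phase names just the scratch registers that
  -- it touches.
  padded : ∀ {P p o n s} xs ys → (∀ i → nth i ys ≡ 0) →
    Run P ⟪ p , xs ++ ys , o ⟫ n s → Run P ⟪ p , xs , o ⟫ n s
  padded xs ys zero-ys r = running λ σ (sat i u g) →
    result r σ (sat i u λ j → subst (λ v → RegisterTape v (σ (2 + j))) (sym (go xs j)) (g j))
    where
    go : ∀ xs i → nth i (xs ++ ys) ≡ nth i xs
    go []       i       = zero-ys i
    go (x ∷ xs) zero    = refl
    go (x ∷ xs) (suc i) = go xs i

  nth-trim : ∀ xs {ys zs} → (∀ i → nth i ys ≡ nth i zs) → ∀ i → nth i (xs ++ ys) ≡ nth i (xs ++ zs)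
  nth-trim []       eq i       = eq i
  nth-trim (x ∷ xs) eq zero    = refl
  nth-trim (x ∷ xs) eq (suc i) = nth-trim xs eq i

  trim : ∀ {P p o s n} xs {ys zs} → (∀ i → nth i ys ≡ nth i zs) →
    Run P s n ⟪ p , xs ++ ys , o ⟫ → Run P s n ⟪ p , xs ++ zs , o ⟫
  trim xs eq = adjust (nth-trim xs eq)

  widen : ∀ {P p o s n} xs {ys zs} → (∀ i → nth i ys ≡ nth i zs) →
    Run P ⟪ p , xs ++ ys , o ⟫ n s → Run P ⟪ p , xs ++ zs , o ⟫ n s
  widen xs eq r = running λ σ (sat i u g) →
    result r σ (sat i u λ j → subst (λ v → RegisterTape v (σ (2 + j))) (sym (nth-trim xs eq j)) (g j))

  -- The registers form a stack: `xs` holds the d variables in scope and the frame above it holds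
  -- scratch values. Addresses `d + j` are resolved in the frame without looking into `xs`.
  module Top (xs : List ℕ) {d : ℕ} (len : length xs ≡ d) where

    top : ∀ j ys → nth (d + j) (xs ++ ys) ≡ nth j ys
    top j ys = trans (cong (λ z → nth (z + j) (xs ++ ys)) (sym len)) (nth-++ xs j ys)

    top-inc : ∀ {p o} j ys → Run (inc (d + j)) ⟪ p , xs ++ ys , o ⟫ 2 ⟪ p , xs ++ update j suc ys , o ⟫
    top-inc j ys = exactly (trans (cong (λ z → update (z + j) suc (xs ++ ys)) (sym len)) (update-++ xs j suc ys))
      (run-inc (d + j))

    top-dec : ∀ {p o v} j ys → nth j ys ≡ suc v →
      Run (dec (d + j)) ⟪ p , xs ++ ys , o ⟫ 1 ⟪ p , xs ++ update j pred ys , o ⟫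
    top-dec j ys eq = exactly (trans (cong (λ z → update (z + j) pred (xs ++ ys)) (sym len)) (update-++ xs j pred ys))
      (run-dec (d + j) (trans (top j ys) eq))

-- Polynomial bounds.

record Polynomial (f : ℕ → ℕ) : Set where
  constructor degree
  field
    exponent : ℕ
    bounds   : ∀ n → f n ≤ (2 + n) ^ exponent

^-mono : ∀ n {a b} → a ≤ b → (2 + n) ^ a ≤ (2 + n) ^ b
^-mono n = ℕ.^-monoʳ-≤ (2 + n)

poly-const : ∀ c → Polynomial (λ _ → c)
poly-const c = degree c λ n → ℕ.≤-trans (c≤2^c c) (ℕ.^-monoˡ-≤ c (ℕ.m≤m+n 2 n))
  where
  c≤2^c : ∀ c → c ≤ 2 ^ c
  c≤2^c zero    = z≤n
  c≤2^c (suc c) = ℕ.≤-trans (ℕ.+-mono-≤ (ℕ.m^n>0 2 c) (c≤2^c c)) (ℕ.+-monoʳ-≤ (2 ^ c) (ℕ.≤-reflexive (sym (ℕ.+-identityʳ (2 ^ c)))))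

poly-id : Polynomial (λ n → n)
poly-id = degree 1 λ n → ℕ.≤-trans (ℕ.m≤n+m n 2) (ℕ.≤-reflexive (sym (ℕ.*-identityʳ (2 + n))))

-- The bounds are powers of `2 + n` rather than of n: since the base is at least 2, doubling a power
-- costs just one more in the exponent, and constants are powers too.
poly-+ : ∀ {f g} → Polynomial f → Polynomial g → Polynomial (λ n → f n + g n)
poly-+ {f} {g} (degree a p) (degree b q) = degree (suc (a ⊔ b)) λ n → begin
  f n + g n                                ≤⟨ ℕ.+-mono-≤ (ℕ.≤-trans (p n) (^-mono n (ℕ.m≤m⊔n a b)))
                                                         (ℕ.≤-trans (q n) (^-mono n (ℕ.m≤n⊔m a b))) ⟩
  (2 + n) ^ (a ⊔ b) + (2 + n) ^ (a ⊔ b)    ≤⟨ ℕ.+-monoʳ-≤ ((2 + n) ^ (a ⊔ b)) (ℕ.m≤m+n _ (n * (2 + n) ^ (a ⊔ b))) ⟩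
  (2 + n) ^ suc (a ⊔ b)                    ∎
  where open ℕ.≤-Reasoning

poly-* : ∀ {f g} → Polynomial f → Polynomial g → Polynomial (λ n → f n * g n)
poly-* (degree a p) (degree b q) = degree (a + b) λ n →
  ℕ.≤-trans (ℕ.*-mono-≤ (p n) (q n)) (ℕ.≤-reflexive (sym (ℕ.^-distribˡ-+-* (2 + n) a b)))

poly-∘ : ∀ {f g} → Polynomial f → Polynomial g → Polynomial (λ n → f (g n))
poly-∘ {f} {g} (degree a p) (degree b q) = degree ((2 + b) * a) λ n → begin
  f (g n)                      ≤⟨ p (g n) ⟩
  (2 + g n) ^ a                ≤⟨ ℕ.^-monoˡ-≤ a (begin
    2 + g n                                  ≤⟨ ℕ.+-mono-≤ (ℕ.m≤m+n 2 n) (q n) ⟩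
    (2 + n) + (2 + n) ^ b                    ≤⟨ ℕ.+-mono-≤ (ℕ.m≤m*n (2 + n) ((2 + n) ^ b) {{ℕ.m^n≢0 (2 + n) b}})
                                                           (ℕ.m≤n*m ((2 + n) ^ b) (2 + n)) ⟩
    (2 + n) ^ suc b + (2 + n) ^ suc b        ≤⟨ ℕ.+-monoʳ-≤ ((2 + n) ^ suc b) (ℕ.m≤m+n _ (n * (2 + n) ^ suc b)) ⟩
    (2 + n) ^ (2 + b)                        ∎) ⟩
  ((2 + n) ^ (2 + b)) ^ a      ≡⟨ ℕ.^-*-assoc (2 + n) (2 + b) a ⟩
  (2 + n) ^ ((2 + b) * a)      ∎
  where open ℕ.≤-Reasoning

-- Arithmetic expressions and printing code, compiled to programs.

infixl 6 _⊕_ _⊖_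
infixl 7 _⊗_

-- _⊖_ is truncated subtraction; bit e is 0 beyond the end of the input, 1 for false and 2 for true.
data Expr (n : ℕ) : Set where
  var         : Fin n → Expr n
  num         : ℕ → Expr n
  _⊕_ _⊗_ _⊖_ : Expr n → Expr n → Expr n
  len         : Expr n
  bit         : Expr n → Expr n

data Code : ℕ → Set where
  emit      : ∀ {n} → Word → Code n
  _▸_       : ∀ {n} → Code n → Code n → Code n
  for       : ∀ {n} → Expr n → Code (suc n) → Code n
  ifNonzero : ∀ {n} → Expr n → Code n → Code n → Code n
  print     : ∀ {n} → Expr n → Code n

infixr 5 _▸_

symbolValue : Symbol → ℕ
symbolValue nothing      = 0
symbolValue (just false) = 1
symbolValue (just true)  = 2

-- The indices descend because the compiled `for` decrements its counter before each round and lets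
-- the body use that same register as its variable.
loop : ∀ {A : Set} → ℕ → (ℕ → List A) → List A
loop zero    f = []
loop (suc n) f = f n ++ loop n f

printed : ℕ → Word
printed n = encodeℕᵇ (fromℕ n)

module Semantics (w : Word) where

  value : ∀ {n} → Expr n → List ℕ → ℕ
  value (var i) env = nth (toℕ i) env
  value (num c) env = c
  value (e ⊕ f) env = value e env + value f env
  value (e ⊗ f) env = value e env * value f env
  value (e ⊖ f) env = value e env ∸ value f env
  value len     env = length w
  value (bit e) env = symbolValue (symbolAt (value e env) w)

  output : ∀ {n} → Code n → List ℕ → Word
  output (emit o)          env = o
  output (c ▸ c′)          env = output c env ++ output c′ env
  output (for e c)         env = loop (value e env) (λ i → output c (env ++ i ∷ []))
  output (ifNonzero e c c′) env = if 0 <ᵇ value e env then output c env else output c′ env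
  output (print e)         env = printed (value e env)

  value-++ : ∀ {n} (e : Expr n) xs ys → n ≤ length xs → value e (xs ++ ys) ≡ value e xs
  value-++ (var i) xs ys n≤ = nth-++ˡ (toℕ i) xs ys (ℕ.<-≤-trans (Fin.toℕ<n i) n≤)
  value-++ (num c) xs ys n≤ = refl
  value-++ (e ⊕ f) xs ys n≤ = cong₂ _+_ (value-++ e xs ys n≤) (value-++ f xs ys n≤)
  value-++ (e ⊗ f) xs ys n≤ = cong₂ _*_ (value-++ e xs ys n≤) (value-++ f xs ys n≤)
  value-++ (e ⊖ f) xs ys n≤ = cong₂ _∸_ (value-++ e xs ys n≤) (value-++ f xs ys n≤)
  value-++ len     xs ys n≤ = refl
  value-++ (bit e) xs ys n≤ = cong (λ z → symbolValue (symbolAt z w)) (value-++ e xs ys n≤)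

maxValue : ∀ {n} → Expr n → ℕ → ℕ
maxValue (var i) V = V
maxValue (num c) V = c
maxValue (e ⊕ f) V = maxValue e V + maxValue f V
maxValue (e ⊗ f) V = maxValue e V * maxValue f V
maxValue (e ⊖ f) V = maxValue e V
maxValue len     V = V
maxValue (bit e) V = 2

poly-maxValue : ∀ {n} (e : Expr n) → Polynomial (maxValue e)
poly-maxValue (var i) = poly-id
poly-maxValue (num c) = poly-const c
poly-maxValue (e ⊕ f) = poly-+ (poly-maxValue e) (poly-maxValue f)
poly-maxValue (e ⊗ f) = poly-* (poly-maxValue e) (poly-maxValue f)
poly-maxValue (e ⊖ f) = poly-maxValue e
poly-maxValue len     = poly-id
poly-maxValue (bit e) = poly-const 2

increments : ℕ → ℕ → Prog
increments zero    r = skip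
increments (suc c) r = inc r ⨾ increments c r

-- Leaves the value of the expression in register d, with all later registers 0.
evaluate : ∀ {n} → Expr n → ℕ → Prog
evaluate (var i) d =
  whilePos (toℕ i) (dec (toℕ i) ⨾ inc (d + 0) ⨾ inc (d + 1)) ⨾
  whilePos (d + 1) (dec (d + 1) ⨾ inc (toℕ i))
evaluate (num c) d = increments c (d + 0)
evaluate (e ⊕ f) d = evaluate e d ⨾ evaluate f (d + 1) ⨾ whilePos (d + 1) (dec (d + 1) ⨾ inc (d + 0))
evaluate (e ⊗ f) d = evaluate e d ⨾ evaluate f (d + 1) ⨾
  whilePos (d + 0) (dec (d + 0) ⨾
    whilePos (d + 1) (dec (d + 1) ⨾ inc (d + 2) ⨾ inc (d + 3)) ⨾
    whilePos (d + 3) (dec (d + 3) ⨾ inc (d + 1))) ⨾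
  whilePos (d + 1) (dec (d + 1)) ⨾
  whilePos (d + 2) (dec (d + 2) ⨾ inc (d + 0))
evaluate (e ⊖ f) d = evaluate e d ⨾ evaluate f (d + 1) ⨾
  whilePos (d + 1) (dec (d + 1) ⨾ ifPos (d + 0) (dec (d + 0)) skip)
evaluate len     d =
  while 0 isMark (inRight ⨾ inc (d + 0)) ⨾
  whilePos (d + 0) (dec (d + 0) ⨾ inLeft ⨾ inc (d + 1)) ⨾
  whilePos (d + 1) (dec (d + 1) ⨾ inc (d + 0))
evaluate (bit e) d = evaluate e d ⨾
  whilePos (d + 0) (dec (d + 0) ⨾ inRight ⨾ inc (d + 1)) ⨾
  branch 0 isMark (branch 0 isTrue (inc (d + 0) ⨾ inc (d + 0)) (inc (d + 0))) skip ⨾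
  whilePos (d + 1) (dec (d + 1) ⨾ inLeft)

evaluateCost : ∀ {n} → Expr n → ℕ → ℕ
evaluateCost (var i) V = (V * 6 + 1) + (V * 4 + 1)
evaluateCost (num c) V = c * 2 + 1
evaluateCost (e ⊕ f) V = evaluateCost e V + (evaluateCost f V + (maxValue f V * 4 + 1))
evaluateCost (e ⊗ f) V = evaluateCost e V + (evaluateCost f V +
  ((maxValue e V * suc (1 + ((maxValue f V * 6 + 1) + (maxValue f V * 4 + 1))) + 1) +
  ((maxValue f V * 2 + 1) + (maxValue e V * maxValue f V * 4 + 1))))
evaluateCost (e ⊖ f) V = evaluateCost e V + (evaluateCost f V + (maxValue f V * 4 + 1))
evaluateCost len     V = (V * 4 + 1) + ((V * 5 + 1) + (V * 4 + 1))
evaluateCost (bit e) V = evaluateCost e V + ((maxValue e V * 5 + 1) + (6 + (maxValue e V * 3 + 1)))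

poly-evaluateCost : ∀ {n} (e : Expr n) → Polynomial (evaluateCost e)
poly-linear : ∀ {f} → Polynomial f → ∀ c → Polynomial (λ V → f V * c + 1)
poly-linear p c = poly-+ (poly-* p (poly-const c)) (poly-const 1)
poly-evaluateCost (var i) = poly-+ (poly-linear poly-id 6) (poly-linear poly-id 4)
poly-evaluateCost (num c) = poly-const (c * 2 + 1)
poly-evaluateCost (e ⊕ f) = poly-+ (poly-evaluateCost e) (poly-+ (poly-evaluateCost f) (poly-linear (poly-maxValue f) 4))
poly-evaluateCost (e ⊗ f) = poly-+ (poly-evaluateCost e) (poly-+ (poly-evaluateCost f)
  (poly-+ (poly-+ (poly-* (poly-maxValue e) (poly-+ (poly-const 2)
      (poly-+ (poly-linear (poly-maxValue f) 6) (poly-linear (poly-maxValue f) 4)))) (poly-const 1))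
    (poly-+ (poly-linear (poly-maxValue f) 2) (poly-linear (poly-* (poly-maxValue e) (poly-maxValue f)) 4))))
poly-evaluateCost (e ⊖ f) = poly-+ (poly-evaluateCost e) (poly-+ (poly-evaluateCost f) (poly-linear (poly-maxValue f) 4))
poly-evaluateCost len     = poly-+ (poly-linear poly-id 4) (poly-+ (poly-linear poly-id 5) (poly-linear poly-id 4))
poly-evaluateCost (bit e) = poly-+ (poly-evaluateCost e) (poly-+ (poly-linear (poly-maxValue e) 5)
  (poly-+ (poly-const 6) (poly-linear (poly-maxValue e) 3)))

Below : ℕ → ℕ → List ℕ → Set
Below n V env = ∀ (i : Fin n) → nth (toℕ i) env ≤ V

module Evaluation (w : Word) (O : Word → Word) where
  open Memory w O
  open Semantics w

  value≤ : ∀ {n} (e : Expr n) {V} env → length w ≤ V → Below n V env → value e env ≤ maxValue e V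
  value≤ (var i) env w≤ b = b i
  value≤ (num c) env w≤ b = ℕ.≤-refl
  value≤ (e ⊕ f) env w≤ b = ℕ.+-mono-≤ (value≤ e env w≤ b) (value≤ f env w≤ b)
  value≤ (e ⊗ f) env w≤ b = ℕ.*-mono-≤ (value≤ e env w≤ b) (value≤ f env w≤ b)
  value≤ (e ⊖ f) env w≤ b = ℕ.≤-trans (ℕ.m∸n≤m (value e env) (value f env)) (value≤ e env w≤ b)
  value≤ len     env w≤ b = w≤
  value≤ (bit e) env w≤ b = two (symbolAt (value e env) w)
    where
    two : ∀ s → symbolValue s ≤ 2
    two nothing      = z≤n
    two (just false) = s≤s z≤n
    two (just true)  = s≤s (s≤s z≤n)

  below-snoc : ∀ {n V v} env → length env ≡ n → Below n V env → Below (suc n) (V + v) (env ++ v ∷ [])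
  below-snoc {n} {V} {v} env eq b i with toℕ i <? length env
  ... | yes i< = ℕ.≤-trans (ℕ.≤-reflexive (nth-++ˡ (toℕ i) env (v ∷ []) i<))
    (ℕ.≤-trans (subst (λ z → nth z env ≤ V) (Fin.toℕ-fromℕ< i<n) (b (Fin.fromℕ< i<n))) (ℕ.m≤m+n V v))
    where
    i<n : toℕ i < n
    i<n = subst (toℕ i <_) eq i<
  ... | no i≮ = ℕ.≤-trans (ℕ.≤-reflexive (trans (cong (λ z → nth z (env ++ v ∷ [])) i≡) (nth-++ env 0 (v ∷ [])))) (ℕ.m≤n+m v V)
    where
    i≡ : toℕ i ≡ length env + 0
    i≡ = trans (ℕ.≤-antisym (ℕ.≤-trans (ℕ.≤-pred (Fin.toℕ<n i)) (ℕ.≤-reflexive (sym eq))) (ℕ.≮⇒≥ i≮))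
      (sym (ℕ.+-identityʳ (length env)))

  length-snoc : ∀ (env : List ℕ) v {d} → length env ≡ d → length (env ++ v ∷ []) ≡ d + 1
  length-snoc env v eq = trans (List.length-++ env) (cong (_+ 1) eq)

  EvaluatesTo : ∀ {n} → Expr n → ℕ → Set
  EvaluatesTo {n} e V = ∀ env {d o} → length env ≡ d → n ≤ d → Below n V env →
    Run (evaluate e d) ⟪ 0 , env , o ⟫ (evaluateCost e V) ⟪ 0 , env ++ value e env ∷ [] , o ⟫

  run-increments : ∀ c env {p d o} j → length env ≡ d →
    Run (increments c (d + 0)) ⟪ p , env ++ j ∷ [] , o ⟫ (c * 2 + 1) ⟪ p , env ++ (c + j) ∷ [] , o ⟫
  run-increments zero    env     j eq = run-skip
  run-increments (suc c) env {p} j eq = Top.top-inc env eq 0 (j ∷ []) ▹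
    exactly (cong (λ z → env ++ z ∷ []) (ℕ.+-suc c j)) (run-increments c env (suc j) eq)

  drop₁ : ∀ {x} i → nth i (x ∷ 0 ∷ []) ≡ nth i (x ∷ [])
  drop₁ zero          = refl
  drop₁ (suc zero)    = refl
  drop₁ (suc (suc i)) = refl

  drop₂ : ∀ {x} i → nth i (x ∷ 0 ∷ 0 ∷ []) ≡ nth i (x ∷ [])
  drop₂ zero                = refl
  drop₂ (suc zero)          = refl
  drop₂ (suc (suc zero))    = refl
  drop₂ (suc (suc (suc i))) = refl

  drop₃ : ∀ {x} i → nth i (x ∷ 0 ∷ 0 ∷ 0 ∷ []) ≡ nth i (x ∷ [])
  drop₃ zero                      = refl
  drop₃ (suc zero)                = refl
  drop₃ (suc (suc zero))          = refl
  drop₃ (suc (suc (suc zero)))    = refl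
  drop₃ (suc (suc (suc (suc i)))) = refl

  add₂ : ∀ {x y} i → nth i (x ∷ y ∷ 0 ∷ 0 ∷ []) ≡ nth i (x ∷ y ∷ [])
  add₂ zero    = refl
  add₂ (suc i) = drop₂ i

  zero₁ : ∀ i → nth i (0 ∷ []) ≡ 0
  zero₁ zero    = refl
  zero₁ (suc i) = refl

  zero₂ : ∀ i → nth i (0 ∷ 0 ∷ []) ≡ 0
  zero₂ zero    = refl
  zero₂ (suc i) = zero₁ i

  -- Reading a register empties it. The value is therefore moved to two scratch registers at once,
  -- and one of the copies is moved back.
  run-var : ∀ {V n} (i : Fin n) → EvaluatesTo (var i) V
  run-var {V} i env {d} {o} eq n≤ b =
    exactly (cong (_++ v ∷ []) restore) (trim (update l (λ _ → v) env) drop₁ (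
      padded env (0 ∷ 0 ∷ []) zero₂ (from (cong (_++ 0 ∷ 0 ∷ []) restore)
        (countdown₀ l S₁ reg₁ body₁ V v (b i))) ▹
      countdown₀ (d + 1) S₂ reg₂ body₂ V v (b i)))
    where
    l v : ℕ
    l = toℕ i
    v = nth l env
    l< : l < length env
    l< = subst (l <_) (sym eq) (ℕ.<-≤-trans (Fin.toℕ<n i) n≤)
    at : ∀ k → length (update l (λ _ → k) env) ≡ d
    at k = trans (length-update l _ env l<) eq
    l<′ : ∀ k → l < length (update l (λ _ → k) env)
    l<′ k = subst (l <_) (sym (length-update l _ env l<)) l<
    S₁ S₂ : ℕ → ℕ → Mem
    S₁ k j = ⟪ 0 , update l (λ _ → k) env ++ j ∷ j ∷ [] , o ⟫
    S₂ k j = ⟪ 0 , update l (λ _ → j) env ++ v ∷ k ∷ [] , o ⟫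
    reg₁ : ∀ k j → nth l (update l (λ _ → k) env ++ j ∷ j ∷ []) ≡ k
    reg₁ k j = trans (nth-++ˡ l (update l (λ _ → k) env) (j ∷ j ∷ []) (l<′ k)) (nth-update-same l _ env)
    reg₂ : ∀ k j → nth (d + 1) (update l (λ _ → j) env ++ v ∷ k ∷ []) ≡ k
    reg₂ k j = Top.top (update l (λ _ → j) env) (at j) 1 (v ∷ k ∷ [])
    set : ∀ f k m ys → f k ≡ m → update l f (update l (λ _ → k) env ++ ys) ≡ update l (λ _ → m) env ++ ys
    set f k m ys fk = trans (update-++ˡ l f _ ys (l<′ k)) (cong (_++ ys) (update-update l f _ _ env fk))
    body₁ : ∀ k j → Run (dec l ⨾ inc (d + 0) ⨾ inc (d + 1)) (S₁ (suc k) j) 5 (S₁ k (suc j))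
    body₁ k j = exactly (set pred (suc k) k _ refl) (run-dec l (reg₁ (suc k) j)) ▹
      Top.top-inc (update l (λ _ → k) env) (at k) 0 (j ∷ j ∷ []) ▹
      Top.top-inc (update l (λ _ → k) env) (at k) 1 (suc j ∷ j ∷ [])
    body₂ : ∀ k j → Run (dec (d + 1) ⨾ inc l) (S₂ (suc k) j) 3 (S₂ k (suc j))
    body₂ k j = Top.top-dec (update l (λ _ → j) env) (at j) 1 (v ∷ suc k ∷ []) refl ▹ exactly (set suc j (suc j) _ refl) (run-inc l)
    restore : update l (λ _ → v) env ≡ env
    restore = update-id l _ env l< refl

  run-evaluate : ∀ {n} (e : Expr n) {V} → length w ≤ V → EvaluatesTo e V

  run-second : ∀ {n} (f : Expr n) {V} → length w ≤ V → ∀ env {d o} x → length env ≡ d → n ≤ d → Below n V env →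
    Run (evaluate f (d + 1)) ⟪ 0 , env ++ x ∷ [] , o ⟫ (evaluateCost f V)
      ⟪ 0 , env ++ x ∷ value f env ∷ [] , o ⟫
  run-second {n} f {V} w≤ env x eq n≤ b = exactly
    (trans (List.++-assoc env (x ∷ []) _)
      (cong (λ z → env ++ x ∷ z ∷ []) (value-++ f env (x ∷ []) (subst (n ≤_) (sym eq) n≤))))
    (run-evaluate f w≤ (env ++ x ∷ []) (length-snoc env x eq) (ℕ.≤-trans n≤ (ℕ.m≤m+n _ 1))
      (λ i → ℕ.≤-trans (ℕ.≤-reflexive (nth-++ˡ (toℕ i) env (x ∷ [])
        (subst (toℕ i <_) (sym eq) (ℕ.<-≤-trans (Fin.toℕ<n i) n≤)))) (b i)))

  -- Head position and counter agree throughout, and `v` is the part of the input already passed; at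
  -- the first blank the counter is the length.
  run-length : ∀ env {d o} → length env ≡ d → ∀ v u p → length v ≡ p → v ++ u ≡ w →
    Run (while 0 isMark (inRight ⨾ inc (d + 0))) ⟪ p , env ++ p ∷ [] , o ⟫ (length u * 4 + 1)
      ⟪ length w , env ++ length w ∷ [] , o ⟫
  run-length env {d} {o} eq v [] p refl refl =
    subst (λ z → Run _ ⟪ length v , env ++ length v ∷ [] , o ⟫ 1 ⟪ z , env ++ z ∷ [] , o ⟫)
      (sym (cong length (List.++-identityʳ v))) (while-input-stop (at-end v))
    where
    at-end : ∀ v → symbolAt (length v) (v ++ []) ≡ blank
    at-end []      = refl
    at-end (_ ∷ v) = at-end v
  run-length env eq v (b ∷ u) p refl w≡ = while-input-next
    (trans (cong (symbolAt (length v)) (sym w≡)) (at-middle v))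
    (run-inRight ▹ Top.top-inc env eq 0 (p ∷ []))
    (run-length env eq (v ++ b ∷ []) u (suc p) (trans (List.length-++ v) (ℕ.+-comm (length v) 1))
      (trans (List.++-assoc v (b ∷ []) u) w≡))
    where
    at-middle : ∀ v → symbolAt (length v) (v ++ b ∷ u) ≡ just b
    at-middle []      = refl
    at-middle (_ ∷ v) = at-middle v

  run-evaluate (var i) w≤ = run-var i
  run-evaluate (num c) w≤ env {d} eq n≤ b = padded env (0 ∷ []) zero₁
    (exactly (cong (λ z → env ++ z ∷ []) (ℕ.+-identityʳ c)) (run-increments c env 0 eq))
  run-evaluate (e ⊕ f) {V} w≤ env {d} {o} eq n≤ b =
    run-evaluate e w≤ env eq n≤ b ▹ run-second f w≤ env x eq n≤ b ▹
    trim env drop₁ (exactly (cong (λ z → env ++ z ∷ 0 ∷ []) (ℕ.+-comm y x))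
      (countdown₀ (d + 1) S (λ k j → Top.top env eq 1 (j + x ∷ k ∷ []))
        (λ k j → Top.top-dec env eq 1 (j + x ∷ suc k ∷ []) refl ▹ Top.top-inc env eq 0 (j + x ∷ k ∷ []))
        (maxValue f V) y (value≤ f env w≤ b)))
    where
    x y : ℕ
    x = value e env
    y = value f env
    S : ℕ → ℕ → Mem
    S k j = ⟪ 0 , env ++ j + x ∷ k ∷ [] , o ⟫
  run-evaluate (e ⊗ f) {V} w≤ env {d} {o} eq n≤ b =
    run-evaluate e w≤ env eq n≤ b ▹ run-second f w≤ env x eq n≤ b ▹
    widen env add₂ (countdown₀ (d + 0) S (λ k j → Top.top env eq 0 (k ∷ y ∷ j * y ∷ 0 ∷ [])) outer
      (maxValue e V) x (value≤ e env w≤ b)) ▹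
    countdown₀ (d + 1) C (λ k j → Top.top env eq 1 (0 ∷ k ∷ x * y ∷ 0 ∷ []))
      (λ k j → Top.top-dec env eq 1 (0 ∷ suc k ∷ x * y ∷ 0 ∷ []) refl)
      (maxValue f V) y (value≤ f env w≤ b) ▹
    trim env drop₃ (countdown₀ (d + 2) M (λ k j → Top.top env eq 2 (j ∷ 0 ∷ k ∷ 0 ∷ []))
      (λ k j → Top.top-dec env eq 2 (j ∷ 0 ∷ suc k ∷ 0 ∷ []) refl ▹ Top.top-inc env eq 0 (j ∷ 0 ∷ k ∷ 0 ∷ []))
      (maxValue e V * maxValue f V) (x * y) (ℕ.*-mono-≤ (value≤ e env w≤ b) (value≤ f env w≤ b)))
    where
    x y : ℕ
    x = value e env
    y = value f env
    S C M : ℕ → ℕ → Mem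
    S k j = ⟪ 0 , env ++ k ∷ y ∷ j * y ∷ 0 ∷ [] , o ⟫
    C k j = ⟪ 0 , env ++ 0 ∷ k ∷ x * y ∷ 0 ∷ [] , o ⟫
    M k j = ⟪ 0 , env ++ j ∷ 0 ∷ k ∷ 0 ∷ [] , o ⟫
    T′ U : ℕ → ℕ → ℕ → ℕ → Mem
    T′ k j k′ j′ = ⟪ 0 , env ++ k ∷ k′ ∷ j′ + j * y ∷ j′ ∷ [] , o ⟫
    U k j k′ j′ = ⟪ 0 , env ++ k ∷ j′ ∷ suc j * y ∷ k′ ∷ [] , o ⟫
    -- Each unit of the first factor drains the second factor into the product and into a spare
    -- register, then refills the second factor from the spare one.
    outer : ∀ k j → Run _ (S (suc k) j) _ (S k (suc j))
    outer k j = Top.top-dec env eq 0 (suc k ∷ y ∷ j * y ∷ 0 ∷ []) refl ▹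
      countdown₀ (d + 1) (T′ k j) (λ k′ j′ → Top.top env eq 1 (k ∷ k′ ∷ j′ + j * y ∷ j′ ∷ []))
        (λ k′ j′ → Top.top-dec env eq 1 (k ∷ suc k′ ∷ j′ + j * y ∷ j′ ∷ []) refl ▹
          Top.top-inc env eq 2 (k ∷ k′ ∷ j′ + j * y ∷ j′ ∷ []) ▹
          Top.top-inc env eq 3 (k ∷ k′ ∷ suc j′ + j * y ∷ j′ ∷ []))
        (maxValue f V) y (value≤ f env w≤ b) ▹
      countdown₀ (d + 3) (U k j) (λ k′ j′ → Top.top env eq 3 (k ∷ j′ ∷ suc j * y ∷ k′ ∷ []))
        (λ k′ j′ → Top.top-dec env eq 3 (k ∷ j′ ∷ suc j * y ∷ suc k′ ∷ []) refl ▹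
          Top.top-inc env eq 1 (k ∷ j′ ∷ suc j * y ∷ k′ ∷ []))
        (maxValue f V) y (value≤ f env w≤ b)
  run-evaluate (e ⊖ f) {V} w≤ env {d} {o} eq n≤ b =
    run-evaluate e w≤ env eq n≤ b ▹ run-second f w≤ env x eq n≤ b ▹
    trim env drop₁ (countdown₀ (d + 1) S (λ k j → Top.top env eq 1 (x ∸ j ∷ k ∷ []))
        (λ k j → Top.top-dec env eq 1 (x ∸ j ∷ suc k ∷ []) refl ▹ saturating k j (x ∸ j) refl)
        (maxValue f V) y (value≤ f env w≤ b))
    where
    x y : ℕ
    x = value e env
    y = value f env
    S : ℕ → ℕ → Mem
    S k j = ⟪ 0 , env ++ x ∸ j ∷ k ∷ [] , o ⟫
    saturating : ∀ k j z → x ∸ j ≡ z → Run (ifPos (d + 0) (dec (d + 0)) skip) (S k j) 2 (S k (suc j))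
    saturating k j zero z≡ = if-zero (d + 0) (trans (Top.top env eq 0 (x ∸ j ∷ k ∷ [])) z≡)
      (exactly (cong (λ z → env ++ z ∷ k ∷ [])
        (trans z≡ (trans (sym (cong pred z≡)) (ℕ.pred[m∸n]≡m∸[1+n] x j)))) run-skip)
    saturating k j (suc z) z≡ = if-pos (d + 0) (trans (Top.top env eq 0 (x ∸ j ∷ k ∷ [])) z≡)
      (exactly (cong (λ z → env ++ z ∷ k ∷ []) (ℕ.pred[m∸n]≡m∸[1+n] x j))
        (Top.top-dec env eq 0 (x ∸ j ∷ k ∷ []) z≡))
  run-evaluate len {V} w≤ env {d} {o} eq n≤ b =
    padded env (0 ∷ []) zero₁ (within (ℕ.+-monoˡ-≤ 1 (ℕ.*-monoˡ-≤ 4 w≤)) (run-length env eq [] w 0 refl refl)) ▹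
    widen env drop₁ (countdown₀ (d + 0) S (λ k j → Top.top env eq 0 (k ∷ j ∷ []))
      (λ k j → Top.top-dec env eq 0 (suc k ∷ j ∷ []) refl ▹ run-inLeft ▹ Top.top-inc env eq 1 (k ∷ j ∷ []))
      V (length w) w≤) ▹
    trim env drop₁ (countdown₀ (d + 1) M (λ k j → Top.top env eq 1 (j ∷ k ∷ []))
      (λ k j → Top.top-dec env eq 1 (j ∷ suc k ∷ []) refl ▹ Top.top-inc env eq 0 (j ∷ k ∷ []))
      V (length w) w≤)
    where
    S M : ℕ → ℕ → Mem
    S k j = ⟪ k , env ++ k ∷ j ∷ [] , o ⟫
    M k j = ⟪ 0 , env ++ j ∷ k ∷ [] , o ⟫
  run-evaluate (bit e) {V} w≤ env {d} {o} eq n≤ b =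
    run-evaluate e w≤ env eq n≤ b ▹
    widen env drop₁ (countdown₀ (d + 0) S (λ k j → Top.top env eq 0 (k ∷ j ∷ []))
      (λ k j → Top.top-dec env eq 0 (suc k ∷ j ∷ []) refl ▹ run-inRight ▹ Top.top-inc env eq 1 (k ∷ j ∷ []))
      (maxValue e V) x (value≤ e env w≤ b)) ▹
    branch-input isMark (read (symbolAt x w) refl) ▹
    trim env drop₁ (countdown₀ (d + 1) M (λ k j → Top.top env eq 1 (s ∷ k ∷ []))
      (λ k j → Top.top-dec env eq 1 (s ∷ suc k ∷ []) refl ▹ run-inLeft)
      (maxValue e V) x (value≤ e env w≤ b))
    where
    x s : ℕ
    x = value e env
    s = symbolValue (symbolAt x w)
    S M : ℕ → ℕ → Mem
    S k j = ⟪ j , env ++ k ∷ j ∷ [] , o ⟫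
    M k j = ⟪ k , env ++ s ∷ k ∷ [] , o ⟫
    once twice : Prog
    once  = inc (d + 0)
    twice = inc (d + 0) ⨾ inc (d + 0)
    read : ∀ a → symbolAt x w ≡ a →
      Run (if isMark (symbolAt x w) then branch 0 isTrue twice once else skip) (S 0 x) 5 (M x 0)
    read nothing      x≡ rewrite x≡ = within (s≤s z≤n) run-skip
    read (just false) x≡ = subst (λ β → Run (if isMark β then branch 0 isTrue twice once else skip) (S 0 x) 5
        ⟪ x , env ++ symbolValue β ∷ x ∷ [] , o ⟫) (sym x≡)
      (within (s≤s (s≤s (s≤s z≤n))) (branch-input isTrue
        (subst (λ β → Run (if isTrue β then twice else once) (S 0 x) 2 ⟪ x , env ++ 1 ∷ x ∷ [] , o ⟫) (sym x≡)
          (Top.top-inc env eq 0 (0 ∷ x ∷ [])))))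
    read (just true)  x≡ = subst (λ β → Run (if isMark β then branch 0 isTrue twice once else skip) (S 0 x) 5
        ⟪ x , env ++ symbolValue β ∷ x ∷ [] , o ⟫) (sym x≡)
      (branch-input isTrue
        (subst (λ β → Run (if isTrue β then twice else once) (S 0 x) 4 ⟪ x , env ++ 2 ∷ x ∷ [] , o ⟫) (sym x≡)
          (Top.top-inc env eq 0 (0 ∷ x ∷ []) ▹ Top.top-inc env eq 0 (1 ∷ x ∷ []))))

compile : ∀ {n} → Code n → Prog

emits : Word → Prog
emits []      = skip
emits (b ∷ o) = emitBit b ⨾ emits o

halve : ℕ → Prog
halve d = whilePos (d + 0) (dec (d + 0) ⨾ ifPos (d + 0) (dec (d + 0) ⨾ inc (d + 1)) (inc (d + 2)))

digit : ℕ → Prog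
digit d = emitBit true ⨾ dec (d + 0) ⨾ halve d ⨾
  ifPos (d + 2) (dec (d + 2) ⨾ emitBit true) (emitBit false) ⨾
  whilePos (d + 1) (dec (d + 1) ⨾ inc (d + 0))

printRegister : ℕ → Prog
printRegister d = whilePos (d + 0) (digit d) ⨾ emitBit false

compile (emit o)              = emits o
compile (c ▸ c′)              = compile c ⨾ compile c′
compile {n} (for e c)         = evaluate e n ⨾ whilePos (n + 0) (dec (n + 0) ⨾ compile c)
compile {n} (ifNonzero e c c′) = evaluate e n ⨾
  ifPos (n + 0) (whilePos (n + 0) (dec (n + 0)) ⨾ compile c) (compile c′)
compile {n} (print e)         = evaluate e n ⨾ printRegister n

digitCost : ℕ → ℕ
digitCost B = 1 + (1 + ((B * 6 + 1) + (3 + (B * 4 + 1))))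

-- Inside a loop the new variable is bounded by the loop bound, so the common bound grows from V to
-- `V + maxValue e V`. The nesting depth is fixed by the code, hence only a fixed number of
-- polynomials are composed.
codeCost : ∀ {n} → Code n → ℕ → ℕ
codeCost (emit o)          V = length o + 1
codeCost (c ▸ c′)          V = codeCost c V + codeCost c′ V
codeCost (for e c)         V = evaluateCost e V + (maxValue e V * suc (1 + codeCost c (V + maxValue e V)) + 1)
codeCost (ifNonzero e c c′) V = evaluateCost e V + suc ((maxValue e V * 2 + 1) + codeCost c V + codeCost c′ V)
codeCost (print e)         V = evaluateCost e V + ((maxValue e V * suc (digitCost (maxValue e V)) + 1) + 1)

poly-codeCost : ∀ {n} (c : Code n) → Polynomial (codeCost c)
poly-codeCost (emit o)          = poly-const (length o + 1)
poly-codeCost (c ▸ c′)          = poly-+ (poly-codeCost c) (poly-codeCost c′)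
poly-codeCost (for e c)         = poly-+ (poly-evaluateCost e) (poly-+ (poly-* (poly-maxValue e)
  (poly-+ (poly-const 2) (poly-∘ (poly-codeCost c) (poly-+ poly-id (poly-maxValue e))))) (poly-const 1))
poly-codeCost (ifNonzero e c c′) = poly-+ (poly-evaluateCost e) (poly-+ (poly-const 1)
  (poly-+ (poly-+ (poly-linear (poly-maxValue e) 2) (poly-codeCost c)) (poly-codeCost c′)))
poly-codeCost (print e)         = poly-+ (poly-evaluateCost e) (poly-+ (poly-+ (poly-* (poly-maxValue e)
  (poly-+ (poly-const 3) (poly-+ (poly-linear (poly-maxValue e) 6) (poly-+ (poly-const 3) (poly-linear (poly-maxValue e) 4)))))
  (poly-const 1)) (poly-const 1))

half : ℕ → ℕ
half (suc (suc n)) = suc (half n)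
half _             = 0

parity : ℕ → ℕ
parity zero          = 0
parity (suc zero)    = 1
parity (suc (suc n)) = parity n

half≤ : ∀ n → half n ≤ n
half≤ zero          = z≤n
half≤ (suc zero)    = z≤n
half≤ (suc (suc n)) = s≤s (ℕ.≤-trans (half≤ n) (ℕ.n≤1+n n))

half-parity : ∀ n → n ≡ parity n + 2 * half n
half-parity zero          = refl
half-parity (suc zero)    = refl
half-parity (suc (suc n)) = trans (cong (λ z → suc (suc z)) (half-parity n)) (shift (parity n) (half n))
  where
  shift : ∀ p h → suc (suc (p + 2 * h)) ≡ p + 2 * suc h
  shift = solve 2 (λ p h → con 2 :+ (p :+ con 2 :* h) := p :+ con 2 :* (con 1 :+ h)) refl
    where open ℕSolver.+-*-Solver

parityBit : ℕ → Bool
parityBit n = isMark (if 0 <ᵇ parity n then mark else blank)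

-- With q equal to its parity plus 2h, the number 1 + q is 1 + 2h or 2(1 + h). These are the two
-- digits of bijective base 2, and h is what remains to be printed.
printed-suc : ∀ q → printed (suc q) ≡ true ∷ parityBit q ∷ printed (half q)
printed-suc q = cases (parity q) refl (parity≤1 q)
  where
  parity≤1 : ∀ n → parity n ≤ 1
  parity≤1 zero          = z≤n
  parity≤1 (suc zero)    = s≤s z≤n
  parity≤1 (suc (suc n)) = parity≤1 n
  from-toℕ : ∀ x {n} → ℕᵇ.toℕ x ≡ n → fromℕ n ≡ x
  from-toℕ x refl = ℕᵇ.fromℕ-toℕ x
  h : ℕᵇ
  h = fromℕ (half q)
  cases : ∀ p → parity q ≡ p → p ≤ 1 → printed (suc q) ≡ true ∷ parityBit q ∷ printed (half q)
  cases zero       p≡ _ rewrite p≡ = cong encodeℕᵇ (from-toℕ 1+[2 h ]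
    (cong suc (trans (cong (2 *_) (ℕᵇ.toℕ-fromℕ (half q))) (sym (trans (half-parity q) (cong (_+ 2 * half q) p≡))))))
  cases (suc zero) p≡ _ rewrite p≡ = cong encodeℕᵇ (from-toℕ 2[1+ h ]
    (trans (cong (λ z → 2 * suc z) (ℕᵇ.toℕ-fromℕ (half q)))
      (trans (ℕ.*-suc 2 (half q)) (cong suc (sym (trans (half-parity q) (cong (_+ 2 * half q) p≡)))))))
  cases (suc (suc p)) p≡ (s≤s ())

module Compilation (w : Word) (O : Word → Word) where
  open Memory w O
  open Semantics w
  open Evaluation w O

  run-emits : ∀ {xs o} u → Run (emits u) ⟪ 0 , xs , o ⟫ (length u + 1) ⟪ 0 , xs , o ++ u ⟫
  run-emits {xs} {o} []      = subst (λ z → Run skip ⟪ 0 , xs , o ⟫ 1 ⟪ 0 , xs , z ⟫) (sym (List.++-identityʳ o)) run-skip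
  run-emits {xs} {o} (b ∷ u) = subst (λ z → Run (emits (b ∷ u)) ⟪ 0 , xs , o ⟫ (suc (length u) + 1) ⟪ 0 , xs , z ⟫)
    (List.++-assoc o (b ∷ []) u) (run-emitBit b ▹ run-emits u)

  module Printing (env : List ℕ) {d : ℕ} (eq : length env ≡ d) where

    run-halve : ∀ {o} q h → Run (halve d) ⟪ 0 , env ++ q ∷ h ∷ 0 ∷ [] , o ⟫ (q * 6 + 1)
      ⟪ 0 , env ++ 0 ∷ half q + h ∷ parity q ∷ [] , o ⟫
    run-halve zero h = while-stop (d + 0) (Top.top env eq 0 (0 ∷ h ∷ 0 ∷ []))
    run-halve (suc zero) h = within (ℕ.m≤m+n 6 1) (while-next (d + 0) (Top.top env eq 0 (1 ∷ h ∷ 0 ∷ []))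
      (Top.top-dec env eq 0 (1 ∷ h ∷ 0 ∷ []) refl ▹
        if-zero (d + 0) (Top.top env eq 0 (0 ∷ h ∷ 0 ∷ [])) (Top.top-inc env eq 2 (0 ∷ h ∷ 0 ∷ [])))
      (while-stop (d + 0) (Top.top env eq 0 (0 ∷ h ∷ 1 ∷ []))))
    run-halve (suc (suc q)) h = within (ℕ.+-monoˡ-≤ (q * 6 + 1) (ℕ.m≤m+n 6 6))
      (exactly (cong (λ z → env ++ 0 ∷ z ∷ parity q ∷ []) (ℕ.+-suc (half q) h))
        (while-next (d + 0) (Top.top env eq 0 (suc (suc q) ∷ h ∷ 0 ∷ []))
          (Top.top-dec env eq 0 (suc (suc q) ∷ h ∷ 0 ∷ []) refl ▹
            if-pos (d + 0) (Top.top env eq 0 (suc q ∷ h ∷ 0 ∷ []))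
              (Top.top-dec env eq 0 (suc q ∷ h ∷ 0 ∷ []) refl ▹ Top.top-inc env eq 1 (q ∷ h ∷ 0 ∷ [])))
          (run-halve q (suc h))))

    run-parity : ∀ {o} x q → Run (ifPos (d + 2) (dec (d + 2) ⨾ emitBit true) (emitBit false))
      ⟪ 0 , env ++ 0 ∷ x ∷ parity q ∷ [] , o ⟫ 3 ⟪ 0 , env ++ 0 ∷ x ∷ 0 ∷ [] , o ++ parityBit q ∷ [] ⟫
    run-parity x zero          = within (s≤s (s≤s z≤n))
      (if-zero (d + 2) (Top.top env eq 2 (0 ∷ x ∷ 0 ∷ [])) (run-emitBit false))
    run-parity x (suc zero)    = if-pos (d + 2) (Top.top env eq 2 (0 ∷ x ∷ 1 ∷ []))
      (Top.top-dec env eq 2 (0 ∷ x ∷ 1 ∷ []) refl ▹ run-emitBit true)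
    run-parity x (suc (suc q)) = run-parity x q

    run-digit : ∀ {o} B q → suc q ≤ B → Run (digit d) ⟪ 0 , env ++ suc q ∷ [] , o ⟫ (digitCost B)
      ⟪ 0 , env ++ half q ∷ [] , o ++ true ∷ parityBit q ∷ [] ⟫
    run-digit {o} B q q<B = subst (λ z → Run (digit d) ⟪ 0 , env ++ suc q ∷ [] , o ⟫ (digitCost B) ⟪ 0 , env ++ half q ∷ [] , z ⟫)
      (List.++-assoc o (true ∷ []) (parityBit q ∷ [])) (widen env drop₂ (
      run-emitBit true ▹ Top.top-dec env eq 0 (suc q ∷ 0 ∷ 0 ∷ []) refl ▹
      within (ℕ.+-monoˡ-≤ 1 (ℕ.*-monoˡ-≤ 6 q≤B))
        (exactly (cong (λ z → env ++ 0 ∷ z ∷ parity q ∷ []) (ℕ.+-identityʳ (half q))) (run-halve q 0)) ▹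
      run-parity (half q) q ▹
      trim env drop₂ (countdown₀ (d + 1) S (λ k j → Top.top env eq 1 (j ∷ k ∷ 0 ∷ []))
        (λ k j → Top.top-dec env eq 1 (j ∷ suc k ∷ 0 ∷ []) refl ▹ Top.top-inc env eq 0 (j ∷ k ∷ 0 ∷ []))
        B (half q) (ℕ.≤-trans (half≤ q) q≤B))))
      where
      q≤B : q ≤ B
      q≤B = ℕ.≤-trans (ℕ.n≤1+n q) q<B
      S : ℕ → ℕ → Mem
      S k j = ⟪ 0 , env ++ j ∷ k ∷ 0 ∷ [] , (o ++ true ∷ []) ++ parityBit q ∷ [] ⟫

    -- `f` is fuel, as `half q` is not structurally smaller than `suc q`. `B` stays at the initial
    -- value, so that all digits have the same cost bound.
    run-digits : ∀ {o} B f v → v ≤ f → v ≤ B →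
      Run (printRegister d) ⟪ 0 , env ++ v ∷ [] , o ⟫ ((v * suc (digitCost B) + 1) + 1) ⟪ 0 , env ++ 0 ∷ [] , o ++ printed v ⟫
    run-digits {o} B f v v≤f v≤B = subst
        (λ z → Run (printRegister d) ⟪ 0 , env ++ v ∷ [] , o ⟫ ((v * suc (digitCost B) + 1) + 1) ⟪ 0 , env ++ 0 ∷ [] , z ⟫)
        (trans (List.++-assoc o (digits f v) _) (cong (o ++_) (digits-printed f v v≤f)))
        (loops f v v≤f v≤B ▹ run-emitBit false)
      where
      digits : ℕ → ℕ → Word
      digits (suc f) (suc q) = true ∷ parityBit q ∷ digits f (half q)
      digits _       _       = []
      digits-printed : ∀ f v → v ≤ f → digits f v ++ false ∷ [] ≡ printed v
      digits-printed zero    zero    _ = refl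
      digits-printed (suc f) zero    _ = refl
      digits-printed (suc f) (suc q) (s≤s q≤f) = trans
        (cong (λ z → true ∷ parityBit q ∷ z) (digits-printed f (half q) (ℕ.≤-trans (half≤ q) q≤f))) (sym (printed-suc q))
      stop : ∀ {o} → Run (whilePos (d + 0) (digit d)) ⟪ 0 , env ++ 0 ∷ [] , o ⟫ 1 ⟪ 0 , env ++ 0 ∷ [] , o ++ [] ⟫
      stop {o} = subst (λ z → Run (whilePos (d + 0) (digit d)) ⟪ 0 , env ++ 0 ∷ [] , o ⟫ 1 ⟪ 0 , env ++ 0 ∷ [] , z ⟫)
        (sym (List.++-identityʳ o)) (while-stop (d + 0) (Top.top env eq 0 (0 ∷ [])))
      loops : ∀ {o} f v → v ≤ f → v ≤ B → Run (whilePos (d + 0) (digit d)) ⟪ 0 , env ++ v ∷ [] , o ⟫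
        (v * suc (digitCost B) + 1) ⟪ 0 , env ++ 0 ∷ [] , o ++ digits f v ⟫
      loops zero    zero _ _ = stop
      loops (suc f) zero _ _ = stop
      loops {o} (suc f) (suc q) (s≤s q≤f) q<B = subst
        (λ z → Run (whilePos (d + 0) (digit d)) ⟪ 0 , env ++ suc q ∷ [] , o ⟫ (suc q * suc (digitCost B) + 1) ⟪ 0 , env ++ 0 ∷ [] , z ⟫)
        (List.++-assoc o (true ∷ parityBit q ∷ []) (digits f (half q)))
        (within (ℕ.≤-trans
            (ℕ.+-monoʳ-≤ (suc (digitCost B)) (ℕ.+-monoˡ-≤ 1 (ℕ.*-monoˡ-≤ (suc (digitCost B)) (half≤ q))))
            (ℕ.≤-reflexive (sym (ℕ.+-assoc (suc (digitCost B)) (q * suc (digitCost B)) 1))))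
          (while-next (d + 0) (Top.top env eq 0 (suc q ∷ [])) (run-digit B q q<B)
            (loops f (half q) (ℕ.≤-trans (half≤ q) q≤f) (ℕ.≤-trans (half≤ q) (ℕ.≤-trans (ℕ.n≤1+n q) q<B)))))

  run-code : ∀ {n} (c : Code n) {V} → length w ≤ V → ∀ env {o} → length env ≡ n → Below n V env →
    Run (compile c) ⟪ 0 , env , o ⟫ (codeCost c V) ⟪ 0 , env , o ++ output c env ⟫
  run-code (emit u) w≤ env eq b = run-emits u
  run-code (c ▸ c′) {V} w≤ env {o} eq b = subst (λ z → Run (compile (c ▸ c′)) ⟪ 0 , env , o ⟫ (codeCost (c ▸ c′) V) ⟪ 0 , env , z ⟫)
    (List.++-assoc o _ _) (run-code c w≤ env eq b ▹ run-code c′ w≤ env eq b)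
  run-code {n} (for e c) {V} w≤ env {o} eq b = run-evaluate e w≤ env eq ℕ.≤-refl b ▹
    within (ℕ.+-monoˡ-≤ 1 (ℕ.*-monoˡ-≤ (suc (1 + C)) x≤)) (cleared (rounds x ℕ.≤-refl))
    where
    x C : ℕ
    x = value e env
    C = codeCost c (V + maxValue e V)
    x≤ : x ≤ maxValue e V
    x≤ = value≤ e env w≤ b
    f : ℕ → Word
    f i = output c (env ++ i ∷ [])
    zeros : ∀ i → nth i (0 ∷ []) ≡ nth i []
    zeros = zero₁
    cleared : ∀ {P s m u} → Run P s m ⟪ 0 , env ++ 0 ∷ [] , u ⟫ → Run P s m ⟪ 0 , env , u ⟫
    cleared r = exactly (List.++-identityʳ env) (trim env zeros r)
    rounds : ∀ {o} k → k ≤ x → Run (whilePos (n + 0) (dec (n + 0) ⨾ compile c)) ⟪ 0 , env ++ k ∷ [] , o ⟫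
      (k * suc (1 + C) + 1) ⟪ 0 , env ++ 0 ∷ [] , o ++ loop k f ⟫
    rounds {o} zero k≤ = subst (λ z → Run (whilePos (n + 0) (dec (n + 0) ⨾ compile c)) ⟪ 0 , env ++ 0 ∷ [] , o ⟫ 1 ⟪ 0 , env ++ 0 ∷ [] , z ⟫)
      (sym (List.++-identityʳ o)) (while-stop (n + 0) (Top.top env eq 0 (0 ∷ [])))
    rounds {o} (suc k) k≤ = subst
      (λ z → Run (whilePos (n + 0) (dec (n + 0) ⨾ compile c)) ⟪ 0 , env ++ suc k ∷ [] , o ⟫ (suc k * suc (1 + C) + 1) ⟪ 0 , env ++ 0 ∷ [] , z ⟫)
      (List.++-assoc o (f k) (loop k f))
      (within (ℕ.≤-reflexive (sym (ℕ.+-assoc (suc (1 + C)) (k * suc (1 + C)) 1)))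
        (while-next (n + 0) (Top.top env eq 0 (suc k ∷ []))
          (Top.top-dec env eq 0 (suc k ∷ []) refl ▹
            run-code c (ℕ.≤-trans w≤ (ℕ.m≤m+n V _)) (env ++ k ∷ []) (trans (length-snoc env k eq) (ℕ.+-comm n 1))
              (λ i → ℕ.≤-trans (below-snoc env eq b i)
                (ℕ.+-monoʳ-≤ V (ℕ.≤-trans (ℕ.≤-trans (ℕ.n≤1+n k) k≤) x≤))))
          (rounds k (ℕ.≤-trans (ℕ.n≤1+n k) k≤))))
  run-code {n} (ifNonzero e c c′) {V} w≤ env {o} eq b = run-evaluate e w≤ env eq ℕ.≤-refl b ▹ choose (value e env) refl
    where
    clear : ℕ → ℕ → Mem
    clear k j = ⟪ 0 , env ++ k ∷ [] , o ⟫
    M : ℕ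
    M = maxValue e V * 2 + 1
    choose : ∀ x → value e env ≡ x → Run (ifPos (n + 0) (whilePos (n + 0) (dec (n + 0)) ⨾ compile c) (compile c′))
      ⟪ 0 , env ++ x ∷ [] , o ⟫ (suc (M + codeCost c V + codeCost c′ V))
      ⟪ 0 , env , o ++ (if 0 <ᵇ x then output c env else output c′ env) ⟫
    choose zero    x≡ = within (s≤s (ℕ.m≤n+m (codeCost c′ V) (M + codeCost c V)))
      (if-zero (n + 0) (Top.top env eq 0 (0 ∷ []))
        (running λ σ (sat i u g) → result (run-code c′ w≤ env eq b) σ (sat i u λ j →
          subst (λ v → RegisterTape v (σ (2 + j))) (trans (nth-trim env zero₁ j) (cong (nth j) (List.++-identityʳ env))) (g j))))
    choose (suc k) x≡ = within (s≤s (ℕ.m≤m+n (M + codeCost c V) (codeCost c′ V)))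
      (if-pos (n + 0) (Top.top env eq 0 (suc k ∷ []))
        (exactly (List.++-identityʳ env) (trim env zero₁
          (countdown₀ (n + 0) clear (λ k j → Top.top env eq 0 (k ∷ [])) (λ k j → Top.top-dec env eq 0 (suc k ∷ []) refl)
            (maxValue e V) (suc k) (subst (_≤ maxValue e V) x≡ (value≤ e env w≤ b)))) ▹
          run-code c w≤ env eq b))
  run-code {n} (print e) {V} w≤ env eq b = run-evaluate e w≤ env eq ℕ.≤-refl b ▹
    within (ℕ.+-monoˡ-≤ 1 (ℕ.+-monoˡ-≤ 1 (ℕ.*-monoˡ-≤ (suc (digitCost (maxValue e V))) (value≤ e env w≤ b))))
      (exactly (List.++-identityʳ env) (trim env zero₁
        (Printing.run-digits env eq (maxValue e V) (value e env) (value e env) ℕ.≤-refl (value≤ e env w≤ b))))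

-- The query, the reading of the answer, and the cost of both.

record Hoare (O : Word → Word) (A : Store → Set) (P : Prog) (n : ℕ) (B : Store → Set) : Set where
  constructor hoare
  field
    executes : ∀ σ → A σ → ∃[ m ] ∃[ σ′ ] m ≤ n × Exec O P σ m σ′ × B σ′

open Hoare

module _ {O : Word → Word} where

  infixr 5 _⟫_

  _⟫_ : ∀ {A B C P Q m n} → Hoare O A P m B → Hoare O B Q n C → Hoare O A (P ⨾ Q) (m + n) C
  p ⟫ q = hoare λ σ a →
    let (_ , σ′ , m≤ , e , b) = executes p σ a
        (_ , σ″ , n≤ , e′ , c) = executes q σ′ b
    in _ , σ″ , ℕ.+-mono-≤ m≤ n≤ , compose e e′ , c

  slower : ∀ {A B P m n} → m ≤ n → Hoare O A P m B → Hoare O A P n B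
  slower m≤n p = hoare λ σ a → let (_ , σ′ , k≤ , e , b) = executes p σ a in _ , σ′ , ℕ.≤-trans k≤ m≤n , e , b

  while-done : ∀ {A P τ β} → (∀ σ → A σ → β (currentAt σ τ) ≡ false) → Hoare O A (while τ β P) 1 A
  while-done f = hoare λ σ a → 1 , σ , ℕ.≤-refl , while-false (f σ a) , a

  while-more : ∀ {A B C P τ β m n} → (∀ σ → A σ → β (currentAt σ τ) ≡ true) →
    Hoare O A P m B → Hoare O B (while τ β P) n C → Hoare O A (while τ β P) (suc (m + n)) C
  while-more f p q = hoare λ σ a →
    let (_ , σ′ , m≤ , e , b) = executes p σ a
        (_ , σ″ , n≤ , e′ , c) = executes q σ′ b
    in _ , σ″ , s≤s (ℕ.+-mono-≤ m≤ n≤) , while-true (f σ a) e e′ , c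

  branch-yes : ∀ {A B P Q τ β n} → (∀ σ → A σ → β (currentAt σ τ) ≡ true) →
    Hoare O A P n B → Hoare O A (branch τ β P Q) (suc n) B
  branch-yes f p = hoare λ σ a →
    let (_ , σ′ , m≤ , e , b) = executes p σ a in _ , σ′ , s≤s m≤ , branch-true (f σ a) e , b

  branch-no : ∀ {A B P Q τ β n} → (∀ σ → A σ → β (currentAt σ τ) ≡ false) →
    Hoare O A Q n B → Hoare O A (branch τ β P Q) (suc n) B
  branch-no f p = hoare λ σ a →
    let (_ , σ′ , m≤ , e , b) = executes p σ a in _ , σ′ , s≤s m≤ , branch-false (f σ a) e , b

-- Nothing is said about the cells before the head, because the answer is parsed from left to right
-- without return.
data Reading : Word → Tape → Set where
  at-end : ∀ {ls} → Reading [] (tape ls blank [])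
  at-bit : ∀ {ls b u} → Reading (b ∷ u) (tape ls (just b) (map just u))

reading-right : ∀ {b u} t → Reading (b ∷ u) t → Reading u (act (Tape.current t , right) t)
reading-right {u = []}    _ at-bit = at-end
reading-right {u = c ∷ u} _ at-bit = at-bit

reading-start : ∀ u → Reading u (writeWord u)
reading-start []      = at-end
reading-start (b ∷ u) = at-bit

bitsBeforeBlank : List Symbol → Word
bitsBeforeBlank (just b ∷ ss) = b ∷ bitsBeforeBlank ss
bitsBeforeBlank _             = []

-- The local function of readWord has no name here, so its type is left to unification.
mutual
  readWord-bits : ∀ ls c rs → readWord (tape ls c rs) ≡ bitsBeforeBlank (c ∷ rs)
  readWord-bits ls c rs with List._∷_ c rs
  ... | ss = readWord-local ls c rs ss

  readWord-local : ∀ (ls : List Symbol) (c : Symbol) (rs ss : List Symbol) → _ ≡ bitsBeforeBlank ss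
  readWord-local ls c rs []            = refl
  readWord-local ls c rs (nothing ∷ _) = refl
  readWord-local ls c rs (just b ∷ ss) = cong (b ∷_) (readWord-local ls c rs ss)

isTrue-reading : ∀ {b u} t → Reading (b ∷ u) t → isTrue (Tape.current t) ≡ b
isTrue-reading _ at-bit = refl

-- After the query neither the input tape nor the other registers matter. Tape 2 (register 0) holds
-- how many more points are allowed and tape 3 (register 1) how many came in excess.
record Answer (u : Word) (k f : ℕ) (σ : Store) : Set where
  constructor answer
  field
    unread  : Reading u (σ 1)
    allowance   : RegisterTape k (σ 2)
    overrun : RegisterTape f (σ 3)

open Answer

outRight outLeft : Prog
outRight = step 1 (_, right)
outLeft  = step 1 (_, left)

parseDigits parseRational : Prog
parseDigits   = while 1 isTrue (outRight ⨾ outRight) ⨾ outRight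
parseRational = outRight ⨾ parseDigits ⨾ parseDigits

parseRationals : ℕ → Prog
parseRationals zero    = skip
parseRationals (suc d) = parseRational ⨾ parseRationals d

-- Counts the points of the answer: register 0 down from the allowance, then register 1 up.
parsePoints : ℕ → Prog
parsePoints d = while 1 isTrue (outRight ⨾ parseRationals d ⨾ ifPos 0 (dec 0) (inc 1))

module _ {O : Word → Word} where

  parse-right : ∀ {b u k f} → Hoare O (Answer (b ∷ u) k f) outRight 1 (Answer u k f)
  parse-right = hoare λ σ (answer r q v) → let t = act (currentAt σ 1 , right) (σ 1) in
    1 , setTape 1 t σ , ℕ.≤-refl , step , answer
      (subst (Reading _) (sym (setTape-same 1 t σ)) (reading-right (σ 1) r))
      (subst (RegisterTape _) (sym (setTape-other 1 t σ 2 (λ ()))) q)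
      (subst (RegisterTape _) (sym (setTape-other 1 t σ 3 (λ ()))) v)

  parse-skip : ∀ {u k f} → Hoare O (Answer u k f) skip 1 (Answer u k f)
  parse-skip = hoare λ σ (answer r q v) → let t = act (currentAt σ 0 , stay) (σ 0) in
    1 , setTape 0 t σ , ℕ.≤-refl , step , answer
      (subst (Reading _) (sym (setTape-other 0 t σ 1 (λ ()))) r)
      (subst (RegisterTape _) (sym (setTape-other 0 t σ 2 (λ ()))) q)
      (subst (RegisterTape _) (sym (setTape-other 0 t σ 3 (λ ()))) v)

  bit-read : ∀ {b u k f} → ∀ σ → Answer (b ∷ u) k f σ → isTrue (currentAt σ 1) ≡ b
  bit-read σ a = isTrue-reading (σ 1) (unread a)

  parse-digits : ∀ x {u k f} → Hoare O (Answer (encodeℕᵇ x ++ u) k f) parseDigits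
    (length (encodeℕᵇ x) * 2) (Answer u k f)
  parse-digits x = go x
    where
    pairs : ∀ x {u k f} → Hoare O (Answer (encodeℕᵇ x ++ u) k f) (while 1 isTrue (outRight ⨾ outRight))
      (pred (length (encodeℕᵇ x) * 2)) (Answer (false ∷ u) k f)
    pairs ℕᵇ.zero    = while-done bit-read
    pairs 2[1+ x ]   = more-pairs x (pairs x)
      where
      more-pairs : ∀ x {b u k f} → Hoare O (Answer (encodeℕᵇ x ++ u) k f) (while 1 isTrue (outRight ⨾ outRight))
        (pred (length (encodeℕᵇ x) * 2)) (Answer (false ∷ u) k f) →
        Hoare O (Answer (true ∷ b ∷ encodeℕᵇ x ++ u) k f) (while 1 isTrue (outRight ⨾ outRight))
        (3 + length (encodeℕᵇ x) * 2) (Answer (false ∷ u) k f)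
      more-pairs x p = slower (ℕ.+-monoʳ-≤ 3 ℕ.pred[n]≤n)
        (while-more bit-read (parse-right ⟫ parse-right) p)
    pairs 1+[2 x ]   = slower (ℕ.+-monoʳ-≤ 3 ℕ.pred[n]≤n)
      (while-more bit-read (parse-right ⟫ parse-right) (pairs x))
    positive : ∀ x → suc (pred (length (encodeℕᵇ x) * 2)) ≡ length (encodeℕᵇ x) * 2
    positive ℕᵇ.zero  = refl
    positive 2[1+ x ] = refl
    positive 1+[2 x ] = refl
    go : ∀ x {u k f} → Hoare O (Answer (encodeℕᵇ x ++ u) k f) parseDigits (length (encodeℕᵇ x) * 2) (Answer u k f)
    go x = slower (ℕ.≤-reflexive (trans (ℕ.+-comm _ 1) (positive x))) (pairs x ⟫ parse-right)

  parse-two : ∀ {b} x y {u k f} → Hoare O (Answer (b ∷ (encodeℕᵇ x ++ encodeℕᵇ y) ++ u) k f) parseRational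
    (length (b ∷ encodeℕᵇ x ++ encodeℕᵇ y) * 2) (Answer u k f)
  parse-two {b} x y {u} {k} {f} = slower
    (s≤s (ℕ.≤-trans (ℕ.≤-reflexive (trans (sym (ℕ.*-distribʳ-+ 2 (length (encodeℕᵇ x)) _))
      (cong (_* 2) (sym (List.length-++ (encodeℕᵇ x)))))) (ℕ.n≤1+n _)))
    (parse-right ⟫ subst (λ z → Hoare O (Answer z k f) parseDigits (length (encodeℕᵇ x) * 2) (Answer (encodeℕᵇ y ++ u) k f))
      (sym (List.++-assoc (encodeℕᵇ x) _ u)) (parse-digits x) ⟫ parse-digits y)

  parse-rational : ∀ q {u k f} → Hoare O (Answer (encodeℚ q ++ u) k f) parseRational (length (encodeℚ q) * 2) (Answer u k f)
  parse-rational (mkℚ (ℤ.+ n) d _)   = parse-two (fromℕ n) (fromℕ d)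
  parse-rational (mkℚ -[1+ n ] d _) = parse-two (fromℕ n) (fromℕ d)

  parse-vec : ∀ {d} (v : Vec ℚ d) {u k f} → Hoare O (Answer (encodeVec v ++ u) k f) (parseRationals d)
    (length (encodeVec v) * 2 + 1) (Answer u k f)
  parse-vec []      = parse-skip
  parse-vec (q ∷ v) {u} {k} {f} = slower
    (ℕ.≤-reflexive (trans (sym (ℕ.+-assoc (length (encodeℚ q) * 2) _ 1)) (cong (_+ 1)
      (trans (sym (ℕ.*-distribʳ-+ 2 (length (encodeℚ q)) _)) (cong (_* 2) (sym (List.length-++ (encodeℚ q))))))))
    (subst (λ z → Hoare O (Answer z k f) parseRational (length (encodeℚ q) * 2) (Answer (encodeVec v ++ u) k f))
      (sym (List.++-assoc (encodeℚ q) _ u)) (parse-rational q) ⟫ parse-vec v)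

  count : ∀ {u} k f → Hoare O (Answer u k f) (ifPos 0 (dec 0) (inc 1)) 3 (Answer u (pred k) ((1 ∸ k) + f))
  count zero    f = branch-no (λ σ a → isMark-register 0 (σ 2) (allowance a)) (hoare λ σ (answer r q v) →
    let t  = act (currentAt σ 3 , right) (σ 3)
        σ₁ = setTape 3 t σ
        t₂ = act (mark , stay) (σ₁ 3)
    in 2 , setTape 3 t₂ σ₁ , ℕ.≤-refl , compose step step , answer
      (subst (Reading _) (sym (trans (setTape-other 3 t₂ σ₁ 1 (λ ())) (setTape-other 3 t σ 1 (λ ())))) r)
      (subst (RegisterTape _) (sym (trans (setTape-other 3 t₂ σ₁ 2 (λ ())) (setTape-other 3 t σ 2 (λ ())))) q)
      (subst (RegisterTape _) (sym (trans (setTape-same 3 t₂ σ₁) (cong (act (mark , stay)) (setTape-same 3 t σ))))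
        (push-blank (σ 3) v)))
  count {u} (suc k) f = subst (λ z → Hoare O (Answer u (suc k) f) (ifPos 0 (dec 0) (inc 1)) 3 (Answer u k (z + f))) (sym (ℕ.0∸n≡0 k)) (slower (ℕ.n≤1+n 2)
    (branch-yes (λ σ a → isMark-register (suc k) (σ 2) (allowance a)) (hoare λ σ (answer r q v) →
    let t = act (blank , left) (σ 2)
    in 1 , setTape 2 t σ , ℕ.≤-refl , step , answer
      (subst (Reading _) (sym (setTape-other 2 t σ 1 (λ ()))) r)
      (subst (RegisterTape _) (sym (setTape-same 2 t σ)) (pop-blank (σ 2) q))
      (subst (RegisterTape _) (sym (setTape-other 2 t σ 3 (λ ()))) v))))

  -- Started with f = 0, the final overrun is `length Q ∸ k`, which vanishes exactly when the answer
  -- has at most k points; this is the test that decides the language. The factor 7 pays for the 6 +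
  -- 2ℓ steps spent on a point whose code has 1 + ℓ bits.
  parse-points : ∀ {d} (Q : List (Vec ℚ d)) k f →
    Hoare O (Answer (encodePoints Q) k f) (parsePoints d) (length (encodePoints Q) * 7)
      (Answer (false ∷ []) (k ∸ length Q) ((length Q ∸ k) + f))
  parse-points {d} [] k f = slower (s≤s z≤n) (subst (λ z → Hoare O (Answer (false ∷ []) k f) (parsePoints d) 1 (Answer (false ∷ []) k (z + f)))
    (sym (ℕ.0∸n≡0 k)) (while-done bit-read))
  parse-points {d} (p ∷ Q) k f = slower bound
    (while-more bit-read (parse-right ⟫ parse-vec p ⟫ count k f)
      (subst₂ (λ y z → Hoare O (Answer (encodePoints Q) (pred k) ((1 ∸ k) + f)) (parsePoints d) (length (encodePoints Q) * 7) (Answer (false ∷ []) y z))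
        (pred-∸ k (length Q)) (over k (length Q)) (parse-points Q (pred k) ((1 ∸ k) + f))))
    where
    pred-∸ : ∀ k n → pred k ∸ n ≡ k ∸ suc n
    pred-∸ zero    n = ℕ.0∸n≡0 n
    pred-∸ (suc k) n = refl
    over : ∀ k n → (n ∸ pred k) + ((1 ∸ k) + f) ≡ (suc n ∸ k) + f
    over zero    n = ℕ.+-suc n f
    over (suc k) n = cong (λ z → (n ∸ k) + (z + f)) (ℕ.0∸n≡0 k)
    ℓ r : ℕ
    ℓ = length (encodeVec p)
    r = length (encodePoints Q)
    bound : suc ((1 + ((ℓ * 2 + 1) + 3)) + r * 7) ≤ length (encodePoints (p ∷ Q)) * 7
    bound = begin
      suc ((1 + ((ℓ * 2 + 1) + 3)) + r * 7) ≡⟨ arrange ℓ (r * 7) ⟩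
      6 + ℓ * 2 + r * 7                     ≤⟨ ℕ.+-monoˡ-≤ (r * 7) (ℕ.+-mono-≤ (ℕ.n≤1+n 6) (ℕ.*-monoʳ-≤ ℓ (ℕ.m≤m+n 2 5))) ⟩
      7 + ℓ * 7 + r * 7                     ≡⟨ cong (7 +_) (sym (ℕ.*-distribʳ-+ 7 ℓ r)) ⟩
      suc (ℓ + r) * 7                       ≡⟨ cong (λ z → suc z * 7) (sym (List.length-++ (encodeVec p))) ⟩
      length (encodePoints (p ∷ Q)) * 7     ∎
      where
      open ℕ.≤-Reasoning
      arrange : ∀ a b → suc ((1 + ((a * 2 + 1) + 3)) + b) ≡ 6 + a * 2 + b
      arrange = solve 2 (λ a b → con 1 :+ ((con 1 :+ ((a :* con 2 :+ con 1) :+ con 3)) :+ b) := con 6 :+ a :* con 2 :+ b) refl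
        where open ℕSolver.+-*-Solver

-- A query is read from the head up to the first blank, so the head has to return to the first bit.
-- The way back stops at the blank cell before the word.
rewind : Prog
rewind = outLeft ⨾ while 1 isMark outLeft ⨾ outRight

reductionProg : ℕ → Code 0 → Expr 0 → Prog
reductionProg d c K = compile c ⨾ evaluate K 0 ⨾ rewind ⨾ query ⨾ parsePoints d

length-loop : ∀ {A : Set} n (f : ℕ → List A) c → (∀ i → i < n → length (f i) ≤ c) → length (loop n f) ≤ n * c
length-loop zero    f c h = z≤n
length-loop (suc n) f c h = ℕ.≤-trans (ℕ.≤-reflexive (List.length-++ (f n)))
  (ℕ.+-mono-≤ (h n ℕ.≤-refl) (length-loop n f c (λ i i<n → h i (ℕ.≤-trans i<n (ℕ.n≤1+n n)))))

length-printed : ∀ v → length (printed v) ≤ v * 2 + 1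
length-printed v = go v v ℕ.≤-refl
  where
  go : ∀ f v → v ≤ f → length (printed v) ≤ v * 2 + 1
  go f       zero    _         = ℕ.≤-refl
  go (suc f) (suc q) (s≤s q≤f) rewrite printed-suc q = s≤s (s≤s (ℕ.≤-trans (go f (half q) (ℕ.≤-trans (half≤ q) q≤f))
    (ℕ.+-monoˡ-≤ 1 (ℕ.*-monoˡ-≤ 2 (half≤ q)))))

module _ (w : Word) where
  open Semantics w
  open Evaluation w id using (value≤; below-snoc)

  -- The cost of a code thus also bounds the size of the instance that it prints and, through it,
  -- the size of any admissible answer.
  length-output : ∀ {n} (c : Code n) {V} → length w ≤ V → ∀ env → length env ≡ n → Below n V env →
    length (output c env) ≤ codeCost c V
  length-output (emit o) w≤ env eq b = ℕ.m≤m+n (length o) 1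
  length-output (c ▸ c′) w≤ env eq b = ℕ.≤-trans (ℕ.≤-reflexive (List.length-++ (output c env)))
    (ℕ.+-mono-≤ (length-output c w≤ env eq b) (length-output c′ w≤ env eq b))
  length-output {n} (for e c) {V} w≤ env eq b = ℕ.≤-trans
    (length-loop (value e env) _ C λ i i< → length-output c (ℕ.≤-trans w≤ (ℕ.m≤m+n V _)) (env ++ i ∷ [])
      (trans (List.length-++ env) (trans (cong (_+ 1) eq) (ℕ.+-comm n 1)))
      (λ j → ℕ.≤-trans (below-snoc env eq b j) (ℕ.+-monoʳ-≤ V (ℕ.≤-trans (ℕ.<⇒≤ i<) (value≤ e env w≤ b)))))
    (ℕ.≤-trans (ℕ.*-mono-≤ (value≤ e env w≤ b) (ℕ.m≤n+m C 2))
      (ℕ.≤-trans (ℕ.m≤m+n _ 1) (ℕ.m≤n+m _ (evaluateCost e V))))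
    where
    C : ℕ
    C = codeCost c (V + maxValue e V)
  length-output (ifNonzero e c c′) {V} w≤ env eq b = ℕ.≤-trans (either (0 <ᵇ value e env))
    (ℕ.≤-trans (ℕ.n≤1+n _) (ℕ.m≤n+m _ (evaluateCost e V)))
    where
    M : ℕ
    M = maxValue e V * 2 + 1
    either : ∀ β → length (if β then output c env else output c′ env) ≤ M + codeCost c V + codeCost c′ V
    either true  = ℕ.≤-trans (length-output c w≤ env eq b) (ℕ.≤-trans (ℕ.m≤n+m _ M) (ℕ.m≤m+n _ (codeCost c′ V)))
    either false = ℕ.≤-trans (length-output c′ w≤ env eq b) (ℕ.m≤n+m _ (M + codeCost c V))
  length-output (print e) {V} w≤ env eq b = ℕ.≤-trans (length-printed (value e env))
    (ℕ.≤-trans (ℕ.+-monoˡ-≤ 1 (ℕ.*-mono-≤ (value≤ e env w≤ b) (ℕ.m≤m+n 2 _)))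
      (ℕ.≤-trans (ℕ.m≤m+n _ 1) (ℕ.m≤n+m _ (evaluateCost e V))))

rewindCost : ℕ → ℕ
rewindCost n = 1 + ((n * 2 + 1) + 1)

record Output (t : Tape) (k : ℕ) (σ : Store) : Set where
  constructor wrote
  field
    onTape  : σ 1 ≡ t
    allowance₀  : RegisterTape k (σ 2)
    overrun₀ : RegisterTape 0 (σ 3)

-- The head is on the last symbol of a word whose part before the head is u, reversed.
backTape : Word → Word → Tape
backTape []      v = tape [] blank (map just v ++ blank ∷ [])
backTape (b ∷ u) v = tape (map just u) (just b) (map just v ++ blank ∷ [])

module _ {O : Word → Word} where

  output-move : ∀ {t k} dir → Hoare O (Output t k) (step 1 (_, dir)) 1 (Output (act (Tape.current t , dir) t) k)
  output-move dir = hoare λ σ (wrote eq q v) → let t′ = act (currentAt σ 1 , dir) (σ 1) in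
    1 , setTape 1 t′ σ , ℕ.≤-refl , step , wrote
      (trans (setTape-same 1 t′ σ) (cong (λ t → act (Tape.current t , dir) t) eq))
      (subst (RegisterTape _) (sym (setTape-other 1 t′ σ 2 (λ ()))) q)
      (subst (RegisterTape _) (sym (setTape-other 1 t′ σ 3 (λ ()))) v)

  back-left : ∀ b u v → act (just b , left) (backTape (b ∷ u) v) ≡ backTape u (b ∷ v)
  back-left b []      v = refl
  back-left b (c ∷ u) v = refl

  back-loop : ∀ u v {k} → Hoare O (Output (backTape u v) k) (while 1 isMark outLeft) (length u * 2 + 1)
    (Output (backTape [] (u List.ʳ++ v)) k)
  back-loop []      v     = while-done λ σ a → cong (isMark ∘ Tape.current) (Output.onTape a)
  back-loop (b ∷ u) v {k} = while-more (λ σ a → cong (isMark ∘ Tape.current) (Output.onTape a))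
    (subst (λ t → Hoare O (Output (backTape (b ∷ u) v) k) outLeft 1 (Output t k)) (back-left b u v) (output-move left))
    (back-loop u (b ∷ v))

  run-rewind : ∀ o {k} → Hoare O (Output (outputTape o) k) rewind (rewindCost (length o))
    (Output (act (blank , right) (backTape [] o)) k)
  run-rewind o {k} =
    subst (λ t → Hoare O (Output (outputTape o) k) outLeft 1 (Output t k)) (first (reverse o)) (output-move left) ⟫
    subst₂ (λ ℓ u → Hoare O (Output (backTape (reverse o) []) k) (while 1 isMark outLeft) (ℓ * 2 + 1) (Output (backTape [] u) k))
      (List.length-reverse o) (trans (List.ʳ++-defn (reverse o)) (trans (List.++-identityʳ _) (List.reverse-involutive o)))
      (back-loop (reverse o) []) ⟫
    output-move right
    where
    first : ∀ u → act (blank , left) (tape (map just u) blank []) ≡ backTape u []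
    first []      = refl
    first (b ∷ u) = refl

readWord-rewound : ∀ o → readWord (act (blank , right) (backTape [] o)) ≡ o
readWord-rewound []      = refl
readWord-rewound (b ∷ o) = trans (readWord-bits (blank ∷ []) (just b) (map just o ++ blank ∷ [])) (cong (b ∷_) (bits o))
  where
  bits : ∀ o → bitsBeforeBlank (map just o ++ blank ∷ []) ≡ o
  bits []      = refl
  bits (b ∷ o) = cong (b ∷_) (bits o)

reductionCost : Code 0 → Expr 0 → ℕ → ℕ → ℕ
reductionCost c K n ℓ = codeCost c n + (evaluateCost K n + (rewindCost (codeCost c n) + (1 + ℓ * 7)))

module _ (d : ℕ) (c : Code 0) (K : Expr 0) (w : Word) (O : Word → Word) where
  open Memory w O
  open Semantics w

  private
    o : Word
    o = output c []
    k : ℕ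
    k = value K []

  prepare : Hoare O (λ σ → ∀ i → σ i ≡ initialStore w i) (compile c ⨾ evaluate K 0)
    (codeCost c (length w) + evaluateCost K (length w)) (Output (outputTape o) k)
  prepare = hoare λ σ eq →
    let (m , σ′ , m≤ , e , sat _ u g) = result (Compilation.run-code w O c ℕ.≤-refl [] refl (λ ()) ▹
          Evaluation.run-evaluate w O K ℕ.≤-refl [] refl z≤n (λ ())) σ (start σ eq)
    in m , σ′ , m≤ , e , wrote u (g 0) (g 1)
    where
    input₀ : ∀ w → InputTape w 0 (writeWord w)
    input₀ []      = shows refl 1 refl
    input₀ (b ∷ w) = shows refl 0 (cong (just b ∷_) (sym (List.++-identityʳ (map just w))))
    start : ∀ σ → (∀ i → σ i ≡ initialStore w i) → σ ⊨ ⟪ 0 , [] , [] ⟫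
    start σ eq = sat (subst (InputTape w 0) (sym (eq 0)) (input₀ w)) (eq 1)
      (λ i → subst (RegisterTape 0) (sym (eq (2 + i))) (holds (none (refl ∷ [])) []))

  run-query : ∀ {t} → Hoare O (Output t k) query 1 (Answer (O (readWord t)) k 0)
  run-query {t} = hoare λ σ (wrote eq q v) → let t′ = writeWord (O (readWord (σ 1))) in
    1 , setTape 1 t′ σ , ℕ.≤-refl , query , answer
      (subst (Reading _) (sym (setTape-same 1 t′ σ))
        (subst (λ z → Reading (O (readWord t)) (writeWord (O (readWord z)))) (sym eq) (reading-start _)))
      (subst (RegisterTape _) (sym (setTape-other 1 t′ σ 2 (λ ()))) q)
      (subst (RegisterTape _) (sym (setTape-other 1 t′ σ 3 (λ ()))) v)

  run-reduction : ∀ (Q : List (Vec ℚ d)) → O o ≡ encodePoints Q → ∀ {n} →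
    reductionCost c K (length w) (length (encodePoints Q)) + 1 ≤ n →
    run (machine (reductionProg d c K) 3 (not ∘ isMark)) (λ _ → O) n w [] ≡ just (not (0 <ᵇ (length Q ∸ k)))
  run-reduction Q eq n≥ =
    let (m , σ , m≤ , e , a) = executes whole (initialStore w) (λ _ → refl)
    in trans (machine-runs {O = O} (reassociate e) (ℕ.≤-trans (ℕ.+-monoˡ-≤ 1 m≤) n≥))
      (cong (just ∘ not) (trans (isMark-register _ (σ 3) (overrun a)) (cong (0 <ᵇ_) (ℕ.+-identityʳ (length Q ∸ k)))))
    where
    tail : Hoare O (Output (outputTape o) k) (rewind ⨾ query ⨾ parsePoints d)
      (rewindCost (length o) + (1 + length (encodePoints Q) * 7)) (Answer (false ∷ []) (k ∸ length Q) ((length Q ∸ k) + 0))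
    tail = run-rewind o ⟫ subst (λ u → Hoare O _ query 1 (Answer u k 0)) (trans (cong O (readWord-rewound o)) eq) run-query ⟫
      parse-points Q k 0
    whole : Hoare O (λ σ → ∀ i → σ i ≡ initialStore w i) ((compile c ⨾ evaluate K 0) ⨾ rewind ⨾ query ⨾ parsePoints d)
      (reductionCost c K (length w) (length (encodePoints Q))) (Answer (false ∷ []) (k ∸ length Q) ((length Q ∸ k) + 0))
    whole = slower (ℕ.≤-trans (ℕ.≤-reflexive (ℕ.+-assoc (codeCost c (length w)) _ _))
      (ℕ.+-monoʳ-≤ (codeCost c (length w)) (ℕ.+-monoʳ-≤ (evaluateCost K (length w)) (ℕ.+-monoˡ-≤ _
        (ℕ.+-monoʳ-≤ 1 (ℕ.+-monoˡ-≤ 1 (ℕ.+-monoˡ-≤ 1 (ℕ.*-monoˡ-≤ 2 (length-output w c ℕ.≤-refl [] refl (λ ()))))))))))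
      (prepare ⟫ tail)
    reassociate : ∀ {P Q R σ m σ′} → Exec O ((P ⨾ Q) ⨾ R) σ m σ′ → Exec O (P ⨾ Q ⨾ R) σ m σ′
    reassociate {P} {Q} {R} {σ} {σ′ = σ′} (compose {n = n} (compose {m = a} {n = b} p q) r) = subst (λ z → Exec O (P ⨾ Q ⨾ R) σ z σ′) (sym (ℕ.+-assoc a b n)) (compose p (compose q r))

poly-bound : ∀ {f} → Polynomial f → ∃[ e ] (∀ n → f n ≤ poly e n)
poly-bound {f} (degree a p) = 2 * a + 3 ^ a , λ n → ℕ.≤-trans (p n) (go n)
  where
  open ℕ.≤-Reasoning
  go : ∀ n → (2 + n) ^ a ≤ poly (2 * a + 3 ^ a) n
  -- For n at most 1 the power of n in `poly` does not grow with the exponent, so the additive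
  -- constant has to do the work.
  go 0 = ℕ.≤-trans (ℕ.^-monoˡ-≤ a (ℕ.n≤1+n 2)) (ℕ.≤-trans (ℕ.m≤n+m (3 ^ a) (2 * a)) (ℕ.m≤n+m _ (0 ^ (2 * a + 3 ^ a))))
  go 1 = ℕ.≤-trans (ℕ.m≤n+m (3 ^ a) (2 * a)) (ℕ.m≤n+m _ (1 ^ (2 * a + 3 ^ a)))
  go n@(suc (suc m)) = begin
    (2 + n) ^ a                   ≤⟨ ℕ.^-monoˡ-≤ a (begin
      2 + n                         ≤⟨ ℕ.+-mono-≤ (ℕ.m≤m+n 2 m) (ℕ.m≤m+n n (m * n)) ⟩
      n + (n + m * n)               ≡⟨ cong (λ z → n * z) (sym (ℕ.*-identityʳ n)) ⟩
      n ^ 2                         ∎) ⟩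
    (n ^ 2) ^ a                   ≡⟨ ℕ.^-*-assoc n 2 a ⟩
    n ^ (2 * a)                   ≤⟨ ℕ.^-monoʳ-≤ n (ℕ.m≤m+n (2 * a) (3 ^ a)) ⟩
    n ^ (2 * a + 3 ^ a)           ≤⟨ ℕ.m≤m+n _ (2 * a + 3 ^ a) ⟩
    poly (2 * a + 3 ^ a) n        ∎

length-encodePoints : ∀ {d} (Q : List (Vec ℚ d)) B → (∀ {q} → q ∈ Q → length (encodeVec q) ≤ B) →
  length (encodePoints Q) ≤ length Q * suc B + 1
length-encodePoints []      B h = ℕ.≤-refl
length-encodePoints (q ∷ Q) B h = s≤s (ℕ.≤-trans (ℕ.≤-reflexive (List.length-++ (encodeVec q)))
  (ℕ.≤-trans (ℕ.+-mono-≤ (h (here refl)) (length-encodePoints Q B (h ∘ there))) (ℕ.≤-reflexive (sym (ℕ.+-assoc B _ 1)))))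

length-point : ∀ {d} {q : Vec ℚ d} {P} → q ∈ P → length (encodeVec q) ≤ length (encodePoints P)
length-point {q = q} {P = p ∷ P} (here refl) = ℕ.≤-trans (ℕ.m≤m+n _ _)
  (ℕ.≤-trans (ℕ.≤-reflexive (sym (List.length-++ (encodeVec q)))) (ℕ.n≤1+n _))
length-point {P = p ∷ P} (there q∈) = ℕ.≤-trans (length-point q∈) (ℕ.≤-trans (ℕ.m≤n+m _ (length (encodeVec p)))
  (ℕ.≤-trans (ℕ.≤-reflexive (sym (List.length-++ (encodeVec p)))) (ℕ.n≤1+n _)))

length≤encode : ∀ {d} (P : List (Vec ℚ d)) → length P ≤ length (encodePoints P)
length≤encode []      = z≤n
length≤encode (p ∷ P) = s≤s (ℕ.≤-trans (length≤encode P) (ℕ.≤-trans (ℕ.m≤n+m _ (length (encodeVec p)))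
  (ℕ.≤-reflexive (sym (List.length-++ (encodeVec p))))))

∈-split : ∀ {A : Set} {x : A} {ys} → x ∈ ys → ∃[ us ] ∃[ vs ] ys ≡ us ++ x ∷ vs
∈-split (here refl) = [] , _ , refl
∈-split (there x∈)  = let (us , vs , eq) = ∈-split x∈ in _ ∷ us , vs , cong (_ ∷_) eq

∈-remove : ∀ {A : Set} {x y : A} us {vs} → y ≢ x → y ∈ us ++ x ∷ vs → y ∈ us ++ vs
∈-remove []       y≢x (here y≡x)  = contradiction y≡x y≢x
∈-remove []       y≢x (there y∈)  = y∈
∈-remove (u ∷ us) y≢x (here y≡u)  = here y≡u
∈-remove (u ∷ us) y≢x (there y∈)  = there (∈-remove us y≢x y∈)

unique-length : ∀ {A : Set} {xs ys : List A} → Unique xs → xs ⊆ ys → length xs ≤ length ys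
unique-length {xs = []}     _         _   = z≤n
unique-length {xs = x ∷ xs} (x∉ ∷ u) sub with ∈-split (sub (here refl))
... | us , vs , refl = ℕ.≤-trans (s≤s (unique-length u λ y∈ → ∈-remove us (λ { refl → All.lookup x∉ y∈ refl }) (sub (there y∈))))
  (ℕ.≤-reflexive (trans (cong suc (List.length-++ us)) (trans (sym (ℕ.+-suc (length us) (length vs))) (sym (List.length-++ us)))))

-- For showing that a small regret set contains nothing besides the points that are forced.
pigeonhole : ∀ {A : Set} (_≈?_ : DecidableEquality A) {xs ys : List A} → Unique xs → xs ⊆ ys → length ys ≤ length xs → ys ⊆ xs
pigeonhole _≈?_ {xs} {ys} u sub ≤ {y} y∈ with Any.any? (y ≈?_) xs
... | yes y∈xs = y∈xs
... | no  y∉xs = contradiction (unique-length {xs = y ∷ xs} (All.tabulate (λ z∈ y≡z → y∉xs (subst (_∈ xs) (sym y≡z) z∈)) ∷ u)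
  (λ { (here refl) → y∈ ; (there z∈) → sub z∈ })) (ℕ.≤⇒≯ ≤)

-- One query is enough: the machine prints the instance, computes the threshold `K` and compares it
-- with the number of points in the answer.
reduces : ∀ {d} (L : Language) (c : Code 0) (K : Expr 0) (I : Word → GRMRInstance d) →
  (∀ w → Semantics.output w c [] ≡ SearchProblem.encodeInstance (GRMR d) (I w)) →
  (∀ w Q → IsMinimumRegretSet (I w) Q → L w ⇔ (List⁺.length Q ≤ Semantics.value w K [])) →
  L ≤ᵀ GRMR d
reduces {d} L c K I encodes decides = record
  { reduction = machine (reductionProg d c K) 3 (not ∘ isMark)
  ; exponent  = proj₁ bound
  ; halts     = λ O solves w → _ , proj₂ (proj₂ (outcome O solves w))
  ; correct   = λ O solves w →
      let (Q , minimum , result) = outcome O solves w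
          L⇔ = decides w Q minimum
      in mk⇔ (λ l → trans result (cong just (accepts (Equivalence.to L⇔ l))))
             (λ r → Equivalence.from L⇔ (accepted (Maybe.just-injective (trans (sym result) r))))
  }
  where
  cost : ℕ → ℕ
  cost n = reductionCost c K n (codeCost c n * suc (codeCost c n) + 1) + 1
  C : Polynomial (codeCost c)
  C = poly-codeCost c
  poly-cost : Polynomial cost
  poly-cost = poly-+ (poly-+ C (poly-+ (poly-evaluateCost K) (poly-+
    (poly-+ (poly-const 1) (poly-+ (poly-linear C 2) (poly-const 1)))
    (poly-+ (poly-const 1) (poly-* (poly-+ (poly-* C (poly-+ (poly-const 1) C)) (poly-const 1)) (poly-const 7)))))) (poly-const 1)
  bound : ∃[ e ] (∀ n → cost n ≤ poly e n)
  bound = poly-bound poly-cost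
  accepts : ∀ {m k} → m ≤ k → not (0 <ᵇ (m ∸ k)) ≡ true
  accepts m≤k rewrite ℕ.m≤n⇒m∸n≡0 m≤k = refl
  accepted : ∀ {m k} → not (0 <ᵇ (m ∸ k)) ≡ true → m ≤ k
  accepted {m} {k} eq = ℕ.m∸n≡0⇒m≤n (zero-of (m ∸ k) eq)
    where
    zero-of : ∀ z → not (0 <ᵇ z) ≡ true → z ≡ 0
    zero-of zero _ = refl
  outcome : ∀ O → Solves O (GRMR d) → ∀ w → ∃[ Q ] IsMinimumRegretSet (I w) Q ×
    (run (machine (reductionProg d c K) 3 (not ∘ isMark)) (λ _ → O) (poly (proj₁ bound) (length w)) w []
      ≡ just (not (0 <ᵇ (List⁺.length Q ∸ Semantics.value w K []))))
  outcome O solves w =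
    let (Q , minimum , eq) = solves (I w)
    in Q , minimum , run-reduction d c K w O (toList Q) (trans (cong O (encodes w)) eq)
         (ℕ.≤-trans (ℕ.+-monoˡ-≤ 1 (ℕ.+-monoʳ-≤ (codeCost c (length w)) (ℕ.+-monoʳ-≤ (evaluateCost K (length w))
           (ℕ.+-monoʳ-≤ (rewindCost (codeCost c (length w))) (ℕ.+-monoʳ-≤ 1 (ℕ.*-monoˡ-≤ 7 (size Q (proj₁ minimum))))))))
           (proj₂ bound (length w)))
    where
    P : List (Vec ℚ d)
    P = toList (GRMRInstance.P (I w))
    encoding≤ : length (encodePoints P) ≤ codeCost c (length w)
    encoding≤ = ℕ.≤-trans (ℕ.≤-trans (ℕ.m≤m+n _ _) (ℕ.≤-reflexive (sym (List.length-++ (encodePoints P)))))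
      (ℕ.≤-trans (ℕ.≤-reflexive (cong length (sym (encodes w)))) (length-output w c ℕ.≤-refl [] refl (λ ())))
    -- The oracle is arbitrary, but a solution is a duplicate-free part of P: it has at most as many
    -- points as P, each with a code no longer than that of P. So parsing takes polynomial time
    -- whatever oracle is used.
    size : ∀ Q → IsRegretSet (I w) Q → length (encodePoints (toList Q)) ≤ codeCost c (length w) * suc (codeCost c (length w)) + 1
    size Q r = ℕ.≤-trans (length-encodePoints (toList Q) _ λ q∈ → ℕ.≤-trans (length-point (IsRegretSet.subset r q∈)) encoding≤)
      (ℕ.+-monoˡ-≤ 1 (ℕ.*-monoˡ-≤ _ (ℕ.≤-trans (unique-length (IsRegretSet.unique r) (IsRegretSet.subset r))
        (ℕ.≤-trans (length≤encode P) encoding≤))))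

-- Regret in terms of rational directions.

open ℝ using (seq)
open Sphere using (vector; unit)

dot : ∀ {d} → Vec ℚ d → Vec ℚ d → ℚ
dot p x = Vec.foldr′ ℚ._+_ 0ℚ (Vec.zipWith ℚ._*_ p x)

sample : ∀ {d} → Point d → ℕ → Vec ℚ d
sample v n = Vec.map (λ r → seq r n) v

-- A real direction is handled through its rational approximations: each term of the real inner
-- product is a rational inner product, so the geometry below can stay in ℚ.
dot-sample : ∀ {d} (p v : Point d) n → seq ⟨ p , v ⟩ n ≡ dot (sample p n) (sample v n)
dot-sample []      []      n = refl
dot-sample (r ∷ p) (s ∷ v) n = cong ((seq r n ℚ.* seq s n) ℚ.+_) (dot-sample p v n)

sample-embed : ∀ {d} (p : Vec ℚ d) n → sample (Vec.map fromℚ p) n ≡ p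
sample-embed []      n = refl
sample-embed (q ∷ p) n = cong (q ∷_) (sample-embed p n)

maxDot : ∀ {d} → List⁺ (Vec ℚ d) → Vec ℚ d → ℚ
maxDot (p ∷ ps) x = List.foldr ℚ._⊔_ (dot p x) (map (λ q → dot q x) ps)

ω-sample : ∀ {d} (s : Sphere d) (P : List⁺ (Vec ℚ d)) n → seq (ω s (embed P)) n ≡ maxDot P (sample (vector s) n)
ω-sample s (p ∷ ps) n = go ps
  where
  point : ∀ q → seq ⟨ Vec.map fromℚ q , vector s ⟩ n ≡ dot q (sample (vector s) n)
  point q = trans (dot-sample (Vec.map fromℚ q) (vector s) n) (cong (λ r → dot r (sample (vector s) n)) (sample-embed q n))
  go : ∀ qs → seq (List.foldr _⊔ᴿ_ ⟨ Vec.map fromℚ p , vector s ⟩ (map ⟨_, vector s ⟩ (map (Vec.map fromℚ) qs))) n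
    ≡ List.foldr ℚ._⊔_ (dot p (sample (vector s) n)) (map (λ q → dot q (sample (vector s) n)) qs)
  go []       = point p
  go (q ∷ qs) = cong₂ ℚ._⊔_ (point q) (go qs)

dot≤maxDot : ∀ {d} {q : Vec ℚ d} (Q : List⁺ (Vec ℚ d)) x → q ∈ toList Q → dot q x ℚ.≤ maxDot Q x
dot≤maxDot (p ∷ ps) x = go ps
  where
  go : ∀ qs {q} → q ∈ p ∷ qs → dot q x ℚ.≤ List.foldr ℚ._⊔_ (dot p x) (map (λ q → dot q x) qs)
  go []       (here refl)         = ℚ.≤-refl
  go (r ∷ qs) (here refl)         = ℚ.≤-trans (go qs (here refl)) (ℚ.p≤q⊔p (dot r x) _)
  go (r ∷ qs) (there (here refl)) = ℚ.p≤p⊔q (dot r x) _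
  go (r ∷ qs) (there (there q∈))  = ℚ.≤-trans (go qs (there q∈)) (ℚ.p≤q⊔p (dot r x) _)

maxDot-attained : ∀ {d} (Q : List⁺ (Vec ℚ d)) x → ∃[ q ] q ∈ toList Q × maxDot Q x ≡ dot q x
maxDot-attained (p ∷ ps) x = go ps
  where
  go : ∀ qs → ∃[ q ] q ∈ p ∷ qs × List.foldr ℚ._⊔_ (dot p x) (map (λ q → dot q x) qs) ≡ dot q x
  go []       = p , here refl , refl
  go (r ∷ qs) with go qs | ℚ.⊔-sel (dot r x) (List.foldr ℚ._⊔_ (dot p x) (map (λ q → dot q x) qs))
  ... | q , q∈ , eq       | inj₁ eq′ = r , there (here refl) , eq′
  ... | q , here q≡ , eq  | inj₂ eq′ = q , here q≡ , trans eq′ eq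
  ... | q , there q∈ , eq | inj₂ eq′ = q , there (there q∈) , trans eq′ eq

0≤+ : ∀ {p q} → 0ℚ ℚ.≤ p → 0ℚ ℚ.≤ q → 0ℚ ℚ.≤ p ℚ.+ q
0≤+ = ℚ.+-mono-≤ {0ℚ} {_} {0ℚ}

0≤* : ∀ {p q} → 0ℚ ℚ.≤ p → 0ℚ ℚ.≤ q → 0ℚ ℚ.≤ p ℚ.* q
0≤* {p} {q} 0≤p 0≤q = ℚ.nonNegative⁻¹ (p ℚ.* q) {{ℚ.nonNeg*nonNeg⇒nonNeg p {{ℚ.nonNegative 0≤p}} q {{ℚ.nonNegative 0≤q}}}}

0≤- : ∀ {p q} → p ℚ.≤ q → 0ℚ ℚ.≤ q ℚ.- p
0≤- {p} {q} p≤q = subst (ℚ._≤ q ℚ.- p) (ℚ.+-inverseʳ p) (ℚ.+-monoˡ-≤ (ℚ.- p) p≤q)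

by-difference : ∀ {p q r} → q ℚ.- p ≡ r → 0ℚ ℚ.≤ r → p ℚ.≤ q
by-difference {p} {q} {r} eq 0≤r = subst₂ ℚ._≤_ (ℚ.+-identityˡ p)
  (trans (cong (ℚ._+ p) (sym eq)) (solve 2 (λ p q → (q :- p) :+ p := q) refl p q)) (ℚ.+-monoˡ-≤ p 0≤r)
  where open ℚSolver.+-*-Solver

by-difference-< : ∀ {p q r} → q ℚ.- p ≡ r → 0ℚ ℚ.< r → p ℚ.< q
by-difference-< {p} {q} {r} eq 0<r = subst₂ ℚ._<_ (ℚ.+-identityˡ p)
  (trans (cong (ℚ._+ p) (sym eq)) (solve 2 (λ p q → (q :- p) :+ p := q) refl p q)) (ℚ.+-monoˡ-< p 0<r)
  where open ℚSolver.+-*-Solver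

0<- : ∀ {p q} → p ℚ.< q → 0ℚ ℚ.< q ℚ.- p
0<- {p} {q} p<q = subst (ℚ._< q ℚ.- p) (ℚ.+-inverseʳ p) (ℚ.+-monoˡ-< (ℚ.- p) p<q)

0<* : ∀ {p q} → 0ℚ ℚ.< p → 0ℚ ℚ.< q → 0ℚ ℚ.< p ℚ.* q
0<* {p} {q} 0<p 0<q = ℚ.positive⁻¹ (p ℚ.* q) {{ℚ.pos*pos⇒pos p {{ℚ.positive 0<p}} q {{ℚ.positive 0<q}}}}

rationalSphere : ∀ {d} (v : Vec ℚ d) → dot v v ≡ 1ℚ → Sphere d
rationalSphere v eq = record
  { vector = Vec.map fromℚ v
  ; unit   = (λ δ 0<δ → 0 , λ n _ → ℚ.≤-trans (ℚ.≤-reflexive (norm n)) (above δ 0<δ))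
           , (λ δ 0<δ → 0 , λ n _ → ℚ.≤-trans (above δ 0<δ) (ℚ.≤-reflexive (cong (ℚ._+ δ) (sym (norm n)))))
  }
  where
  norm : ∀ n → seq ⟨ Vec.map fromℚ v , Vec.map fromℚ v ⟩ n ≡ 1ℚ
  norm n = trans (dot-sample (Vec.map fromℚ v) (Vec.map fromℚ v) n)
    (trans (cong₂ dot (sample-embed v n) (sample-embed v n)) eq)
  above : ∀ δ → 0ℚ ℚ.< δ → 1ℚ ℚ.≤ 1ℚ ℚ.+ δ
  above δ 0<δ = subst (ℚ._≤ 1ℚ ℚ.+ δ) (ℚ.+-identityʳ 1ℚ) (ℚ.+-monoʳ-≤ 1ℚ (ℚ.<⇒≤ 0<δ))

module _ {d} (P : List⁺ (Vec ℚ d)) (standing : Standing (embed P)) (Q : List⁺ (Vec ℚ d)) (ε : ℚ) where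

  private
    -- From the index supplied by the standing condition on, ω is at least δ, so the truncation
    -- inside `recip` has no effect and the reciprocal is exact.
    reciprocal : ∀ s n → proj₁ (proj₂ (proj₂ (standing s))) ≤ n →
      ∃[ r ] seq (inverse (ω s (embed P)) (standing s)) n ≡ r × 0ℚ ℚ.< r × maxDot P (sample (vector s) n) ℚ.* r ≡ 1ℚ
    reciprocal s n N≤n with standing s
    ... | δ , 0<δ , N , above = r , refl , ℚ.positive⁻¹ r {{recip-pos δ {{ℚ.positive 0<δ}} (seq (ω s (embed P)) n)}} ,
      trans (cong (ℚ._* r) (sym (trans (ℚ.p≥q⇒p⊔q≡p (subst (ℚ._≤ _) (ℚ.+-identityˡ δ) (above n N≤n))) (ω-sample s P n))))
        (recip-inverse δ {{ℚ.positive 0<δ}} (seq (ω s (embed P)) n))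
      where
      r : ℚ
      r = recip δ {{ℚ.positive 0<δ}} (seq (ω s (embed P)) n)

    regret-seq : ∀ s n {r} → seq (inverse (ω s (embed P)) (standing s)) n ≡ r →
      seq (regretRatio (embed P) standing (embed Q) s) n ≡ 1ℚ ℚ.- maxDot Q (sample (vector s) n) ℚ.* r
    regret-seq s n eq = cong₂ (λ a b → 1ℚ ℚ.- a ℚ.* b) (ω-sample s Q n) eq

  -- The samples of a real unit vector need not have norm 1, hence the hypothesis is about all
  -- rational vectors x.
  regret-intro : (∀ x {p} → p ∈ toList P → (1ℚ ℚ.- ε) ℚ.* dot p x ℚ.≤ maxDot Q x) →
    MaximumRegretRatio≤ (embed P) standing (embed Q) (fromℚ ε)
  regret-intro h s δ 0<δ = proj₁ (proj₂ (proj₂ (standing s))) , λ n N≤n →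
    let (r , r≡ , 0<r , wr) = reciprocal s n N≤n
        x = sample (vector s) n
        (p , p∈ , p≡) = maxDot-attained P x
        le = subst (λ z → (1ℚ ℚ.- ε) ℚ.* z ℚ.≤ maxDot Q x) (sym p≡) (h x p∈)
    in subst (ℚ._≤ ε ℚ.+ δ) (sym (regret-seq s n r≡))
      (by-difference (trans (cong (λ z → ε ℚ.+ δ ℚ.- (z ℚ.- maxDot Q x ℚ.* r)) (sym wr)) (trans (arrange ε δ (maxDot P x) (maxDot Q x) r)
        (cong (λ z → δ ℚ.+ (z ℚ.+ (maxDot Q x ℚ.- (1ℚ ℚ.- ε) ℚ.* maxDot P x) ℚ.* r)) (trans (cong (λ z → ε ℚ.- ε ℚ.* z) wr) (cancel ε)))))
        (0≤+ (ℚ.<⇒≤ 0<δ) (0≤+ ℚ.≤-refl (0≤* (0≤- le) (ℚ.<⇒≤ 0<r)))))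
    where
    open ℚSolver.+-*-Solver
    arrange : ∀ ε δ w v r → ε ℚ.+ δ ℚ.- (w ℚ.* r ℚ.- v ℚ.* r)
      ≡ δ ℚ.+ ((ε ℚ.- ε ℚ.* (w ℚ.* r)) ℚ.+ (v ℚ.- (1ℚ ℚ.- ε) ℚ.* w) ℚ.* r)
    arrange = solve 5 (λ ε δ w v r → ε :+ δ :- (w :* r :- v :* r)
      := δ :+ ((ε :- ε :* (w :* r)) :+ (v :- (con 1ℚ :- ε) :* w) :* r)) refl
    cancel : ∀ ε → ε ℚ.- ε ℚ.* 1ℚ ≡ 0ℚ
    cancel = solve 1 (λ ε → ε :- ε :* con 1ℚ := con 0ℚ) refl

  -- For lower bounds rational unit vectors suffice. In such a direction the sequences are constant
  -- from some index on, so a violated inequality would be a fixed excess γ over ε, which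
  -- contradicts the limit condition for any positive δ below γ.
  regret-elim : MaximumRegretRatio≤ (embed P) standing (embed Q) (fromℚ ε) →
    ∀ v → dot v v ≡ 1ℚ → ∀ {p} → p ∈ toList P → 0ℚ ℚ.≤ 1ℚ ℚ.- ε →
    ∃[ q ] q ∈ toList Q × (1ℚ ℚ.- ε) ℚ.* dot p v ℚ.≤ dot q v
  regret-elim regret v eq {p} p∈ 0≤1-ε = q , q∈ , ℚ.≮⇒≥ λ q< → impossible (subst (ℚ._< (1ℚ ℚ.- ε) ℚ.* dot p v) (sym q≡) q<)
    where
    s : Sphere d
    s = rationalSphere v eq
    attained : ∃[ q ] q ∈ toList Q × maxDot Q v ≡ dot q v
    attained = maxDot-attained Q v
    q = proj₁ attained
    q∈ = proj₁ (proj₂ attained)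
    q≡ = proj₂ (proj₂ attained)
    open ℚSolver.+-*-Solver
    arrange : ∀ ε w v r → (w ℚ.* r ℚ.- v ℚ.* r) ℚ.- ε ℚ.* (w ℚ.* r) ≡ ((1ℚ ℚ.- ε) ℚ.* w ℚ.- v) ℚ.* r
    arrange = solve 4 (λ ε w v r → (w :* r :- v :* r) :- ε :* (w :* r) := ((con 1ℚ :- ε) :* w :- v) :* r) refl
    impossible : ¬ (maxDot Q v ℚ.< (1ℚ ℚ.- ε) ℚ.* dot p v)
    impossible Q<p = ℚ.<-irrefl refl (ℚ.<-≤-trans (ℚ.+-monoʳ-< ε δ<γ)
        (subst₂ ℚ._≤_ excess refl (proj₂ (regret s δ 0<δ) n (ℕ.m≤m⊔n N₁ N₂))))
      where
      N₂ : ℕ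
      N₂ = proj₁ (proj₂ (proj₂ (standing s)))
      rcp : ∀ n → N₂ ≤ n → ∃[ r ] seq (inverse (ω s (embed P)) (standing s)) n ≡ r × 0ℚ ℚ.< r × maxDot P v ℚ.* r ≡ 1ℚ
      rcp n N≤n = subst (λ x → ∃[ r ] seq (inverse (ω s (embed P)) (standing s)) n ≡ r × 0ℚ ℚ.< r × maxDot P x ℚ.* r ≡ 1ℚ)
        (sample-embed v n) (reciprocal s n N≤n)
      gap : ∀ {r} → 0ℚ ℚ.< r → 0ℚ ℚ.< ((1ℚ ℚ.- ε) ℚ.* maxDot P v ℚ.- maxDot Q v) ℚ.* r
      gap 0<r = 0<* (0<- (ℚ.<-≤-trans Q<p (ℚ.*-monoˡ-≤-nonNeg (1ℚ ℚ.- ε) {{ℚ.nonNegative 0≤1-ε}} (dot≤maxDot P v p∈)))) 0<r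
      -- The reciprocal does not depend on the index: the sequences are constant.
      r : ℚ
      r = proj₁ (rcp N₂ ℕ.≤-refl)
      γ : ℚ
      γ = ((1ℚ ℚ.- ε) ℚ.* maxDot P v ℚ.- maxDot Q v) ℚ.* r
      dense : ∃[ δ ] 0ℚ ℚ.< δ × δ ℚ.< γ
      dense = ℚ.<-dense (gap (proj₁ (proj₂ (proj₂ (rcp N₂ ℕ.≤-refl)))))
      δ = proj₁ dense
      0<δ = proj₁ (proj₂ dense)
      δ<γ = proj₂ (proj₂ dense)
      N₁ : ℕ
      N₁ = proj₁ (regret s δ 0<δ)
      n : ℕ
      n = N₁ ⊔ N₂
      same : ∀ {a b} → maxDot P v ℚ.* a ≡ 1ℚ → maxDot P v ℚ.* b ≡ 1ℚ → a ≡ b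
      same {a} {b} wa wb = trans (sym (ℚ.*-identityˡ a)) (trans (cong (ℚ._* a) (sym wb))
        (trans (solve 3 (λ w a b → (w :* b) :* a := (w :* a) :* b) refl (maxDot P v) a b) (trans (cong (ℚ._* b) wa) (ℚ.*-identityˡ b))))
      here′ = rcp n (ℕ.m≤n⊔m N₁ N₂)
      excess : seq (regretRatio (embed P) standing (embed Q) s) n ≡ ε ℚ.+ γ
      excess = trans (regret-seq s n (trans (proj₁ (proj₂ here′)) (same (proj₂ (proj₂ (proj₂ here′))) wr)))
        (trans (cong (λ x → 1ℚ ℚ.- maxDot Q x ℚ.* r) (sample-embed v n))
          (trans (solve 3 (λ ε a b → a :- b := ε :+ ((a :- b) :- ε :* con 1ℚ)) refl ε 1ℚ (maxDot Q v ℚ.* r))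
            (cong (ε ℚ.+_) (trans (cong (λ z → (z ℚ.- maxDot Q v ℚ.* r) ℚ.- ε ℚ.* z) (sym wr)) (arrange ε (maxDot P v) (maxDot Q v) r)))))
        where
        wr : maxDot P v ℚ.* r ≡ 1ℚ
        wr = proj₂ (proj₂ (proj₂ (rcp N₂ ℕ.≤-refl)))

-- The samples of a unit vector eventually have squared norm at least ½. A lower bound that is
-- uniform over such x gives the positive distance from 0 demanded by `_<ᴿ_`.
standing-intro : ∀ {d} (P : List⁺ (Vec ℚ d)) c → 0ℚ ℚ.< c →
  (∀ x → ℚ.½ ℚ.≤ dot x x → c ℚ.≤ maxDot P x) → Standing (embed P)
standing-intro P c 0<c h s with proj₂ (unit s) ℚ.½ (ℚ.positive⁻¹ ℚ.½)
... | N , close = c , 0<c , N , λ n N≤n → subst₂ ℚ._≤_ (sym (ℚ.+-identityˡ c)) (sym (ω-sample s P n))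
  (h (sample (vector s) n) (subst (ℚ.½ ℚ.≤_) (dot-sample (vector s) (vector s) n)
    (by-difference (trans (shift (seq ⟨ vector s , vector s ⟩ n)) refl) (0≤- (close n N≤n)))))
  where
  shift : ∀ a → a ℚ.- ℚ.½ ≡ (a ℚ.+ ℚ.½) ℚ.- 1ℚ
  shift = solve 1 (λ a → a :- con ℚ.½ := (a :+ con ℚ.½) :- con 1ℚ) refl
    where open ℚSolver.+-*-Solver

-- Lattice points on a paraboloid and convex combinations of them.

ι : ℤ → ℚ
ι z = mkℚ z 0 λ { (_ , d∣1) → ℕ.∣1⇒≡1 d∣1 }

ι-+ : ∀ a b → ι (a ℤ.+ b) ≡ ι a ℚ.+ ι b
ι-+ a b = ℚ.toℚᵘ-injective (ℚᵘ.≃-trans (*≡* (solve 2 (λ a b → (a :+ b) :* con (ℤ.+ 1) := (a :* con (ℤ.+ 1) :+ b :* con (ℤ.+ 1)) :* con (ℤ.+ 1)) refl a b))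
  (ℚᵘ.≃-sym (ℚ.toℚᵘ-homo-+ (ι a) (ι b))))
  where open ℤSolver.+-*-Solver

ι-* : ∀ a b → ι (a ℤ.* b) ≡ ι a ℚ.* ι b
ι-* a b = ℚ.toℚᵘ-injective (ℚᵘ.≃-trans (*≡* (solve 2 (λ a b → (a :* b) :* con (ℤ.+ 1) := (a :* b) :* con (ℤ.+ 1)) refl a b))
  (ℚᵘ.≃-sym (ℚ.toℚᵘ-homo-* (ι a) (ι b))))
  where open ℤSolver.+-*-Solver

ι-neg : ∀ a → ι (ℤ.- a) ≡ ℚ.- ι a
ι-neg (ℤ.+ zero)  = refl
ι-neg (ℤ.+ suc n) = refl
ι-neg -[1+ n ]    = refl

ι-- : ∀ a b → ι (a ℤ.- b) ≡ ι a ℚ.- ι b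
ι-- a b = trans (ι-+ a (ℤ.- b)) (cong (ι a ℚ.+_) (ι-neg b))

ι-≤ : ∀ {a b} → a ℤ.≤ b → ι a ℚ.≤ ι b
ι-≤ {a} {b} a≤b = ℚ.*≤* (subst₂ ℤ._≤_ (sym (ℤ.*-identityʳ a)) (sym (ℤ.*-identityʳ b)) a≤b)

ι-< : ∀ {a b} → a ℤ.< b → ι a ℚ.< ι b
ι-< {a} {b} a<b = ℚ.*<* (subst₂ ℤ._<_ (sym (ℤ.*-identityʳ a)) (sym (ℤ.*-identityʳ b)) a<b)

mkℚ-scaled : ∀ n d .(c : Coprime ℤ.∣ n ∣ (suc d)) → mkℚ n d c ℚ.* ι (ℤ.+ suc d) ≡ ι n
mkℚ-scaled n d c = ℚ.toℚᵘ-injective (ℚᵘ.≃-trans (ℚ.toℚᵘ-homo-* (mkℚ n d c) (ι (ℤ.+ suc d)))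
  (*≡* (trans (ℤ.*-identityʳ (n ℤ.* ℤ.+ suc d)) (cong (λ e → n ℤ.* ℤ.+ e) (sym (ℕ.*-identityʳ (suc d)))))))

-- An offset from the centre of a gadget, and a height.
record Offset : Set where
  constructor off
  field
    ex ey eh : ℤ

  power : ℤ
  power = eh ℤ.- ex ℤ.* ex ℤ.- ey ℤ.* ey

open Offset

Weighted : Set
Weighted = List (ℕ × Offset)

moment : (Offset → ℤ) → Weighted → ℤ
moment f []             = ℤ.+ 0
moment f ((w , r) ∷ ws) = ℤ.+ w ℤ.* f r ℤ.+ moment f ws

weight : Weighted → ℤ
weight = moment (λ _ → ℤ.+ 1)

-- This is `weight ws` times the amount of power that the weighted mean of the points loses against
-- `r`.
defect : Weighted → Offset → ℤ
defect ws r = weight ws ℤ.* power r ℤ.- moment power ws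

-- Balanced first moments put the mean at the same place of the plane as `r`, so only powers remain
-- to be compared. As 3300 = 15 · 220, the loss is at most 15/16 of `δ`. It is bounded on both sides
-- because the third component of a direction can have either sign.
record Covers (ws : Weighted) (r : Offset) : Set where
  constructor covers
  field
    balance-x : moment ex ws ≡ weight ws ℤ.* ex r
    balance-y : moment ey ws ≡ weight ws ℤ.* ey r
    positive  : ℤ.+ 0 ℤ.< weight ws
    shallow   : ℤ.+ 16 ℤ.* defect ws r ℤ.≤ ℤ.+ 3300 ℤ.* weight ws
    shallow′  : ℤ.- (ℤ.+ 3300 ℤ.* weight ws) ℤ.≤ ℤ.+ 16 ℤ.* defect ws r

covers? : ∀ ws r → Dec (Covers ws r)
covers? ws r = Dec.map′ (λ { (a , b , c , d , e) → covers a b c d e }) (λ { (covers a b c d e) → a , b , c , d , e })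
  ((_ ℤ.≟ _) ×-dec (_ ℤ.≟ _) ×-dec (_ ℤ.<? _) ×-dec (_ ℤ.≤? _) ×-dec (_ ℤ.≤? _))

-- Chosen between 206.25, the largest loss permitted by `Covers`, and 221, the margin in
-- `outranked`.
δ : ℚ
δ = ι (ℤ.+ 220)

dot-zeros : ∀ n (x : Vec ℚ n) → dot (Vec.replicate n 0ℚ) x ≡ 0ℚ
dot-zeros zero    []      = refl
dot-zeros (suc n) (x ∷ v) = trans (cong₂ ℚ._+_ (ℚ.*-zeroˡ x) (dot-zeros n v)) refl

-- The lattice points lie near the paraboloid z = 1 − x² − y², with σ the lattice spacing; the shift by σ²
-- makes all coordinates of the form (kS + 1)/Sⁿ with S = 1/σ, hence in lowest terms.
module Lattice (k : ℕ) (σ : ℚ) where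

  s : ℚ
  s = σ ℚ.* σ

  coordinate : ℚ → ℚ
  coordinate X = s ℚ.+ σ ℚ.* X

  -- Over the denominator S⁴, the squares of the two shifted coordinates subtract 1 each modulo S;
  -- the added 3 brings the numerator of a height back to 1.
  apex : ℚ
  apex = 1ℚ ℚ.+ ι (ℤ.+ 3) ℚ.* (s ℚ.* s)

  height : ℚ → ℚ → ℚ → ℚ
  height X Y h = apex ℚ.+ s ℚ.* h ℚ.- coordinate X ℚ.* coordinate X ℚ.- coordinate Y ℚ.* coordinate Y

  point : ℚ → ℚ → ℚ → Vec ℚ (3 + k)
  point X Y h = coordinate X ∷ coordinate Y ∷ height X Y h ∷ Vec.replicate k 0ℚ

  -- The second term makes the numerator over S⁴ equal to 220 S² + 1, which is prime to S.
  ε : ℚ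
  ε = δ ℚ.* s ℚ.+ s ℚ.* s

  dot-point : ∀ X Y h x y z v → dot (point X Y h) (x ∷ y ∷ z ∷ v)
    ≡ coordinate X ℚ.* x ℚ.+ coordinate Y ℚ.* y ℚ.+ height X Y h ℚ.* z
  dot-point X Y h x y z v = trans (cong (λ e → coordinate X ℚ.* x ℚ.+ (coordinate Y ℚ.* y ℚ.+ (height X Y h ℚ.* z ℚ.+ e))) (dot-zeros k v))
    (solve 3 (λ a b c → a :+ (b :+ (c :+ con 0ℚ)) := a :+ b :+ c) refl (coordinate X ℚ.* x) (coordinate Y ℚ.* y) (height X Y h ℚ.* z))
    where open ℚSolver.+-*-Solver

  module Around (X₀ Y₀ : ℚ) where

    a b ρ : ℚ
    a = coordinate X₀
    b = coordinate Y₀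
    ρ = a ℚ.* a ℚ.+ b ℚ.* b

    at : Offset → Vec ℚ (3 + k)
    at r = point (X₀ ℚ.+ ι (ex r)) (Y₀ ℚ.+ ι (ey r)) (ι (eh r))

    ι-power : ∀ r → ι (power r) ≡ ι (eh r) ℚ.- ι (ex r) ℚ.* ι (ex r) ℚ.- ι (ey r) ℚ.* ι (ey r)
    ι-power r = trans (ι-- (eh r ℤ.- ex r ℤ.* ex r) (ey r ℤ.* ey r))
      (cong₂ ℚ._-_ (trans (ι-- (eh r) (ex r ℤ.* ex r)) (cong (λ e → ι (eh r) ℚ.- e) (ι-* (ex r) (ex r)))) (ι-* (ey r) (ey r)))

    module _ (x y z : ℚ) (v : Vec ℚ k) where

      k₀ k₁ k₂ k₃ : ℚ
      k₀ = a ℚ.* x ℚ.+ b ℚ.* y ℚ.+ (apex ℚ.- a ℚ.* a ℚ.- b ℚ.* b) ℚ.* z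
      k₁ = σ ℚ.* x ℚ.- (a ℚ.+ a) ℚ.* σ ℚ.* z
      k₂ = σ ℚ.* y ℚ.- (b ℚ.+ b) ℚ.* σ ℚ.* z
      k₃ = s ℚ.* z

      -- This is the lifting trick: the squares in the third coordinate turn a linear functional on
      -- the cap into an affine function of `ex`, `ey` and `power`. Once first moments are balanced,
      -- a comparison of points in any direction is a comparison of powers.
      dot-at : ∀ r → dot (at r) (x ∷ y ∷ z ∷ v)
        ≡ k₀ ℚ.+ k₁ ℚ.* ι (ex r) ℚ.+ k₂ ℚ.* ι (ey r) ℚ.+ k₃ ℚ.* ι (power r)
      dot-at r = trans (dot-point (X₀ ℚ.+ ι (ex r)) (Y₀ ℚ.+ ι (ey r)) (ι (eh r)) x y z v)
        (trans (cong₂ (λ p q → p ℚ.* x ℚ.+ q ℚ.* y ℚ.+ (apex ℚ.+ s ℚ.* ι (eh r) ℚ.- p ℚ.* p ℚ.- q ℚ.* q) ℚ.* z)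
            (split s σ X₀ (ι (ex r))) (split s σ Y₀ (ι (ey r))))
          (trans (expand σ a b (ι (ex r)) (ι (ey r)) (ι (eh r)) x y z apex)
          (cong (λ m → k₀ ℚ.+ k₁ ℚ.* ι (ex r) ℚ.+ k₂ ℚ.* ι (ey r) ℚ.+ k₃ ℚ.* m) (sym (ι-power r)))))
        where
        open ℚSolver.+-*-Solver
        expand : ∀ σ a b e f h x y z c →
          (a ℚ.+ σ ℚ.* e) ℚ.* x ℚ.+ (b ℚ.+ σ ℚ.* f) ℚ.* y
            ℚ.+ (c ℚ.+ σ ℚ.* σ ℚ.* h ℚ.- (a ℚ.+ σ ℚ.* e) ℚ.* (a ℚ.+ σ ℚ.* e) ℚ.- (b ℚ.+ σ ℚ.* f) ℚ.* (b ℚ.+ σ ℚ.* f)) ℚ.* z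
          ≡ (a ℚ.* x ℚ.+ b ℚ.* y ℚ.+ (c ℚ.- a ℚ.* a ℚ.- b ℚ.* b) ℚ.* z)
            ℚ.+ (σ ℚ.* x ℚ.- (a ℚ.+ a) ℚ.* σ ℚ.* z) ℚ.* e ℚ.+ (σ ℚ.* y ℚ.- (b ℚ.+ b) ℚ.* σ ℚ.* z) ℚ.* f
            ℚ.+ σ ℚ.* σ ℚ.* z ℚ.* (h ℚ.- e ℚ.* e ℚ.- f ℚ.* f)
        expand = solve 10 (λ σ a b e f h x y z c →
          (a :+ σ :* e) :* x :+ (b :+ σ :* f) :* y
            :+ (c :+ σ :* σ :* h :- (a :+ σ :* e) :* (a :+ σ :* e) :- (b :+ σ :* f) :* (b :+ σ :* f)) :* z
          := (a :* x :+ b :* y :+ (c :- a :* a :- b :* b) :* z)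
            :+ (σ :* x :- (a :+ a) :* σ :* z) :* e :+ (σ :* y :- (b :+ b) :* σ :* z) :* f
            :+ σ :* σ :* z :* (h :- e :* e :- f :* f)) refl
        split : ∀ s σ X e → s ℚ.+ σ ℚ.* (X ℚ.+ e) ≡ (s ℚ.+ σ ℚ.* X) ℚ.+ σ ℚ.* e
        split = solve 4 (λ s σ X e → s :+ σ :* (X :+ e) := (s :+ σ :* X) :+ σ :* e) refl

      total : Weighted → ℚ
      total []             = 0ℚ
      total ((w , r) ∷ ws) = ι (ℤ.+ w) ℚ.* dot (at r) (x ∷ y ∷ z ∷ v) ℚ.+ total ws

      total-moments : ∀ ws → total ws ≡ k₀ ℚ.* ι (weight ws) ℚ.+ k₁ ℚ.* ι (moment ex ws) ℚ.+ k₂ ℚ.* ι (moment ey ws) ℚ.+ k₃ ℚ.* ι (moment power ws)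
      total-moments []             = solve 4 (λ a b c d → con 0ℚ := a :* con 0ℚ :+ b :* con 0ℚ :+ c :* con 0ℚ :+ d :* con 0ℚ) refl k₀ k₁ k₂ k₃
        where open ℚSolver.+-*-Solver
      total-moments ((w , r) ∷ ws) = trans
        (cong₂ (λ p q → ι (ℤ.+ w) ℚ.* p ℚ.+ q) (dot-at r) (total-moments ws))
        (trans (lemma k₀ k₁ k₂ k₃ (ι (ℤ.+ w)) (ι (ex r)) (ι (ey r)) (ι (power r)) _ _ _ _)
          (sym (cong₄ (cons (λ _ → ℤ.+ 1)) (cons ex) (cons ey) (cons power))))
        where
        open ℚSolver.+-*-Solver
        cons : ∀ f → ι (moment f ((w , r) ∷ ws)) ≡ ι (ℤ.+ w) ℚ.* ι (f r) ℚ.+ ι (moment f ws)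
        cons f = trans (ι-+ (ℤ.+ w ℤ.* f r) (moment f ws)) (cong (ℚ._+ ι (moment f ws)) (ι-* (ℤ.+ w) (f r)))
        cong₄ : ∀ {p p′ q q′ t t′ m m′} → p ≡ p′ → q ≡ q′ → t ≡ t′ → m ≡ m′ →
          k₀ ℚ.* p ℚ.+ k₁ ℚ.* q ℚ.+ k₂ ℚ.* t ℚ.+ k₃ ℚ.* m ≡ k₀ ℚ.* p′ ℚ.+ k₁ ℚ.* q′ ℚ.+ k₂ ℚ.* t′ ℚ.+ k₃ ℚ.* m′
        cong₄ refl refl refl refl = refl
        lemma : ∀ k₀ k₁ k₂ k₃ w e f m A B C D →
          w ℚ.* (k₀ ℚ.+ k₁ ℚ.* e ℚ.+ k₂ ℚ.* f ℚ.+ k₃ ℚ.* m) ℚ.+ (k₀ ℚ.* A ℚ.+ k₁ ℚ.* B ℚ.+ k₂ ℚ.* C ℚ.+ k₃ ℚ.* D)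
          ≡ k₀ ℚ.* (w ℚ.* 1ℚ ℚ.+ A) ℚ.+ k₁ ℚ.* (w ℚ.* e ℚ.+ B) ℚ.+ k₂ ℚ.* (w ℚ.* f ℚ.+ C) ℚ.+ k₃ ℚ.* (w ℚ.* m ℚ.+ D)
        lemma = solve 12 (λ k₀ k₁ k₂ k₃ w e f m A B C D →
          w :* (k₀ :+ k₁ :* e :+ k₂ :* f :+ k₃ :* m) :+ (k₀ :* A :+ k₁ :* B :+ k₂ :* C :+ k₃ :* D)
          := k₀ :* (w :* con 1ℚ :+ A) :+ k₁ :* (w :* e :+ B) :+ k₂ :* (w :* f :+ C) :+ k₃ :* (w :* m :+ D)) refl

      -- A convex combination of selected points that passes below the point at r by at most 15/16 of the
      -- tolerance covers it: the remaining sixteenth pays for the directions that are not vertical.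
      covered : ∀ {ws r Ω t} → Covers ws r → 0ℚ ℚ.≤ 1ℚ ℚ.- ε → z ℚ.≤ t → ℚ.- z ℚ.≤ t → ι (ℤ.+ 15) ℚ.* t ℚ.≤ ι (ℤ.+ 16) ℚ.* Ω →
        0ℚ ℚ.≤ Ω → 0ℚ ℚ.≤ s → All (λ (_ , q) → dot (at q) (x ∷ y ∷ z ∷ v) ℚ.≤ Ω) ws →
        (1ℚ ℚ.- ε) ℚ.* dot (at r) (x ∷ y ∷ z ∷ v) ℚ.≤ Ω
      covered {ws} {r} {Ω} {t} (covers bx by pos sh sh′) 0≤1-ε z≤t -z≤t t≤Ω 0≤Ω 0≤s all = ℚ.≤-trans
        (ℚ.*-monoˡ-≤-nonNeg (1ℚ ℚ.- ε) {{ℚ.nonNegative 0≤1-ε}} g≤)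
        (by-difference (solve 3 (λ Ω d s → Ω :- (con 1ℚ :- (d :* s :+ s :* s)) :* ((con 1ℚ :+ d :* s) :* Ω)
            := (s :* s :+ (d :* s :+ s :* s) :* (d :* s)) :* Ω) refl Ω δ s)
          (0≤* (0≤+ (0≤* 0≤s 0≤s) (0≤* (0≤+ (0≤* 0≤δ 0≤s) (0≤* 0≤s 0≤s)) (0≤* 0≤δ 0≤s))) 0≤Ω))
        where
        open ℚSolver.+-*-Solver
        W D g : ℚ
        W = ι (weight ws)
        D = ι (defect ws r)
        g = dot (at r) (x ∷ y ∷ z ∷ v)
        0≤δ : 0ℚ ℚ.≤ δ
        0≤δ = ι-≤ {ℤ.+ 0} {ℤ.+ 220} (ℤ.+≤+ z≤n)
        0<W : 0ℚ ℚ.< W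
        0<W = ι-< pos
        total≤ : ∀ ws → All (λ (_ , q) → dot (at q) (x ∷ y ∷ z ∷ v) ℚ.≤ Ω) ws → total ws ℚ.≤ ι (weight ws) ℚ.* Ω
        total≤ []             []         = ℚ.≤-reflexive (sym (ℚ.*-zeroˡ Ω))
        total≤ ((w , q) ∷ ws) (q≤ ∷ all) = ℚ.≤-trans
          (ℚ.+-mono-≤ (ℚ.*-monoˡ-≤-nonNeg (ι (ℤ.+ w)) {{ℚ.nonNegative (ι-≤ {ℤ.+ 0} (ℤ.+≤+ z≤n))}} q≤) (total≤ ws all))
          (ℚ.≤-reflexive (trans (sym (ℚ.*-distribʳ-+ Ω (ι (ℤ.+ w)) (ι (weight ws))))
            (cong (ℚ._* Ω) (sym (trans (ι-+ (ℤ.+ w ℤ.* ℤ.+ 1) (weight ws)) (cong (λ e → ι e ℚ.+ ι (weight ws)) (ℤ.*-identityʳ (ℤ.+ w))))))))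
        identity : W ℚ.* g ≡ total ws ℚ.+ k₃ ℚ.* D
        identity = trans (cong (W ℚ.*_) (dot-at r)) (trans
          (solve 9 (λ W k₀ k₁ k₂ k₃ e f m P → W :* (k₀ :+ k₁ :* e :+ k₂ :* f :+ k₃ :* m)
            := (k₀ :* W :+ k₁ :* (W :* e) :+ k₂ :* (W :* f) :+ k₃ :* P) :+ k₃ :* (W :* m :- P)) refl
            W k₀ k₁ k₂ k₃ (ι (ex r)) (ι (ey r)) (ι (power r)) (ι (moment power ws)))
          (cong₂ ℚ._+_ (trans (cong₂ (λ p q → k₀ ℚ.* W ℚ.+ k₁ ℚ.* p ℚ.+ k₂ ℚ.* q ℚ.+ k₃ ℚ.* ι (moment power ws))
              (trans (sym (ι-* (weight ws) (ex r))) (cong ι (sym bx))) (trans (sym (ι-* (weight ws) (ey r))) (cong ι (sym by))))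
              (sym (total-moments ws)))
            (cong (k₃ ℚ.*_) (sym (trans (ι-- (weight ws ℤ.* power r) (moment power ws)) (cong (ℚ._- ι (moment power ws)) (ι-* (weight ws) (power r))))))))
        K : ℚ
        K = ι (ℤ.+ 3300) ℚ.* W
        upper : ι (ℤ.+ 16) ℚ.* D ℚ.≤ K
        upper = subst₂ ℚ._≤_ (ι-* (ℤ.+ 16) (defect ws r)) (ι-* (ℤ.+ 3300) (weight ws)) (ι-≤ sh)
        lower : ℚ.- K ℚ.≤ ι (ℤ.+ 16) ℚ.* D
        lower = subst₂ ℚ._≤_ (trans (ι-neg (ℤ.+ 3300 ℤ.* weight ws)) (cong ℚ.-_ (ι-* (ℤ.+ 3300) (weight ws)))) (ι-* (ℤ.+ 16) (defect ws r)) (ι-≤ sh′)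
        g≤ : g ℚ.≤ (1ℚ ℚ.+ δ ℚ.* s) ℚ.* Ω
        -- The factor 32 comes from bounding a product of two signed quantities: (K - 16D)(t + z) +
        -- (16D + K)(t - z) = 2Kt - 32Dz, and both summands on the left are nonnegative.
        g≤ = ℚ.*-cancelˡ-≤-pos (ι (ℤ.+ 32) ℚ.* W) {{ℚ.positive (0<* {ι (ℤ.+ 32)} (ι-< {ℤ.+ 0} {ℤ.+ 32} (ℤ.+<+ (s≤s z≤n))) 0<W)}} (by-difference
          (trans (cong₂ ℚ._-_ {x = ι (ℤ.+ 32) ℚ.* W ℚ.* ((1ℚ ℚ.+ δ ℚ.* s) ℚ.* Ω)} refl (trans (ℚ.*-assoc (ι (ℤ.+ 32)) W g) (cong (ι (ℤ.+ 32) ℚ.*_) identity)))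
            (solve 8 (λ W Ω s T z t D O → con (ι (ℤ.+ 32)) :* W :* ((con 1ℚ :+ con δ :* s) :* Ω) :- con (ι (ℤ.+ 32)) :* (T :+ s :* z :* D)
              := con (ι (ℤ.+ 32)) :* (W :* Ω :- T) :+ con (ι (ℤ.+ 440)) :* W :* s :* (con (ι (ℤ.+ 16)) :* Ω :- con (ι (ℤ.+ 15)) :* t)
                :+ s :* ((con (ι (ℤ.+ 3300)) :* W :- con (ι (ℤ.+ 16)) :* D) :* (t :- (:- z)) :+ (con (ι (ℤ.+ 16)) :* D :- (:- (con (ι (ℤ.+ 3300)) :* W))) :* (t :- z)))
              refl W Ω s (total ws) z t D 0ℚ))
          (0≤+ (0≤+ (0≤* {ι (ℤ.+ 32)} (ι-≤ {ℤ.+ 0} {ℤ.+ 32} (ℤ.+≤+ z≤n)) (0≤- (total≤ ws all)))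
                    (0≤* (0≤* (0≤* {ι (ℤ.+ 440)} (ι-≤ {ℤ.+ 0} {ℤ.+ 440} (ℤ.+≤+ z≤n)) (ℚ.<⇒≤ 0<W)) 0≤s) (0≤- t≤Ω)))
            (0≤* 0≤s (0≤+ (0≤* (0≤- upper) (0≤- -z≤t)) (0≤* (0≤- lower) (0≤- z≤t))))))

-- Estimates on a fine lattice.

*-mono-≤ : ∀ {p q r t} → 0ℚ ℚ.≤ p → p ℚ.≤ q → 0ℚ ℚ.≤ r → r ℚ.≤ t → p ℚ.* r ℚ.≤ q ℚ.* t
*-mono-≤ {p} {q} {r} {t} 0≤p p≤q 0≤r r≤t = ℚ.≤-trans
  (ℚ.*-monoˡ-≤-nonNeg p {{ℚ.nonNegative 0≤p}} r≤t)
  (ℚ.*-monoʳ-≤-nonNeg t {{ℚ.nonNegative (ℚ.≤-trans 0≤r r≤t)}} p≤q)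

0≤ι : ∀ n → 0ℚ ℚ.≤ ι (ℤ.+ n)
0≤ι n = ι-≤ {ℤ.+ 0} {ℤ.+ n} (ℤ.+≤+ z≤n)

-- The second argument is one less than the denominator, so `n/ 3 3` below is three quarters and
-- `n/ 1 127` is 1/128.
n/ : ℕ → ℕ → ℚ
n/ n d = ℤ.+ n ℚ./ suc d

-- σ is the lattice spacing and μ bounds the positions, so coordinates are at most η = σμ. The
-- relation 32σμ² = 1 gives η⁴ = s/1024, which makes quantities of fourth order in η small against
-- the unit s of power.
module Scale (k : ℕ) (σ μ : ℚ) (0<σ : 0ℚ ℚ.< σ) (4≤μ : ι (ℤ.+ 4) ℚ.≤ μ) (scale : ι (ℤ.+ 32) ℚ.* (σ ℚ.* μ ℚ.* μ) ≡ 1ℚ) where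

  open Lattice k σ

  0≤σ : 0ℚ ℚ.≤ σ
  0≤σ = ℚ.<⇒≤ 0<σ

  0<s : 0ℚ ℚ.< s
  0<s = 0<* 0<σ 0<σ

  0≤s : 0ℚ ℚ.≤ s
  0≤s = ℚ.<⇒≤ 0<s

  0≤μ : 0ℚ ℚ.≤ μ
  0≤μ = ℚ.≤-trans (0≤ι 4) 4≤μ

  η : ℚ
  η = σ ℚ.* μ

  0≤η : 0ℚ ℚ.≤ η
  0≤η = 0≤* 0≤σ 0≤μ

  σ≤ : ι (ℤ.+ 512) ℚ.* σ ℚ.≤ 1ℚ
  σ≤ = subst₂ ℚ._≤_ (arrange σ) scale
    (ℚ.*-monoˡ-≤-nonNeg (ι (ℤ.+ 32)) (*-mono-≤ (0≤* 0≤σ (0≤ι 4)) (ℚ.*-monoˡ-≤-nonNeg σ {{ℚ.nonNegative 0≤σ}} 4≤μ) (0≤ι 4) 4≤μ))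
    where
    open ℚSolver.+-*-Solver
    arrange : ∀ σ → ι (ℤ.+ 32) ℚ.* (σ ℚ.* ι (ℤ.+ 4) ℚ.* ι (ℤ.+ 4)) ≡ ι (ℤ.+ 512) ℚ.* σ
    arrange = solve 1 (λ σ → con (ι (ℤ.+ 32)) :* (σ :* con (ι (ℤ.+ 4)) :* con (ι (ℤ.+ 4))) := con (ι (ℤ.+ 512)) :* σ) refl

  η≤ : ι (ℤ.+ 128) ℚ.* η ℚ.≤ 1ℚ
  η≤ = subst₂ ℚ._≤_ (arrange σ μ) scale
    (ℚ.*-monoˡ-≤-nonNeg (ι (ℤ.+ 32)) (ℚ.*-monoˡ-≤-nonNeg (σ ℚ.* μ) {{ℚ.nonNegative 0≤η}} 4≤μ))
    where
    open ℚSolver.+-*-Solver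
    arrange : ∀ σ μ → ι (ℤ.+ 32) ℚ.* (σ ℚ.* μ ℚ.* ι (ℤ.+ 4)) ≡ ι (ℤ.+ 128) ℚ.* (σ ℚ.* μ)
    arrange = solve 2 (λ σ μ → con (ι (ℤ.+ 32)) :* (σ :* μ :* con (ι (ℤ.+ 4))) := con (ι (ℤ.+ 128)) :* (σ :* μ)) refl

  η²≤ : ι (ℤ.+ 16384) ℚ.* (η ℚ.* η) ℚ.≤ 1ℚ
  η²≤ = subst (ℚ._≤ 1ℚ) (arrange η) (*-mono-≤ (0≤* (0≤ι 128) 0≤η) η≤ (0≤* (0≤ι 128) 0≤η) η≤)
    where
    open ℚSolver.+-*-Solver
    arrange : ∀ η → (ι (ℤ.+ 128) ℚ.* η) ℚ.* (ι (ℤ.+ 128) ℚ.* η) ≡ ι (ℤ.+ 16384) ℚ.* (η ℚ.* η)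
    arrange = solve 1 (λ η → (con (ι (ℤ.+ 128)) :* η) :* (con (ι (ℤ.+ 128)) :* η) := con (ι (ℤ.+ 16384)) :* (η :* η)) refl

  s≤ : ι (ℤ.+ 262144) ℚ.* s ℚ.≤ 1ℚ
  s≤ = subst (ℚ._≤ 1ℚ) (arrange σ) (*-mono-≤ (0≤* (0≤ι 512) 0≤σ) σ≤ (0≤* (0≤ι 512) 0≤σ) σ≤)
    where
    open ℚSolver.+-*-Solver
    arrange : ∀ η → (ι (ℤ.+ 512) ℚ.* η) ℚ.* (ι (ℤ.+ 512) ℚ.* η) ≡ ι (ℤ.+ 262144) ℚ.* (η ℚ.* η)
    arrange = solve 1 (λ η → (con (ι (ℤ.+ 512)) :* η) :* (con (ι (ℤ.+ 512)) :* η) := con (ι (ℤ.+ 262144)) :* (η :* η)) refl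

  -- Weaker forms of the bounds on σ, s and η, with a free nonnegative coefficient.
  shrink : ∀ {a} n m → ι (ℤ.+ n) ℚ.* a ℚ.≤ 1ℚ → 0ℚ ℚ.≤ a → m ≤ n → ι (ℤ.+ m) ℚ.* a ℚ.≤ 1ℚ
  shrink {a} n m h 0≤a m≤n = ℚ.≤-trans (ℚ.*-monoʳ-≤-nonNeg a {{ℚ.nonNegative 0≤a}} (ι-≤ (ℤ.+≤+ m≤n))) h

  s≤1 : s ℚ.≤ 1ℚ
  s≤1 = subst (ℚ._≤ 1ℚ) (ℚ.*-identityˡ s) (shrink 262144 1 s≤ 0≤s (s≤s z≤n))

  s²≤s : s ℚ.* s ℚ.≤ s
  s²≤s = subst (s ℚ.* s ℚ.≤_) (ℚ.*-identityʳ s) (ℚ.*-monoˡ-≤-nonNeg s {{ℚ.nonNegative 0≤s}} s≤1)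

  0≤s² : 0ℚ ℚ.≤ s ℚ.* s
  0≤s² = 0≤* 0≤s 0≤s

  s≤σ : s ℚ.≤ σ
  s≤σ = subst (s ℚ.≤_) (ℚ.*-identityʳ σ) (ℚ.*-monoˡ-≤-nonNeg σ {{ℚ.nonNegative 0≤σ}}
    (subst (ℚ._≤ 1ℚ) (ℚ.*-identityˡ σ) (shrink 512 1 σ≤ 0≤σ (s≤s z≤n))))

  0≤δ : 0ℚ ℚ.≤ δ
  0≤δ = 0≤ι 220

  0≤ε : 0ℚ ℚ.≤ ε
  0≤ε = 0≤+ (0≤* 0≤δ 0≤s) 0≤s²

  ε≤ : ι (ℤ.+ 4) ℚ.* ε ℚ.≤ 1ℚ
  ε≤ = by-difference (solve 2 (λ s q → con 1ℚ :- con (ι (ℤ.+ 4)) :* (con δ :* s :+ q)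
      := (con 1ℚ :- con (ι (ℤ.+ 884)) :* s) :+ con (ι (ℤ.+ 4)) :* (s :- q)) refl s (s ℚ.* s))
    (0≤+ (0≤- (shrink 262144 884 s≤ 0≤s (ℕ.m≤m+n 884 261260))) (0≤* (0≤ι 4) (0≤- s²≤s)))
    where open ℚSolver.+-*-Solver

  0≤1-ε : 0ℚ ℚ.≤ 1ℚ ℚ.- ε
  0≤1-ε = 0≤- (ℚ.≤-trans (ℚ.≤-trans (ℚ.≤-reflexive (sym (ℚ.*-identityˡ ε)))
    (ℚ.*-monoʳ-≤-nonNeg ε {{ℚ.nonNegative 0≤ε}} (ι-≤ {ℤ.+ 1} {ℤ.+ 4} (ℤ.+≤+ (s≤s z≤n))))) ε≤)

  -- With positions of at least 6, each squared coordinate is at least 36 s. This outweighs a height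
  -- offset of up to 34 and keeps the points below z = 1. The spare 1 in `below` absorbs the shift
  -- of a coordinate by s.
  record Good (X : ℚ) : Set where
    constructor good
    field
      above : ι (ℤ.+ 6) ℚ.≤ X
      below : X ℚ.+ 1ℚ ℚ.≤ μ

  coordinate≤η : ∀ {X} → Good X → coordinate X ℚ.≤ η
  coordinate≤η {X} (good _ b) = ℚ.≤-trans (ℚ.+-monoˡ-≤ (σ ℚ.* X) s≤σ)
    (ℚ.≤-trans (ℚ.≤-reflexive (solve 2 (λ σ X → σ :+ σ :* X := σ :* (X :+ con 1ℚ)) refl σ X))
      (ℚ.*-monoˡ-≤-nonNeg σ {{ℚ.nonNegative 0≤σ}} b))
    where open ℚSolver.+-*-Solver

  6σ≤coordinate : ∀ {X} → Good X → ι (ℤ.+ 6) ℚ.* σ ℚ.≤ coordinate X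
  6σ≤coordinate {X} (good a _) = ℚ.≤-trans (ℚ.*-monoʳ-≤-nonNeg σ {{ℚ.nonNegative 0≤σ}} a)
    (by-difference (solve 3 (λ s σ X → s :+ σ :* X :- X :* σ := s) refl s σ X) 0≤s)
    where open ℚSolver.+-*-Solver

  0≤coordinate : ∀ {X} → Good X → 0ℚ ℚ.≤ coordinate X
  0≤coordinate g = ℚ.≤-trans (0≤* (0≤ι 6) 0≤σ) (6σ≤coordinate g)

  square≤ : ∀ {X} → Good X → coordinate X ℚ.* coordinate X ℚ.≤ η ℚ.* η
  square≤ g = *-mono-≤ (0≤coordinate g) (coordinate≤η g) (0≤coordinate g) (coordinate≤η g)

  36s≤square : ∀ {X} → Good X → ι (ℤ.+ 36) ℚ.* s ℚ.≤ coordinate X ℚ.* coordinate X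
  36s≤square {X} g = subst (ℚ._≤ coordinate X ℚ.* coordinate X) (solve 1 (λ σ → (con (ι (ℤ.+ 6)) :* σ) :* (con (ι (ℤ.+ 6)) :* σ) := con (ι (ℤ.+ 36)) :* (σ :* σ)) refl σ)
    (*-mono-≤ (0≤* (0≤ι 6) 0≤σ) (6σ≤coordinate g) (0≤* (0≤ι 6) 0≤σ) (6σ≤coordinate g))
    where open ℚSolver.+-*-Solver

  height≤1 : ∀ {X Y h} → Good X → Good Y → h ℚ.≤ ι (ℤ.+ 34) → height X Y h ℚ.≤ 1ℚ
  height≤1 {X} {Y} {h} gX gY h≤ = by-difference
    (solve 5 (λ s q h A B → con 1ℚ :- (con 1ℚ :+ con (ι (ℤ.+ 3)) :* q :+ s :* h :- A :- B)
        := con (ι (ℤ.+ 3)) :* (s :- q) :+ s :* (con (ι (ℤ.+ 34)) :- h) :+ (A :- con (ι (ℤ.+ 36)) :* s) :+ (B :- con (ι (ℤ.+ 36)) :* s) :+ con (ι (ℤ.+ 35)) :* s)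
      refl s (s ℚ.* s) h (coordinate X ℚ.* coordinate X) (coordinate Y ℚ.* coordinate Y))
    (0≤+ (0≤+ (0≤+ (0≤+ (0≤* (0≤ι 3) (0≤- s²≤s)) (0≤* 0≤s (0≤- h≤))) (0≤- (36s≤square gX))) (0≤- (36s≤square gY))) (0≤* (0≤ι 35) 0≤s))
    where open ℚSolver.+-*-Solver

  depth≤ : ∀ {X Y h} → Good X → Good Y → ι (ℤ.- ℤ.+ 64) ℚ.≤ h →
    1ℚ ℚ.- height X Y h ℚ.≤ ι (ℤ.+ 2) ℚ.* (η ℚ.* η) ℚ.+ ι (ℤ.+ 64) ℚ.* s
  depth≤ {X} {Y} {h} gX gY h≥ = by-difference
    (solve 6 (λ s q h A B E → con (ι (ℤ.+ 2)) :* E :+ con (ι (ℤ.+ 64)) :* s :- (con 1ℚ :- (con 1ℚ :+ con (ι (ℤ.+ 3)) :* q :+ s :* h :- A :- B))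
        := (E :- A) :+ (E :- B) :+ con (ι (ℤ.+ 3)) :* q :+ s :* (h :- con (ι (ℤ.- ℤ.+ 64))))
      refl s (s ℚ.* s) h (coordinate X ℚ.* coordinate X) (coordinate Y ℚ.* coordinate Y) (η ℚ.* η))
    (0≤+ (0≤+ (0≤+ (0≤- (square≤ gX)) (0≤- (square≤ gY))) (0≤* (0≤ι 3) 0≤s²)) (0≤* 0≤s (0≤- h≥)))
    where open ℚSolver.+-*-Solver

  31≤height : ∀ {X Y h} → Good X → Good Y → ι (ℤ.- ℤ.+ 64) ℚ.≤ h → ι (ℤ.+ 31) ℚ.≤ ι (ℤ.+ 32) ℚ.* height X Y h
  31≤height {X} {Y} {h} gX gY h≥ = by-difference
    (solve 3 (λ H E s → con (ι (ℤ.+ 32)) :* H :- con (ι (ℤ.+ 31))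
        := con (ι (ℤ.+ 32)) :* ((con (ι (ℤ.+ 2)) :* E :+ con (ι (ℤ.+ 64)) :* s) :- (con 1ℚ :- H))
          :+ con ℚ.½ :* ((con 1ℚ :- con (ι (ℤ.+ 128)) :* E) :+ (con 1ℚ :- con (ι (ℤ.+ 4096)) :* s)))
      refl (height X Y h) (η ℚ.* η) s)
    (0≤+ (0≤* (0≤ι 32) (0≤- (depth≤ gX gY h≥))) (0≤* (ℚ.nonNegative⁻¹ ℚ.½)
      (0≤+ (0≤- (shrink 16384 128 η²≤ (0≤* 0≤η 0≤η) (ℕ.m≤m+n 128 16256))) (0≤- (shrink 262144 4096 s≤ 0≤s (ℕ.m≤m+n 4096 258048))))))
    where open ℚSolver.+-*-Solver

  module Toward (X₀ Y₀ : ℚ) (gX₀ : Good X₀) (gY₀ : Good Y₀) where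
    open Around X₀ Y₀

    0≤ρ : 0ℚ ℚ.≤ ρ
    0≤ρ = 0≤+ (0≤* (0≤coordinate gX₀) (0≤coordinate gX₀)) (0≤* (0≤coordinate gY₀) (0≤coordinate gY₀))

    0<1+ρ : 0ℚ ℚ.< 1ℚ ℚ.+ ρ
    0<1+ρ = ℚ.<-≤-trans (ℚ.positive⁻¹ 1ℚ) (subst (ℚ._≤ 1ℚ ℚ.+ ρ) (ℚ.+-identityʳ 1ℚ) (ℚ.+-monoʳ-≤ 1ℚ 0≤ρ))

    r : ℚ
    r = (ℚ.1/ (1ℚ ℚ.+ ρ)) {{ℚ.pos⇒nonZero (1ℚ ℚ.+ ρ) {{ℚ.positive 0<1+ρ}}}}

    0<r : 0ℚ ℚ.< r
    0<r = ℚ.positive⁻¹ r {{ℚ.1/pos⇒pos (1ℚ ℚ.+ ρ) {{ℚ.positive 0<1+ρ}}}}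

    r-inverse : (1ℚ ℚ.+ ρ) ℚ.* r ≡ 1ℚ
    r-inverse = ℚ.*-inverseʳ (1ℚ ℚ.+ ρ) {{ℚ.pos⇒nonZero (1ℚ ℚ.+ ρ) {{ℚ.positive 0<1+ρ}}}}

    -- Inverse stereographic projection of (a, b).
    normal : Vec ℚ (3 + k)
    normal = (a ℚ.+ a) ℚ.* r ∷ (b ℚ.+ b) ℚ.* r ∷ (1ℚ ℚ.- ρ) ℚ.* r ∷ Vec.replicate k 0ℚ

    normal-unit : dot normal normal ≡ 1ℚ
    normal-unit = trans (cong (λ e → x ℚ.* x ℚ.+ (y ℚ.* y ℚ.+ (z ℚ.* z ℚ.+ e))) (dot-zeros k _))
      (trans (arrange a b r) (trans (cong (λ e → e ℚ.* e) r-inverse) refl))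
      where
      open ℚSolver.+-*-Solver
      x = (a ℚ.+ a) ℚ.* r
      y = (b ℚ.+ b) ℚ.* r
      z = (1ℚ ℚ.- ρ) ℚ.* r
      arrange : ∀ a b r → (((a ℚ.+ a) ℚ.* r) ℚ.* ((a ℚ.+ a) ℚ.* r)) ℚ.+ ((((b ℚ.+ b) ℚ.* r) ℚ.* ((b ℚ.+ b) ℚ.* r))
        ℚ.+ ((((1ℚ ℚ.- (a ℚ.* a ℚ.+ b ℚ.* b)) ℚ.* r) ℚ.* ((1ℚ ℚ.- (a ℚ.* a ℚ.+ b ℚ.* b)) ℚ.* r)) ℚ.+ 0ℚ))
        ≡ ((1ℚ ℚ.+ (a ℚ.* a ℚ.+ b ℚ.* b)) ℚ.* r) ℚ.* ((1ℚ ℚ.+ (a ℚ.* a ℚ.+ b ℚ.* b)) ℚ.* r)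
      arrange = solve 3 (λ a b r → (((a :+ a) :* r) :* ((a :+ a) :* r)) :+ ((((b :+ b) :* r) :* ((b :+ b) :* r))
        :+ ((((con 1ℚ :- (a :* a :+ b :* b)) :* r) :* ((con 1ℚ :- (a :* a :+ b :* b)) :* r)) :+ con 0ℚ))
        := ((con 1ℚ :+ (a :* a :+ b :* b)) :* r) :* ((con 1ℚ :+ (a :* a :+ b :* b)) :* r)) refl

    heightAt : Offset → ℚ
    heightAt q = height (X₀ ℚ.+ ι (Offset.ex q)) (Y₀ ℚ.+ ι (Offset.ey q)) (ι (Offset.eh q))

    -- The paraboloid has normal (2a, 2b, 1), whose length is in general irrational. Replacing the
    -- third component by 1 - ρ makes the length 1 + ρ; the price is the last term, ρ times the
    -- depth of the point below 1.
    level : Offset → ℚ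
    level q = apex ℚ.+ s ℚ.* ι (Offset.power q) ℚ.+ ρ ℚ.* (1ℚ ℚ.- heightAt q)

    dot-normal : ∀ q → dot (at q) normal ≡ level q ℚ.* r
    dot-normal q = trans (dot-at _ _ _ _ q) (trans
      (expand σ a b e f m r apex) (cong (ℚ._* r) (cong (λ H → apex ℚ.+ s ℚ.* m ℚ.+ ρ ℚ.* (1ℚ ℚ.- H)) (sym height≡))))
      where
      open ℚSolver.+-*-Solver
      e = ι (Offset.ex q)
      f = ι (Offset.ey q)
      m = ι (Offset.power q)
      h = ι (Offset.eh q)
      height≡ : heightAt q ≡ apex ℚ.+ s ℚ.* m ℚ.- a ℚ.* a ℚ.- b ℚ.* b ℚ.- (a ℚ.+ a) ℚ.* σ ℚ.* e ℚ.- (b ℚ.+ b) ℚ.* σ ℚ.* f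
      height≡ = trans (cong₂ (λ A B → apex ℚ.+ s ℚ.* h ℚ.- A ℚ.* A ℚ.- B ℚ.* B) (split s σ X₀ e) (split s σ Y₀ f))
        (trans (square σ a b e f h apex) (cong (λ m → apex ℚ.+ s ℚ.* m ℚ.- a ℚ.* a ℚ.- b ℚ.* b ℚ.- (a ℚ.+ a) ℚ.* σ ℚ.* e ℚ.- (b ℚ.+ b) ℚ.* σ ℚ.* f) (sym (ι-power q))))
        where
        split : ∀ s σ X e → s ℚ.+ σ ℚ.* (X ℚ.+ e) ≡ (s ℚ.+ σ ℚ.* X) ℚ.+ σ ℚ.* e
        split = solve 4 (λ s σ X e → s :+ σ :* (X :+ e) := (s :+ σ :* X) :+ σ :* e) refl
        square : ∀ σ a b e f h c → c ℚ.+ σ ℚ.* σ ℚ.* h ℚ.- (a ℚ.+ σ ℚ.* e) ℚ.* (a ℚ.+ σ ℚ.* e) ℚ.- (b ℚ.+ σ ℚ.* f) ℚ.* (b ℚ.+ σ ℚ.* f)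
          ≡ c ℚ.+ σ ℚ.* σ ℚ.* (h ℚ.- e ℚ.* e ℚ.- f ℚ.* f) ℚ.- a ℚ.* a ℚ.- b ℚ.* b ℚ.- (a ℚ.+ a) ℚ.* σ ℚ.* e ℚ.- (b ℚ.+ b) ℚ.* σ ℚ.* f
        square = solve 7 (λ σ a b e f h c → c :+ σ :* σ :* h :- (a :+ σ :* e) :* (a :+ σ :* e) :- (b :+ σ :* f) :* (b :+ σ :* f)
          := c :+ σ :* σ :* (h :- e :* e :- f :* f) :- a :* a :- b :* b :- (a :+ a) :* σ :* e :- (b :+ b) :* σ :* f) refl
      expand : ∀ σ a b e f m r c →
        (a ℚ.* ((a ℚ.+ a) ℚ.* r) ℚ.+ b ℚ.* ((b ℚ.+ b) ℚ.* r) ℚ.+ (c ℚ.- a ℚ.* a ℚ.- b ℚ.* b) ℚ.* ((1ℚ ℚ.- (a ℚ.* a ℚ.+ b ℚ.* b)) ℚ.* r))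
          ℚ.+ (σ ℚ.* ((a ℚ.+ a) ℚ.* r) ℚ.- (a ℚ.+ a) ℚ.* σ ℚ.* ((1ℚ ℚ.- (a ℚ.* a ℚ.+ b ℚ.* b)) ℚ.* r)) ℚ.* e
          ℚ.+ (σ ℚ.* ((b ℚ.+ b) ℚ.* r) ℚ.- (b ℚ.+ b) ℚ.* σ ℚ.* ((1ℚ ℚ.- (a ℚ.* a ℚ.+ b ℚ.* b)) ℚ.* r)) ℚ.* f
          ℚ.+ σ ℚ.* σ ℚ.* ((1ℚ ℚ.- (a ℚ.* a ℚ.+ b ℚ.* b)) ℚ.* r) ℚ.* m
        ≡ (c ℚ.+ σ ℚ.* σ ℚ.* m ℚ.+ (a ℚ.* a ℚ.+ b ℚ.* b) ℚ.* (1ℚ ℚ.- (c ℚ.+ σ ℚ.* σ ℚ.* m ℚ.- a ℚ.* a ℚ.- b ℚ.* b ℚ.- (a ℚ.+ a) ℚ.* σ ℚ.* e ℚ.- (b ℚ.+ b) ℚ.* σ ℚ.* f))) ℚ.* r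
      expand = solve 8 (λ σ a b e f m r c →
        (a :* ((a :+ a) :* r) :+ b :* ((b :+ b) :* r) :+ (c :- a :* a :- b :* b) :* ((con 1ℚ :- (a :* a :+ b :* b)) :* r))
          :+ (σ :* ((a :+ a) :* r) :- (a :+ a) :* σ :* ((con 1ℚ :- (a :* a :+ b :* b)) :* r)) :* e
          :+ (σ :* ((b :+ b) :* r) :- (b :+ b) :* σ :* ((con 1ℚ :- (a :* a :+ b :* b)) :* r)) :* f
          :+ σ :* σ :* ((con 1ℚ :- (a :* a :+ b :* b)) :* r) :* m
        := (c :+ σ :* σ :* m :+ (a :* a :+ b :* b) :* (con 1ℚ :- (c :+ σ :* σ :* m :- a :* a :- b :* b :- (a :+ a) :* σ :* e :- (b :+ b) :* σ :* f))) :* r) refl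

    GoodAt : Offset → Set
    GoodAt q = Good (X₀ ℚ.+ ι (Offset.ex q)) × Good (Y₀ ℚ.+ ι (Offset.ey q)) × (ℤ.- ℤ.+ 64 ℤ.≤ Offset.eh q) × (Offset.eh q ℤ.≤ ℤ.+ 34)

    -- ρ is at most 2η² and the depth at most 2η² + 64 s. Since η⁴ = s/1024 and η² is tiny, the
    -- product is only a fraction of the unit s.
    error≤ : ∀ q → GoodAt q → ι (ℤ.+ 4) ℚ.* (ρ ℚ.* (1ℚ ℚ.- heightAt q)) ℚ.≤ s
    error≤ q (gX , gY , h≥ , h≤) = ℚ.≤-trans
      (ℚ.*-monoˡ-≤-nonNeg (ι (ℤ.+ 4)) (*-mono-≤ 0≤ρ (ℚ.+-mono-≤ (square≤ gX₀) (square≤ gY₀)) (0≤- (height≤1 gX gY (ι-≤ h≤))) (depth≤ gX gY (ι-≤ h≥))))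
      (by-difference (arrange σ μ)
        (0≤* 0≤s (0≤+ (0≤* (0≤ι 16) (0≤- θ≤)) (0≤* (0≤ι 512) (0≤- sμ²≤)))))
      where
      open ℚSolver.+-*-Solver
      θ² : ℚ
      θ² = (σ ℚ.* μ ℚ.* μ) ℚ.* (σ ℚ.* μ ℚ.* μ)
      arrange : ∀ σ μ → σ ℚ.* σ ℚ.- ι (ℤ.+ 4) ℚ.* (((σ ℚ.* μ) ℚ.* (σ ℚ.* μ) ℚ.+ (σ ℚ.* μ) ℚ.* (σ ℚ.* μ)) ℚ.* (ι (ℤ.+ 2) ℚ.* ((σ ℚ.* μ) ℚ.* (σ ℚ.* μ)) ℚ.+ ι (ℤ.+ 64) ℚ.* (σ ℚ.* σ)))
        ≡ σ ℚ.* σ ℚ.* (ι (ℤ.+ 16) ℚ.* (n/ 1 31 ℚ.- (σ ℚ.* μ ℚ.* μ) ℚ.* (σ ℚ.* μ ℚ.* μ)) ℚ.+ ι (ℤ.+ 512) ℚ.* (n/ 1 1023 ℚ.- (σ ℚ.* μ) ℚ.* (σ ℚ.* μ)))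
      arrange = solve 2 (λ σ μ → σ :* σ :- con (ι (ℤ.+ 4)) :* (((σ :* μ) :* (σ :* μ) :+ (σ :* μ) :* (σ :* μ)) :* (con (ι (ℤ.+ 2)) :* ((σ :* μ) :* (σ :* μ)) :+ con (ι (ℤ.+ 64)) :* (σ :* σ)))
        := σ :* σ :* (con (ι (ℤ.+ 16)) :* (con (n/ 1 31) :- (σ :* μ :* μ) :* (σ :* μ :* μ)) :+ con (ι (ℤ.+ 512)) :* (con (n/ 1 1023) :- (σ :* μ) :* (σ :* μ)))) refl
      θ≤ : θ² ℚ.≤ n/ 1 31
      θ≤ = by-difference (trans (cong (λ z → n/ 1 31 ℚ.- z) θ²≡) refl) (ℚ.nonNegative⁻¹ (n/ 31 1023))
        where
        θ²≡ : θ² ≡ n/ 1 1023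
        θ²≡ = trans (solve 1 (λ t → t :* t := con (n/ 1 1023) :* ((con (ι (ℤ.+ 32)) :* t) :* (con (ι (ℤ.+ 32)) :* t))) refl (σ ℚ.* μ ℚ.* μ))
          (cong (λ z → n/ 1 1023 ℚ.* (z ℚ.* z)) scale)
      sμ²≤ : (σ ℚ.* μ) ℚ.* (σ ℚ.* μ) ℚ.≤ n/ 1 1023
      sμ²≤ = ℚ.*-cancelˡ-≤-pos (ι (ℤ.+ 1024)) (shrink 16384 1024 η²≤ (0≤* 0≤η 0≤η) (ℕ.m≤m+n 1024 15360))

    -- Of the margin 221 the tolerance consumes 220. The remaining unit s pays for the error of `q`,
    -- at most s/4, and for terms of order s²; the error of `p` has the favourable sign because
    -- heights are at most 1.
    outranked : ∀ p q → GoodAt p → GoodAt q → Offset.power q ℤ.+ ℤ.+ 221 ℤ.≤ Offset.power p → Offset.power p ℤ.≤ ℤ.+ 34 →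
      dot (at q) normal ℚ.< (1ℚ ℚ.- ε) ℚ.* dot (at p) normal
    outranked p q gp@(pX , pY , _ , ph≤) gq gap p≤ = subst₂ ℚ._<_ (sym (dot-normal q))
      (trans (ℚ.*-assoc (1ℚ ℚ.- ε) (level p) r) (cong ((1ℚ ℚ.- ε) ℚ.*_) (sym (dot-normal p))))
      (ℚ.*-monoˡ-<-pos r {{ℚ.positive 0<r}} (by-difference-< {level q} {(1ℚ ℚ.- ε) ℚ.* level p} {surplus}
        (arrange s (s ℚ.* s) (ι (Offset.power p)) (ι (Offset.power q)) (ρ ℚ.* (1ℚ ℚ.- heightAt p)) (ρ ℚ.* (1ℚ ℚ.- heightAt q)))
        positive))
      where
      open ℚSolver.+-*-Solver
      mp mq Ep Eq T′ : ℚ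
      mp = ι (Offset.power p)
      mq = ι (Offset.power q)
      Ep = ρ ℚ.* (1ℚ ℚ.- heightAt p)
      Eq = ρ ℚ.* (1ℚ ℚ.- heightAt q)
      T′ = (δ ℚ.+ s) ℚ.* (ι (ℤ.+ 3) ℚ.* (s ℚ.* s) ℚ.+ ι (ℤ.+ 34) ℚ.* s)
      surplus : ℚ
      surplus = s ℚ.* (mp ℚ.- (mq ℚ.+ ι (ℤ.+ 221))) ℚ.+ (δ ℚ.* s ℚ.+ s ℚ.* s) ℚ.* s ℚ.* (ι (ℤ.+ 34) ℚ.- mp)
        ℚ.+ (1ℚ ℚ.- (δ ℚ.* s ℚ.+ s ℚ.* s)) ℚ.* Ep ℚ.+ n/ 1 3 ℚ.* (s ℚ.- ι (ℤ.+ 4) ℚ.* Eq)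
        ℚ.+ s ℚ.* (n/ 3 3 ℚ.- s ℚ.- T′)
      arrange : ∀ s Q mp mq Ep Eq →
        (1ℚ ℚ.- (δ ℚ.* s ℚ.+ s ℚ.* s)) ℚ.* ((1ℚ ℚ.+ ι (ℤ.+ 3) ℚ.* (s ℚ.* s)) ℚ.+ s ℚ.* mp ℚ.+ Ep) ℚ.- ((1ℚ ℚ.+ ι (ℤ.+ 3) ℚ.* (s ℚ.* s)) ℚ.+ s ℚ.* mq ℚ.+ Eq)
        ≡ s ℚ.* (mp ℚ.- (mq ℚ.+ ι (ℤ.+ 221))) ℚ.+ (δ ℚ.* s ℚ.+ s ℚ.* s) ℚ.* s ℚ.* (ι (ℤ.+ 34) ℚ.- mp)
          ℚ.+ (1ℚ ℚ.- (δ ℚ.* s ℚ.+ s ℚ.* s)) ℚ.* Ep ℚ.+ n/ 1 3 ℚ.* (s ℚ.- ι (ℤ.+ 4) ℚ.* Eq)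
          ℚ.+ s ℚ.* (n/ 3 3 ℚ.- s ℚ.- (δ ℚ.+ s) ℚ.* (ι (ℤ.+ 3) ℚ.* (s ℚ.* s) ℚ.+ ι (ℤ.+ 34) ℚ.* s))
      arrange = solve 6 (λ s Q mp mq Ep Eq →
        (con 1ℚ :- (con δ :* s :+ s :* s)) :* ((con 1ℚ :+ con (ι (ℤ.+ 3)) :* (s :* s)) :+ s :* mp :+ Ep) :- ((con 1ℚ :+ con (ι (ℤ.+ 3)) :* (s :* s)) :+ s :* mq :+ Eq)
        := s :* (mp :- (mq :+ con (ι (ℤ.+ 221)))) :+ (con δ :* s :+ s :* s) :* s :* (con (ι (ℤ.+ 34)) :- mp)
          :+ (con 1ℚ :- (con δ :* s :+ s :* s)) :* Ep :+ con (n/ 1 3) :* (s :- con (ι (ℤ.+ 4)) :* Eq)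
          :+ s :* (con (n/ 3 3) :- s :- (con δ :+ s) :* (con (ι (ℤ.+ 3)) :* (s :* s) :+ con (ι (ℤ.+ 34)) :* s))) refl
      T≤ : T′ ℚ.≤ ι (ℤ.+ 221) ℚ.* (ι (ℤ.+ 37) ℚ.* s)
      T≤ = *-mono-≤ {δ ℚ.+ s} {ι (ℤ.+ 221)} {ι (ℤ.+ 3) ℚ.* (s ℚ.* s) ℚ.+ ι (ℤ.+ 34) ℚ.* s} {ι (ℤ.+ 37) ℚ.* s} (0≤+ 0≤δ 0≤s) (ℚ.+-monoʳ-≤ δ s≤1) (0≤+ (0≤* (0≤ι 3) 0≤s²) (0≤* (0≤ι 34) 0≤s))
        (by-difference (solve 2 (λ s q → con (ι (ℤ.+ 37)) :* s :- (con (ι (ℤ.+ 3)) :* q :+ con (ι (ℤ.+ 34)) :* s) := con (ι (ℤ.+ 3)) :* (s :- q)) refl s (s ℚ.* s))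
          (0≤* (0≤ι 3) (0≤- s²≤s)))
      0<bracket : 0ℚ ℚ.< n/ 3 3 ℚ.- s ℚ.- T′
      0<bracket = by-difference-< {r = (ι (ℤ.+ 221) ℚ.* (ι (ℤ.+ 37) ℚ.* s) ℚ.- T′) ℚ.+ n/ 1 3 ℚ.* (1ℚ ℚ.- ι (ℤ.+ 32712) ℚ.* s) ℚ.+ ℚ.½}
        (solve 2 (λ s t → con (n/ 3 3) :- s :- t :- con 0ℚ := (con (ι (ℤ.+ 221)) :* (con (ι (ℤ.+ 37)) :* s) :- t) :+ con (n/ 1 3) :* (con 1ℚ :- con (ι (ℤ.+ 32712)) :* s) :+ con ℚ.½) refl s T′)
        (ℚ.+-mono-≤-< (0≤+ (0≤- T≤) (0≤* {n/ 1 3} (ℚ.nonNegative⁻¹ (n/ 1 3)) (0≤- (shrink 262144 32712 s≤ 0≤s (ℕ.m≤m+n 32712 229432))))) (ℚ.positive⁻¹ ℚ.½))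
      positive : 0ℚ ℚ.< surplus
      positive = ℚ.+-mono-≤-< (0≤+ (0≤+ (0≤+
        (0≤* 0≤s (0≤- (subst (ℚ._≤ mp) (ι-+ (Offset.power q) (ℤ.+ 221)) (ι-≤ gap))))
        (0≤* (0≤* 0≤ε 0≤s) (0≤- (ι-≤ p≤))))
        (0≤* 0≤1-ε (0≤* 0≤ρ (0≤- (height≤1 pX pY (ι-≤ ph≤))))))
        (0≤* {n/ 1 3} (ℚ.nonNegative⁻¹ (n/ 1 3)) (0≤- (error≤ q gq))))
        (0<* 0<s 0<bracket)

-- The gadgets: choices, corners, ends and gaps.

data Choice : Set where
  lp ln rp rn bp bn : Choice

record Shape : Set where
  constructor shape
  field
    dx dy hp hn : ℕ

open Shape

-- Displacements are shifted by 8. The letters say which neighbouring gaps the choice covers: left, right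
-- or both in the row; previous or next in the column.
choiceShape : Choice → Shape
choiceShape lp = shape 7 7 0 0
choiceShape ln = shape 7 9 0 0
choiceShape rp = shape 9 7 0 0
choiceShape rn = shape 9 9 0 0
choiceShape bp = shape 8 6 34 0
choiceShape bn = shape 8 10 34 0

-- The heights are fitted to each other. Seen from a neighbouring gap, a choice that should cover it
-- has power -226 or -162, one that should not has -290, a corner -290 and an end -289. The gap
-- itself has -64, and the limit -64 - 221 = -285 separates the two groups. The coincidences behind
-- this are 34 - 18² = -34 - 16² = -17² - 1.
cornerShape leftShape rightShape gapShape : Shape
cornerShape = shape 8 8 0 34
leftShape   = shape 7 8 0 0
rightShape  = shape 9 8 0 0
gapShape    = shape 8 8 0 64

-- Along a row only `bp` and `bn` cover both sides. Along a column each choice covers exactly one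
-- side, and this side is the truth value that it carries.
coversLeft coversRight coversPrev coversNext : Choice → Bool
coversLeft lp = true
coversLeft ln = true
coversLeft bp = true
coversLeft bn = true
coversLeft _  = false
coversRight rp = true
coversRight rn = true
coversRight bp = true
coversRight bn = true
coversRight _  = false
coversPrev lp = true
coversPrev rp = true
coversPrev bp = true
coversPrev _  = false
coversNext ln = true
coversNext rn = true
coversNext bn = true
coversNext _  = false

-- There are six choices, so the gadget facts that follow are settled by evaluation of a decision
-- procedure.
every? : ∀ {P : Choice → Set} → (∀ c → Dec (P c)) → Dec (∀ c → P c)
every? P? = Dec.map′
  (λ { (a , b , c , d , e , f) → λ { lp → a ; ln → b ; rp → c ; rn → d ; bp → e ; bn → f } })
  (λ h → h lp , h ln , h rp , h rn , h bp , h bn)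
  (P? lp ×-dec P? ln ×-dec P? rp ×-dec P? rn ×-dec P? bp ×-dec P? bn)

place : ℤ → ℤ → Shape → Offset
place cx cy t = off (ℤ.+ 16 ℤ.* cx ℤ.+ (ℤ.+ dx t ℤ.- ℤ.+ 8)) (ℤ.+ 16 ℤ.* cy ℤ.+ (ℤ.+ dy t ℤ.- ℤ.+ 8)) (ℤ.+ hp t ℤ.- ℤ.+ hn t)

positivePart : ℤ → ℕ
positivePart (ℤ.+ n)  = n
positivePart -[1+ _ ] = 0

0ᶻ 1ᶻ -1ᶻ : ℤ
0ᶻ  = ℤ.+ 0
1ᶻ  = ℤ.+ 1
-1ᶻ = -[1+ 0 ]

-- How a choice and the four corners of its cell cover another choice of the same cell.
cellWeights : Choice → Choice → Weighted
cellWeights c c′ = (192 , place 0ᶻ 0ᶻ t) ∷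
    (ℤ.∣ ℤ.+ 16 ℤ.+ u ℤ.+ v ∣ , place 1ᶻ 1ᶻ cornerShape) ∷ (ℤ.∣ ℤ.+ 16 ℤ.+ u ℤ.- v ∣ , place 1ᶻ -1ᶻ cornerShape) ∷
    (ℤ.∣ ℤ.+ 16 ℤ.- u ℤ.+ v ∣ , place -1ᶻ 1ᶻ cornerShape) ∷ (ℤ.∣ ℤ.+ 16 ℤ.- u ℤ.- v ∣ , place -1ᶻ -1ᶻ cornerShape) ∷ []
  where
  t = choiceShape c
  t′ = choiceShape c′
  -- Balance of moments requires 192 a + 64 u = 256 a′ for the displacements a and a′ of the two
  -- choices. As |u| + |v| is at most 14, the corner weights 16 ± u ± v are positive, and the
  -- absolute values above merely pass to ℕ.
  u = (ℤ.+ 4 ℤ.* (ℤ.+ dx t′ ℤ.- ℤ.+ 8)) ℤ.- (ℤ.+ 3 ℤ.* (ℤ.+ dx t ℤ.- ℤ.+ 8))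
  v = (ℤ.+ 4 ℤ.* (ℤ.+ dy t′ ℤ.- ℤ.+ 8)) ℤ.- (ℤ.+ 3 ℤ.* (ℤ.+ dy t ℤ.- ℤ.+ 8))

-- How the points on both sides of a gap and two corners cover the gap.
rowWeights columnWeights : Shape → Shape → Weighted
rowWeights t t′ = (16 * (8 + dx t′) , place -1ᶻ 0ᶻ t) ∷ (16 * (24 ∸ dx t) , place 1ᶻ 0ᶻ t′) ∷
    (positivePart m , place 0ᶻ -1ᶻ cornerShape) ∷ (positivePart (ℤ.- m) , place 0ᶻ 1ᶻ cornerShape) ∷ []
  where
  -- Each of the two points is weighted by the distance of the other one from the gap, which
  -- balances the direction of the row. `m` is what is left across the row, and one of the two
  -- corners, at distance 16, cancels it.
  m = ℤ.+ (8 + dx t′) ℤ.* (ℤ.+ dy t ℤ.- ℤ.+ 8) ℤ.+ ℤ.+ (24 ∸ dx t) ℤ.* (ℤ.+ dy t′ ℤ.- ℤ.+ 8)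
columnWeights t t′ = (16 * (8 + dy t′) , place 0ᶻ -1ᶻ t) ∷ (16 * (24 ∸ dy t) , place 0ᶻ 1ᶻ t′) ∷
    (positivePart m , place -1ᶻ 0ᶻ cornerShape) ∷ (positivePart (ℤ.- m) , place 1ᶻ 0ᶻ cornerShape) ∷ []
  where
  m = ℤ.+ (8 + dy t′) ℤ.* (ℤ.+ dx t ℤ.- ℤ.+ 8) ℤ.+ ℤ.+ (24 ∸ dy t) ℤ.* (ℤ.+ dx t′ ℤ.- ℤ.+ 8)

cell-covers : ∀ c c′ → Covers (cellWeights c c′) (place 0ᶻ 0ᶻ (choiceShape c′))
cell-covers = toWitness {a? = every? λ c → every? λ c′ → covers? (cellWeights c c′) (place 0ᶻ 0ᶻ (choiceShape c′))} tt

gapOffset : Offset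
gapOffset = place 0ᶻ 0ᶻ gapShape

-- One covering neighbour is enough: even when the other neighbour leans away from the gap, the
-- combination of both stays within the permitted loss.
row-covers : ∀ c c′ → (coversRight c ≡ true ⊎ coversLeft c′ ≡ true) → Covers (rowWeights (choiceShape c) (choiceShape c′)) gapOffset
row-covers = toWitness {a? = every? λ c → every? λ c′ → ((coversRight c Bool.≟ true) ⊎-dec (coversLeft c′ Bool.≟ true))
  →-dec covers? (rowWeights (choiceShape c) (choiceShape c′)) gapOffset} tt

left-covers : ∀ c → coversLeft c ≡ true → Covers (rowWeights leftShape (choiceShape c)) gapOffset
left-covers = toWitness {a? = every? λ c → (coversLeft c Bool.≟ true) →-dec covers? (rowWeights leftShape (choiceShape c)) gapOffset} tt

right-covers : ∀ c → coversRight c ≡ true → Covers (rowWeights (choiceShape c) rightShape) gapOffset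
right-covers = toWitness {a? = every? λ c → (coversRight c Bool.≟ true) →-dec covers? (rowWeights (choiceShape c) rightShape) gapOffset} tt

column-covers : ∀ c c′ → (coversNext c ≡ true ⊎ coversPrev c′ ≡ true) → Covers (columnWeights (choiceShape c) (choiceShape c′)) gapOffset
column-covers = toWitness {a? = every? λ c → every? λ c′ → ((coversNext c Bool.≟ true) ⊎-dec (coversPrev c′ Bool.≟ true))
  →-dec covers? (columnWeights (choiceShape c) (choiceShape c′)) gapOffset} tt

-- Grid positions, reduced fractions and distances.

data Pt : Set where
  corner        : ℕ → ℕ → Pt
  leftEnd rightEnd : ℕ → Pt
  hgap vgap     : ℕ → ℕ → Pt
  cell          : ℕ → ℕ → Choice → Pt

shapeOf : Pt → Shape
shapeOf (corner _ _) = cornerShape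
shapeOf (leftEnd _)  = leftShape
shapeOf (rightEnd _) = rightShape
shapeOf (hgap _ _)   = gapShape
shapeOf (vgap _ _)   = gapShape
shapeOf (cell _ _ c) = choiceShape c

coprime-product : ∀ {m n o} → Coprime m n → Coprime m o → Coprime m (n * o)
coprime-product c c′ {d} (d∣m , d∣no) =
  c′ (d∣m , coprime-divisor (λ (e∣d , e∣n) → c (ℕ.∣-trans e∣d d∣m , e∣n)) d∣no)

coprime-1+ : ∀ {m} S x → m ≡ 1 + S * x → Coprime m S
coprime-1+ S x refl {d} (d∣m , d∣S) = ℕ.∣1⇒≡1 (ℕ.∣m+n∣m⇒∣n (subst (d ℕ.∣_) (ℕ.+-comm 1 (S * x)) d∣m) (ℕ.∣m⇒∣m*n x d∣S))

-- Identifies an explicitly reduced fraction by clearing its denominator, where `p` is the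
-- reciprocal of d. No normalisation of rationals has to be unfolded.
scaled-value : ∀ n e {d} .(c : Coprime ℤ.∣ n ∣ (suc e)) (p : ℚ) → suc e ≡ d → ι (ℤ.+ d) ℚ.* p ≡ 1ℚ → mkℚ n e c ≡ ι n ℚ.* p
scaled-value n e c p refl eq = trans (sym (ℚ.*-identityʳ q)) (trans (cong (q ℚ.*_) (sym eq))
  (trans (sym (ℚ.*-assoc q (ι (ℤ.+ suc e)) p)) (cong (ℚ._* p) (mkℚ-scaled n e c))))
  where
  q = mkℚ n e c

Separated : ℕ → ℕ → ℕ → Set
Separated j a b = (a + j ≤ b) ⊎ (b + j ≤ a)

separated-swap : ∀ {j a b} → Separated j a b → Separated j b a
separated-swap = Sum.swap

separated-suc : ∀ {j a b} → Separated j a b → Separated j (suc a) (suc b)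
separated-suc = Sum.map s≤s s≤s

double-mono : ∀ {i j} → suc i ≤ j → 2 * i + 2 ≤ 2 * j
double-mono {i} i<j = ℕ.≤-trans (ℕ.≤-reflexive (trans (ℕ.+-comm (2 * i) 2) (sym (ℕ.*-suc 2 i)))) (ℕ.*-monoʳ-≤ 2 i<j)

odd-even : ∀ i j → Separated 1 (1 + 2 * i) (2 * j)
odd-even i j with suc i ≤? j
... | yes i<j = inj₁ (ℕ.≤-trans (ℕ.≤-reflexive (sym (ℕ.+-suc (2 * i) 1))) (double-mono i<j))
... | no  i≮j = inj₂ (ℕ.≤-trans (ℕ.≤-reflexive (ℕ.+-comm (2 * j) 1)) (s≤s (ℕ.*-monoʳ-≤ 2 (ℕ.≮⇒≥ i≮j))))

even-odd : ∀ i j → Separated 1 (2 * i) (1 + 2 * j)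
even-odd i j = separated-swap (odd-even j i)

distinct-double : ∀ {i j} → i ≢ j → Separated 2 (2 * i) (2 * j)
distinct-double {i} {j} i≢j with suc i ≤? j
... | yes i<j = inj₁ (double-mono i<j)
... | no  i≮j = inj₂ (double-mono (ℕ.≤∧≢⇒< (ℕ.≮⇒≥ i≮j) (i≢j ∘ sym)))

square-abs : ∀ z → z ℤ.* z ≡ ℤ.+ (ℤ.∣ z ∣ * ℤ.∣ z ∣)
square-abs (ℤ.+ n)  = sym (ℤ.pos-* n n)
square-abs -[1+ n ] = refl

square≥ : ∀ {n} z → n ≤ ℤ.∣ z ∣ → ℤ.+ (n * n) ℤ.≤ z ℤ.* z
square≥ z n≤ = ℤ.≤-trans (ℤ.+≤+ (ℕ.*-mono-≤ n≤ n≤)) (ℤ.≤-reflexive (sym (square-abs z)))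

power≤ : ∀ {m n H t} r → m ≤ ℤ.∣ Offset.ex r ∣ → n ≤ ℤ.∣ Offset.ey r ∣ → Offset.eh r ℤ.≤ H →
  H ℤ.- ℤ.+ (m * m) ℤ.- ℤ.+ (n * n) ℤ.+ ℤ.+ 221 ℤ.≤ t → Offset.power r ℤ.+ ℤ.+ 221 ℤ.≤ t
power≤ r m≤ n≤ h≤ bound = ℤ.≤-trans (ℤ.+-monoˡ-≤ (ℤ.+ 221) (ℤ.+-mono-≤ (ℤ.+-mono-≤ h≤ (ℤ.neg-mono-≤ (square≥ (Offset.ex r) m≤)))
  (ℤ.neg-mono-≤ (square≥ (Offset.ey r) n≤)))) bound

displacement : ℕ → ℕ → ℕ → ℤ
displacement a a₀ x = ℤ.+ 16 ℤ.* (ℤ.+ a ℤ.- ℤ.+ a₀) ℤ.+ (ℤ.+ x ℤ.- ℤ.+ 8)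

displacement-right : ∀ j n {a a₀ x} → a₀ + j ≤ a → n + 8 ≤ 16 * j + x → n ≤ ℤ.∣ displacement a a₀ x ∣
displacement-right j n {a₀ = a₀} {x} h h′ with ℕ.m≤n⇒∃[o]m+o≡n h | ℕ.m≤n⇒∃[o]m+o≡n h′
... | e , refl | q , eq = ℕ.≤-trans (ℕ.m≤m+n n (q + 16 * e)) (ℕ.≤-reflexive (cong ℤ.∣_∣ (sym value)))
  where
  open ℤSolver.+-*-Solver
  value : displacement (a₀ + j + e) a₀ x ≡ ℤ.+ (n + (q + 16 * e))
  value = trans (solve 4 (λ a j e x → con (ℤ.+ 16) :* ((a :+ j :+ e) :- a) :+ (x :- con (ℤ.+ 8)) := (con (ℤ.+ 16) :* j :+ x) :+ con (ℤ.+ 16) :* e :- con (ℤ.+ 8))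
      refl (ℤ.+ a₀) (ℤ.+ j) (ℤ.+ e) (ℤ.+ x))
    (trans (cong (λ z → z ℤ.+ ℤ.+ 16 ℤ.* ℤ.+ e ℤ.- ℤ.+ 8) (trans (cong (ℤ._+ ℤ.+ x) (sym (ℤ.pos-* 16 j))) (cong ℤ.+_ (sym eq))))
      (trans (solve 3 (λ n q e → (n :+ con (ℤ.+ 8) :+ q) :+ con (ℤ.+ 16) :* e :- con (ℤ.+ 8) := n :+ (q :+ con (ℤ.+ 16) :* e)) refl (ℤ.+ n) (ℤ.+ q) (ℤ.+ e))
        (cong (λ z → ℤ.+ n ℤ.+ (ℤ.+ q ℤ.+ z)) (sym (ℤ.pos-* 16 e)))))

displacement-left : ∀ j n {a a₀ x} → a + j ≤ a₀ → n + x ≤ 16 * j + 8 → n ≤ ℤ.∣ displacement a a₀ x ∣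
displacement-left j n {a} {x = x} h h′ with ℕ.m≤n⇒∃[o]m+o≡n h | ℕ.m≤n⇒∃[o]m+o≡n h′
... | e , refl | q , eq = ℕ.≤-trans (ℕ.m≤m+n n (q + 16 * e)) (ℕ.≤-reflexive (trans (sym (ℤ.∣-i∣≡∣i∣ (ℤ.+ (n + (q + 16 * e))))) (cong ℤ.∣_∣ (sym value))))
  where
  open ℤSolver.+-*-Solver
  value : displacement a (a + j + e) x ≡ ℤ.- (ℤ.+ (n + (q + 16 * e)))
  value = trans (solve 4 (λ a j e x → con (ℤ.+ 16) :* (a :- (a :+ j :+ e)) :+ (x :- con (ℤ.+ 8)) := :- ((con (ℤ.+ 16) :* j :+ con (ℤ.+ 8)) :+ con (ℤ.+ 16) :* e :- x))
      refl (ℤ.+ a) (ℤ.+ j) (ℤ.+ e) (ℤ.+ x))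
    (trans (cong (λ z → ℤ.- (z ℤ.+ ℤ.+ 16 ℤ.* ℤ.+ e ℤ.- ℤ.+ x)) (trans (cong (ℤ._+ ℤ.+ 8) (sym (ℤ.pos-* 16 j))) (cong ℤ.+_ (sym eq))))
      (trans (solve 4 (λ n q e x → :- ((n :+ x :+ q) :+ con (ℤ.+ 16) :* e :- x) := :- (n :+ (q :+ con (ℤ.+ 16) :* e))) refl (ℤ.+ n) (ℤ.+ q) (ℤ.+ e) (ℤ.+ x))
        (cong (λ z → ℤ.- (ℤ.+ n ℤ.+ (ℤ.+ q ℤ.+ z))) (sym (ℤ.pos-* 16 e)))))

displacement-separated : ∀ j n {a a₀ x} → Separated j a a₀ → n + 8 ≤ 16 * j + x → n + x ≤ 16 * j + 8 → n ≤ ℤ.∣ displacement a a₀ x ∣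
displacement-separated j n (inj₁ h) _ h″ = displacement-left j n h h″
displacement-separated j n (inj₂ h) h′ _ = displacement-right j n h h′

record ShapeBounds (t : Shape) : Set where
  constructor bounds
  field
    6≤dx  : 6 ≤ dx t
    dx≤10 : dx t ≤ 10
    6≤dy  : 6 ≤ dy t
    dy≤10 : dy t ≤ 10
    hp≤34 : hp t ≤ 34
    hn≤64 : hn t ≤ 64

shapeBounds? : ∀ t → Dec (ShapeBounds t)
shapeBounds? t = Dec.map′ (λ { (a , b , c , d , e , f) → bounds a b c d e f }) (λ { (bounds a b c d e f) → a , b , c , d , e , f })
  (6 ≤? dx t ×-dec dx t ≤? 10 ×-dec 6 ≤? dy t ×-dec dy t ≤? 10 ×-dec hp t ≤? 34 ×-dec hn t ≤? 64)

choiceBounds : ∀ c → ShapeBounds (choiceShape c)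
choiceBounds = toWitness {a? = every? λ c → shapeBounds? (choiceShape c)} tt

shapeBounds : ∀ p → ShapeBounds (shapeOf p)
shapeBounds (corner _ _) = toWitness {a? = shapeBounds? cornerShape} tt
shapeBounds (leftEnd _)  = toWitness {a? = shapeBounds? leftShape} tt
shapeBounds (rightEnd _) = toWitness {a? = shapeBounds? rightShape} tt
shapeBounds (hgap _ _)   = toWitness {a? = shapeBounds? gapShape} tt
shapeBounds (vgap _ _)   = toWitness {a? = shapeBounds? gapShape} tt
shapeBounds (cell _ _ c) = choiceBounds c

shapeHeight≤ : ∀ {t} → ShapeBounds t → ℤ.+ hp t ℤ.- ℤ.+ hn t ℤ.≤ ℤ.+ 34
shapeHeight≤ {t} b = ℤ.≤-trans (ℤ.i≤j⇒i-k≤j (ℤ.+ hn t) (ℤ.+≤+ (ShapeBounds.hp≤34 b))) ℤ.≤-refl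

≤-shapeHeight : ∀ {t} → ShapeBounds t → ℤ.- ℤ.+ 64 ℤ.≤ ℤ.+ hp t ℤ.- ℤ.+ hn t
≤-shapeHeight {t} b = ℤ.≤-trans (ℤ.neg-mono-≤ (ℤ.+≤+ (ShapeBounds.hn≤64 b)))
  (ℤ.≤-trans (ℤ.≤-reflexive (sym (ℤ.+-identityˡ _))) (ℤ.+-monoˡ-≤ (ℤ.- ℤ.+ hn t) (ℤ.+≤+ z≤n)))

-- Lists produced by loops.

∈-loop⁺ : ∀ {A : Set} {x : A} {n} {f : ℕ → List A} i → i < n → x ∈ f i → x ∈ loop n f
∈-loop⁺ {n = suc n} {f} i i<n x∈ with i ≟ n
... | yes refl = ∈.∈-++⁺ˡ x∈
... | no i≢n   = ∈.∈-++⁺ʳ (f n) (∈-loop⁺ i (ℕ.≤∧≢⇒< (ℕ.≤-pred i<n) i≢n) x∈)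

∈-loop⁻ : ∀ {A : Set} {x : A} n {f : ℕ → List A} → x ∈ loop n f → ∃[ i ] i < n × x ∈ f i
∈-loop⁻ (suc n) {f} x∈ with ∈.∈-++⁻ (f n) x∈
... | inj₁ x∈f = n , ℕ.≤-refl , x∈f
... | inj₂ x∈l = let (i , i<n , x∈f) = ∈-loop⁻ n x∈l in i , ℕ.≤-trans i<n (ℕ.n≤1+n n) , x∈f

unique-loop : ∀ {A : Set} n (f : ℕ → List A) (key : A → ℕ) → (∀ i → i < n → Unique (f i)) →
  (∀ i {x} → x ∈ f i → key x ≡ i) → Unique (loop n f)
unique-loop zero    f key u keyed = []
unique-loop (suc n) f key u keyed = Unique.++⁺ (u n ℕ.≤-refl) (unique-loop n f key (λ i i<n → u i (ℕ.≤-trans i<n (ℕ.n≤1+n n))) keyed)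
  λ (x∈ , x∈′) → let (i , i<n , x∈f) = ∈-loop⁻ n x∈′ in ℕ.<⇒≢ i<n (trans (sym (keyed i x∈f)) (keyed n x∈))

length-loop-constant : ∀ {A : Set} n (f : ℕ → List A) c → (∀ i → length (f i) ≡ c) → length (loop n f) ≡ n * c
length-loop-constant zero    f c h = refl
length-loop-constant (suc n) f c h = trans (List.length-++ (f n)) (cong₂ _+_ (h n) (length-loop-constant n f c h))

-- Axis vectors.

axis : ∀ {n} → Fin n → ℚ → Vec ℚ n
axis zero    t = t ∷ Vec.replicate _ 0ℚ
axis (suc i) t = 0ℚ ∷ axis i t

dot-axis : ∀ {n} (i : Fin n) t x → dot (axis i t) x ≡ t ℚ.* Vec.lookup x i
dot-axis zero    t (x ∷ v) = trans (cong (t ℚ.* x ℚ.+_) (dot-zeros _ v)) (ℚ.+-identityʳ (t ℚ.* x))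
dot-axis (suc i) t (x ∷ v) = trans (cong₂ ℚ._+_ (ℚ.*-zeroˡ x) (dot-axis i t v)) (ℚ.+-identityˡ _)

dot-comm : ∀ {n} (x y : Vec ℚ n) → dot x y ≡ dot y x
dot-comm []      []      = refl
dot-comm (x ∷ v) (y ∷ w) = cong₂ ℚ._+_ (ℚ.*-comm x y) (dot-comm v w)

lookup-axis-same : ∀ {n} (i : Fin n) t → Vec.lookup (axis i t) i ≡ t
lookup-axis-same zero    t = refl
lookup-axis-same (suc i) t = lookup-axis-same i t

lookup-axis-other : ∀ {n} (i j : Fin n) t → j ≢ i → Vec.lookup (axis i t) j ≡ 0ℚ
lookup-axis-other zero    zero    t j≢i = contradiction refl j≢i
lookup-axis-other zero    (suc j) t j≢i = Vec.lookup-replicate j 0ℚ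
lookup-axis-other (suc i) zero    t j≢i = refl
lookup-axis-other (suc i) (suc j) t j≢i = lookup-axis-other i j t (j≢i ∘ cong suc)

sign : Bool → ℚ
sign true  = 1ℚ
sign false = ℚ.- 1ℚ

axisVec : ∀ {n} → Fin n × Bool → Vec ℚ n
axisVec (i , b) = axis i (sign b)

axisVec-injective : ∀ {n} {p q : Fin n × Bool} → axisVec p ≡ axisVec q → p ≡ q
axisVec-injective {p = i , b} {j , c} eq with i Fin.≟ j
... | yes refl = cong (i ,_) (signs b c (trans (sym (lookup-axis-same i (sign b))) (trans (cong (λ v → Vec.lookup v i) eq) (lookup-axis-same i (sign c)))))
  where
  signs : ∀ b c → sign b ≡ sign c → b ≡ c
  signs true  true  _ = refl
  signs false false _ = refl
  signs true  false ()
  signs false true  ()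
... | no i≢j = contradiction (trans (sym (lookup-axis-same i (sign b))) (trans (cong (λ v → Vec.lookup v i) eq) (lookup-axis-other j i (sign c) i≢j))) (nonzero b)
  where
  nonzero : ∀ b → sign b ≢ 0ℚ
  nonzero true  ()
  nonzero false ()

dot-bound : ∀ {n} (x : Vec ℚ n) b → (∀ i → Vec.lookup x i ℚ.* Vec.lookup x i ℚ.≤ b) → dot x x ℚ.≤ ι (ℤ.+ n) ℚ.* b
dot-bound []      b h = ℚ.≤-reflexive (sym (ℚ.*-zeroˡ b))
dot-bound {suc n} (x ∷ v) b h = ℚ.≤-trans (ℚ.+-mono-≤ (h zero) (dot-bound v b (h ∘ suc)))
  (ℚ.≤-reflexive (trans (cong (ℚ._+ ι (ℤ.+ n) ℚ.* b) (sym (ℚ.*-identityˡ b)))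
    (trans (sym (ℚ.*-distribʳ-+ b 1ℚ (ι (ℤ.+ n)))) (cong (ℚ._* b) (sym (ι-+ (ℤ.+ 1) (ℤ.+ n)))))))

square-bound : ∀ {x b} → x ℚ.≤ b → ℚ.- x ℚ.≤ b → x ℚ.* x ℚ.≤ b ℚ.* b
square-bound {x} {b} x≤ -x≤ = by-difference (solve 2 (λ x b → b :* b :- x :* x := (b :- x) :* (b :- (:- x))) refl x b) (0≤* (0≤- x≤) (0≤- -x≤))
  where open ℚSolver.+-*-Solver

module Axes (k : ℕ) where

  third : Fin (3 + k)
  third = suc (suc zero)

  later : Fin k → Fin (3 + k)
  later i = suc (suc (suc i))

  -- The positive third axis is left out. Its product with a normal is nearly that of the cap
  -- points, so the coarse estimates that dispose of the other axes would fail for it. A corner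
  -- close to the apex closes the hull on that side.
  axesTail axes : List (Fin (3 + k) × Bool)
  axesTail = (suc zero , true) ∷ map (λ i → later i , true) (List.allFin k) ++ map (_, false) (List.allFin (3 + k))
  axes     = (zero , true) ∷ axesTail

  negative-axis : ∀ i → (i , false) ∈ axes
  negative-axis i = there (there (∈.∈-++⁺ʳ (map (λ i → later i , true) (List.allFin k)) (∈.∈-map⁺ (_, false) (∈.∈-allFin i))))

  positive-axis : ∀ i → i ≢ third → (i , true) ∈ axes
  positive-axis zero                _  = here refl
  positive-axis (suc zero)          _  = there (here refl)
  positive-axis (suc (suc zero))    ≢3 = contradiction refl ≢3
  positive-axis (suc (suc (suc i))) _  = there (there (∈.∈-++⁺ˡ (∈.∈-map⁺ (λ i → later i , true) (∈.∈-allFin i))))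

  later≢third : ∀ i {b} → _≢_ {A = Fin (3 + k) × Bool} (third , b) (later i , b)
  later≢third i ()

  no-third-axis : (third , true) ∉ axes
  no-third-axis (there (there ∈)) with ∈.∈-++⁻ (map (λ i → later i , true) (List.allFin k)) ∈
  ... | inj₁ ∈₁ = let (i , _ , eq) = ∈.∈-map⁻ (λ i → later i , true) ∈₁ in later≢third i eq
  ... | inj₂ ∈₂ with ∈.∈-map⁻ (_, false) ∈₂
  ...   | _ , _ , ()

  axes-unique : Unique axes
  axes-unique = All.tabulate (λ x∈ eq → first x∈ (sym eq)) ∷ All.tabulate (λ x∈ eq → second x∈ (sym eq)) ∷
    Unique.++⁺ (Unique.map⁺ (λ { refl → refl }) (Unique.allFin⁺ k)) (Unique.map⁺ (λ { refl → refl }) (Unique.allFin⁺ (3 + k))) disjoint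
    where
    rest = map (λ i → later i , true) (List.allFin k) ++ map (_, false) (List.allFin (3 + k))
    in-rest : ∀ {x} → x ∈ rest → (∃[ i ] x ≡ (later i , true)) ⊎ (∃[ i ] x ≡ (i , false))
    in-rest x∈ with ∈.∈-++⁻ (map (λ i → later i , true) (List.allFin k)) x∈
    ... | inj₁ x∈₁ = let (i , _ , eq) = ∈.∈-map⁻ (λ i → later i , true) x∈₁ in inj₁ (i , eq)
    ... | inj₂ x∈₂ = let (i , _ , eq) = ∈.∈-map⁻ (_, false) x∈₂ in inj₂ (i , eq)
    first : ∀ {x} → x ∈ axesTail → x ≢ (zero , true)
    first (here refl) ()
    first (there x∈) eq with in-rest x∈
    first (there x∈) refl | inj₁ (_ , ())
    first (there x∈) refl | inj₂ (_ , ())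
    second : ∀ {x} → x ∈ rest → x ≢ (suc zero , true)
    second x∈ eq with in-rest x∈
    second x∈ refl | inj₁ (_ , ())
    second x∈ refl | inj₂ (_ , ())
    disjoint : ∀ {x} → x ∈ map (λ i → later i , true) (List.allFin k) × x ∈ map (_, false) (List.allFin (3 + k)) → ⊥
    disjoint (x∈ , x∈′) with ∈.∈-map⁻ (λ i → later i , true) x∈ | ∈.∈-map⁻ (_, false) x∈′
    ... | _ , _ , refl | _ , _ , ()

  axes≤1 : ∀ (p : Fin (3 + k) × Bool) → VecAll.All (λ c → ℚ.- 1ℚ ℚ.≤ c × c ℚ.≤ 1ℚ) (axisVec p)
  axes≤1 (i , b) = go i
    where
    zero-ok : ℚ.- 1ℚ ℚ.≤ 0ℚ × 0ℚ ℚ.≤ 1ℚ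
    zero-ok = ι-≤ { -[1+ 0 ]} {ℤ.+ 0} ℤ.-≤+ , ι-≤ {ℤ.+ 0} {ℤ.+ 1} (ℤ.+≤+ z≤n)
    zeros : ∀ n → VecAll.All (λ c → ℚ.- 1ℚ ℚ.≤ c × c ℚ.≤ 1ℚ) (Vec.replicate n 0ℚ)
    zeros zero    = VecAll.[]
    zeros (suc n) = zero-ok VecAll.∷ zeros n
    sign-ok : ∀ b → ℚ.- 1ℚ ℚ.≤ sign b × sign b ℚ.≤ 1ℚ
    sign-ok true  = ι-≤ { -[1+ 0 ]} {ℤ.+ 1} ℤ.-≤+ , ℚ.≤-refl
    sign-ok false = ℚ.≤-refl , ι-≤ { -[1+ 0 ]} {ℤ.+ 1} ℤ.-≤+
    go : ∀ {n} (i : Fin n) → VecAll.All (λ c → ℚ.- 1ℚ ℚ.≤ c × c ℚ.≤ 1ℚ) (axis i (sign b))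
    go zero    = sign-ok b VecAll.∷ zeros _
    go (suc i) = zero-ok VecAll.∷ go i

half-double : ∀ n → half (2 * n) ≡ n
half-double zero    = refl
half-double (suc n) = trans (cong half (ℕ.*-suc 2 n)) (cong suc (half-double n))

half-odd : ∀ n → half (1 + 2 * n) ≡ n
half-odd zero    = refl
half-odd (suc n) = trans (cong (half ∘ suc) (ℕ.*-suc 2 n)) (cong suc (half-odd n))

parity-double : ∀ n → parity (2 * n) ≡ 0
parity-double zero    = refl
parity-double (suc n) = trans (cong parity (ℕ.*-suc 2 n)) (parity-double n)

parity-odd : ∀ n → parity (1 + 2 * n) ≡ 1
parity-odd zero    = refl
parity-odd (suc n) = trans (cong (parity ∘ suc) (ℕ.*-suc 2 n)) (parity-odd n)

sixteens : ∀ {a x b y} → x ≤ 10 → y ≤ 10 → 16 * a + x ≡ 16 * b + y → a ≡ b × x ≡ y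
sixteens {zero}  {x} {zero}  x≤ y≤ eq = refl , eq
sixteens {zero}  {x} {suc b} {y} x≤ y≤ eq = contradiction
  (ℕ.≤-trans (ℕ.≤-trans (ℕ.m≤m+n 16 (16 * b)) (ℕ.≤-trans (ℕ.≤-reflexive (sym (ℕ.*-suc 16 b))) (ℕ.m≤m+n (16 * suc b) y)))
    (ℕ.≤-trans (ℕ.≤-reflexive (sym eq)) x≤)) (ℕ.<⇒≱ {10} {16} (ℕ.m≤m+n 11 5))
sixteens {suc a} {x} {zero} {y} x≤ y≤ eq = let (p , q) = sixteens {zero} {y} {suc a} {x} y≤ x≤ (sym eq) in sym p , sym q
sixteens {suc a} {x} {suc b} {y} x≤ y≤ eq =
  let (p , q) = sixteens {a} {x} {b} {y} x≤ y≤ (ℕ.+-cancelˡ-≡ 16 _ _ (trans (shift a x) (trans eq (sym (shift b y))))) in cong suc p , q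
  where
  shift : ∀ a x → 16 + (16 * a + x) ≡ 16 * suc a + x
  shift a x = trans (sym (ℕ.+-assoc 16 (16 * a) x)) (cong (_+ x) (sym (ℕ.*-suc 16 a)))

∈-∷-++⁻ : ∀ {A : Set} {x z : A} xs {ys} → z ∈ x ∷ (xs ++ ys) → z ∈ x ∷ xs ⊎ z ∈ ys
∈-∷-++⁻ {x = x} xs = ∈.∈-++⁻ (x ∷ xs)

unique-∷-++ : ∀ {A : Set} {x : A} {xs ys} → Unique (x ∷ xs) → Unique ys → (∀ {z} → z ∈ x ∷ xs × z ∈ ys → ⊥) → Unique (x ∷ (xs ++ ys))
unique-∷-++ u v disjoint = Unique.++⁺ u v disjoint

-- Rows before B are disjunctions of positive literals, the later ones of negative literals.
record Satisfies (R B : ℕ) (literals : ℕ → List ℕ) (X : ℕ → Bool) : Set where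
  constructor satisfies
  field
    positives : ∀ i → i < R → i < B → ∃[ j ] j ∈ literals i × X j ≡ true
    negatives : ∀ i → i < R → ¬ i < B → ∃[ j ] j ∈ literals i × X j ≡ false

-- The instance built from a grid of clauses and variables.

module Board (k R C M S : ℕ) (M≡ : M ≡ 32 * (2 + (R + C))) (S≡ : S ≡ 32 * (M * M))
  (B : ℕ) (literals : ℕ → List ℕ) (literals-unique : ∀ i → Unique (literals i)) (literals< : ∀ i {j} → j ∈ literals i → j < C) where
  -- A doubled grid: corners have odd column and even row, cells even column and odd row, and the
  -- two other parities are those of the horizontal and the vertical gaps. The ends lie in the
  -- border columns 0 and 2 + 2C.
  col row : Pt → ℕ
  col (corner i j) = 1 + 2 * j
  col (leftEnd i)  = 0
  col (rightEnd i) = 2 + 2 * C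
  col (hgap i j)   = 1 + 2 * j
  col (vgap i j)   = 2 + 2 * j
  col (cell i j c) = 2 + 2 * j
  row (corner i j) = 2 * i
  row (leftEnd i)  = 1 + 2 * i
  row (rightEnd i) = 1 + 2 * i
  row (hgap i j)   = 1 + 2 * i
  row (vgap i j)   = 2 + 2 * i
  row (cell i j c) = 1 + 2 * i

  InRange : Pt → Set
  InRange (corner i j) = i ≤ R × j ≤ C
  InRange (leftEnd i)  = i < R
  InRange (rightEnd i) = i < R
  InRange (hgap i j)   = i < R × j ≤ C
  InRange (vgap i j)   = suc i < R × j < C
  InRange (cell i j c) = i < R × j < C

  -- A grid step is 16 lattice units, and M exceeds all positions. M and S are variables with
  -- defining equations, so that type checking has no large numbers to unfold.
  posX posY : Pt → ℕ
  posX p = 16 * col p + dx (shapeOf p)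
  posY p = 16 * row p + dy (shapeOf p)

  64≤M : 64 ≤ M
  64≤M = ℕ.≤-trans (ℕ.*-monoʳ-≤ 32 (ℕ.m≤m+n 2 (R + C))) (ℕ.≤-reflexive (sym M≡))

  MM-nonZero : NonZero (M * M)
  MM-nonZero = ℕ.m*n≢0 M M {{M≢0}} {{M≢0}}
    where
    M≢0 : NonZero M
    M≢0 = >-nonZero (ℕ.≤-trans (s≤s z≤n) 64≤M)

  instance
    S-nonZero : NonZero S
    S-nonZero = subst NonZero (sym S≡) (ℕ.m*n≢0 32 (M * M) {{>-nonZero {32} (s≤s z≤n)}} {{MM-nonZero}})

  SS-nonZero : NonZero (S * S)
  SS-nonZero = ℕ.m*n≢0 S S

  T₁ T₂ : ℕ
  T₁ = S * S ∸ 1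
  T₂ = (S * S) * (S * S) ∸ 1

  suc-T₁ : suc T₁ ≡ S * S
  suc-T₁ = ℕ.m+[n∸m]≡n (>-nonZero⁻¹ (S * S) {{SS-nonZero}})

  suc-T₂ : suc T₂ ≡ (S * S) * (S * S)
  suc-T₂ = ℕ.m+[n∸m]≡n (>-nonZero⁻¹ ((S * S) * (S * S)) {{ℕ.m*n≢0 (S * S) (S * S) {{SS-nonZero}} {{SS-nonZero}}}})

  σ-coprime : Coprime 1 (suc (S ∸ 1))
  σ-coprime (d∣1 , _) = ℕ.∣1⇒≡1 d∣1

  σ μ : ℚ
  σ = mkℚ (ℤ.+ 1) (S ∸ 1) σ-coprime
  μ = ι (ℤ.+ M)

  Sσ : ι (ℤ.+ S) ℚ.* σ ≡ 1ℚ
  Sσ = trans (ℚ.*-comm (ι (ℤ.+ S)) σ) (trans (cong (λ z → σ ℚ.* ι (ℤ.+ z)) (sym (ℕ.m+[n∸m]≡n (>-nonZero⁻¹ S))))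
    (mkℚ-scaled (ℤ.+ 1) (S ∸ 1) σ-coprime))

  ι-ℕ* : ∀ m n → ι (ℤ.+ (m * n)) ≡ ι (ℤ.+ m) ℚ.* ι (ℤ.+ n)
  ι-ℕ* m n = trans (cong ι (ℤ.pos-* m n)) (ι-* (ℤ.+ m) (ℤ.+ n))

  ι-ℕ+ : ∀ m n → ι (ℤ.+ (m + n)) ≡ ι (ℤ.+ m) ℚ.+ ι (ℤ.+ n)
  ι-ℕ+ m n = ι-+ (ℤ.+ m) (ℤ.+ n)

  0<σ : 0ℚ ℚ.< σ
  0<σ = ℚ.positive⁻¹ σ

  4≤μ : ι (ℤ.+ 4) ℚ.≤ μ
  4≤μ = ι-≤ (ℤ.+≤+ (ℕ.≤-trans (ℕ.m≤m+n 4 60) 64≤M))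

  scale : ι (ℤ.+ 32) ℚ.* (σ ℚ.* μ ℚ.* μ) ≡ 1ℚ
  scale = trans (solve 3 (λ a σ μ → a :* (σ :* μ :* μ) := (a :* (μ :* μ)) :* σ) refl (ι (ℤ.+ 32)) σ μ)
    (trans (cong (ℚ._* σ) (trans (cong (ι (ℤ.+ 32) ℚ.*_) (sym (ι-ℕ* M M))) (trans (sym (ι-ℕ* 32 (M * M))) (cong (ι ∘ ℤ.+_) (sym S≡))))) Sσ)
    where open ℚSolver.+-*-Solver

  open Lattice k σ public
  open Scale k σ μ 0<σ 4≤μ scale public

  SSσσ : ι (ℤ.+ (S * S)) ℚ.* s ≡ 1ℚ
  SSσσ = trans (cong (ℚ._* s) (ι-ℕ* S S))
    (trans (solve 2 (λ S σ → (S :* S) :* (σ :* σ) := (S :* σ) :* (S :* σ)) refl (ι (ℤ.+ S)) σ) (cong (λ z → z ℚ.* z) Sσ))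
    where open ℚSolver.+-*-Solver

  SSSSss : ι (ℤ.+ ((S * S) * (S * S))) ℚ.* (s ℚ.* s) ≡ 1ℚ
  SSSSss = trans (cong (ℚ._* (s ℚ.* s)) (ι-ℕ* (S * S) (S * S)))
    (trans (solve 2 (λ S σ → (S :* S) :* (σ :* σ) := (S :* σ) :* (S :* σ)) refl (ι (ℤ.+ (S * S))) s) (cong (λ z → z ℚ.* z) SSσσ))
    where open ℚSolver.+-*-Solver

  numerator : ℕ → ℕ
  numerator X = 1 + S * X

  heightPlus heightMinus : ℕ → ℕ → Shape → ℕ
  heightPlus X Y t  = (S * S) * (S * S) + 3 + S * S * hp t
  heightMinus X Y t = numerator X * numerator X + numerator Y * numerator Y + S * S * hn t

  heightNumerator : ℕ → ℕ → Shape → ℕ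
  heightNumerator X Y t = heightPlus X Y t ∸ heightMinus X Y t

  coprime₁ : ∀ X → Coprime (numerator X) (suc T₁)
  coprime₁ X = subst (Coprime (numerator X)) (sym suc-T₁) (coprime-product (coprime-1+ S X refl) (coprime-1+ S X refl))

  coprimeε : Coprime (1 + S * (220 * S)) (suc T₂)
  coprimeε = subst (Coprime _) (sym suc-T₂) (coprime-product c c)
    where
    c : Coprime (1 + S * (220 * S)) (S * S)
    c = coprime-product (coprime-1+ S (220 * S) refl) (coprime-1+ S (220 * S) refl)

  Bounded : ℕ → ℕ → Shape → Set
  Bounded X Y t = suc X ≤ M × suc Y ≤ M × hn t ≤ 64

  -- The numerator of a height is a truncated difference, hence correct only if nothing is
  -- truncated. The subtracted part is at most S²(2M² + 64), which is at most S² · 32M² = S³ and so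
  -- at most S⁴.
  heightMinus≤ : ∀ X Y t → Bounded X Y t → heightMinus X Y t ≤ heightPlus X Y t
  heightMinus≤ X Y t (X< , Y< , h≤) = begin
    numerator X * numerator X + numerator Y * numerator Y + S * S * hn t
      ≤⟨ ℕ.+-mono-≤ (ℕ.+-mono-≤ (ℕ.*-mono-≤ (small X<) (small X<)) (ℕ.*-mono-≤ (small Y<) (small Y<))) (ℕ.*-monoʳ-≤ (S * S) h≤) ⟩
    S * M * (S * M) + S * M * (S * M) + S * S * 64
      ≡⟨ solve 2 (λ S M → S :* M :* (S :* M) :+ S :* M :* (S :* M) :+ S :* S :* con 64 := S :* S :* (con 2 :* (M :* M) :+ con 64)) refl S M ⟩
    S * S * (2 * (M * M) + 64)
      ≤⟨ ℕ.*-monoʳ-≤ (S * S) (ℕ.≤-trans (begin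
        2 * (M * M) + 64          ≤⟨ ℕ.+-monoʳ-≤ (2 * (M * M)) (ℕ.≤-trans (ℕ.≤-trans (ℕ.m≤m+n 64 4032) (ℕ.*-mono-≤ 64≤M 64≤M)) (ℕ.m≤n*m (M * M) 30)) ⟩
        2 * (M * M) + 30 * (M * M) ≡⟨ trans (sym (ℕ.*-distribʳ-+ (M * M) 2 30)) (sym S≡) ⟩
        S ∎) (ℕ.m≤m*n S S)) ⟩
    S * S * (S * S)
      ≤⟨ ℕ.≤-trans (ℕ.m≤m+n _ 3) (ℕ.m≤m+n _ (S * S * hp t)) ⟩
    heightPlus X Y t ∎
    where
    open ℕ.≤-Reasoning
    open ℕSolver.+-*-Solver
    small : ∀ {X} → suc X ≤ M → numerator X ≤ S * M
    small {X} X< = ℕ.≤-trans (ℕ.≤-trans (ℕ.+-monoˡ-≤ (S * X) (>-nonZero⁻¹ S)) (ℕ.≤-reflexive (sym (ℕ.*-suc S X)))) (ℕ.*-monoʳ-≤ S X<)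

  heightNumerator-sum : ∀ X Y t → Bounded X Y t → heightNumerator X Y t + heightMinus X Y t ≡ heightPlus X Y t
  heightNumerator-sum X Y t b = ℕ.m∸n+n≡m (heightMinus≤ X Y t b)

  coprime₂ : ∀ X Y t → Bounded X Y t → Coprime (heightNumerator X Y t) (suc T₂)
  coprime₂ X Y t b = subst (Coprime _) (sym suc-T₂) (coprime-product (coprime-product c c) (coprime-product c c))
    where
    H = heightNumerator X Y t
    u = X + X + S * X * X + (Y + Y + S * Y * Y) + S * hn t
    v = S * S * S + S * hp t
    -- Expanding the squares leaves the constants 1 and 1 against the 3 of `apex`. Cancelling 2
    -- exhibits H as 1 modulo S.
    equation : H + S * u ≡ S * v + 1
    equation = ℕ.+-cancelʳ-≡ 2 (H + S * u) (S * v + 1) (trans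
      (solve 6 (λ H S X Y h g → H :+ S :* (X :+ X :+ S :* X :* X :+ (Y :+ Y :+ S :* Y :* Y) :+ S :* h) :+ con 2
        := H :+ ((con 1 :+ S :* X) :* (con 1 :+ S :* X) :+ (con 1 :+ S :* Y) :* (con 1 :+ S :* Y) :+ S :* S :* h)) refl H S X Y (hn t) (hp t))
      (trans (heightNumerator-sum X Y t b)
        (solve 2 (λ S g → (S :* S) :* (S :* S) :+ con 3 :+ S :* S :* g := S :* (S :* S :* S :+ S :* g) :+ con 1 :+ con 2) refl S (hp t))))
      where open ℕSolver.+-*-Solver
    c : Coprime H S
    c {d} (d∣H , d∣S) = ℕ.∣1⇒≡1 (ℕ.∣m+n∣m⇒∣n (subst (d ℕ.∣_) equation (ℕ.∣m∣n⇒∣m+n d∣H (ℕ.∣m⇒∣m*n u d∣S))) (ℕ.∣m⇒∣m*n v d∣S))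

  -- Out of range the height would not be in lowest terms, hence the case distinction.
  heightℚ : ℕ → ℕ → Shape → ℚ
  heightℚ X Y t with suc X ≤? M ×-dec suc Y ≤? M ×-dec hn t ≤? 64
  ... | yes b = mkℚ (ℤ.+ heightNumerator X Y t) T₂ (coprime₂ X Y t b)
  ... | no _  = 0ℚ

  explicitVec : Pt → Vec ℚ (3 + k)
  explicitVec p = mkℚ (ℤ.+ numerator (posX p)) T₁ (coprime₁ (posX p)) ∷ mkℚ (ℤ.+ numerator (posY p)) T₁ (coprime₁ (posY p)) ∷
    heightℚ (posX p) (posY p) (shapeOf p) ∷ Vec.replicate k 0ℚ

  -- Opaque because the conversion checker gets lost in the unfolded coordinates.
  opaque
    vec : Pt → Vec ℚ (3 + k)
    vec = explicitVec

  opaque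
    unfolding vec
    vec-def : ∀ p → vec p ≡ explicitVec p
    vec-def p = refl

  εℚ : ℚ
  εℚ = mkℚ (ℤ.+ (1 + S * (220 * S))) T₂ coprimeε

  εℚ≡ : εℚ ≡ ε
  εℚ≡ = trans (scaled-value _ T₂ _ (s ℚ.* s) suc-T₂ SSSSss) (trans (cong (ℚ._* (s ℚ.* s))
      (trans (ι-ℕ+ 1 (S * (220 * S))) (cong (1ℚ ℚ.+_) (trans (cong (ι ∘ ℤ.+_) (trans (sym (ℕ.*-assoc S 220 S)) (trans (cong (_* S) (ℕ.*-comm S 220)) (ℕ.*-assoc 220 S S))))
        (ι-ℕ* 220 (S * S))))))
    (trans (solve 3 (λ q d s → (con 1ℚ :+ d :* q) :* (s :* s) := d :* (q :* s) :* s :+ s :* s) refl (ι (ℤ.+ (S * S))) δ s)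
      (cong (λ z → δ ℚ.* z ℚ.* s ℚ.+ s ℚ.* s) SSσσ ⟨by⟩ cong (λ z → z ℚ.* s ℚ.+ s ℚ.* s) (ℚ.*-identityʳ δ))))
    where
    open ℚSolver.+-*-Solver
    _⟨by⟩_ : ∀ {a b c : ℚ} → a ≡ b → b ≡ c → a ≡ c
    _⟨by⟩_ = trans

  coordinate≡ : ∀ X → mkℚ (ℤ.+ numerator X) T₁ (coprime₁ X) ≡ coordinate (ι (ℤ.+ X))
  coordinate≡ X = trans (scaled-value _ T₁ _ s suc-T₁ SSσσ) (trans (cong (ℚ._* s)
      (trans (ι-ℕ+ 1 (S * X)) (cong (1ℚ ℚ.+_) (ι-ℕ* S X))))
    (trans (solve 3 (λ S X σ → (con 1ℚ :+ S :* X) :* (σ :* σ) := σ :* σ :+ (S :* σ) :* σ :* X) refl (ι (ℤ.+ S)) (ι (ℤ.+ X)) σ)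
      (cong (s ℚ.+_) (trans (cong (λ z → z ℚ.* σ ℚ.* ι (ℤ.+ X)) Sσ) (cong (ℚ._* ι (ℤ.+ X)) (ℚ.*-identityˡ σ))))))
    where open ℚSolver.+-*-Solver

  shapeHeight : Shape → ℤ
  shapeHeight t = ℤ.+ hp t ℤ.- ℤ.+ hn t

  height≡ : ∀ X Y t → Bounded X Y t → heightℚ X Y t ≡ height (ι (ℤ.+ X)) (ι (ℤ.+ Y)) (ι (shapeHeight t))
  height≡ X Y t b with suc X ≤? M ×-dec suc Y ≤? M ×-dec hn t ≤? 64
  ... | no ¬b = contradiction b ¬b
  ... | yes _ = trans (scaled-value _ T₂ _ (s ℚ.* s) suc-T₂ SSSSss) (trans (cong (ℚ._* (s ℚ.* s)) difference)
    (trans (expand (ι (ℤ.+ S)) σ (ι (ℤ.+ X)) (ι (ℤ.+ Y)) (ι (ℤ.+ hp t)) (ι (ℤ.+ hn t)))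
      (trans (cong (λ z → (z ℚ.* z ℚ.* (z ℚ.* z) ℚ.+ ι (ℤ.+ 3) ℚ.* (s ℚ.* s) ℚ.+ z ℚ.* z ℚ.* s ℚ.* ι (ℤ.+ hp t)
            ℚ.- (s ℚ.+ z ℚ.* σ ℚ.* ι (ℤ.+ X)) ℚ.* (s ℚ.+ z ℚ.* σ ℚ.* ι (ℤ.+ X)) ℚ.- (s ℚ.+ z ℚ.* σ ℚ.* ι (ℤ.+ Y)) ℚ.* (s ℚ.+ z ℚ.* σ ℚ.* ι (ℤ.+ Y))
            ℚ.- z ℚ.* z ℚ.* s ℚ.* ι (ℤ.+ hn t))) Sσ)
        (trans (solve 5 (λ σ X Y g h →
            con 1ℚ :* con 1ℚ :* (con 1ℚ :* con 1ℚ) :+ con (ι (ℤ.+ 3)) :* (σ :* σ :* (σ :* σ)) :+ con 1ℚ :* con 1ℚ :* (σ :* σ) :* g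
              :- (σ :* σ :+ con 1ℚ :* σ :* X) :* (σ :* σ :+ con 1ℚ :* σ :* X) :- (σ :* σ :+ con 1ℚ :* σ :* Y) :* (σ :* σ :+ con 1ℚ :* σ :* Y)
              :- con 1ℚ :* con 1ℚ :* (σ :* σ) :* h
            := con 1ℚ :+ con (ι (ℤ.+ 3)) :* (σ :* σ :* (σ :* σ)) :+ σ :* σ :* (g :- h) :- (σ :* σ :+ σ :* X) :* (σ :* σ :+ σ :* X) :- (σ :* σ :+ σ :* Y) :* (σ :* σ :+ σ :* Y))
            refl σ (ι (ℤ.+ X)) (ι (ℤ.+ Y)) (ι (ℤ.+ hp t)) (ι (ℤ.+ hn t)))
          (cong (λ z → apex ℚ.+ s ℚ.* z ℚ.- coordinate (ι (ℤ.+ X)) ℚ.* coordinate (ι (ℤ.+ X)) ℚ.- coordinate (ι (ℤ.+ Y)) ℚ.* coordinate (ι (ℤ.+ Y)))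
            (sym (ι-- (ℤ.+ hp t) (ℤ.+ hn t))))))))
    where
    open ℚSolver.+-*-Solver
    numeratorℚ : ∀ X → ι (ℤ.+ numerator X) ≡ 1ℚ ℚ.+ ι (ℤ.+ S) ℚ.* ι (ℤ.+ X)
    numeratorℚ X = trans (ι-ℕ+ 1 (S * X)) (cong (1ℚ ℚ.+_) (ι-ℕ* S X))
    square : ∀ X → ι (ℤ.+ (numerator X * numerator X)) ≡ (1ℚ ℚ.+ ι (ℤ.+ S) ℚ.* ι (ℤ.+ X)) ℚ.* (1ℚ ℚ.+ ι (ℤ.+ S) ℚ.* ι (ℤ.+ X))
    square X = trans (ι-ℕ* (numerator X) (numerator X)) (cong₂ ℚ._*_ (numeratorℚ X) (numeratorℚ X))
    SSh : ∀ h → ι (ℤ.+ (S * S * h)) ≡ ι (ℤ.+ S) ℚ.* ι (ℤ.+ S) ℚ.* ι (ℤ.+ h)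
    SSh h = trans (ι-ℕ* (S * S) h) (cong (ℚ._* ι (ℤ.+ h)) (ι-ℕ* S S))
    plus≡ : ι (ℤ.+ heightPlus X Y t) ≡ ι (ℤ.+ S) ℚ.* ι (ℤ.+ S) ℚ.* (ι (ℤ.+ S) ℚ.* ι (ℤ.+ S)) ℚ.+ ι (ℤ.+ 3) ℚ.+ ι (ℤ.+ S) ℚ.* ι (ℤ.+ S) ℚ.* ι (ℤ.+ hp t)
    plus≡ = trans (ι-ℕ+ ((S * S) * (S * S) + 3) (S * S * hp t)) (cong₂ ℚ._+_
      (trans (ι-ℕ+ ((S * S) * (S * S)) 3) (cong (ℚ._+ ι (ℤ.+ 3)) (trans (ι-ℕ* (S * S) (S * S)) (cong (λ z → z ℚ.* z) (ι-ℕ* S S))))) (SSh (hp t)))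
    minus≡ : ι (ℤ.+ heightMinus X Y t) ≡ (1ℚ ℚ.+ ι (ℤ.+ S) ℚ.* ι (ℤ.+ X)) ℚ.* (1ℚ ℚ.+ ι (ℤ.+ S) ℚ.* ι (ℤ.+ X))
      ℚ.+ (1ℚ ℚ.+ ι (ℤ.+ S) ℚ.* ι (ℤ.+ Y)) ℚ.* (1ℚ ℚ.+ ι (ℤ.+ S) ℚ.* ι (ℤ.+ Y)) ℚ.+ ι (ℤ.+ S) ℚ.* ι (ℤ.+ S) ℚ.* ι (ℤ.+ hn t)
    minus≡ = trans (ι-ℕ+ (numerator X * numerator X + numerator Y * numerator Y) (S * S * hn t)) (cong₂ ℚ._+_
      (trans (ι-ℕ+ (numerator X * numerator X) (numerator Y * numerator Y)) (cong₂ ℚ._+_ (square X) (square Y))) (SSh (hn t)))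
    difference : ι (ℤ.+ heightNumerator X Y t) ≡ _
    difference = trans (trans (solve 2 (λ a b → a := (a :+ b) :- b) refl (ι (ℤ.+ heightNumerator X Y t)) (ι (ℤ.+ heightMinus X Y t)))
      (cong (ℚ._- ι (ℤ.+ heightMinus X Y t)) (trans (sym (ι-ℕ+ (heightNumerator X Y t) (heightMinus X Y t))) (cong (ι ∘ ℤ.+_) (heightNumerator-sum X Y t b)))))
      (cong₂ ℚ._-_ plus≡ minus≡)
    expand : ∀ S σ X Y g h →
      (S ℚ.* S ℚ.* (S ℚ.* S) ℚ.+ ι (ℤ.+ 3) ℚ.+ S ℚ.* S ℚ.* g
        ℚ.- ((1ℚ ℚ.+ S ℚ.* X) ℚ.* (1ℚ ℚ.+ S ℚ.* X) ℚ.+ (1ℚ ℚ.+ S ℚ.* Y) ℚ.* (1ℚ ℚ.+ S ℚ.* Y) ℚ.+ S ℚ.* S ℚ.* h)) ℚ.* (σ ℚ.* σ ℚ.* (σ ℚ.* σ))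
      ≡ (S ℚ.* σ) ℚ.* (S ℚ.* σ) ℚ.* ((S ℚ.* σ) ℚ.* (S ℚ.* σ)) ℚ.+ ι (ℤ.+ 3) ℚ.* (σ ℚ.* σ ℚ.* (σ ℚ.* σ)) ℚ.+ (S ℚ.* σ) ℚ.* (S ℚ.* σ) ℚ.* (σ ℚ.* σ) ℚ.* g
        ℚ.- (σ ℚ.* σ ℚ.+ (S ℚ.* σ) ℚ.* σ ℚ.* X) ℚ.* (σ ℚ.* σ ℚ.+ (S ℚ.* σ) ℚ.* σ ℚ.* X)
        ℚ.- (σ ℚ.* σ ℚ.+ (S ℚ.* σ) ℚ.* σ ℚ.* Y) ℚ.* (σ ℚ.* σ ℚ.+ (S ℚ.* σ) ℚ.* σ ℚ.* Y) ℚ.- (S ℚ.* σ) ℚ.* (S ℚ.* σ) ℚ.* (σ ℚ.* σ) ℚ.* h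
    expand = solve 6 (λ S σ X Y g h →
      (S :* S :* (S :* S) :+ con (ι (ℤ.+ 3)) :+ S :* S :* g
        :- ((con 1ℚ :+ S :* X) :* (con 1ℚ :+ S :* X) :+ (con 1ℚ :+ S :* Y) :* (con 1ℚ :+ S :* Y) :+ S :* S :* h)) :* (σ :* σ :* (σ :* σ))
      := (S :* σ) :* (S :* σ) :* ((S :* σ) :* (S :* σ)) :+ con (ι (ℤ.+ 3)) :* (σ :* σ :* (σ :* σ)) :+ (S :* σ) :* (S :* σ) :* (σ :* σ) :* g
        :- (σ :* σ :+ (S :* σ) :* σ :* X) :* (σ :* σ :+ (S :* σ) :* σ :* X)
        :- (σ :* σ :+ (S :* σ) :* σ :* Y) :* (σ :* σ :+ (S :* σ) :* σ :* Y) :- (S :* σ) :* (S :* σ) :* (σ :* σ) :* h) refl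

  open Axes k public

  -- Which points can replace which.

  rel : ℕ → ℕ → Pt → Offset
  rel a₀ b₀ p = place (ℤ.+ col p ℤ.- ℤ.+ a₀) (ℤ.+ row p ℤ.- ℤ.+ b₀) (shapeOf p)

  -- In the normal direction at grid position (a₀, b₀), such a point misses a point of power t by
  -- more than the tolerance.
  record Beaten (a₀ b₀ : ℕ) (t : ℤ) (q : Pt) : Set where
    constructor beaten
    field
      margin : Offset.power (rel a₀ b₀ q) ℤ.+ ℤ.+ 221 ℤ.≤ t

  -- A point lies within 2 lattice units of its grid position, so j grid steps leave a distance of
  -- at least 16j - 2.
  apart-x : ∀ {a₀} q j → Separated j (col q) a₀ → ∀ n → n + 2 ≤ 16 * j → n ≤ ℤ.∣ displacement (col q) a₀ (dx (shapeOf q)) ∣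
  apart-x q j sep n n≤ = displacement-separated j n sep
    (ℕ.≤-trans (ℕ.≤-reflexive (sym (ℕ.+-assoc n 2 6))) (ℕ.+-mono-≤ n≤ (ShapeBounds.6≤dx (shapeBounds q))))
    (ℕ.≤-trans (ℕ.+-monoʳ-≤ n (ShapeBounds.dx≤10 (shapeBounds q))) (ℕ.≤-trans (ℕ.≤-reflexive (sym (ℕ.+-assoc n 2 8))) (ℕ.+-monoˡ-≤ 8 n≤)))

  apart-y : ∀ {b₀} q j → Separated j (row q) b₀ → ∀ n → n + 2 ≤ 16 * j → n ≤ ℤ.∣ displacement (row q) b₀ (dy (shapeOf q)) ∣
  apart-y q j sep n n≤ = displacement-separated j n sep
    (ℕ.≤-trans (ℕ.≤-reflexive (sym (ℕ.+-assoc n 2 6))) (ℕ.+-mono-≤ n≤ (ShapeBounds.6≤dy (shapeBounds q))))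
    (ℕ.≤-trans (ℕ.+-monoʳ-≤ n (ShapeBounds.dy≤10 (shapeBounds q))) (ℕ.≤-trans (ℕ.≤-reflexive (sym (ℕ.+-assoc n 2 8))) (ℕ.+-monoˡ-≤ 8 n≤)))

  beaten-far-x : ∀ {a₀ b₀ t} q → Separated 2 (col q) a₀ → ℤ.- ℤ.+ 64 ℤ.≤ t → Beaten a₀ b₀ t q
  beaten-far-x {a₀} {b₀} q sep t≥ = beaten (power≤ (rel a₀ b₀ q) (apart-x q 2 sep 30 ℕ.≤-refl) z≤n (shapeHeight≤ (shapeBounds q)) (ℤ.≤-trans (ℤ.-≤- (ℕ.m≤m+n 63 581)) t≥))

  beaten-far-y : ∀ {a₀ b₀ t} q → Separated 2 (row q) b₀ → ℤ.- ℤ.+ 64 ℤ.≤ t → Beaten a₀ b₀ t q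
  beaten-far-y {a₀} {b₀} q sep t≥ = beaten (power≤ (rel a₀ b₀ q) z≤n (apart-y q 2 sep 30 ℕ.≤-refl) (shapeHeight≤ (shapeBounds q)) (ℤ.≤-trans (ℤ.-≤- (ℕ.m≤m+n 63 581)) t≥))

  beaten-diagonal : ∀ {a₀ b₀ t} q → Separated 1 (col q) a₀ → Separated 1 (row q) b₀ → ℤ.- ℤ.+ 64 ℤ.≤ t → Beaten a₀ b₀ t q
  beaten-diagonal {a₀} {b₀} q sep sep′ t≥ = beaten (power≤ (rel a₀ b₀ q) (apart-x q 1 sep 14 ℕ.≤-refl) (apart-y q 1 sep′ 14 ℕ.≤-refl)
    (shapeHeight≤ (shapeBounds q)) (ℤ.≤-trans (ℤ.-≤- (ℕ.m≤m+n 63 73)) t≥))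

  beaten-x : ∀ {a₀ b₀ t} q → dx (shapeOf q) ≡ 8 → Separated 1 (col q) a₀ →
    shapeHeight (shapeOf q) ℤ.- ℤ.+ 256 ℤ.- ℤ.+ 0 ℤ.+ ℤ.+ 221 ℤ.≤ t → Beaten a₀ b₀ t q
  beaten-x {a₀} {b₀} q x≡ sep h = beaten (power≤ (rel a₀ b₀ q) (displacement-separated 1 16 sep (ℕ.≤-reflexive (cong (16 +_) (sym x≡))) (ℕ.≤-reflexive (cong (16 +_) x≡))) z≤n ℤ.≤-refl h)

  beaten-y : ∀ {a₀ b₀ t} q → dy (shapeOf q) ≡ 8 → Separated 1 (row q) b₀ →
    shapeHeight (shapeOf q) ℤ.- ℤ.+ 0 ℤ.- ℤ.+ 256 ℤ.+ ℤ.+ 221 ℤ.≤ t → Beaten a₀ b₀ t q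
  beaten-y {a₀} {b₀} q y≡ sep h = beaten (power≤ (rel a₀ b₀ q) z≤n (displacement-separated 1 16 sep (ℕ.≤-reflexive (cong (16 +_) (sym y≡))) (ℕ.≤-reflexive (cong (16 +_) y≡))) ℤ.≤-refl h)

  closed : ∀ {z t} {_ : True (z ℤ.≤? t)} → z ℤ.≤ t
  closed {_} {_} {w} = toWitness w

  -- -34 is the power of a corner at its own grid position; ends have -1 and the choice `lp` has -2,
  -- so the same limit serves for them. -64 is the power of a gap.
  -34ᶻ -64ᶻ : ℤ
  -34ᶻ = ℤ.- ℤ.+ 34
  -64ᶻ = ℤ.- ℤ.+ 64

  even-separated : ∀ j → Separated 2 0 (2 + 2 * j)
  even-separated j = inj₁ (s≤s (s≤s z≤n))

  odd-separated : ∀ j → Separated 1 0 (1 + 2 * j)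
  odd-separated j = inj₁ (s≤s z≤n)

  -- In the normal direction at a corner all other points fall short by more than the tolerance, so
  -- a regret set cannot do without it. The ends follow the same pattern.
  corner-unique : ∀ i j q → InRange q → (q ≡ corner i j) ⊎ Beaten (1 + 2 * j) (2 * i) -34ᶻ q
  corner-unique i j (corner i′ j′) _ with i′ ≟ i | j′ ≟ j
  ... | yes refl | yes refl = inj₁ refl
  ... | no i≢    | _        = inj₂ (beaten-far-y (corner i′ j′) (distinct-double i≢) closed)
  ... | yes _    | no j≢    = inj₂ (beaten-far-x (corner i′ j′) (separated-suc (distinct-double j≢)) closed)
  corner-unique i j (leftEnd i′)  _ = inj₂ (beaten-y (leftEnd i′) refl (odd-even i′ i) closed)
  corner-unique i j (rightEnd i′) _ = inj₂ (beaten-y (rightEnd i′) refl (odd-even i′ i) closed)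
  corner-unique i j (hgap i′ j′)  _ = inj₂ (beaten-y (hgap i′ j′) refl (odd-even i′ i) closed)
  corner-unique i j (vgap i′ j′)  _ = inj₂ (beaten-x (vgap i′ j′) refl (separated-suc (odd-even j′ j)) closed)
  corner-unique i j (cell i′ j′ c) _ = inj₂ (beaten-diagonal (cell i′ j′ c) (separated-suc (odd-even j′ j)) (odd-even i′ i) closed)

  leftEnd-unique : ∀ i q → InRange q → (q ≡ leftEnd i) ⊎ Beaten 0 (1 + 2 * i) -34ᶻ q
  leftEnd-unique i (corner i′ j′)  _ = inj₂ (beaten-y (corner i′ j′) refl (even-odd i′ i) closed)
  leftEnd-unique i (leftEnd i′)    _ with i′ ≟ i
  ... | yes refl = inj₁ refl
  ... | no i≢    = inj₂ (beaten-far-y (leftEnd i′) (separated-suc (distinct-double i≢)) closed)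
  leftEnd-unique i (rightEnd i′)   _ = inj₂ (beaten-far-x (rightEnd i′) (separated-swap (even-separated C)) closed)
  leftEnd-unique i (hgap i′ j′)    _ = inj₂ (beaten-x (hgap i′ j′) refl (separated-swap (odd-separated j′)) closed)
  leftEnd-unique i (vgap i′ j′)    _ = inj₂ (beaten-far-x (vgap i′ j′) (separated-swap (even-separated j′)) closed)
  leftEnd-unique i (cell i′ j′ c)  _ = inj₂ (beaten-far-x (cell i′ j′ c) (separated-swap (even-separated j′)) closed)

  rightEnd-unique : ∀ i q → InRange q → (q ≡ rightEnd i) ⊎ Beaten (2 + 2 * C) (1 + 2 * i) -34ᶻ q
  rightEnd-unique i (corner i′ j′)  _ = inj₂ (beaten-y (corner i′ j′) refl (even-odd i′ i) closed)
  rightEnd-unique i (leftEnd i′)    _ = inj₂ (beaten-far-x (leftEnd i′) (even-separated C) closed)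
  rightEnd-unique i (rightEnd i′)   _ with i′ ≟ i
  ... | yes refl = inj₁ refl
  ... | no i≢    = inj₂ (beaten-far-y (rightEnd i′) (separated-suc (distinct-double i≢)) closed)
  rightEnd-unique i (hgap i′ j′)    _ = inj₂ (beaten-x (hgap i′ j′) refl (separated-suc (even-odd j′ C)) closed)
  rightEnd-unique i (vgap i′ j′)   (_ , j<) = inj₂ (beaten-far-x (vgap i′ j′) (separated-suc (separated-suc (distinct-double (ℕ.<⇒≢ j<)))) closed)
  rightEnd-unique i (cell i′ j′ c) (_ , j<) = inj₂ (beaten-far-x (cell i′ j′ c) (separated-suc (separated-suc (distinct-double (ℕ.<⇒≢ j<)))) closed)

  -- Here the survivors are all choices of the one cell. This forces some choice to be selected and
  -- leaves open which.
  cell-unique : ∀ i j → j < C → ∀ q → InRange q → (∃[ c ] q ≡ cell i j c) ⊎ Beaten (2 + 2 * j) (1 + 2 * i) -34ᶻ q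
  cell-unique i j j<C (corner i′ j′)  _ = inj₂ (beaten-y (corner i′ j′) refl (even-odd i′ i) closed)
  cell-unique i j j<C (leftEnd i′)    _ = inj₂ (beaten-far-x (leftEnd i′) (even-separated j) closed)
  cell-unique i j j<C (rightEnd i′)   _ = inj₂ (beaten-far-x (rightEnd i′) (separated-suc (separated-suc (distinct-double (ℕ.<⇒≢ j<C ∘ sym)))) closed)
  cell-unique i j j<C (hgap i′ j′)    _ = inj₂ (beaten-x (hgap i′ j′) refl (separated-suc (even-odd j′ j)) closed)
  cell-unique i j j<C (vgap i′ j′)    _ = inj₂ (beaten-y (vgap i′ j′) refl (separated-suc (odd-even i′ i)) closed)
  cell-unique i j j<C (cell i′ j′ c)  _ with i′ ≟ i | j′ ≟ j
  ... | yes refl | yes refl = inj₁ (c , refl)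
  ... | no i≢    | _        = inj₂ (beaten-far-y (cell i′ j′ c) (separated-suc (distinct-double i≢)) closed)
  ... | yes _    | no j≢    = inj₂ (beaten-far-x (cell i′ j′ c) (separated-suc (separated-suc (distinct-double j≢))) closed)

  IsGap : Pt → Set
  IsGap (hgap _ _) = ⊤
  IsGap (vgap _ _) = ⊤
  IsGap _          = ⊥

  step-right : ∀ a → ℤ.+ suc a ℤ.- ℤ.+ a ≡ 1ᶻ
  step-right a = solve 1 (λ a → (con (ℤ.+ 1) :+ a) :- a := con (ℤ.+ 1)) refl (ℤ.+ a)
    where open ℤSolver.+-*-Solver

  step-left : ∀ a → ℤ.+ a ℤ.- ℤ.+ suc a ≡ -1ᶻ
  step-left a = solve 1 (λ a → a :- (con (ℤ.+ 1) :+ a) := con (ℤ.- ℤ.+ 1)) refl (ℤ.+ a)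
    where open ℤSolver.+-*-Solver

  step-none : ∀ a → ℤ.+ a ℤ.- ℤ.+ a ≡ 0ᶻ
  step-none a = ℤ.+-inverseʳ (ℤ.+ a)

  place≡ : ∀ {cx cx′ cy cy′} t → cx ≡ cx′ → cy ≡ cy′ → place cx cy t ≡ place cx′ cy′ t
  place≡ t refl refl = refl

  beaten-at : ∀ {a₀ b₀ t} cx cy q → ℤ.+ col q ℤ.- ℤ.+ a₀ ≡ cx → ℤ.+ row q ℤ.- ℤ.+ b₀ ≡ cy →
    Offset.power (place cx cy (shapeOf q)) ℤ.+ ℤ.+ 221 ℤ.≤ t → Beaten a₀ b₀ t q
  beaten-at {t = t} cx cy q x≡ y≡ h = beaten (subst (λ r → Offset.power r ℤ.+ ℤ.+ 221 ℤ.≤ t) (sym (place≡ (shapeOf q) x≡ y≡)) h)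

  right-uncovered : ∀ c → coversLeft c ≡ false → Offset.power (place 1ᶻ 0ᶻ (choiceShape c)) ℤ.+ ℤ.+ 221 ℤ.≤ -64ᶻ
  right-uncovered = toWitness {a? = every? λ c → (coversLeft c Bool.≟ false) →-dec (Offset.power (place 1ᶻ 0ᶻ (choiceShape c)) ℤ.+ ℤ.+ 221 ℤ.≤? -64ᶻ)} tt

  left-uncovered : ∀ c → coversRight c ≡ false → Offset.power (place -1ᶻ 0ᶻ (choiceShape c)) ℤ.+ ℤ.+ 221 ℤ.≤ -64ᶻ
  left-uncovered = toWitness {a? = every? λ c → (coversRight c Bool.≟ false) →-dec (Offset.power (place -1ᶻ 0ᶻ (choiceShape c)) ℤ.+ ℤ.+ 221 ℤ.≤? -64ᶻ)} tt

  below-uncovered : ∀ c → coversPrev c ≡ false → Offset.power (place 0ᶻ 1ᶻ (choiceShape c)) ℤ.+ ℤ.+ 221 ℤ.≤ -64ᶻ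
  below-uncovered = toWitness {a? = every? λ c → (coversPrev c Bool.≟ false) →-dec (Offset.power (place 0ᶻ 1ᶻ (choiceShape c)) ℤ.+ ℤ.+ 221 ℤ.≤? -64ᶻ)} tt

  above-uncovered : ∀ c → coversNext c ≡ false → Offset.power (place 0ᶻ -1ᶻ (choiceShape c)) ℤ.+ ℤ.+ 221 ℤ.≤ -64ᶻ
  above-uncovered = toWitness {a? = every? λ c → (coversNext c Bool.≟ false) →-dec (Offset.power (place 0ᶻ -1ᶻ (choiceShape c)) ℤ.+ ℤ.+ 221 ℤ.≤? -64ᶻ)} tt

  CoversRow : ℕ → ℕ → Pt → Set
  CoversRow i j q = (∃[ c ] q ≡ cell i j c × coversLeft c ≡ true) ⊎ (∃[ j′ ] ∃[ c ] j ≡ suc j′ × q ≡ cell i j′ c × coversRight c ≡ true)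

  CoversColumn : ℕ → ℕ → Pt → Set
  CoversColumn i j q = (∃[ c ] q ≡ cell i j c × coversNext c ≡ true) ⊎ (∃[ c ] q ≡ cell (suc i) j c × coversPrev c ≡ true)

  -- An end is 17 units away from the outermost gap of its row, just too far to cover it. So all
  -- gaps of a row, one more than its cells, are left to the cells.
  hgap-covered : ∀ i j → j ≤ C → ∀ q → ¬ IsGap q → InRange q → CoversRow i j q ⊎ Beaten (1 + 2 * j) (1 + 2 * i) -64ᶻ q
  hgap-covered i j j≤C (corner i′ j′)  _ _ = inj₂ (beaten-y (corner i′ j′) refl (even-odd i′ i) closed)
  hgap-covered i j j≤C (leftEnd i′)    _ _ = inj₂ (beaten (power≤ (rel (1 + 2 * j) (1 + 2 * i) (leftEnd i′))
    (displacement-left 1 17 {0} {1 + 2 * j} (s≤s z≤n) ℕ.≤-refl) z≤n ℤ.≤-refl closed))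
  hgap-covered i j j≤C (rightEnd i′)   _ _ = inj₂ (beaten (power≤ (rel (1 + 2 * j) (1 + 2 * i) (rightEnd i′))
    (displacement-right 1 17 {2 + 2 * C} {1 + 2 * j} (s≤s (ℕ.≤-trans (ℕ.≤-reflexive (ℕ.+-comm (2 * j) 1)) (s≤s (ℕ.*-monoʳ-≤ 2 j≤C)))) ℕ.≤-refl) z≤n ℤ.≤-refl closed))
  hgap-covered i j j≤C (hgap _ _) ¬gap _ = contradiction tt ¬gap
  hgap-covered i j j≤C (vgap _ _) ¬gap _ = contradiction tt ¬gap
  hgap-covered i j j≤C (cell i′ j′ c)  _ _ with i′ ≟ i
  ... | no i≢ = inj₂ (beaten-far-y (cell i′ j′ c) (separated-suc (distinct-double i≢)) closed)
  ... | yes refl with j′ ≟ j | suc j′ ≟ j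
  ...   | yes refl | _ = cases (coversLeft c) refl
    where
    cases : ∀ β → coversLeft c ≡ β → CoversRow i j (cell i j c) ⊎ Beaten (1 + 2 * j) (1 + 2 * i) -64ᶻ (cell i j c)
    cases true  eq = inj₁ (inj₁ (c , refl , eq))
    cases false eq = inj₂ (beaten-at 1ᶻ 0ᶻ (cell i j c) (step-right (1 + 2 * j)) (step-none (1 + 2 * i)) (right-uncovered c eq))
  ...   | no _ | yes refl = cases (coversRight c) refl
    where
    cases : ∀ β → coversRight c ≡ β → CoversRow i (suc j′) (cell i j′ c) ⊎ Beaten (1 + 2 * suc j′) (1 + 2 * i) -64ᶻ (cell i j′ c)
    cases true  eq = inj₁ (inj₂ (j′ , c , refl , refl , eq))
    cases false eq = inj₂ (beaten-at -1ᶻ 0ᶻ (cell i j′ c)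
      (trans (cong (λ z → ℤ.+ (2 + 2 * j′) ℤ.- ℤ.+ suc z) (ℕ.*-suc 2 j′)) (step-left (2 + 2 * j′))) (step-none (1 + 2 * i)) (left-uncovered c eq))
  ...   | no j≢ | no sj≢ = inj₂ (beaten-far-x (cell i j′ c) far closed)
    where
    far : Separated 2 (2 + 2 * j′) (1 + 2 * j)
    far with suc j ≤? j′
    ... | yes j<j′ = inj₂ (ℕ.≤-trans (s≤s (double-mono j<j′)) (ℕ.n≤1+n _))
    ... | no  j≮j′ = inj₁ (s≤s (ℕ.≤-trans (ℕ.≤-trans (ℕ.n≤1+n _) (ℕ.≤-reflexive (cong (_+ 2) (sym (ℕ.*-suc 2 j′))))) (double-mono (ℕ.≤∧≢⇒< (ℕ.≤∧≢⇒< (ℕ.≮⇒≥ j≮j′) j≢) sj≢))))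

  vgap-covered : ∀ i j → j < C → ∀ q → ¬ IsGap q → InRange q → CoversColumn i j q ⊎ Beaten (2 + 2 * j) (2 + 2 * i) -64ᶻ q
  vgap-covered i j j<C (corner i′ j′)  _ _ = inj₂ (beaten-x (corner i′ j′) refl (separated-suc (even-odd j′ j)) closed)
  vgap-covered i j j<C (leftEnd i′)    _ _ = inj₂ (beaten-far-x (leftEnd i′) (even-separated j) closed)
  vgap-covered i j j<C (rightEnd i′)   _ _ = inj₂ (beaten-far-x (rightEnd i′) (separated-suc (separated-suc (distinct-double (ℕ.<⇒≢ j<C ∘ sym)))) closed)
  vgap-covered i j j<C (hgap _ _) ¬gap _ = contradiction tt ¬gap
  vgap-covered i j j<C (vgap _ _) ¬gap _ = contradiction tt ¬gap
  vgap-covered i j j<C (cell i′ j′ c)  _ _ with j′ ≟ j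
  ... | no j≢ = inj₂ (beaten-far-x (cell i′ j′ c) (separated-suc (separated-suc (distinct-double j≢))) closed)
  ... | yes refl with i′ ≟ i | i′ ≟ suc i
  ...   | yes refl | _ = cases (coversNext c) refl
    where
    cases : ∀ β → coversNext c ≡ β → CoversColumn i j (cell i j c) ⊎ Beaten (2 + 2 * j) (2 + 2 * i) -64ᶻ (cell i j c)
    cases true  eq = inj₁ (inj₁ (c , refl , eq))
    cases false eq = inj₂ (beaten-at 0ᶻ -1ᶻ (cell i j c) (step-none (2 + 2 * j)) (step-left (1 + 2 * i)) (above-uncovered c eq))
  ...   | no _ | yes refl = cases (coversPrev c) refl
    where
    cases : ∀ β → coversPrev c ≡ β → CoversColumn i j (cell (suc i) j c) ⊎ Beaten (2 + 2 * j) (2 + 2 * i) -64ᶻ (cell (suc i) j c)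
    cases true  eq = inj₁ (inj₂ (c , refl , eq))
    cases false eq = inj₂ (beaten-at 0ᶻ 1ᶻ (cell (suc i) j c) (step-none (2 + 2 * j))
      (trans (cong (λ z → ℤ.+ suc z ℤ.- ℤ.+ (2 + 2 * i)) (ℕ.*-suc 2 i)) (step-right (2 + 2 * i))) (below-uncovered c eq))
  ...   | no i≢ | no i≢′ = inj₂ (beaten-far-y (cell i′ j c) far closed)
    where
    far : Separated 2 (1 + 2 * i′) (2 + 2 * i)
    far with suc i ≤? i′
    ... | yes i<i′ = inj₂ (ℕ.≤-trans (ℕ.≤-reflexive (cong (_+ 2) (sym (ℕ.*-suc 2 i)))) (ℕ.≤-trans (double-mono (ℕ.≤∧≢⇒< i<i′ (i≢′ ∘ sym))) (ℕ.n≤1+n _)))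
    ... | no  i≮i′ = inj₁ (s≤s (ℕ.≤-trans (double-mono (ℕ.≤∧≢⇒< (ℕ.≮⇒≥ i≮i′) i≢)) (ℕ.n≤1+n _)))

  -- The only choice in row i that may cover both sides. Its sign is the sign of the clause, and
  -- `section 6` offers it just at the literals.
  both : ℕ → Choice
  both i = if i <ᵇ B then bp else bn

  -- The list of points and its distinctness.

  kind : Pt → ℕ
  kind (corner _ _)  = 0
  kind (leftEnd _)   = 1
  kind (rightEnd _)  = 2
  kind (hgap _ _)    = 3
  kind (vgap _ _)    = 4
  kind (cell _ _ lp) = 5
  kind (cell _ _ ln) = 5
  kind (cell _ _ rp) = 5
  kind (cell _ _ rn) = 5
  kind (cell _ _ bp) = 6
  kind (cell _ _ bn) = 6

  line column : Pt → ℕ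
  line (corner i j)    = i
  line (leftEnd i)     = i
  line (rightEnd i)    = i
  line (hgap i j)      = i
  line (vgap i j)      = i
  line (cell i j c)    = i
  column (corner i j)  = j
  column (leftEnd i)   = 0
  column (rightEnd i)  = 0
  column (hgap i j)    = j
  column (vgap i j)    = j
  column (cell i j c)  = j

  -- One section per loop of the printing code. In the proof of distinctness `kind` recovers the
  -- section and `line` and `column` the loop indices.
  section : ℕ → List Pt
  section 0 = loop (suc R) λ i → loop (suc C) λ j → corner i j ∷ []
  section 1 = loop R λ i → leftEnd i ∷ []
  section 2 = loop R λ i → rightEnd i ∷ []
  section 3 = loop R λ i → loop (suc C) λ j → hgap i j ∷ []
  section 4 = loop (R ∸ 1) λ i → loop C λ j → vgap i j ∷ []
  section 5 = loop R λ i → loop C λ j → cell i j lp ∷ cell i j ln ∷ cell i j rp ∷ cell i j rn ∷ []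
  section 6 = loop R λ i → map (λ j → cell i j (both i)) (literals i)
  section _ = []

  pts : List Pt
  pts = loop 7 section

  data Valid (i j : ℕ) : Choice → Set where
    valid-lp : Valid i j lp
    valid-ln : Valid i j ln
    valid-rp : Valid i j rp
    valid-rn : Valid i j rn
    valid-bp : i < B → j ∈ literals i → Valid i j bp
    valid-bn : ¬ i < B → j ∈ literals i → Valid i j bn

  both-cases : ∀ i → (i < B × both i ≡ bp) ⊎ (¬ i < B × both i ≡ bn)
  both-cases i with i <ᵇ B in eq
  ... | true  = inj₁ (ℕ.<ᵇ⇒< i B (subst T (sym eq) tt) , refl)
  ... | false = inj₂ ((λ i<B → subst T eq (ℕ.<⇒<ᵇ i<B)) , refl)

  corner∈ : ∀ {i j} → i ≤ R → j ≤ C → corner i j ∈ pts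
  corner∈ {i} {j} i≤ j≤ = ∈-loop⁺ {n = 7} {section} 0 (s≤s z≤n) (∈-loop⁺ {n = suc R} {λ i → loop (suc C) λ j → corner i j ∷ []} i (s≤s i≤) (∈-loop⁺ {n = suc C} {λ j → corner i j ∷ []} j (s≤s j≤) (here refl)))

  leftEnd∈ : ∀ {i} → i < R → leftEnd i ∈ pts
  leftEnd∈ {i} i< = ∈-loop⁺ {n = 7} {section} 1 (s≤s (s≤s z≤n)) (∈-loop⁺ i i< (here refl))

  rightEnd∈ : ∀ {i} → i < R → rightEnd i ∈ pts
  rightEnd∈ {i} i< = ∈-loop⁺ {n = 7} {section} 2 (s≤s (s≤s (s≤s z≤n))) (∈-loop⁺ i i< (here refl))

  hgap∈ : ∀ {i j} → i < R → j ≤ C → hgap i j ∈ pts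
  hgap∈ {i} {j} i< j≤ = ∈-loop⁺ {n = 7} {section} 3 (ℕ.m≤m+n 4 3) (∈-loop⁺ i i< (∈-loop⁺ {n = suc C} {λ j → hgap i j ∷ []} j (s≤s j≤) (here refl)))

  vgap∈ : ∀ {i j} → suc i < R → j < C → vgap i j ∈ pts
  vgap∈ {i} {j} i< j< = ∈-loop⁺ {n = 7} {section} 4 (ℕ.m≤m+n 5 2) (∈-loop⁺ i (ℕ.∸-monoˡ-≤ 1 i<) (∈-loop⁺ j j< (here refl)))

  cell∈ : ∀ {i j c} → i < R → j < C → Valid i j c → cell i j c ∈ pts
  cell∈ {i} {j} i< j< valid-lp = ∈-loop⁺ {n = 7} {section} 5 (ℕ.m≤m+n 6 1) (∈-loop⁺ i i< (∈-loop⁺ j j< (here refl)))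
  cell∈ {i} {j} i< j< valid-ln = ∈-loop⁺ {n = 7} {section} 5 (ℕ.m≤m+n 6 1) (∈-loop⁺ i i< (∈-loop⁺ j j< (there (here refl))))
  cell∈ {i} {j} i< j< valid-rp = ∈-loop⁺ {n = 7} {section} 5 (ℕ.m≤m+n 6 1) (∈-loop⁺ i i< (∈-loop⁺ j j< (there (there (here refl)))))
  cell∈ {i} {j} i< j< valid-rn = ∈-loop⁺ {n = 7} {section} 5 (ℕ.m≤m+n 6 1) (∈-loop⁺ i i< (∈-loop⁺ j j< (there (there (there (here refl))))))
  cell∈ {i} {j} i< j< (valid-bp i<B j∈) = ∈-loop⁺ {n = 7} {section} 6 ℕ.≤-refl (∈-loop⁺ {f = λ i → map (λ j → cell i j (both i)) (literals i)} i i< (subst (λ c → cell i j c ∈ map (λ j → cell i j (both i)) (literals i)) (bp≡ (both-cases i)) (∈.∈-map⁺ (λ j → cell i j (both i)) j∈)))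
    where
    bp≡ : (i < B × both i ≡ bp) ⊎ (¬ i < B × both i ≡ bn) → both i ≡ bp
    bp≡ (inj₁ (_ , eq))  = eq
    bp≡ (inj₂ (i≮ , _)) = contradiction i<B i≮
  cell∈ {i} {j} i< j< (valid-bn i≮B j∈) = ∈-loop⁺ {n = 7} {section} 6 ℕ.≤-refl (∈-loop⁺ {f = λ i → map (λ j → cell i j (both i)) (literals i)} i i< (subst (λ c → cell i j c ∈ map (λ j → cell i j (both i)) (literals i)) (bn≡ (both-cases i)) (∈.∈-map⁺ (λ j → cell i j (both i)) j∈)))
    where
    bn≡ : (i < B × both i ≡ bp) ⊎ (¬ i < B × both i ≡ bn) → both i ≡ bn
    bn≡ (inj₁ (i<B , _)) = contradiction i<B i≮B
    bn≡ (inj₂ (_ , eq))  = eq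

  -- The geometry needs only `InRange`. The literal condition records which double-sided choices
  -- exist at all.
  Present : Pt → Set
  Present (cell i j c) = i < R × j < C × Valid i j c
  Present p            = InRange p

  section-present : ∀ n {p} → p ∈ section n → Present p × kind p ≡ n
  section-present 0 p∈ with ∈-loop⁻ (suc R) {λ i → loop (suc C) λ j → corner i j ∷ []} p∈
  ... | i , i< , p∈′ with ∈-loop⁻ (suc C) {λ j → corner i j ∷ []} p∈′
  ... | j , j< , here refl = (ℕ.≤-pred i< , ℕ.≤-pred j<) , refl
  section-present 1 p∈ with ∈-loop⁻ R p∈
  ... | i , i< , here refl = i< , refl
  section-present 2 p∈ with ∈-loop⁻ R p∈
  ... | i , i< , here refl = i< , refl
  section-present 3 p∈ with ∈-loop⁻ R p∈
  ... | i , i< , p∈′ with ∈-loop⁻ (suc C) {λ j → hgap i j ∷ []} p∈′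
  ... | j , j< , here refl = (i< , ℕ.≤-pred j<) , refl
  section-present 4 p∈ with ∈-loop⁻ (R ∸ 1) p∈
  ... | i , i< , p∈′ with ∈-loop⁻ C p∈′
  ... | j , j< , here refl = (ℕ.≤-trans (s≤s i<) (ℕ.≤-reflexive (ℕ.m+[n∸m]≡n (ℕ.≤-trans (s≤s z≤n) (ℕ.≤-trans i< (ℕ.m∸n≤m R 1))))) , j<) , refl
  section-present 5 p∈ with ∈-loop⁻ R p∈
  ... | i , i< , p∈′ with ∈-loop⁻ C p∈′
  ... | j , j< , here refl = (i< , j< , valid-lp) , refl
  ... | j , j< , there (here refl) = (i< , j< , valid-ln) , refl
  ... | j , j< , there (there (here refl)) = (i< , j< , valid-rp) , refl
  ... | j , j< , there (there (there (here refl))) = (i< , j< , valid-rn) , refl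
  section-present 6 p∈ with ∈-loop⁻ R p∈
  ... | i , i< , p∈′ with ∈.∈-map⁻ (λ j → cell i j (both i)) p∈′
  ... | j , j∈ , refl with both i | both-cases i
  ... | .bp | inj₁ (i<B , refl) = (i< , literals< i j∈ , valid-bp i<B j∈) , refl
  ... | .bn | inj₂ (i≮B , refl) = (i< , literals< i j∈ , valid-bn i≮B j∈) , refl

  present : ∀ {p} → p ∈ pts → Present p
  present p∈ = let (n , _ , p∈′) = ∈-loop⁻ 7 {section} p∈ in proj₁ (section-present n p∈′)

  inRange : ∀ {p} → p ∈ pts → InRange p
  inRange {p} p∈ = go p (present p∈)
    where
    go : ∀ p → Present p → InRange p
    go (corner i j)  h = h
    go (leftEnd i)   h = h
    go (rightEnd i)  h = h
    go (hgap i j)    h = h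
    go (vgap i j)    h = h
    go (cell i j c)  (i< , j< , _) = i< , j<

  by-line : ∀ n {f : ℕ → List Pt} → (∀ i {p} → p ∈ f i → line p ≡ i) → (∀ i → Unique (f i)) → Unique (loop n f)
  by-line n {f} keyed u = unique-loop n f line (λ i _ → u i) keyed

  by-column : ∀ n {f : ℕ → List Pt} → (∀ j {p} → p ∈ f j → column p ≡ j) → (∀ j → Unique (f j)) → Unique (loop n f)
  by-column n {f} keyed u = unique-loop n f column (λ i _ → u i) keyed

  inner : ∀ {n} {f : ℕ → List Pt} {i p} → (∀ j {p} → p ∈ f j → line p ≡ i) → p ∈ loop n f → line p ≡ i
  inner {n} h p∈ = let (j , _ , p∈′) = ∈-loop⁻ n p∈ in h j p∈′

  single : ∀ (p : Pt) → Unique (p ∷ [])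
  single p = [] ∷ []

  section-unique : ∀ n → Unique (section n)
  section-unique 0 = by-line (suc R) {λ i → loop (suc C) λ j → corner i j ∷ []} (λ i → inner {suc C} {λ j → corner i j ∷ []} λ { j (here refl) → refl }) λ i → by-column (suc C) {λ j → corner i j ∷ []} (λ { j (here refl) → refl }) λ j → single _
  section-unique 1 = by-line R (λ { i (here refl) → refl }) λ i → single _
  section-unique 2 = by-line R (λ { i (here refl) → refl }) λ i → single _
  section-unique 3 = by-line R (λ i → inner {suc C} {λ j → hgap i j ∷ []} λ { j (here refl) → refl }) λ i → by-column (suc C) {λ j → hgap i j ∷ []} (λ { j (here refl) → refl }) λ j → single _
  section-unique 4 = by-line (R ∸ 1) (λ i → inner {C} λ { j (here refl) → refl }) λ i → by-column C (λ { j (here refl) → refl }) λ j → single _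
  section-unique 5 = by-line R (λ i → inner {C} λ { j (here refl) → refl ; j (there (here refl)) → refl ; j (there (there (here refl))) → refl ; j (there (there (there (here refl)))) → refl })
    λ i → by-column C (λ { j (here refl) → refl ; j (there (here refl)) → refl ; j (there (there (here refl))) → refl ; j (there (there (there (here refl)))) → refl })
    λ j → ((λ ()) ∷ (λ ()) ∷ (λ ()) ∷ []) ∷ ((λ ()) ∷ (λ ()) ∷ []) ∷ ((λ ()) ∷ []) ∷ [] ∷ []
  section-unique 6 = by-line R (λ i p∈ → let (_ , _ , eq) = ∈.∈-map⁻ (λ j → cell i j (both i)) p∈ in cong line eq)
    λ i → Unique.map⁺ (λ eq → cong column eq) (literals-unique i)
  section-unique (suc (suc (suc (suc (suc (suc (suc _))))))) = []

  pts-unique : Unique pts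
  pts-unique = unique-loop 7 section kind (λ n _ → section-unique n) (λ n p∈ → proj₂ (section-present n p∈))

  col≤ : ∀ p → InRange p → col p ≤ 2 + 2 * C
  col≤ (corner i j) (_ , j≤) = s≤s (ℕ.≤-trans (ℕ.*-monoʳ-≤ 2 j≤) (ℕ.n≤1+n _))
  col≤ (leftEnd i)  _        = z≤n
  col≤ (rightEnd i) _        = ℕ.≤-refl
  col≤ (hgap i j) (_ , j≤)   = s≤s (ℕ.≤-trans (ℕ.*-monoʳ-≤ 2 j≤) (ℕ.n≤1+n _))
  col≤ (vgap i j) (_ , j<)   = s≤s (s≤s (ℕ.*-monoʳ-≤ 2 (ℕ.<⇒≤ j<)))
  col≤ (cell i j c) (_ , j<) = s≤s (s≤s (ℕ.*-monoʳ-≤ 2 (ℕ.<⇒≤ j<)))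

  odd≤ : ∀ {i} → i < R → 1 + 2 * i ≤ 2 * R
  odd≤ {i} i< = ℕ.≤-trans (ℕ.n≤1+n _) (ℕ.≤-trans (ℕ.≤-reflexive (sym (ℕ.*-suc 2 i))) (ℕ.*-monoʳ-≤ 2 i<))

  row≤ : ∀ p → InRange p → row p ≤ 2 * R
  row≤ (corner i j) (i≤ , _) = ℕ.*-monoʳ-≤ 2 i≤
  row≤ (leftEnd i)  i<       = odd≤ i<
  row≤ (rightEnd i) i<       = odd≤ i<
  row≤ (hgap i j) (i< , _)   = odd≤ i<
  row≤ (vgap i j) (i< , _)   = ℕ.≤-trans (ℕ.≤-reflexive (sym (ℕ.*-suc 2 i))) (ℕ.*-monoʳ-≤ 2 (ℕ.<⇒≤ i<))
  row≤ (cell i j c) (i< , _) = odd≤ i<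

  posX< : ∀ {a x} → a ≤ 2 + 2 * C → x ≤ 10 → suc (16 * a + x) ≤ M
  posX< {a} {x} a≤ x≤ = ℕ.≤-trans (s≤s (ℕ.+-mono-≤ (ℕ.*-monoʳ-≤ 16 a≤) x≤)) (ℕ.≤-trans (ℕ.m≤m+n _ (21 + 32 * R)) (ℕ.≤-reflexive (trans
    (solve 2 (λ R C → con 1 :+ (con 16 :* (con 2 :+ con 2 :* C) :+ con 10) :+ (con 21 :+ con 32 :* R) := con 32 :* (con 2 :+ (R :+ C))) refl R C) (sym M≡))))
    where open ℕSolver.+-*-Solver

  posY< : ∀ {b y} → b ≤ 2 * R → y ≤ 10 → suc (16 * b + y) ≤ M
  posY< {b} {y} b≤ y≤ = ℕ.≤-trans (s≤s (ℕ.+-mono-≤ (ℕ.*-monoʳ-≤ 16 b≤) y≤)) (ℕ.≤-trans (ℕ.m≤m+n _ (53 + 32 * C)) (ℕ.≤-reflexive (trans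
    (solve 2 (λ R C → con 1 :+ (con 16 :* (con 2 :* R) :+ con 10) :+ (con 53 :+ con 32 :* C) := con 32 :* (con 2 :+ (R :+ C))) refl R C) (sym M≡))))
    where open ℕSolver.+-*-Solver

  good-ℕ : ∀ a {x} → 6 ≤ x → suc (16 * a + x) ≤ M → Good (ι (ℤ.+ (16 * a + x)))
  good-ℕ a {x} 6≤ < = good (ι-≤ (ℤ.+≤+ (ℕ.≤-trans 6≤ (ℕ.m≤n+m x (16 * a)))))
    (ℚ.≤-trans (ℚ.≤-reflexive (trans (sym (ι-+ (ℤ.+ (16 * a + x)) (ℤ.+ 1))) (cong (ι ∘ ℤ.+_) (ℕ.+-comm (16 * a + x) 1)))) (ι-≤ (ℤ.+≤+ <)))

  bounded-point : ∀ p → InRange p → Bounded (posX p) (posY p) (shapeOf p)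
  bounded-point p r = posX< (col≤ p r) (ShapeBounds.dx≤10 (shapeBounds p)) , posY< (row≤ p r) (ShapeBounds.dy≤10 (shapeBounds p)) , ShapeBounds.hn≤64 (shapeBounds p)

  goodX : ∀ p → InRange p → Good (ι (ℤ.+ posX p))
  goodX p r = good-ℕ (col p) (ShapeBounds.6≤dx (shapeBounds p)) (proj₁ (bounded-point p r))

  goodY : ∀ p → InRange p → Good (ι (ℤ.+ posY p))
  goodY p r = good-ℕ (row p) (ShapeBounds.6≤dy (shapeBounds p)) (proj₁ (proj₂ (bounded-point p r)))

  center : ℕ → ℚ
  center a = ι (ℤ.+ (16 * a + 8))

  center-displacement : ∀ a₀ a x → ι (ℤ.+ (16 * a + x)) ≡ center a₀ ℚ.+ ι (displacement a a₀ x)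
  center-displacement a₀ a x = trans (cong ι (trans (cong (ℤ._+ ℤ.+ x) (ℤ.pos-* 16 a))
      (trans (solve 3 (λ a b x → con (ℤ.+ 16) :* a :+ x := (con (ℤ.+ 16) :* b :+ con (ℤ.+ 8)) :+ (con (ℤ.+ 16) :* (a :- b) :+ (x :- con (ℤ.+ 8)))) refl (ℤ.+ a) (ℤ.+ a₀) (ℤ.+ x))
        (cong (λ z → (z ℤ.+ ℤ.+ 8) ℤ.+ displacement a a₀ x) (sym (ℤ.pos-* 16 a₀))))))
    (ι-+ (ℤ.+ (16 * a₀ + 8)) (displacement a a₀ x))
    where open ℤSolver.+-*-Solver

  vec-point : ∀ p → InRange p → vec p ≡ point (ι (ℤ.+ posX p)) (ι (ℤ.+ posY p)) (ι (shapeHeight (shapeOf p)))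
  vec-point p r = trans (vec-def p) (explicit-point p r)
    where
    explicit-point : ∀ p → InRange p → explicitVec p ≡ point (ι (ℤ.+ posX p)) (ι (ℤ.+ posY p)) (ι (shapeHeight (shapeOf p)))
    explicit-point p r = cong₂ _∷_ (coordinate≡ (posX p)) (cong₂ _∷_ (coordinate≡ (posY p))
      (cong (_∷ Vec.replicate k 0ℚ) (height≡ (posX p) (posY p) (shapeOf p) (bounded-point p r))))

  vec-at : ∀ a₀ b₀ p → InRange p → vec p ≡ Around.at (center a₀) (center b₀) (rel a₀ b₀ p)
  vec-at a₀ b₀ p r = trans (vec-point p r) (cong₂ (λ X Y → point X Y (ι (shapeHeight (shapeOf p))))
    (center-displacement a₀ (col p) (dx (shapeOf p))) (center-displacement b₀ (row p) (dy (shapeOf p))))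

  -- A left inverse: the parities of column and row separate corners and the two kinds of gaps, and
  -- the displacement inside a grid step tells ends and choices apart.
  positions-injective : ∀ p q → posX p ≡ posX q → posY p ≡ posY q → p ≡ q
  positions-injective p q x≡ y≡ = trans (sym (decoded p)) (trans (same (proj₁ xs) (proj₂ xs) (proj₁ ys) (proj₂ ys)) (decoded q))
    where
    xs = sixteens {col p} {dx (shapeOf p)} {col q} (ShapeBounds.dx≤10 (shapeBounds p)) (ShapeBounds.dx≤10 (shapeBounds q)) x≡
    ys = sixteens {row p} {dy (shapeOf p)} {row q} (ShapeBounds.dy≤10 (shapeBounds p)) (ShapeBounds.dy≤10 (shapeBounds q)) y≡
    inCell : ℕ → ℕ → ℕ → ℕ → Pt
    inCell 7 8  a b = leftEnd (half b)
    inCell 9 8  a b = rightEnd (half b)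
    inCell 7 7  a b = cell (half b) (pred (half a)) lp
    inCell 7 9  a b = cell (half b) (pred (half a)) ln
    inCell 9 7  a b = cell (half b) (pred (half a)) rp
    inCell 9 9  a b = cell (half b) (pred (half a)) rn
    inCell 8 6  a b = cell (half b) (pred (half a)) bp
    inCell _ _  a b = cell (half b) (pred (half a)) bn
    parities : ℕ → ℕ → ℕ → ℕ → ℕ → ℕ → Pt
    parities 1 0 a b x y = corner (half b) (half a)
    parities 1 _ a b x y = hgap (half b) (half a)
    parities _ 0 a b x y = vgap (pred (half b)) (pred (half a))
    parities _ _ a b x y = inCell x y a b
    decoder : ℕ → ℕ → ℕ → ℕ → Pt
    decoder a x b y = parities (parity a) (parity b) a b x y
    same : ∀ {a a′ x x′ b b′ y y′} → a ≡ a′ → x ≡ x′ → b ≡ b′ → y ≡ y′ → decoder a x b y ≡ decoder a′ x′ b′ y′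
    same refl refl refl refl = refl
    decoded : ∀ p → decoder (col p) (dx (shapeOf p)) (row p) (dy (shapeOf p)) ≡ p
    decoded (corner i j) rewrite parity-odd j | parity-double i | half-odd j | half-double i = refl
    decoded (leftEnd i)  rewrite parity-odd i | half-odd i = refl
    decoded (rightEnd i) rewrite parity-double C | parity-odd i | half-odd i = refl
    decoded (hgap i j)   rewrite parity-odd j | parity-odd i | half-odd j | half-odd i = refl
    decoded (vgap i j)   rewrite parity-double j | parity-double i | half-double j | half-double i = refl
    decoded (cell i j c) rewrite parity-double j | parity-odd i = choice c
      where
      choice : ∀ c → inCell (dx (choiceShape c)) (dy (choiceShape c)) (2 + 2 * j) (1 + 2 * i) ≡ cell i j c
      choice lp rewrite half-odd i | half-double j = refl
      choice ln rewrite half-odd i | half-double j = refl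
      choice rp rewrite half-odd i | half-double j = refl
      choice rn rewrite half-odd i | half-double j = refl
      choice bp rewrite half-odd i | half-double j = refl
      choice bn rewrite half-odd i | half-double j = refl

  vec-injective : ∀ {p q} → vec p ≡ vec q → p ≡ q
  vec-injective {p} {q} eq = positions-injective p q (same (Vec.∷-injectiveˡ eq′)) (same (Vec.∷-injectiveˡ (Vec.∷-injectiveʳ eq′)))
    where
    eq′ : explicitVec p ≡ explicitVec q
    eq′ = trans (sym (vec-def p)) (trans eq (vec-def q))
    same : ∀ {X Y} → mkℚ (ℤ.+ numerator X) T₁ (coprime₁ X) ≡ mkℚ (ℤ.+ numerator Y) T₁ (coprime₁ Y) → X ≡ Y
    same {X} {Y} eq = ℕ.*-cancelˡ-≡ X Y S (ℕ.suc-injective (ℤ.+-injective (proj₁ (ℚ.mkℚ-injective eq))))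

  vec≢axis : ∀ p ib → vec p ≢ axisVec ib
  vec≢axis p (zero , b)  eq = nonzero (posY p) (cong (λ v → Vec.lookup v (suc zero)) (trans (sym (vec-def p)) eq))
    where
    nonzero : ∀ X → mkℚ (ℤ.+ numerator X) T₁ (coprime₁ X) ≢ 0ℚ
    nonzero X ()
  vec≢axis p (suc i , b) eq = nonzero (posX p) (cong (λ v → Vec.lookup v zero) (trans (sym (vec-def p)) eq))
    where
    nonzero : ∀ X → mkℚ (ℤ.+ numerator X) T₁ (coprime₁ X) ≢ 0ℚ
    nonzero X ()

  -- The standing condition and the instance.

  allPoints : List Pt → List⁺ (Vec ℚ (3 + k))
  allPoints ps = axisVec (zero , true) ∷ (map axisVec axesTail ++ map vec ps)

  axis∈ : ∀ ps {ib} → ib ∈ axes → axisVec ib ∈ toList (allPoints ps)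
  axis∈ ps ib∈ = ∈.∈-++⁺ˡ {xs = map axisVec axes} (∈.∈-map⁺ axisVec ib∈)

  vec∈ : ∀ {ps p} → p ∈ ps → vec p ∈ toList (allPoints ps)
  vec∈ {ps} {p} p∈ = there (∈.∈-++⁺ʳ (map axisVec axesTail) (∈.∈-map⁺ vec p∈))

  ∈-allPoints : ∀ ps {q} → q ∈ toList (allPoints ps) → (∃[ ib ] ib ∈ axes × q ≡ axisVec ib) ⊎ (∃[ p ] p ∈ ps × q ≡ vec p)
  ∈-allPoints ps {q} q∈ = Sum.map (∈.∈-map⁻ axisVec {xs = axes}) (∈.∈-map⁻ vec {xs = ps}) (∈-∷-++⁻ (map axisVec axesTail) q∈)

  allPoints-unique : ∀ {ps} → Unique ps → Unique (toList (allPoints ps))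
  allPoints-unique {ps} u = unique-∷-++ (Unique.map⁺ (λ {p} {q} → axisVec-injective {p = p} {q}) axes-unique) (Unique.map⁺ (λ {p} {q} → vec-injective {p} {q}) u) λ (q∈ , q∈′) →
    let (ib , _ , eq) = ∈.∈-map⁻ axisVec {xs = axes} q∈
        (p , _ , eq′) = ∈.∈-map⁻ vec q∈′
    in vec≢axis p ib (trans (sym eq′) eq)

  length-allPoints : ∀ ps → List⁺.length (allPoints ps) ≡ length axes + length ps
  length-allPoints ps = cong suc (trans (List.length-++ (map axisVec axesTail)) (cong₂ _+_ (List.length-map axisVec axesTail) (List.length-map vec ps)))

  apexPoint : Pt
  apexPoint = corner 0 0

  apex∈ : apexPoint ∈ pts
  apex∈ = corner∈ z≤n z≤n

  -- Only the axes and one corner are assumed to be in Q, so the same estimates serve for the full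
  -- point set and for every selection.
  module Bounds (Q : List⁺ (Vec ℚ (3 + k))) (axes⊆ : ∀ {ib} → ib ∈ axes → axisVec ib ∈ toList Q)
    (apex⊆ : vec apexPoint ∈ toList Q) (x : Vec ℚ (3 + k)) where

    Ω : ℚ
    Ω = maxDot Q x

    below : ∀ i → ℚ.- Vec.lookup x i ℚ.≤ Ω
    below i = subst (ℚ._≤ Ω) (trans (dot-axis i (sign false) x) (solve 1 (λ a → :- con 1ℚ :* a := :- a) refl (Vec.lookup x i)))
      (dot≤maxDot Q x (axes⊆ (negative-axis i)))
      where open ℚSolver.+-*-Solver

    above : ∀ i → i ≢ third → Vec.lookup x i ℚ.≤ Ω
    above i i≢ = subst (ℚ._≤ Ω) (trans (dot-axis i (sign true) x) (ℚ.*-identityˡ _)) (dot≤maxDot Q x (axes⊆ (positive-axis i i≢)))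

    0≤Ω : 0ℚ ℚ.≤ Ω
    0≤Ω = by-difference (solve 2 (λ Ω a → Ω :- con 0ℚ := con ℚ.½ :* ((Ω :- a) :+ (Ω :- :- a))) refl Ω (Vec.lookup x zero))
      (0≤* {ℚ.½} (ℚ.nonNegative⁻¹ ℚ.½) (0≤+ (0≤- (above zero (λ ()))) (0≤- (below zero))))
      where open ℚSolver.+-*-Solver

    -- The apex is nearly (0, 0, 1).
    vertical : ι (ℤ.+ 15) ℚ.* Vec.lookup x third ℚ.≤ ι (ℤ.+ 16) ℚ.* Ω
    vertical = go x refl (ℚ.≤-total 0ℚ (Vec.lookup x third))
      where
      open ℚSolver.+-*-Solver
      X = ι (ℤ.+ posX apexPoint)
      Y = ι (ℤ.+ posY apexPoint)
      h = ι (shapeHeight (shapeOf apexPoint))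
      gX : Good X
      gX = goodX apexPoint (z≤n , z≤n)
      gY : Good Y
      gY = goodY apexPoint (z≤n , z≤n)
      small : ∀ {X} → Good X → 0ℚ ℚ.≤ n/ 1 127 ℚ.- coordinate X
      small {X} g = 0≤- (ℚ.≤-trans (coordinate≤η g) (ℚ.*-cancelˡ-≤-pos (ι (ℤ.+ 128)) η≤))
      go : ∀ y → x ≡ y → (0ℚ ℚ.≤ Vec.lookup x third) ⊎ (Vec.lookup x third ℚ.≤ 0ℚ) → ι (ℤ.+ 15) ℚ.* Vec.lookup x third ℚ.≤ ι (ℤ.+ 16) ℚ.* Ω
      go _ _ (inj₂ ≤0) = ℚ.≤-trans (by-difference (solve 1 (λ a → con 0ℚ :- con (ι (ℤ.+ 15)) :* a := con (ι (ℤ.+ 15)) :* (con 0ℚ :- a)) refl (Vec.lookup x third)) (0≤* (0≤ι 15) (0≤- ≤0))) (0≤* (0≤ι 16) 0≤Ω)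
      go (x₁ ∷ x₂ ∷ x₃ ∷ v) x≡ (inj₁ 0≤′) = subst (λ z → ι (ℤ.+ 15) ℚ.* z ℚ.≤ ι (ℤ.+ 16) ℚ.* Ω) (sym (at third)) (by-difference
        -- Since a and b are at most 1/128 and H is at least 31/32, the product with this corner is
        -- at least 31/32 x₃ - Ω/64. Multiplying by 31/2 yields the claim with some room.
        (solve 7 (λ a b H Ω x₁ x₂ x₃ → con (ι (ℤ.+ 16)) :* Ω :- con (ι (ℤ.+ 15)) :* x₃
          := con (n/ 31 1) :* ((Ω :- (a :* x₁ :+ b :* x₂ :+ H :* x₃)) :+ a :* (x₁ :- :- Ω) :+ b :* (x₂ :- :- Ω)
                :+ (con (n/ 1 127) :- a) :* Ω :+ (con (n/ 1 127) :- b) :* Ω :+ con (n/ 1 31) :* ((con (ι (ℤ.+ 32)) :* H :- con (ι (ℤ.+ 31))) :* x₃))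
             :+ con (n/ 33 127) :* Ω :+ con (n/ 1 63) :* x₃)
          refl (coordinate X) (coordinate Y) (height X Y h) Ω x₁ x₂ x₃)
        (0≤+ (0≤+ (0≤* {n/ 31 1} (ℚ.nonNegative⁻¹ (n/ 31 1)) (0≤+ (0≤+ (0≤+ (0≤+ (0≤+
            (0≤- selected)
            (0≤* (0≤coordinate gX) (0≤- (neg zero))))
            (0≤* (0≤coordinate gY) (0≤- (neg (suc zero)))))
            (0≤* (small gX) 0≤Ω))
            (0≤* (small gY) 0≤Ω))
            (0≤* {n/ 1 31} (ℚ.nonNegative⁻¹ (n/ 1 31)) (0≤* (0≤- (31≤height gX gY (ι-≤ (≤-shapeHeight (shapeBounds apexPoint))))) 0≤x₃))))
          (0≤* {n/ 33 127} (ℚ.nonNegative⁻¹ (n/ 33 127)) 0≤Ω)) (0≤* {n/ 1 63} (ℚ.nonNegative⁻¹ (n/ 1 63)) 0≤x₃)))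
        where
        at : ∀ i → Vec.lookup x i ≡ Vec.lookup (x₁ ∷ x₂ ∷ x₃ ∷ v) i
        at i = cong (λ y → Vec.lookup y i) x≡
        0≤x₃ : 0ℚ ℚ.≤ x₃
        0≤x₃ = subst (0ℚ ℚ.≤_) (at third) 0≤′
        neg : ∀ i → ℚ.- Ω ℚ.≤ Vec.lookup (x₁ ∷ x₂ ∷ x₃ ∷ v) i
        neg i = subst₂ ℚ._≤_ refl (trans (solve 1 (λ a → :- :- a := a) refl _) (at i)) (ℚ.neg-antimono-≤ (below i))
        selected : coordinate X ℚ.* x₁ ℚ.+ coordinate Y ℚ.* x₂ ℚ.+ height X Y h ℚ.* x₃ ℚ.≤ Ω
        selected = subst (ℚ._≤ Ω) (trans (cong₂ dot (vec-point apexPoint (z≤n , z≤n)) x≡) (dot-point X Y h x₁ x₂ x₃ v)) (dot≤maxDot Q x apex⊆)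

    tilt : ℚ
    tilt = ℚ.∣ Vec.lookup x third ∣

    15tilt≤ : ι (ℤ.+ 15) ℚ.* tilt ℚ.≤ ι (ℤ.+ 16) ℚ.* Ω
    15tilt≤ with ℚ.∣p∣≡p∨∣p∣≡-p (Vec.lookup x third)
    ... | inj₁ eq = subst (λ z → ι (ℤ.+ 15) ℚ.* z ℚ.≤ ι (ℤ.+ 16) ℚ.* Ω) (sym eq) vertical
    ... | inj₂ eq = subst (λ z → ι (ℤ.+ 15) ℚ.* z ℚ.≤ ι (ℤ.+ 16) ℚ.* Ω) (sym eq)
      (ℚ.≤-trans (ℚ.*-monoˡ-≤-nonNeg (ι (ℤ.+ 15)) (below third)) (ℚ.*-monoʳ-≤-nonNeg Ω {{ℚ.nonNegative 0≤Ω}} (ι-≤ {ℤ.+ 15} {ℤ.+ 16} (ℤ.+≤+ (ℕ.n≤1+n 15)))))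

    -- The axes bound every coordinate by Ω in absolute value, except the third one from above,
    -- where `vertical` gives 16/15 Ω.
    square≤4Ω² : ∀ i → Vec.lookup x i ℚ.* Vec.lookup x i ℚ.≤ (Ω ℚ.+ Ω) ℚ.* (Ω ℚ.+ Ω)
    square≤4Ω² i = square-bound (upper (i Fin.≟ third)) (ℚ.≤-trans (below i) Ω≤)
      where
      open ℚSolver.+-*-Solver
      Ω≤ : Ω ℚ.≤ Ω ℚ.+ Ω
      Ω≤ = by-difference (solve 1 (λ a → a :+ a :- a := a) refl Ω) 0≤Ω
      upper : Dec (i ≡ third) → Vec.lookup x i ℚ.≤ Ω ℚ.+ Ω
      upper (no i≢)    = ℚ.≤-trans (above i i≢) Ω≤
      upper (yes refl) = ℚ.*-cancelˡ-≤-pos (ι (ℤ.+ 15)) (ℚ.≤-trans vertical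
        (by-difference (solve 1 (λ a → con (ι (ℤ.+ 15)) :* (a :+ a) :- con (ι (ℤ.+ 16)) :* a := con (ι (ℤ.+ 14)) :* a) refl Ω) (0≤* (0≤ι 14) 0≤Ω)))

  standingPoints : Standing (embed (allPoints pts))
  standingPoints = standing-intro (allPoints pts) c (ℚ.positive⁻¹ c) λ x ½≤ → ℚ.≮⇒≥ λ Ω<c → ℚ.<-irrefl refl (ℚ.<-≤-trans
      (ℚ.≤-<-trans (dot-bound x _ (Bounds.square≤4Ω² (allPoints pts) (axis∈ pts) (vec∈ apex∈) x))
        (ℚ.≤-<-trans (bound x Ω<c) (ℚ.*<* (ℤ.+<+ (s≤s (s≤s (s≤s z≤n))))))) ½≤)
    where
    open ℚSolver.+-*-Solver
    D : ℚ
    D = ι (ℤ.+ (3 + k))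
    -- c is 1/(4D) for the dimension D. If Ω were below c, the squared norm would be at most 4DΩ²,
    -- hence at most 4Dc² = c, which is at most 1/4 and less than ½.
    c : ℚ
    c = mkℚ (ℤ.+ 1) (3 * suc (2 + k) + (2 + k)) λ { (d∣1 , _) → ℕ.∣1⇒≡1 d∣1 }
    4Dc : ι (ℤ.+ 4) ℚ.* D ℚ.* c ≡ 1ℚ
    4Dc = trans (ℚ.*-comm (ι (ℤ.+ 4) ℚ.* D) c) (trans (cong (c ℚ.*_) (trans (sym (ι-* (ℤ.+ 4) (ℤ.+ (3 + k))))
      (cong ι (trans (sym (ℤ.pos-* 4 (3 + k))) (cong ℤ.+_ (fourfold k)))))) (mkℚ-scaled (ℤ.+ 1) (3 * suc (2 + k) + (2 + k)) (λ { (d∣1 , _) → ℕ.∣1⇒≡1 d∣1 })))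
      where
      fourfold : ∀ k → 4 * (3 + k) ≡ suc (3 * suc (2 + k) + (2 + k))
      fourfold = solve′ 1 (λ k → con′ 4 :*′ (con′ 3 :+′ k) :=′ con′ 1 :+′ (con′ 3 :*′ (con′ 1 :+′ (con′ 2 :+′ k)) :+′ (con′ 2 :+′ k))) refl
        where open ℕSolver.+-*-Solver renaming (solve to solve′; con to con′; _:+_ to _:+′_; _:*_ to _:*′_; _:=_ to _:=′_)
    bound : ∀ x → maxDot (allPoints pts) x ℚ.< c →
      D ℚ.* ((maxDot (allPoints pts) x ℚ.+ maxDot (allPoints pts) x) ℚ.* (maxDot (allPoints pts) x ℚ.+ maxDot (allPoints pts) x)) ℚ.≤ n/ 1 3
    bound x Ω<c = ℚ.≤-trans (ℚ.*-monoˡ-≤-nonNeg D {{ℚ.nonNegative (0≤ι (3 + k))}} (*-mono-≤ 0≤2Ω 2Ω≤ 0≤2Ω 2Ω≤)) (ℚ.≤-trans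
        (ℚ.≤-reflexive (trans (solve 2 (λ D c → D :* ((c :+ c) :* (c :+ c)) := (con (ι (ℤ.+ 4)) :* D :* c) :* c) refl D c) (trans (cong (ℚ._* c) 4Dc) (ℚ.*-identityˡ c)))) c≤)
      where
      0≤Ω = Bounds.0≤Ω (allPoints pts) (axis∈ pts) (vec∈ apex∈) x
      0≤2Ω = 0≤+ 0≤Ω 0≤Ω
      2Ω≤ = ℚ.+-mono-≤ (ℚ.<⇒≤ Ω<c) (ℚ.<⇒≤ Ω<c)
      c≤ : c ℚ.≤ n/ 1 3
      c≤ = ℚ.*≤* (ℤ.+≤+ (s≤s (ℕ.≤-trans (ℕ.m≤m+n 3 _) (ℕ.≤-reflexive (sym (ℕ.+-identityʳ _))))))

  Normalized : Vec ℚ (3 + k) → Set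
  Normalized = VecAll.All (λ c → ℚ.- 1ℚ ℚ.≤ c × c ℚ.≤ 1ℚ)

  0≤height : ∀ p → InRange p → 0ℚ ℚ.≤ height (ι (ℤ.+ posX p)) (ι (ℤ.+ posY p)) (ι (shapeHeight (shapeOf p)))
  0≤height p r = ℚ.*-cancelˡ-≤-pos (ι (ℤ.+ 32)) (ℚ.≤-trans (ι-≤ {ℤ.+ 0} {ℤ.+ 31} (ℤ.+≤+ z≤n)) (31≤height (goodX p r) (goodY p r) (ι-≤ (≤-shapeHeight (shapeBounds p)))))

  normalizedVec : ∀ p → InRange p → Normalized (point (ι (ℤ.+ posX p)) (ι (ℤ.+ posY p)) (ι (shapeHeight (shapeOf p))))
  normalizedVec p r = coordinate-ok (goodX p r) VecAll.∷ (coordinate-ok (goodY p r) VecAll.∷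
      ((-1≤ (0≤height p r) , height≤1 (goodX p r) (goodY p r) (ι-≤ (shapeHeight≤ (shapeBounds p)))) VecAll.∷ zeros k))
    where
    -1≤ : ∀ {z} → 0ℚ ℚ.≤ z → ℚ.- 1ℚ ℚ.≤ z
    -1≤ = ℚ.≤-trans (ι-≤ { -[1+ 0 ]} {ℤ.+ 0} ℤ.-≤+)
    η≤1 : η ℚ.≤ 1ℚ
    η≤1 = subst (ℚ._≤ 1ℚ) (ℚ.*-identityˡ η) (shrink 128 1 η≤ 0≤η (s≤s z≤n))
    coordinate-ok : ∀ {X} → Good X → ℚ.- 1ℚ ℚ.≤ coordinate X × coordinate X ℚ.≤ 1ℚ
    coordinate-ok g = -1≤ (0≤coordinate g) , ℚ.≤-trans (coordinate≤η g) η≤1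
    zeros : ∀ n → VecAll.All (λ c → ℚ.- 1ℚ ℚ.≤ c × c ℚ.≤ 1ℚ) (Vec.replicate n 0ℚ)
    zeros zero    = VecAll.[]
    zeros (suc n) = (-1≤ ℚ.≤-refl , ι-≤ {ℤ.+ 0} {ℤ.+ 1} (ℤ.+≤+ z≤n)) VecAll.∷ zeros n

  normalizedPoint : ∀ {q} → q ∈ toList (allPoints pts) → Normalized q
  normalizedPoint {q} q∈ = [ (λ (ib , _ , eq) → subst Normalized (sym eq) (axes≤1 ib))
    , (λ (p , p∈ , eq) → subst Normalized
        (sym (trans eq (vec-point p (inRange p∈)))) (normalizedVec p (inRange p∈))) ]′ (∈-allPoints pts q∈)

  ε<1 : ε ℚ.< 1ℚ
  ε<1 = ℚ.≤-<-trans (ℚ.*-cancelˡ-≤-pos (ι (ℤ.+ 4)) (ℚ.≤-trans ε≤ (ℚ.≤-reflexive refl))) (ℚ.*<* {n/ 1 3} {1ℚ} (ℤ.+<+ (s≤s (s≤s z≤n))))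

  instanceOf : GRMRInstance (3 + k)
  instanceOf = record
    { P          = allPoints pts
    ; distinct   = allPoints-unique pts-unique
    ; normalized = normalizedPoint
    ; standing   = standingPoints
    ; ε          = εℚ
    ; 0<ε        = ℚ.positive⁻¹ εℚ
    ; ε<1        = subst (ℚ._< 1ℚ) (sym εℚ≡) ε<1
    }

  module _ (X₀ Y₀ : ℚ) (gX₀ : Good X₀) (gY₀ : Good Y₀) where
    open Around X₀ Y₀
    open Toward X₀ Y₀ gX₀ gY₀

    -- Coarse bounds do: an axis vector reaches at most r/2, while 1 - ε and the level of a cap
    -- point are both at least 3/4, and 9/16 exceeds ½.
    axis-outranked : ∀ p → GoodAt p → ι (ℤ.- ℤ.+ 64) ℚ.≤ ι (Offset.power p) → ∀ ib → ib ∈ axes →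
      dot (axisVec ib) normal ℚ.< (1ℚ ℚ.- ε) ℚ.* dot (at p) normal
    axis-outranked p (pX , pY , _ , ph) p≥ (i , b) ib∈ = ℚ.≤-<-trans (ℚ.≤-trans (ℚ.≤-reflexive (dot-axis i (sign b) normal)) (small i b ib∈))
      (subst₂ ℚ._<_ refl (trans (ℚ.*-assoc (1ℚ ℚ.- ε) (level p) r) (cong ((1ℚ ℚ.- ε) ℚ.*_) (sym (dot-normal p))))
        (ℚ.*-monoˡ-<-pos r {{ℚ.positive 0<r}} {x = ℚ.½} {y = (1ℚ ℚ.- ε) ℚ.* level p} (ℚ.<-≤-trans (ℚ.*<* {ℚ.½} {n/ 9 15} (ℤ.+<+ (ℕ.m≤m+n 17 1))) (*-mono-≤ {n/ 3 3} {1ℚ ℚ.- ε} {n/ 3 3} {level p} (ℚ.nonNegative⁻¹ (n/ 3 3)) 3/4≤1-ε (ℚ.nonNegative⁻¹ (n/ 3 3)) 3/4≤level))))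
      where
      open ℚSolver.+-*-Solver
      0≤½r : 0ℚ ℚ.≤ ℚ.½ ℚ.* r
      0≤½r = 0≤* {ℚ.½} (ℚ.nonNegative⁻¹ ℚ.½) (ℚ.<⇒≤ 0<r)
      3/4≤1-ε : n/ 3 3 ℚ.≤ 1ℚ ℚ.- ε
      3/4≤1-ε = by-difference (solve 1 (λ e → (con 1ℚ :- e) :- con (n/ 3 3) := con (n/ 1 3) :* (con 1ℚ :- con (ι (ℤ.+ 4)) :* e)) refl ε) (0≤* {n/ 1 3} (ℚ.nonNegative⁻¹ (n/ 1 3)) (0≤- ε≤))
      3/4≤level : n/ 3 3 ℚ.≤ level p
      3/4≤level = by-difference (solve 4 (λ s q m e → (con 1ℚ :+ con (ι (ℤ.+ 3)) :* q :+ s :* m :+ e) :- con (n/ 3 3)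
          := con (n/ 1 3) :* (con 1ℚ :- con (ι (ℤ.+ 256)) :* s) :+ con (ι (ℤ.+ 3)) :* q :+ s :* (m :- con (ι (ℤ.- ℤ.+ 64))) :+ e) refl s (s ℚ.* s) (ι (Offset.power p)) (ρ ℚ.* (1ℚ ℚ.- heightAt p)))
        (0≤+ (0≤+ (0≤+ (0≤* {n/ 1 3} (ℚ.nonNegative⁻¹ (n/ 1 3)) (0≤- (shrink 262144 256 s≤ 0≤s (ℕ.m≤m+n 256 261888)))) (0≤* (0≤ι 3) 0≤s²)) (0≤* 0≤s (0≤- p≥)))
          (0≤* 0≤ρ (0≤- (height≤1 pX pY (ι-≤ ph)))))
      quarter : ∀ {X} → Good X → n/ 1 3 ℚ.- coordinate X ≡ (n/ 1 127 ℚ.- coordinate X) ℚ.+ n/ 31 127 × 0ℚ ℚ.≤ n/ 1 3 ℚ.- coordinate X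
      quarter {X} g = eq , subst (0ℚ ℚ.≤_) (sym eq) (0≤+ (0≤- (ℚ.≤-trans (coordinate≤η g) (ℚ.*-cancelˡ-≤-pos (ι (ℤ.+ 128)) η≤))) (ℚ.nonNegative⁻¹ (n/ 31 127)))
        where
        eq = solve 1 (λ a → con (n/ 1 3) :- a := (con (n/ 1 127) :- a) :+ con (n/ 31 127)) refl (coordinate X)
      positive-small : ∀ {X} → Good X → sign true ℚ.* ((coordinate X ℚ.+ coordinate X) ℚ.* r) ℚ.≤ ℚ.½ ℚ.* r
      positive-small {X} g = by-difference (solve 2 (λ a r → con ℚ.½ :* r :- con 1ℚ :* ((a :+ a) :* r) := con (ι (ℤ.+ 2)) :* (con (n/ 1 3) :- a) :* r) refl (coordinate X) r)
        (0≤* (0≤* (0≤ι 2) (proj₂ (quarter g))) (ℚ.<⇒≤ 0<r))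
      negative-small : ∀ {z} → 0ℚ ℚ.≤ z → sign false ℚ.* (z ℚ.* r) ℚ.≤ ℚ.½ ℚ.* r
      negative-small {z} 0≤z = by-difference (solve 2 (λ z r → con ℚ.½ :* r :- (:- con 1ℚ) :* (z :* r) := con ℚ.½ :* r :+ z :* r) refl z r) (0≤+ 0≤½r (0≤* 0≤z (ℚ.<⇒≤ 0<r)))
      ρ≤1 : 0ℚ ℚ.≤ 1ℚ ℚ.- ρ
      ρ≤1 = subst (0ℚ ℚ.≤_) (sym (solve 3 (λ A B E → con 1ℚ :- (A :+ B) := (E :- A) :+ (E :- B) :+ (con 1ℚ :- con (ι (ℤ.+ 2)) :* E)) refl (a ℚ.* a) (b₀ ℚ.* b₀) (η ℚ.* η)))
        (0≤+ (0≤+ (0≤- (square≤ gX₀)) (0≤- (square≤ gY₀))) (0≤- (shrink 16384 2 η²≤ (0≤* 0≤η 0≤η) (ℕ.m≤m+n 2 16382))))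
        where
        b₀ = Around.b X₀ Y₀
      small : ∀ i b → (i , b) ∈ axes → sign b ℚ.* Vec.lookup normal i ℚ.≤ ℚ.½ ℚ.* r
      small zero             true  _  = positive-small gX₀
      small zero             false _  = negative-small (0≤+ (0≤coordinate gX₀) (0≤coordinate gX₀))
      small (suc zero)       true  _  = positive-small gY₀
      small (suc zero)       false _  = negative-small (0≤+ (0≤coordinate gY₀) (0≤coordinate gY₀))
      small (suc (suc zero)) true  ∈3 = contradiction ∈3 no-third-axis
      small (suc (suc zero)) false _  = negative-small ρ≤1
      small (suc (suc (suc i))) b  _  = subst (ℚ._≤ ℚ.½ ℚ.* r) (sym (trans (cong (sign b ℚ.*_) (Vec.lookup-replicate i 0ℚ)) (ℚ.*-zeroʳ (sign b)))) 0≤½r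

  good-center-x : ∀ p → InRange p → Good (center (col p))
  good-center-x p r = good-ℕ (col p) (ℕ.m≤m+n 6 2) (posX< (col≤ p r) (ℕ.m≤m+n 8 2))

  good-center-y : ∀ p → InRange p → Good (center (row p))
  good-center-y p r = good-ℕ (row p) (ℕ.m≤m+n 6 2) (posY< (row≤ p r) (ℕ.m≤m+n 8 2))

  good-rel : ∀ a₀ b₀ p → InRange p → Good (center a₀ ℚ.+ ι (Offset.ex (rel a₀ b₀ p))) × Good (center b₀ ℚ.+ ι (Offset.ey (rel a₀ b₀ p)))
    × (ℤ.- ℤ.+ 64 ℤ.≤ Offset.eh (rel a₀ b₀ p)) × (Offset.eh (rel a₀ b₀ p) ℤ.≤ ℤ.+ 34)
  good-rel a₀ b₀ p r = subst Good (center-displacement a₀ (col p) (dx (shapeOf p))) (goodX p r) ,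
    subst Good (center-displacement b₀ (row p) (dy (shapeOf p))) (goodY p r) , ≤-shapeHeight (shapeBounds p) , shapeHeight≤ (shapeBounds p)

  0≤1-εℚ : 0ℚ ℚ.≤ 1ℚ ℚ.- εℚ
  0≤1-εℚ = subst (λ e → 0ℚ ℚ.≤ 1ℚ ℚ.- e) (sym εℚ≡) 0≤1-ε

  own-power : ∀ p → Offset.power (rel (col p) (row p) p) ≡ Offset.power (place 0ᶻ 0ᶻ (shapeOf p))
  own-power p = cong Offset.power (place≡ (shapeOf p) (step-none (col p)) (step-none (row p)))

  -- Points that every regret set contains.

  module Lower (Q : List⁺ (Vec ℚ (3 + k))) (regretSet : IsRegretSet instanceOf Q) where
    open IsRegretSet regretSet

    chosen : ∀ v → dot v v ≡ 1ℚ → ∀ {p} → p ∈ toList (allPoints pts) → ∃[ q ] q ∈ toList Q × (1ℚ ℚ.- ε) ℚ.* dot p v ℚ.≤ dot q v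
    chosen v unit {p} p∈ = map₂ (map₂ (subst (λ e → (1ℚ ℚ.- e) ℚ.* dot p v ℚ.≤ _) εℚ≡))
      (regret-elim (allPoints pts) standingPoints Q εℚ regret v unit p∈ 0≤1-εℚ)

    -- The test direction is the normal at the grid position of `p₀`. Some selected point comes
    -- within the tolerance of `p₀` there. It is no axis vector, and by `outranked` it is not
    -- beaten.
    undominated : ∀ p₀ → p₀ ∈ pts → ∀ t → t ℤ.≤ Offset.power (place 0ᶻ 0ᶻ (shapeOf p₀)) →
      ℤ.- ℤ.+ 64 ℤ.≤ Offset.power (place 0ᶻ 0ᶻ (shapeOf p₀)) → Offset.power (place 0ᶻ 0ᶻ (shapeOf p₀)) ℤ.≤ ℤ.+ 34 →
      ∃[ p ] p ∈ pts × vec p ∈ toList Q × ¬ Beaten (col p₀) (row p₀) t p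
    undominated p₀ p₀∈ t t≤ m≥ m≤ = [ axis-case , point-case ]′ (∈-allPoints pts (subset q∈))
      where
      r₀ : InRange p₀
      r₀ = inRange p₀∈
      a₀ = col p₀
      b₀ = row p₀
      o₀ : Offset
      o₀ = rel a₀ b₀ p₀
      open Around (center a₀) (center b₀) using (at)
      open Toward (center a₀) (center b₀) (good-center-x p₀ r₀) (good-center-y p₀ r₀) using (normal; normal-unit; outranked)
      found : ∃[ q ] q ∈ toList Q × (1ℚ ℚ.- ε) ℚ.* dot (vec p₀) normal ℚ.≤ dot q normal
      found = chosen normal normal-unit (vec∈ p₀∈)
      q = proj₁ found
      q∈ = proj₁ (proj₂ found)
      le : (1ℚ ℚ.- ε) ℚ.* dot (at o₀) normal ℚ.≤ dot q normal
      le = subst (λ v → (1ℚ ℚ.- ε) ℚ.* dot v normal ℚ.≤ dot q normal) (vec-at a₀ b₀ p₀ r₀) (proj₂ (proj₂ found))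
      beaten-absurd : ∀ {z} → q ≡ z → ¬ (dot z normal ℚ.< (1ℚ ℚ.- ε) ℚ.* dot (at o₀) normal)
      beaten-absurd eq lt = ℚ.<-irrefl refl (ℚ.<-≤-trans lt (ℚ.≤-trans le (ℚ.≤-reflexive (cong (λ v → dot v normal) eq))))
      axis-case : (∃[ ib ] ib ∈ axes × q ≡ axisVec ib) → ∃[ p ] p ∈ pts × vec p ∈ toList Q × ¬ Beaten a₀ b₀ t p
      axis-case (ib , ib∈ , eq) = contradiction (axis-outranked (center a₀) (center b₀) (good-center-x p₀ r₀) (good-center-y p₀ r₀) o₀ (good-rel a₀ b₀ p₀ r₀)
        (ι-≤ (ℤ.≤-trans m≥ (ℤ.≤-reflexive (sym (own-power p₀))))) ib ib∈) (beaten-absurd eq)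
      point-case : (∃[ p ] p ∈ pts × q ≡ vec p) → ∃[ p ] p ∈ pts × vec p ∈ toList Q × ¬ Beaten a₀ b₀ t p
      point-case (p , p∈ , eq) = p , p∈ , subst (_∈ toList Q) eq q∈ , λ b →
        beaten-absurd (trans eq (vec-at a₀ b₀ p (inRange p∈))) (outranked o₀ (rel a₀ b₀ p) (good-rel a₀ b₀ p₀ r₀) (good-rel a₀ b₀ p (inRange p∈))
          (ℤ.≤-trans (Beaten.margin b) (ℤ.≤-trans t≤ (ℤ.≤-reflexive (sym (own-power p₀))))) (ℤ.≤-trans (ℤ.≤-reflexive (own-power p₀)) m≤))

    resolve : ∀ {a₀ b₀ t} {A : Set} → (∃[ p ] p ∈ pts × vec p ∈ toList Q × ¬ Beaten a₀ b₀ t p) →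
      (∀ p → p ∈ pts → vec p ∈ toList Q → A ⊎ Beaten a₀ b₀ t p) → A
    resolve (p , p∈ , q∈ , ¬b) f = [ id , (λ b → contradiction b ¬b) ]′ (f p p∈ q∈)

    has-corner : ∀ {i j} → i ≤ R → j ≤ C → vec (corner i j) ∈ toList Q
    has-corner {i} {j} i≤ j≤ = resolve (undominated (corner i j) (corner∈ i≤ j≤) -34ᶻ closed closed closed)
      λ p p∈ q∈ → Sum.map₁ (λ eq → subst (λ p → vec p ∈ toList Q) eq q∈) (corner-unique i j p (inRange p∈))

    has-leftEnd : ∀ {i} → i < R → vec (leftEnd i) ∈ toList Q
    has-leftEnd {i} i< = resolve (undominated (leftEnd i) (leftEnd∈ i<) -34ᶻ closed closed closed)
      λ p p∈ q∈ → Sum.map₁ (λ eq → subst (λ p → vec p ∈ toList Q) eq q∈) (leftEnd-unique i p (inRange p∈))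

    has-rightEnd : ∀ {i} → i < R → vec (rightEnd i) ∈ toList Q
    has-rightEnd {i} i< = resolve (undominated (rightEnd i) (rightEnd∈ i<) -34ᶻ closed closed closed)
      λ p p∈ q∈ → Sum.map₁ (λ eq → subst (λ p → vec p ∈ toList Q) eq q∈) (rightEnd-unique i p (inRange p∈))

    has-cell : ∀ {i j} → i < R → j < C → ∃[ c ] Valid i j c × vec (cell i j c) ∈ toList Q
    has-cell {i} {j} i< j< = resolve (undominated (cell i j lp) (cell∈ i< j< valid-lp) -34ᶻ closed closed closed)
      λ p p∈ q∈ → Sum.map₁ (λ (c , eq) → c , proj₂ (proj₂ (subst Present eq (present p∈))) , subst (λ p → vec p ∈ toList Q) eq q∈) (cell-unique i j j< p (inRange p∈))

    -- In its own direction an axis vector has product 1. A substitute would need at least 1 - ε,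
    -- which is at least 3/4, but cap points reach at most 1/4 and the other axes at most 0.
    has-axis : ∀ {ib} → ib ∈ axes → axisVec ib ∈ toList Q
    has-axis {i , b} ib∈ = [ axis-case , (λ (p , p∈ , eq) → ⊥-elim (ℚ.<-irrefl refl (ℚ.<-≤-trans (ℚ.*<* {n/ 1 3} {n/ 3 3} (ℤ.+<+ (ℕ.m≤m+n 5 7))) (ℚ.≤-trans ge (ℚ.≤-trans (ℚ.≤-reflexive (cong (λ z → dot z v) eq)) (point-low p (inRange p∈))))))) ]′ (∈-allPoints pts (subset q∈))
      where
      open ℚSolver.+-*-Solver
      t = sign b
      v = axis i t
      square : ∀ b → sign b ℚ.* sign b ≡ 1ℚ
      square true  = refl
      square false = refl
      v-unit : dot v v ≡ 1ℚ
      v-unit = trans (dot-axis i t v) (trans (cong (t ℚ.*_) (lookup-axis-same i t)) (square b))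
      found = chosen v v-unit (axis∈ pts ib∈)
      q = proj₁ found
      q∈ = proj₁ (proj₂ found)
      ge : n/ 3 3 ℚ.≤ dot q v
      ge = ℚ.≤-trans (by-difference (solve 1 (λ e → (con 1ℚ :- e) :- con (n/ 3 3) := con (n/ 1 3) :* (con 1ℚ :- con (ι (ℤ.+ 4)) :* e)) refl ε) (0≤* {n/ 1 3} (ℚ.nonNegative⁻¹ (n/ 1 3)) (0≤- ε≤)))
        (ℚ.≤-trans (ℚ.≤-reflexive (trans (sym (ℚ.*-identityʳ (1ℚ ℚ.- ε))) (cong ((1ℚ ℚ.- ε) ℚ.*_) (sym v-unit)))) (proj₂ (proj₂ found)))
      0<3/4 : 0ℚ ℚ.< n/ 3 3
      0<3/4 = ℚ.positive⁻¹ (n/ 3 3)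
      same-sign : ∀ b c → n/ 3 3 ℚ.≤ sign c ℚ.* sign b → c ≡ b
      same-sign true  true  _ = refl
      same-sign false false _ = refl
      same-sign true  false le = ⊥-elim (ℚ.<-irrefl refl (ℚ.<-≤-trans (ℚ.<-≤-trans 0<3/4 le) (ι-≤ { -[1+ 0 ]} {ℤ.+ 0} ℤ.-≤+)))
      same-sign false true  le = ⊥-elim (ℚ.<-irrefl refl (ℚ.<-≤-trans (ℚ.<-≤-trans 0<3/4 le) (ι-≤ { -[1+ 0 ]} {ℤ.+ 0} ℤ.-≤+)))
      axis-case : (∃[ jc ] jc ∈ axes × q ≡ axisVec jc) → axisVec (i , b) ∈ toList Q
      axis-case ((j , c) , jc∈ , eq) = decide (j Fin.≟ i)
        where
        ge′ : n/ 3 3 ℚ.≤ sign c ℚ.* Vec.lookup v j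
        ge′ = ℚ.≤-trans ge (ℚ.≤-reflexive (trans (cong (λ z → dot z v) eq) (dot-axis j (sign c) v)))
        decide : Dec (j ≡ i) → axisVec (i , b) ∈ toList Q
        decide (yes refl) = subst (_∈ toList Q) (trans eq (cong (λ c → axis i (sign c)) (same-sign b c (subst (λ z → n/ 3 3 ℚ.≤ sign c ℚ.* z) (lookup-axis-same i t) ge′)))) q∈
        decide (no j≢i)   = contradiction (ℚ.<-≤-trans 0<3/4 (subst (n/ 3 3 ℚ.≤_) (trans (cong (sign c ℚ.*_) (lookup-axis-other i j t j≢i)) (ℚ.*-zeroʳ (sign c))) ge′)) (ℚ.<-irrefl refl)
      point-low : ∀ p → InRange p → dot (vec p) v ℚ.≤ n/ 1 3
      point-low p r = ℚ.≤-trans (ℚ.≤-reflexive (trans (dot-comm (vec p) v) (trans (dot-axis i t (vec p)) (cong (λ z → t ℚ.* Vec.lookup z i) (vec-point p r))))) (low i b ib∈)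
        where
        P = point (ι (ℤ.+ posX p)) (ι (ℤ.+ posY p)) (ι (shapeHeight (shapeOf p)))
        0≤quarter : 0ℚ ℚ.≤ n/ 1 3
        0≤quarter = ℚ.nonNegative⁻¹ (n/ 1 3)
        plus : ∀ {X} → Good X → sign true ℚ.* coordinate X ℚ.≤ n/ 1 3
        plus {X} g = ℚ.≤-trans (ℚ.≤-reflexive (ℚ.*-identityˡ (coordinate X))) (ℚ.≤-trans (ℚ.≤-trans (coordinate≤η g) (ℚ.*-cancelˡ-≤-pos (ι (ℤ.+ 128)) η≤)) (ℚ.*≤* {n/ 1 127} {n/ 1 3} (ℤ.+≤+ (ℕ.m≤m+n 4 124))))
        minus : ∀ {z} → 0ℚ ℚ.≤ z → sign false ℚ.* z ℚ.≤ n/ 1 3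
        minus {z} 0≤z = ℚ.≤-trans (by-difference (solve 1 (λ z → con 0ℚ :- (:- con 1ℚ) :* z := z) refl z) 0≤z) 0≤quarter
        low : ∀ i b → (i , b) ∈ axes → sign b ℚ.* Vec.lookup P i ℚ.≤ n/ 1 3
        low zero             true  _  = plus (goodX p r)
        low zero             false _  = minus (0≤coordinate (goodX p r))
        low (suc zero)       true  _  = plus (goodY p r)
        low (suc zero)       false _  = minus (0≤coordinate (goodY p r))
        low (suc (suc zero)) true  ∈3 = contradiction ∈3 no-third-axis
        low (suc (suc zero)) false _  = minus (0≤height p r)
        low (suc (suc (suc i))) b  _  = subst (ℚ._≤ n/ 1 3) (sym (trans (cong (sign b ℚ.*_) (Vec.lookup-replicate i 0ℚ)) (ℚ.*-zeroʳ (sign b)))) 0≤quarter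

  -- Selections with one choice per cell and their regret.

  selSection : (ℕ → ℕ → Choice) → ℕ → List Pt
  selSection c 0 = section 0
  selSection c 1 = section 1
  selSection c 2 = section 2
  selSection c 5 = loop R λ i → loop C λ j → cell i j (c i j) ∷ []
  selSection c _ = []

  sel : (ℕ → ℕ → Choice) → List Pt
  sel c = loop 7 (selSection c)

  Form : (ℕ → ℕ → Choice) → Pt → Set
  Form c (corner i j)  = i ≤ R × j ≤ C
  Form c (leftEnd i)   = i < R
  Form c (rightEnd i)  = i < R
  Form c (hgap i j)    = ⊥
  Form c (vgap i j)    = ⊥
  Form c (cell i j ch) = i < R × j < C × ch ≡ c i j

  class : Pt → ℕ
  class (corner _ _) = 0
  class (leftEnd _)  = 1
  class (rightEnd _) = 2
  class (hgap _ _)   = 3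
  class (vgap _ _)   = 4
  class (cell _ _ _) = 5

  selSection-form : ∀ c n {p} → p ∈ selSection c n → Form c p × class p ≡ n
  selSection-form c 0 p∈ with ∈-loop⁻ (suc R) {λ i → loop (suc C) λ j → corner i j ∷ []} p∈
  ... | i , i< , p∈′ with ∈-loop⁻ (suc C) {λ j → corner i j ∷ []} p∈′
  ... | j , j< , here refl = (ℕ.≤-pred i< , ℕ.≤-pred j<) , refl
  selSection-form c 1 p∈ with ∈-loop⁻ R p∈
  ... | i , i< , here refl = i< , refl
  selSection-form c 2 p∈ with ∈-loop⁻ R p∈
  ... | i , i< , here refl = i< , refl
  selSection-form c 5 p∈ with ∈-loop⁻ R p∈
  ... | i , i< , p∈′ with ∈-loop⁻ C p∈′
  ... | j , j< , here refl = (i< , j< , refl) , refl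

  sel-form : ∀ c {p} → p ∈ sel c → Form c p
  sel-form c p∈ = (λ (n , _ , p∈′) → proj₁ (selSection-form c n p∈′)) (∈-loop⁻ 7 {selSection c} p∈)

  sel-unique : ∀ c → Unique (sel c)
  sel-unique c = unique-loop 7 (selSection c) class (λ n _ → u n) (λ n p∈ → proj₂ (selSection-form c n p∈))
    where
    u : ∀ n → Unique (selSection c n)
    u 0 = section-unique 0
    u 1 = section-unique 1
    u 2 = section-unique 2
    u 3 = []
    u 4 = []
    u 5 = by-line R (λ i → inner {C} λ { j (here refl) → refl }) λ i → by-column C (λ { j (here refl) → refl }) λ j → single _
    u (suc (suc (suc (suc (suc (suc _)))))) = []

  corner∈sel : ∀ c {i j} → i ≤ R → j ≤ C → corner i j ∈ sel c
  corner∈sel c {i} {j} i≤ j≤ = ∈-loop⁺ {n = 7} {selSection c} 0 (s≤s z≤n)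
    (∈-loop⁺ {n = suc R} {λ i → loop (suc C) λ j → corner i j ∷ []} i (s≤s i≤) (∈-loop⁺ {n = suc C} {λ j → corner i j ∷ []} j (s≤s j≤) (here refl)))

  leftEnd∈sel : ∀ c {i} → i < R → leftEnd i ∈ sel c
  leftEnd∈sel c {i} i< = ∈-loop⁺ {n = 7} {selSection c} 1 (s≤s (s≤s z≤n)) (∈-loop⁺ i i< (here refl))

  rightEnd∈sel : ∀ c {i} → i < R → rightEnd i ∈ sel c
  rightEnd∈sel c {i} i< = ∈-loop⁺ {n = 7} {selSection c} 2 (s≤s (s≤s (s≤s z≤n))) (∈-loop⁺ i i< (here refl))

  cell∈sel : ∀ c {i j} → i < R → j < C → cell i j (c i j) ∈ sel c
  cell∈sel c {i} {j} i< j< = ∈-loop⁺ {n = 7} {selSection c} 5 (ℕ.m≤m+n 6 1) (∈-loop⁺ i i< (∈-loop⁺ j j< (here refl)))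

  -- The combinatorial puzzle left over from the geometry. Horizontal gap j lies between cells j - 1
  -- and j, and at either end of a row one of the two is missing.
  CellsValid RowsCovered ColumnsCovered : (ℕ → ℕ → Choice) → Set
  CellsValid c     = ∀ i j → i < R → j < C → Valid i j (c i j)
  RowsCovered c    = ∀ i j → i < R → j ≤ C → (∃[ j′ ] j ≡ suc j′ × coversRight (c i j′) ≡ true) ⊎ (j < C × coversLeft (c i j) ≡ true)
  ColumnsCovered c = ∀ i j → suc i < R → j < C → coversNext (c i j) ≡ true ⊎ coversPrev (c (suc i) j) ≡ true

  form∈pts : ∀ c → CellsValid c → ∀ p → Form c p → p ∈ pts
  form∈pts c valid (corner i j)  (i≤ , j≤)       = corner∈ i≤ j≤
  form∈pts c valid (leftEnd i)   i<              = leftEnd∈ i<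
  form∈pts c valid (rightEnd i)  i<              = rightEnd∈ i<
  form∈pts c valid (cell i j ch) (i< , j< , eq) = subst (λ ch → cell i j ch ∈ pts) (sym eq) (cell∈ i< j< (valid i j i< j<))

  -- Kept as the literal sum of the loop lengths, so that it agrees term by term with the expression
  -- that the machine evaluates.
  selectionSize : ℕ
  selectionSize = R * (C * 1) + (R * 1 + (R * 1 + suc R * (suc C * 1)))

  length-sel : ∀ c → length (sel c) ≡ selectionSize
  length-sel c = trans (List.length-++ (selSection c 5)) (cong₂ _+_
      (length-loop-constant R (λ i → loop C λ j → cell i j (c i j) ∷ []) (C * 1) λ i → length-loop-constant C (λ j → cell i j (c i j) ∷ []) 1 λ j → refl)
    (trans (List.length-++ (section 2)) (cong₂ _+_ (length-loop-constant R (λ i → rightEnd i ∷ []) 1 λ i → refl)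
      (trans (List.length-++ (section 1)) (cong₂ _+_ (length-loop-constant R (λ i → leftEnd i ∷ []) 1 λ i → refl)
        (trans (cong length (List.++-identityʳ (section 0)))
          (length-loop-constant (suc R) (λ i → loop (suc C) λ j → corner i j ∷ []) (suc C * 1) λ i → length-loop-constant (suc C) (λ j → corner i j ∷ []) 1 λ j → refl)))))))

  quota : ℕ
  quota = length axes + selectionSize

  length-selected : ∀ c → List⁺.length (allPoints (sel c)) ≡ quota
  length-selected c = trans (length-allPoints (sel c)) (cong (λ z → length axes + z) (length-sel c))

  double-suc : ∀ i → 2 * suc i ≡ 2 + 2 * i
  double-suc i = ℕ.*-suc 2 i

  module Upper (c : ℕ → ℕ → Choice) (valid : CellsValid c) (rows : RowsCovered c) (columns : ColumnsCovered c) where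

    Q : List⁺ (Vec ℚ (3 + k))
    Q = allPoints (sel c)

    record Placed (a₀ b₀ : ℕ) (wo : ℕ × Offset) : Set where
      constructor placed-at
      field
        occupant : Pt
        selected : occupant ∈ sel c
        offset≡  : rel a₀ b₀ occupant ≡ proj₂ wo

    sel-inRange : ∀ {q} → q ∈ sel c → InRange q
    sel-inRange {q} q∈ = inRange (form∈pts c valid q (sel-form c q∈))

    cover : ∀ a₀ b₀ p → InRange p → ∀ {ws r} → rel a₀ b₀ p ≡ r → Covers ws r → All (Placed a₀ b₀) ws →
      ∀ x → (1ℚ ℚ.- ε) ℚ.* dot (vec p) x ℚ.≤ maxDot Q x
    cover a₀ b₀ p p-range {ws} {r} r≡ cov placed x@(x₁ ∷ x₂ ∷ x₃ ∷ v) = subst (λ y → (1ℚ ℚ.- ε) ℚ.* dot y x ℚ.≤ maxDot Q x)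
      (sym (trans (vec-at a₀ b₀ p p-range) (cong (Around.at (center a₀) (center b₀)) r≡)))
      (Around.covered (center a₀) (center b₀) x₁ x₂ x₃ v cov 0≤1-ε (p≤∣p∣ x₃) (subst (ℚ.- x₃ ℚ.≤_) (ℚ.∣-p∣≡∣p∣ x₃) (p≤∣p∣ (ℚ.- x₃)))
        (Bounds.15tilt≤ Q (axis∈ (sel c)) (vec∈ (corner∈sel c z≤n z≤n)) x) (Bounds.0≤Ω Q (axis∈ (sel c)) (vec∈ (corner∈sel c z≤n z≤n)) x) 0≤s
        (All.map below placed))
      where
      below : ∀ {wo} → Placed a₀ b₀ wo → dot (Around.at (center a₀) (center b₀) (proj₂ wo)) x ℚ.≤ maxDot Q x
      below (placed-at q q∈ q≡) = subst (λ y → dot y x ℚ.≤ maxDot Q x) (trans (vec-at a₀ b₀ q (sel-inRange q∈)) (cong (Around.at (center a₀) (center b₀)) q≡))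
        (dot≤maxDot Q x (vec∈ q∈))

    kept : ∀ {q} → q ∈ toList Q → ∀ x → (1ℚ ℚ.- ε) ℚ.* dot q x ℚ.≤ maxDot Q x
    kept {q} q∈ x = ℚ.≤-trans (ℚ.*-monoˡ-≤-nonNeg (1ℚ ℚ.- ε) {{ℚ.nonNegative 0≤1-ε}} (dot≤maxDot Q x q∈))
      (by-difference (solve 2 (λ e m → m :- (con 1ℚ :- e) :* m := e :* m) refl ε (maxDot Q x))
        (0≤* 0≤ε (Bounds.0≤Ω Q (axis∈ (sel c)) (vec∈ (corner∈sel c z≤n z≤n)) x)))
      where open ℚSolver.+-*-Solver

    up : ∀ i → ℤ.+ (2 * suc i) ℤ.- ℤ.+ (1 + 2 * i) ≡ 1ᶻ
    up i = trans (cong (λ z → ℤ.+ z ℤ.- ℤ.+ (1 + 2 * i)) (double-suc i)) (step-right (1 + 2 * i))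

    up′ : ∀ i → ℤ.+ (1 + 2 * suc i) ℤ.- ℤ.+ (2 + 2 * i) ≡ 1ᶻ
    up′ i = trans (cong (λ z → ℤ.+ suc z ℤ.- ℤ.+ (2 + 2 * i)) (double-suc i)) (step-right (2 + 2 * i))

    down : ∀ i → ℤ.+ (2 + 2 * i) ℤ.- ℤ.+ (1 + 2 * suc i) ≡ -1ᶻ
    down i = trans (cong (λ z → ℤ.+ (2 + 2 * i) ℤ.- ℤ.+ suc z) (double-suc i)) (step-left (2 + 2 * i))

    level : ∀ i → ℤ.+ (2 * suc i) ℤ.- ℤ.+ (2 + 2 * i) ≡ 0ᶻ
    level i = trans (cong (λ z → ℤ.+ z ℤ.- ℤ.+ (2 + 2 * i)) (double-suc i)) (step-none (2 + 2 * i))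

    placed-corner : ∀ {a₀ b₀ w cx cy} i j → i ≤ R → j ≤ C → ℤ.+ (1 + 2 * j) ℤ.- ℤ.+ a₀ ≡ cx → ℤ.+ (2 * i) ℤ.- ℤ.+ b₀ ≡ cy → Placed a₀ b₀ (w , place cx cy cornerShape)
    placed-corner i j i≤ j≤ x≡ y≡ = placed-at (corner i j) (corner∈sel c i≤ j≤) (place≡ cornerShape x≡ y≡)

    placed-cell : ∀ {a₀ b₀ w cx cy} i j → i < R → j < C → ℤ.+ (2 + 2 * j) ℤ.- ℤ.+ a₀ ≡ cx → ℤ.+ (1 + 2 * i) ℤ.- ℤ.+ b₀ ≡ cy → Placed a₀ b₀ (w , place cx cy (choiceShape (c i j)))
    placed-cell i j i< j< x≡ y≡ = placed-at (cell i j (c i j)) (cell∈sel c i< j<) (place≡ (choiceShape (c i j)) x≡ y≡)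

    -- Whatever is selected in a cell covers, with the help of the four corners, all the other
    -- choices there. Unselected choices thus impose no condition.
    cell-case : ∀ i j ch → i < R → j < C → ∀ x → (1ℚ ℚ.- ε) ℚ.* dot (vec (cell i j ch)) x ℚ.≤ maxDot Q x
    cell-case i j ch i< j< = cover (2 + 2 * j) (1 + 2 * i) (cell i j ch) (i< , j<) (place≡ (choiceShape ch) (step-none (2 + 2 * j)) (step-none (1 + 2 * i)))
      (cell-covers (c i j) ch)
      (placed-cell i j i< j< (step-none (2 + 2 * j)) (step-none (1 + 2 * i)) ∷
       placed-corner (suc i) (suc j) i< j< (up′ j) (up i) ∷ placed-corner i (suc j) (ℕ.<⇒≤ i<) j< (up′ j) (step-left (2 * i)) ∷
       placed-corner (suc i) j i< (ℕ.<⇒≤ j<) (step-left (1 + 2 * j)) (up i) ∷ placed-corner i j (ℕ.<⇒≤ i<) (ℕ.<⇒≤ j<) (step-left (1 + 2 * j)) (step-left (2 * i)) ∷ [])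

    gap-corners : ∀ {w w′} i j → i < R → j ≤ C → All (Placed (1 + 2 * j) (1 + 2 * i)) ((w , place 0ᶻ -1ᶻ cornerShape) ∷ (w′ , place 0ᶻ 1ᶻ cornerShape) ∷ [])
    gap-corners i j i< j≤ = placed-corner i j (ℕ.<⇒≤ i<) j≤ (step-none (1 + 2 * j)) (step-left (2 * i)) ∷ placed-corner (suc i) j i< j≤ (step-none (1 + 2 * j)) (up i) ∷ []

    hgap-case : ∀ i j → i < R → j ≤ C → ∀ x → (1ℚ ℚ.- ε) ℚ.* dot (vec (hgap i j)) x ℚ.≤ maxDot Q x
    hgap-case i j i< j≤ = go j j≤ (rows i j i< j≤) (suc j ≤? C)
      where
      own : ∀ j → rel (1 + 2 * j) (1 + 2 * i) (hgap i j) ≡ gapOffset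
      own j = place≡ gapShape (step-none (1 + 2 * j)) (step-none (1 + 2 * i))
      right-cell : ∀ {w} j → j < C → Placed (1 + 2 * j) (1 + 2 * i) (w , place 1ᶻ 0ᶻ (choiceShape (c i j)))
      right-cell j j< = placed-cell i j i< j< (step-right (1 + 2 * j)) (step-none (1 + 2 * i))
      left-cell : ∀ {w} j → j < C → Placed (1 + 2 * suc j) (1 + 2 * i) (w , place -1ᶻ 0ᶻ (choiceShape (c i j)))
      left-cell j j< = placed-cell i j i< j< (down j) (step-none (1 + 2 * i))
      go : ∀ j → j ≤ C → (∃[ j′ ] j ≡ suc j′ × coversRight (c i j′) ≡ true) ⊎ (j < C × coversLeft (c i j) ≡ true) → Dec (j < C) →
        ∀ x → (1ℚ ℚ.- ε) ℚ.* dot (vec (hgap i j)) x ℚ.≤ maxDot Q x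
      go zero j≤ (inj₂ (j< , cl)) _ = cover 1 (1 + 2 * i) (hgap i 0) (i< , j≤) (own 0) (left-covers (c i 0) cl)
        (placed-at (leftEnd i) (leftEnd∈sel c i<) (place≡ leftShape (step-left 0) (step-none (1 + 2 * i))) ∷ right-cell 0 j< ∷ gap-corners i 0 i< j≤)
      go (suc j) j≤ h (yes j<) = cover (1 + 2 * suc j) (1 + 2 * i) (hgap i (suc j)) (i< , j≤) (own (suc j))
        (row-covers (c i j) (c i (suc j)) (Sum.map (λ { (_ , refl , cr) → cr }) proj₂ h))
        (left-cell j j≤ ∷ right-cell (suc j) j< ∷ gap-corners i (suc j) i< j≤)
      go (suc j) j≤ (inj₁ (_ , refl , cr)) (no j≮) = cover (1 + 2 * suc j) (1 + 2 * i) (hgap i (suc j)) (i< , j≤) (own (suc j))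
        (right-covers (c i j) cr)
        (left-cell j j≤ ∷ placed-at (rightEnd i) (rightEnd∈sel c i<) (place≡ rightShape
            (trans (cong (λ z → ℤ.+ (2 + 2 * z) ℤ.- ℤ.+ (1 + 2 * suc j)) (ℕ.≤-antisym (ℕ.≮⇒≥ j≮) j≤)) (step-right (1 + 2 * suc j)))
            (step-none (1 + 2 * i))) ∷ gap-corners i (suc j) i< j≤)
      go (suc j) j≤ (inj₂ (j< , _)) (no j≮) = contradiction j< j≮

    vgap-case : ∀ i j → suc i < R → j < C → ∀ x → (1ℚ ℚ.- ε) ℚ.* dot (vec (vgap i j)) x ℚ.≤ maxDot Q x
    vgap-case i j i< j< = cover (2 + 2 * j) (2 + 2 * i) (vgap i j) (i< , j<) (place≡ gapShape (step-none (2 + 2 * j)) (step-none (2 + 2 * i)))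
      (column-covers (c i j) (c (suc i) j) (columns i j i< j<))
      (placed-cell i j (ℕ.<⇒≤ i<) j< (step-none (2 + 2 * j)) (step-left (1 + 2 * i)) ∷ placed-cell (suc i) j i< j< (step-none (2 + 2 * j)) (up′ i) ∷
       placed-corner (suc i) j (ℕ.<⇒≤ i<) (ℕ.<⇒≤ j<) (step-left (1 + 2 * j)) (level i) ∷ placed-corner (suc i) (suc j) (ℕ.<⇒≤ i<) j< (up′ j) (level i) ∷ [])

    point-case : ∀ p → Present p → ∀ x → (1ℚ ℚ.- ε) ℚ.* dot (vec p) x ℚ.≤ maxDot Q x
    point-case (corner i j)  (i≤ , j≤)     = kept (vec∈ (corner∈sel c i≤ j≤))
    point-case (leftEnd i)   i<            = kept (vec∈ (leftEnd∈sel c i<))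
    point-case (rightEnd i)  i<            = kept (vec∈ (rightEnd∈sel c i<))
    point-case (hgap i j)    (i< , j≤)     = hgap-case i j i< j≤
    point-case (vgap i j)    (i< , j<)     = vgap-case i j i< j<
    point-case (cell i j ch) (i< , j< , _) = cell-case i j ch i< j<

    regret-set : IsRegretSet instanceOf Q
    regret-set = record
      { unique = allPoints-unique (sel-unique c)
      ; subset = λ q∈ → [ (λ (ib , ib∈ , eq) → subst (_∈ toList (allPoints pts)) (sym eq) (axis∈ pts ib∈))
                        , (λ (p , p∈ , eq) → subst (_∈ toList (allPoints pts)) (sym eq) (vec∈ (form∈pts c valid p (sel-form c p∈)))) ]′ (∈-allPoints (sel c) q∈)
      ; regret = regret-intro (allPoints pts) standingPoints Q εℚ λ x {q} q∈ → subst (λ e → (1ℚ ℚ.- e) ℚ.* dot q x ℚ.≤ maxDot Q x) (sym εℚ≡)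
          ([ (λ (ib , ib∈ , eq) → subst (λ q → (1ℚ ℚ.- ε) ℚ.* dot q x ℚ.≤ maxDot Q x) (sym eq) (kept (axis∈ (sel c) ib∈) x))
           , (λ (p , p∈ , eq) → subst (λ q → (1ℚ ℚ.- ε) ℚ.* dot q x ℚ.≤ maxDot Q x) (sym eq) (point-case p (present p∈) x)) ]′ (∈-allPoints pts q∈))
      }

  -- From a small regret set to a covering pattern.

  module Extraction (Q : List⁺ (Vec ℚ (3 + k))) (regretSet : IsRegretSet instanceOf Q) (small : List⁺.length Q ≤ quota) where
    open Lower Q regretSet

    pick : ∀ i j → ∃[ c ] (i < R → j < C → Valid i j c × vec (cell i j c) ∈ toList Q)
    pick i j = go (suc i ≤? R) (suc j ≤? C)
      where
      go : Dec (i < R) → Dec (j < C) → ∃[ c ] (i < R → j < C → Valid i j c × vec (cell i j c) ∈ toList Q)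
      go (yes i<) (yes j<) = map₂ (λ h _ _ → h) (has-cell i< j<)
      go (no i≮)  _        = lp , λ i< _ → contradiction i< i≮
      go (yes _)  (no j≮)  = lp , λ _ j< → contradiction j< j≮

    c : ℕ → ℕ → Choice
    c i j = proj₁ (pick i j)

    valid : CellsValid c
    valid i j i< j< = proj₁ (proj₂ (pick i j) i< j<)

    has-form : ∀ p → Form c p → vec p ∈ toList Q
    has-form (corner i j)  (i≤ , j≤)       = has-corner i≤ j≤
    has-form (leftEnd i)   i<              = has-leftEnd i<
    has-form (rightEnd i)  i<              = has-rightEnd i<
    has-form (cell i j ch) (i< , j< , eq) = subst (λ ch → vec (cell i j ch) ∈ toList Q) (sym eq) (proj₂ (proj₂ (pick i j) i< j<))

    selected⊆Q : toList (allPoints (sel c)) ⊆ toList Q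
    selected⊆Q q∈ = [ (λ (ib , ib∈ , eq) → subst (_∈ toList Q) (sym eq) (has-axis ib∈))
      , (λ (p , p∈ , eq) → subst (_∈ toList Q) (sym eq) (has-form p (sel-form c p∈))) ]′ (∈-allPoints (sel c) q∈)

    -- The forced points already use up the quota. No room is left for a gap point or for a second
    -- choice in some cell.
    Q⊆selected : toList Q ⊆ toList (allPoints (sel c))
    Q⊆selected = pigeonhole (Vec.≡-dec ℚ._≟_) (allPoints-unique (sel-unique c)) selected⊆Q (ℕ.≤-trans small (ℕ.≤-reflexive (sym (length-selected c))))

    form-of : ∀ p → vec p ∈ toList Q → Form c p
    form-of p p∈ = [ (λ (ib , _ , eq) → contradiction eq (vec≢axis p ib))
      , (λ (p′ , p′∈ , eq) → subst (Form c) (sym (vec-injective {p} {p′} eq)) (sel-form c p′∈)) ]′ (∈-allPoints (sel c) (Q⊆selected p∈))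

    not-gap : ∀ p → Form c p → ¬ IsGap p
    not-gap (corner _ _) _ ()
    not-gap (leftEnd _)  _ ()
    not-gap (rightEnd _) _ ()
    not-gap (cell _ _ _) _ ()

    rows : RowsCovered c
    rows i j i< j≤ = resolve (undominated (hgap i j) (hgap∈ i< j≤) -64ᶻ closed closed closed)
      λ p p∈ q∈ → Sum.map₁ (translate p (form-of p q∈)) (hgap-covered i j j≤ p (not-gap p (form-of p q∈)) (inRange p∈))
      where
      translate : ∀ p → Form c p → CoversRow i j p → (∃[ j′ ] j ≡ suc j′ × coversRight (c i j′) ≡ true) ⊎ (j < C × coversLeft (c i j) ≡ true)
      translate p form (inj₁ (ch , refl , cl)) = inj₂ (proj₁ (proj₂ form) , subst (λ ch → coversLeft ch ≡ true) (proj₂ (proj₂ form)) cl)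
      translate p form (inj₂ (j′ , ch , j≡ , refl , cr)) = inj₁ (j′ , j≡ , subst (λ ch → coversRight ch ≡ true) (proj₂ (proj₂ form)) cr)

    columns : ColumnsCovered c
    columns i j i< j< = resolve (undominated (vgap i j) (vgap∈ i< j<) -64ᶻ closed closed closed)
      λ p p∈ q∈ → Sum.map₁ (translate p (form-of p q∈)) (vgap-covered i j j< p (not-gap p (form-of p q∈)) (inRange p∈))
      where
      translate : ∀ p → Form c p → CoversColumn i j p → coversNext (c i j) ≡ true ⊎ coversPrev (c (suc i) j) ≡ true
      translate p form (inj₁ (ch , refl , cn)) = inj₁ (subst (λ ch → coversNext ch ≡ true) (proj₂ (proj₂ form)) cn)
      translate p form (inj₂ (ch , refl , cp)) = inj₂ (subst (λ ch → coversPrev ch ≡ true) (proj₂ (proj₂ form)) cp)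


  -- Covering patterns and satisfying assignments.

  module FromAssignment (X : ℕ → Bool) (sat : Satisfies R B literals X) where
    open Satisfies sat

    -- In row i the cells before the satisfied literal lean left, those after it right.
    record Witness (i : ℕ) : Set where
      constructor witness
      field
        place-of : ℕ
        literal  : place-of ∈ literals i
        value    : (i < B × X place-of ≡ true) ⊎ (¬ i < B × X place-of ≡ false)

    find : ∀ i → i < R → Witness i
    find i i< = go (suc i ≤? B)
      where
      go : Dec (i < B) → Witness i
      go (yes i<B) = let (j , j∈ , eq) = positives i i< i<B in witness j j∈ (inj₁ (i<B , eq))
      go (no i≮B)  = let (j , j∈ , eq) = negatives i i< i≮B in witness j j∈ (inj₂ (i≮B , eq))

    data Side : Set where
      before at after : Side

    choose : Side → Bool → Choice
    choose before true  = lp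
    choose before false = ln
    choose at     true  = bp
    choose at     false = bn
    choose after  true  = rp
    choose after  false = rn

    side : ℕ → ℕ → Side
    side j* j = if j <ᵇ j* then before else (if j* <ᵇ j then after else at)

    pivot : ℕ → ℕ
    pivot i = go (suc i ≤? R)
      where
      go : Dec (i < R) → ℕ
      go (yes i<) = Witness.place-of (find i i<)
      go (no _)   = 0

    pivot-witness : ∀ i → i < R → pivot i ∈ literals i × ((i < B × X (pivot i) ≡ true) ⊎ (¬ i < B × X (pivot i) ≡ false))
    pivot-witness i i< with suc i ≤? R
    ... | yes i<′ = Witness.literal (find i i<′) , Witness.value (find i i<′)
    ... | no i≮   = contradiction i< i≮

    c : ℕ → ℕ → Choice
    c i j = choose (side (pivot i) j) (X j)

    side-cases : ∀ j* j → (side j* j ≡ before × j < j*) ⊎ (side j* j ≡ after × j* < j) ⊎ (side j* j ≡ at × j ≡ j*)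
    side-cases j* j with j <ᵇ j* in eq
    ... | true  = inj₁ (refl , ℕ.<ᵇ⇒< j j* (subst T (sym eq) tt))
    ... | false with j* <ᵇ j in eq′
    ...   | true  = inj₂ (inj₁ (refl , ℕ.<ᵇ⇒< j* j (subst T (sym eq′) tt)))
    ...   | false = inj₂ (inj₂ (refl , ℕ.≤-antisym (ℕ.≮⇒≥ λ lt → subst T eq′ (ℕ.<⇒<ᵇ lt)) (ℕ.≮⇒≥ λ lt → subst T eq (ℕ.<⇒<ᵇ lt))))

    valid : CellsValid c
    valid i j i< j< = [ (λ (eq , _) → subst (λ s → Valid i j (choose s (X j))) (sym eq) (free (X j)))
      , [ (λ (eq , _) → subst (λ s → Valid i j (choose s (X j))) (sym eq) (free′ (X j)))
        , (λ (eq , j≡) → subst (λ s → Valid i j (choose s (X j))) (sym eq) (literal-case j≡ (pivot-witness i i<))) ]′ ]′ (side-cases (pivot i) j)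
      where
      free : ∀ b → Valid i j (choose before b)
      free true  = valid-lp
      free false = valid-ln
      free′ : ∀ b → Valid i j (choose after b)
      free′ true  = valid-rp
      free′ false = valid-rn
      literal-case : j ≡ pivot i → pivot i ∈ literals i × ((i < B × X (pivot i) ≡ true) ⊎ (¬ i < B × X (pivot i) ≡ false)) → Valid i j (choose at (X j))
      literal-case j≡ (j∈ , inj₁ (i<B , eq)) = subst (λ b → Valid i j (choose at b)) (sym (trans (cong X j≡) eq)) (valid-bp i<B (subst (_∈ literals i) (sym j≡) j∈))
      literal-case j≡ (j∈ , inj₂ (i≮B , eq)) = subst (λ b → Valid i j (choose at b)) (sym (trans (cong X j≡) eq)) (valid-bn i≮B (subst (_∈ literals i) (sym j≡) j∈))

    leans-left : ∀ s b → s ≢ after → coversLeft (choose s b) ≡ true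
    leans-left before true  _ = refl
    leans-left before false _ = refl
    leans-left at     true  _ = refl
    leans-left at     false _ = refl
    leans-left after  b     h = contradiction refl h

    leans-right : ∀ s b → s ≢ before → coversRight (choose s b) ≡ true
    leans-right after  true  _ = refl
    leans-right after  false _ = refl
    leans-right at     true  _ = refl
    leans-right at     false _ = refl
    leans-right before b     h = contradiction refl h

    not-after : ∀ {j* j} → j ≤ j* → side j* j ≢ after
    not-after {j*} {j} j≤ eq with side-cases j* j
    ... | inj₁ (eq′ , _)         = contradiction (trans (sym eq) eq′) λ ()
    ... | inj₂ (inj₁ (_ , lt))   = ℕ.<⇒≱ lt j≤
    ... | inj₂ (inj₂ (eq′ , _)) = contradiction (trans (sym eq) eq′) λ ()

    not-before : ∀ {j* j} → j* ≤ j → side j* j ≢ before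
    not-before {j*} {j} j≥ eq with side-cases j* j
    ... | inj₁ (_ , lt)          = ℕ.<⇒≱ lt j≥
    ... | inj₂ (inj₁ (eq′ , _)) = contradiction (trans (sym eq) eq′) λ ()
    ... | inj₂ (inj₂ (eq′ , _)) = contradiction (trans (sym eq) eq′) λ ()

    rows : RowsCovered c
    rows i j i< j≤ = go j j≤ (j ≤? pivot i)
      where
      go : ∀ j → j ≤ C → Dec (j ≤ pivot i) → (∃[ j′ ] j ≡ suc j′ × coversRight (c i j′) ≡ true) ⊎ (j < C × coversLeft (c i j) ≡ true)
      go j j≤ (yes j≤*) = inj₂ (ℕ.≤-<-trans j≤* (literals< i (proj₁ (pivot-witness i i<))) , leans-left (side (pivot i) j) (X j) (not-after j≤*))
      go zero    j≤ (no 0≰*) = contradiction z≤n 0≰*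
      go (suc j) j≤ (no j≰*) = inj₁ (j , refl , leans-right (side (pivot i) j) (X j) (not-before (ℕ.≤-pred (ℕ.≰⇒> j≰*))))

    -- All choices of a column carry the same value: a true one is covered from the later row, a
    -- false one from the earlier row.
    columns : ColumnsCovered c
    columns i j i< j< = go (X j) (side (pivot i) j) (side (pivot (suc i)) j)
      where
      go : ∀ b s s′ → coversNext (choose s b) ≡ true ⊎ coversPrev (choose s′ b) ≡ true
      go true  s before  = inj₂ refl
      go true  s at      = inj₂ refl
      go true  s after   = inj₂ refl
      go false before s′ = inj₁ refl
      go false at s′     = inj₁ refl
      go false after s′  = inj₁ refl

  module ToAssignment (1≤B : 1 ≤ B) (B≤R : B ≤ R) (c : ℕ → ℕ → Choice) (valid : CellsValid c) (rows : RowsCovered c) (columns : ColumnsCovered c) where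

    -- Read at the last positive row. Values can only turn true on the way down, so literals found
    -- true in positive rows are still true here, and literals found false in negative rows are
    -- already false here.
    X : ℕ → Bool
    X j = coversPrev (c (B ∸ 1) j)

    exclusive : ∀ ch → coversPrev ch ≡ true → coversNext ch ≡ false
    exclusive lp _ = refl
    exclusive rp _ = refl
    exclusive bp _ = refl
    exclusive ln ()
    exclusive rn ()
    exclusive bn ()

    -- A choice that covers the previous gap leaves the next one to the following row, which must
    -- then cover its own previous gap.
    persists : ∀ i n j → i + n < R → j < C → coversPrev (c i j) ≡ true → coversPrev (c (i + n) j) ≡ true
    persists i zero    j i< j< h = subst (λ z → coversPrev (c z j) ≡ true) (sym (ℕ.+-identityʳ i)) h
    persists i (suc n) j i< j< h = subst (λ z → coversPrev (c z j) ≡ true) (sym (ℕ.+-suc i n))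
      ([ (λ next → contradiction (trans (sym next) (exclusive _ (persists i n j (ℕ.<⇒≤ lt) j< h))) λ ()) , id ]′ (columns (i + n) j lt j<))
      where
      lt : suc (i + n) < R
      lt = subst (_< R) (ℕ.+-suc i n) i<

    Both : ℕ → ℕ → Set
    Both i j = j < C × coversLeft (c i j) ≡ true × coversRight (c i j) ≡ true

    -- Scanning from the left, the first gap can be covered only by the first cell. As long as no
    -- cell covers both sides, each cell is spent on its left gap and passes the next gap on, until
    -- nobody is left for the last one.
    turning : ∀ i → i < R → ∃[ j ] Both i j
    turning i i< = [ id , (λ blocked → last blocked (rows i C i< ℕ.≤-refl)) ]′ (scan C ℕ.≤-refl)
      where
      Blocked : ℕ → Set
      Blocked j = ∀ j′ → j ≡ suc j′ → coversRight (c i j′) ≡ false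
      last : Blocked C → (∃[ j′ ] C ≡ suc j′ × coversRight (c i j′) ≡ true) ⊎ (C < C × coversLeft (c i C) ≡ true) → ∃[ j ] Both i j
      last blocked (inj₁ (j′ , eq , cr)) = contradiction (trans (sym cr) (blocked j′ eq)) λ ()
      last blocked (inj₂ (lt , _))       = contradiction lt (ℕ.<-irrefl refl)
      scan : ∀ j → j ≤ C → (∃[ j ] Both i j) ⊎ Blocked j
      scan zero    _  = inj₂ λ j′ ()
      scan (suc j) j< = [ inj₁ , (λ blocked → next blocked (rows i j i< (ℕ.<⇒≤ j<)) (coversRight (c i j)) refl) ]′ (scan j (ℕ.<⇒≤ j<))
        where
        next : Blocked j → (∃[ j′ ] j ≡ suc j′ × coversRight (c i j′) ≡ true) ⊎ (j < C × coversLeft (c i j) ≡ true) → ∀ b → coversRight (c i j) ≡ b → (∃[ j ] Both i j) ⊎ Blocked (suc j)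
        next blocked (inj₁ (j′ , eq , cr)) b     eq′ = contradiction (trans (sym cr) (blocked j′ eq)) λ ()
        next blocked (inj₂ (_ , cl))       true  eq′ = inj₁ (j , j< , cl , eq′)
        next blocked (inj₂ (_ , cl))       false eq′ = inj₂ λ { j′ refl → eq′ }

    literal-of : ∀ i → i < R → ∃[ j ] j < C × ((i < B × j ∈ literals i × coversPrev (c i j) ≡ true) ⊎ (¬ i < B × j ∈ literals i × coversPrev (c i j) ≡ false))
    literal-of i i< = (λ (j , j< , cl , cr) → j , j< , cases j (c i j) (valid i j i< j<) cl cr) (turning i i<)
      where
      cases : ∀ j ch → Valid i j ch → coversLeft ch ≡ true → coversRight ch ≡ true → (i < B × j ∈ literals i × coversPrev ch ≡ true) ⊎ (¬ i < B × j ∈ literals i × coversPrev ch ≡ false)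
      cases j lp _ _ ()
      cases j ln _ _ ()
      cases j rp _ () _
      cases j rn _ () _
      cases j bp (valid-bp i<B j∈) _ _ = inj₁ (i<B , j∈ , refl)
      cases j bn (valid-bn i≮B j∈) _ _ = inj₂ (i≮B , j∈ , refl)

    B-1<R : B ∸ 1 < R
    B-1<R = ℕ.≤-trans (ℕ.≤-reflexive (ℕ.m+[n∸m]≡n 1≤B)) B≤R

    satisfied : Satisfies R B literals X
    satisfied = satisfies
      (λ i i< i<B → pos i i<B (literal-of i i<))
      (λ i i< i≮B → neg i i< i≮B (literal-of i i<))
      where
      pos : ∀ i → i < B → _ → ∃[ j ] j ∈ literals i × X j ≡ true
      pos i i<B (j , j< , inj₁ (_ , j∈ , cp))  = j , j∈ , subst (λ z → coversPrev (c z j) ≡ true) (ℕ.m+[n∸m]≡n (ℕ.∸-monoˡ-≤ 1 i<B))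
        (persists i (B ∸ 1 ∸ i) j (subst (_< R) (sym (ℕ.m+[n∸m]≡n (ℕ.∸-monoˡ-≤ 1 i<B))) B-1<R) j< cp)
      pos i i<B (j , j< , inj₂ (i≮B , _)) = contradiction i<B i≮B
      neg : ∀ i → i < R → ¬ i < B → _ → ∃[ j ] j ∈ literals i × X j ≡ false
      neg i i< i≮B (j , j< , inj₁ (i<B , _)) = contradiction i<B i≮B
      neg i i< i≮B (j , j< , inj₂ (_ , j∈ , cp)) = j , j∈ , Bool.¬-not λ Xj → contradiction (trans (sym cp)
        (subst (λ z → coversPrev (c z j) ≡ true) (ℕ.m+[n∸m]≡n B-1≤i) (persists (B ∸ 1) (i ∸ (B ∸ 1)) j (subst (_< R) (sym (ℕ.m+[n∸m]≡n B-1≤i)) i<) j< Xj))) λ ()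
        where
        B-1≤i : B ∸ 1 ≤ i
        B-1≤i = ℕ.≤-trans (ℕ.m∸n≤m B 1) (ℕ.≮⇒≥ i≮B)

  satisfiable⇔small : 1 ≤ B → B ≤ R → ∀ Q → IsMinimumRegretSet instanceOf Q → (∃[ X ] Satisfies R B literals X) ⇔ (List⁺.length Q ≤ quota)
  satisfiable⇔small 1≤B B≤R Q (regretSet , minimal) = mk⇔
    (λ (X , sat) → let open FromAssignment X sat in
      ℕ.≤-trans (minimal (allPoints (sel c)) (Upper.regret-set c valid rows columns)) (ℕ.≤-reflexive (length-selected c)))
    (λ small → let open Extraction Q regretSet small in ToAssignment.X 1≤B B≤R c valid rows columns , ToAssignment.satisfied 1≤B B≤R c valid rows columns)

-- Tapes as sequences of cells.

cellAt : ℕ → List Symbol → Symbol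
cellAt i       []       = blank
cellAt zero    (s ∷ _)  = s
cellAt (suc i) (_ ∷ ss) = cellAt i ss

cellAt-map : ∀ i w → cellAt i (map just w) ≡ symbolAt i w
cellAt-map i       []      = refl
cellAt-map zero    (b ∷ w) = refl
cellAt-map (suc i) (b ∷ w) = cellAt-map i w

current-writeWord : ∀ w → Tape.current (writeWord w) ≡ symbolAt 0 w
current-writeWord []      = refl
current-writeWord (b ∷ w) = refl

after-writeWord : ∀ i w → cellAt i (Tape.after (writeWord w)) ≡ symbolAt (suc i) w
after-writeWord i []      = refl
after-writeWord i (b ∷ w) = cellAt-map i w

before-writeWord : ∀ i w → cellAt i (Tape.before (writeWord w)) ≡ blank
before-writeWord i []      = refl
before-writeWord i (b ∷ w) = refl

right-before-zero : ∀ s t → cellAt 0 (Tape.before (act (s , right) t)) ≡ s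
right-before-zero s (tape ls c [])       = refl
right-before-zero s (tape ls c (r ∷ rs)) = refl

right-before-suc : ∀ i s t → cellAt (suc i) (Tape.before (act (s , right) t)) ≡ cellAt i (Tape.before t)
right-before-suc i s (tape ls c [])       = refl
right-before-suc i s (tape ls c (r ∷ rs)) = refl

right-current : ∀ s t → Tape.current (act (s , right) t) ≡ cellAt 0 (Tape.after t)
right-current s (tape ls c [])       = refl
right-current s (tape ls c (r ∷ rs)) = refl

right-after : ∀ i s t → cellAt i (Tape.after (act (s , right) t)) ≡ cellAt (suc i) (Tape.after t)
right-after i s (tape ls c [])       = refl
right-after i s (tape ls c (r ∷ rs)) = refl

left-after-zero : ∀ s t → cellAt 0 (Tape.after (act (s , left) t)) ≡ s
left-after-zero s (tape [] c rs)       = refl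
left-after-zero s (tape (l ∷ ls) c rs) = refl

left-after-suc : ∀ i s t → cellAt (suc i) (Tape.after (act (s , left) t)) ≡ cellAt i (Tape.after t)
left-after-suc i s (tape [] c rs)       = refl
left-after-suc i s (tape (l ∷ ls) c rs) = refl

left-current : ∀ s t → Tape.current (act (s , left) t) ≡ cellAt 0 (Tape.before t)
left-current s (tape [] c rs)       = refl
left-current s (tape (l ∷ ls) c rs) = refl

left-before : ∀ i s t → cellAt i (Tape.before (act (s , left) t)) ≡ cellAt (suc i) (Tape.before t)
left-before i s (tape [] c rs)       = refl
left-before i s (tape (l ∷ ls) c rs) = refl

symbolAt-blank-suc : ∀ i w → symbolAt i w ≡ blank → symbolAt (suc i) w ≡ blank
symbolAt-blank-suc zero    []      h = refl
symbolAt-blank-suc (suc i) []      h = refl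
symbolAt-blank-suc (suc i) (b ∷ w) h = symbolAt-blank-suc i w h

symbolAt-beyond : ∀ i w → length w ≤ i → symbolAt i w ≡ blank
symbolAt-beyond zero    []      h       = refl
symbolAt-beyond (suc i) []      h       = refl
symbolAt-beyond (suc i) (b ∷ w) (s≤s h) = symbolAt-beyond i w h

readPrefix : ℕ → (ℕ → Symbol) → Word
readPrefix zero    f = []
readPrefix (suc n) f with f 0
... | nothing = []
... | just b  = b ∷ readPrefix n (f ∘ suc)

readPrefix-symbol : ∀ n f → (∀ i → suc i < n → f i ≡ blank → f (suc i) ≡ blank) → ∀ i → i < n → symbolAt i (readPrefix n f) ≡ f i
readPrefix-symbol (suc n) f closed i i<n with f 0 in eq
... | nothing = sym (blanks i i<n)
  where
  blanks : ∀ i → i < suc n → f i ≡ blank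
  blanks zero    _  = eq
  blanks (suc i) i< = closed i i< (blanks i (ℕ.<⇒≤ i<))
... | just b with i
...   | zero   = sym eq
...   | suc i′ = readPrefix-symbol n (f ∘ suc) (λ j j< → closed (suc j) (s≤s j<)) i′ (ℕ.≤-pred i<n)

length-readPrefix : ∀ n f m → (∀ i → i < n → m ≤ i → f i ≡ blank) → length (readPrefix n f) ≤ m
length-readPrefix zero    f m h = z≤n
length-readPrefix (suc n) f m h with f 0 in eq
... | nothing = z≤n
length-readPrefix (suc n) f zero    h | just b = contradiction (trans (sym eq) (h 0 (s≤s z≤n) z≤n)) λ ()
length-readPrefix (suc n) f (suc m) h | just b = s≤s (length-readPrefix n (f ∘ suc) m λ i i< m≤ → h (suc i) (s≤s i<) (s≤s m≤))

infix 4 _≟ᴰ_ _≟ˢ_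
_≟ᴰ_ : DecidableEquality Direction
left  ≟ᴰ left  = yes refl
left  ≟ᴰ stay  = no λ ()
left  ≟ᴰ right = no λ ()
stay  ≟ᴰ left  = no λ ()
stay  ≟ᴰ stay  = yes refl
stay  ≟ᴰ right = no λ ()
right ≟ᴰ left  = no λ ()
right ≟ᴰ stay  = no λ ()
right ≟ᴰ right = yes refl

_≟ˢ_ : DecidableEquality Symbol
_≟ˢ_ = Maybe.≡-dec Bool._≟_

-- Computations of a verifier as tableaux.

module Tableaux (V : Machine ⊥) where
  open Machine V using (states; workTapes; initial) renaming (command to instruction)

  tapes : ℕ
  tapes = 2 + workTapes

  -- A halted machine repeats its configuration for ever, so that acceptance within T steps can be
  -- tested at time T exactly.
  next : Fin states → Vec Symbol tapes → Fin states × Vec (Symbol × Direction) tapes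
  next q ss with instruction q
  ... | halt _  = q , idle ss
  ... | move f  = f ss
  ... | ask () _

  Accepting : Fin states → Set
  Accepting q = instruction q ≡ halt true

  accepting? : ∀ q → Dec (Accepting q)
  accepting? q with instruction q
  ... | halt true  = yes refl
  ... | halt false = no λ ()
  ... | move f     = no λ ()
  ... | ask () _

  Config : Set
  Config = Fin states × Vec Tape tapes

  successor : Config → Config
  successor (q , ts) = let (q′ , as) = next q (Vec.map Tape.current ts) in q′ , Vec.zipWith act as ts

  after : ℕ → Config → Config
  after zero    c = c
  after (suc n) c = after n (successor c)

  after-suc : ∀ n c → after (suc n) c ≡ successor (after n c)
  after-suc zero    c = refl
  after-suc (suc n) c = after-suc n (successor c)

  successor-halted : ∀ {q b} ts → instruction q ≡ halt b → successor (q , ts) ≡ (q , ts)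
  successor-halted ts eq rewrite eq = cong (_ ,_) (idle-act ts)

  successor-moved : ∀ {q f} ts → instruction q ≡ move f →
    successor (q , ts) ≡ (proj₁ (f (Vec.map Tape.current ts)) , Vec.zipWith act (proj₂ (f (Vec.map Tape.current ts))) ts)
  successor-moved ts eq rewrite eq = refl

  after-halted : ∀ n {q b} ts → instruction q ≡ halt b → after n (q , ts) ≡ (q , ts)
  after-halted zero    ts eq = refl
  after-halted (suc n) ts eq = trans (cong (after n) (successor-halted ts eq)) (after-halted n ts eq)

  accepting-run : ∀ n q ts → runFrom V ⊥-elim n q ts ≡ just true → Accepting (proj₁ (after n (q , ts)))
  accepting-run n q ts h with instruction q in eq
  accepting-run n q ts refl | halt true = subst Accepting (sym (cong proj₁ (after-halted n ts eq))) eq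
  accepting-run (suc n) q ts h | move f = subst (Accepting ∘ proj₁ ∘ after n) (sym (successor-moved ts eq))
    (accepting-run n (proj₁ (f (Vec.map Tape.current ts))) (Vec.zipWith act (proj₂ (f (Vec.map Tape.current ts))) ts) h)
  accepting-run n q ts h | ask () _

  run-accepting : ∀ n q ts → Accepting (proj₁ (after n (q , ts))) → runFrom V ⊥-elim n q ts ≡ just true
  run-accepting n q ts h with instruction q in eq
  ... | halt b = verdict b (trans (sym eq) (trans (cong instruction (sym (cong proj₁ (after-halted n ts eq)))) h))
    where
    verdict : ∀ b → halt {⊥} {states} {tapes} b ≡ halt true → just b ≡ just true
    verdict b refl = refl
  run-accepting zero    q ts h | move f = contradiction (trans (sym eq) h) λ ()
  run-accepting (suc n) q ts h | move f = run-accepting n (proj₁ (f (Vec.map Tape.current ts))) (Vec.zipWith act (proj₂ (f (Vec.map Tape.current ts))) ts)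
    (subst (Accepting ∘ proj₁ ∘ after n) (successor-moved ts eq) h)
  run-accepting n q ts h | ask () _

  run-mono : ∀ m n q ts {b} → m ≤ n → runFrom V ⊥-elim m q ts ≡ just b → runFrom V ⊥-elim n q ts ≡ just b
  run-mono m n q ts m≤n h with instruction q
  run-mono m n q ts m≤n h | halt _ = h
  run-mono (suc m) (suc n) q ts (s≤s m≤n) h | move f = run-mono m n _ _ m≤n h
  run-mono m n q ts m≤n h | ask () _

  -- A block shows everything about one cell position: whether it is the origin, the state, the
  -- scanned symbols, and the cells at that distance before and after the head of each tape. The
  -- tapes move and the heads stay, so the update is local once state and scanned symbols are
  -- repeated in every block.
  record Block : Set where
    constructor block
    field
      origin  : Bool
      state   : Fin states
      scanned before behind : Vec Symbol tapes

  open Block public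

  action : Block → Fin tapes → Symbol × Direction
  action b = Vec.lookup (proj₂ (next (state b) (scanned b)))

  written : Block → Fin tapes → Symbol
  written b τ = proj₁ (action b τ)

  direction : Block → Fin tapes → Direction
  direction b τ = proj₂ (action b τ)

  infix 9 _!_
  _!_ : Vec Symbol tapes → Fin tapes → Symbol
  v ! τ = Vec.lookup v τ

  -- The conditions on `origin` switch a relation off when its neighbouring block opens a new row.
  -- Concatenating the rows therefore creates no false neighbours.
  SameControl StepHere StepFromRight StepFromLeft Shaped : Block → Block → Set
  SameControl b b′ = origin b′ ≡ false → state b′ ≡ state b × scanned b′ ≡ scanned b
  StepHere b b′ = origin b′ ≡ origin b
    × (∀ τ → direction b τ ≡ stay → before b′ ! τ ≡ before b ! τ × behind b′ ! τ ≡ behind b ! τ)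
    × (origin b ≡ true → state b′ ≡ proj₁ (next (state b) (scanned b)) × (∀ τ →
        (direction b τ ≡ right → before b′ ! τ ≡ written b τ × scanned b′ ! τ ≡ behind b ! τ)
      × (direction b τ ≡ left → behind b′ ! τ ≡ written b τ × scanned b′ ! τ ≡ before b ! τ)
      × (direction b τ ≡ stay → scanned b′ ! τ ≡ written b τ)))
  StepFromRight b b′ = origin b ≡ false → ∀ τ → (direction b τ ≡ right → behind b′ ! τ ≡ behind b ! τ)
    × (direction b τ ≡ left → before b′ ! τ ≡ before b ! τ)
  StepFromLeft b b′ = origin b′ ≡ false → ∀ τ → (direction b τ ≡ right → before b′ ! τ ≡ before b ! τ)
    × (direction b τ ≡ left → behind b′ ! τ ≡ behind b ! τ)
  Shaped b b′ = behind b ! suc zero ≡ blank → behind b′ ! suc zero ≡ blank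

  -- Of the input tapes only the cells before the head are fixed here: tape 0 is tied to the word by
  -- separate conditions, and tape 1 is free to hold a guessed certificate. The last component
  -- passes a blank from the scanned first symbol to the cell after it; `Shaped` handles the cells
  -- further on.
  Initial : Block → Set
  Initial b = state b ≡ initial × (∀ τ → before b ! τ ≡ blank)
    × (∀ τ → scanned b ! suc (suc τ) ≡ blank × behind b ! suc (suc τ) ≡ blank)
    × (origin b ≡ true → scanned b ! suc zero ≡ blank → behind b ! suc zero ≡ blank)

  -- Decidability is used computationally: the violating pairs of blocks are filtered into the fixed
  -- list of clauses.
  same-control? : ∀ b b′ → Dec (SameControl b b′)
  same-control? b b′ = (origin b′ Bool.≟ false) →-dec ((state b′ Fin.≟ state b) ×-dec Vec.≡-dec _≟ˢ_ (scanned b′) (scanned b))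

  step-here? : ∀ b b′ → Dec (StepHere b b′)
  step-here? b b′ = (origin b′ Bool.≟ origin b)
    ×-dec Fin.all? (λ τ → (direction b τ ≟ᴰ stay) →-dec ((before b′ ! τ ≟ˢ before b ! τ) ×-dec (behind b′ ! τ ≟ˢ behind b ! τ)))
    ×-dec ((origin b Bool.≟ true) →-dec ((state b′ Fin.≟ proj₁ (next (state b) (scanned b))) ×-dec Fin.all? λ τ →
        ((direction b τ ≟ᴰ right) →-dec ((before b′ ! τ ≟ˢ written b τ) ×-dec (scanned b′ ! τ ≟ˢ behind b ! τ)))
      ×-dec ((direction b τ ≟ᴰ left) →-dec ((behind b′ ! τ ≟ˢ written b τ) ×-dec (scanned b′ ! τ ≟ˢ before b ! τ)))
      ×-dec ((direction b τ ≟ᴰ stay) →-dec (scanned b′ ! τ ≟ˢ written b τ))))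

  step-from-right? : ∀ b b′ → Dec (StepFromRight b b′)
  step-from-right? b b′ = (origin b Bool.≟ false) →-dec Fin.all? λ τ → ((direction b τ ≟ᴰ right) →-dec (behind b′ ! τ ≟ˢ behind b ! τ))
    ×-dec ((direction b τ ≟ᴰ left) →-dec (before b′ ! τ ≟ˢ before b ! τ))

  step-from-left? : ∀ b b′ → Dec (StepFromLeft b b′)
  step-from-left? b b′ = (origin b′ Bool.≟ false) →-dec Fin.all? λ τ → ((direction b τ ≟ᴰ right) →-dec (before b′ ! τ ≟ˢ before b ! τ))
    ×-dec ((direction b τ ≟ᴰ left) →-dec (behind b′ ! τ ≟ˢ behind b ! τ))

  shaped? : ∀ b b′ → Dec (Shaped b b′)
  shaped? b b′ = (behind b ! suc zero ≟ˢ blank) →-dec (behind b′ ! suc zero ≟ˢ blank)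

  initial? : ∀ b → Dec (Initial b)
  initial? b = (state b Fin.≟ initial) ×-dec Fin.all? (λ τ → before b ! τ ≟ˢ blank)
    ×-dec Fin.all? (λ τ → (scanned b ! suc (suc τ) ≟ˢ blank) ×-dec (behind b ! suc (suc τ) ≟ˢ blank))
    ×-dec ((origin b Bool.≟ true) →-dec ((scanned b ! suc zero ≟ˢ blank) →-dec (behind b ! suc zero ≟ˢ blank)))

  -- The rows of the tableau, of width W, are concatenated. Nothing is required across the
  -- right end of a row; what comes in there has not reached the origin by time T.
  record Tableau (w : Word) (T Y : ℕ) (β : ℕ → Block) : Set where
    W : ℕ
    W = T + 2
    N : ℕ
    N = W * W
    field
      control   : ∀ s → s + 1 < N → SameControl (β s) (β (s + 1))
      here′     : ∀ s → s + W + 1 < N → StepHere (β s) (β (s + W))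
      fromRight : ∀ s → s + W + 1 < N → StepFromRight (β (s + 1)) (β (s + W))
      fromLeft  : ∀ s → s + W + 1 < N → StepFromLeft (β s) (β (s + W + 1))
      start     : ∀ s → s < W → Initial (β s)
      origin₀   : origin (β 0) ≡ true
      origin₊   : ∀ s → 0 < s → s < W → origin (β s) ≡ false
      input₀    : ∀ s → s < W → scanned (β s) ! zero ≡ symbolAt 0 w
      input₊    : ∀ s → s < W → behind (β s) ! zero ≡ symbolAt (s + 1) w
      short₀    : ∀ s → s < W → Y ≤ 0 → scanned (β s) ! suc zero ≡ blank
      short₊    : ∀ s → s < W → Y ≤ s + 1 → behind (β s) ! suc zero ≡ blank
      shape₊    : ∀ s → s + 1 < W → Shaped (β s) (β (s + 1))
      final     : Accepting (state (β (T * W)))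

  startConfig : Word → Word → Config
  startConfig w y = initial , writeWord w ∷ writeWord y ∷ Vec.replicate workTapes (writeWord [])

  tapeAt : Config → Fin tapes → Tape
  tapeAt (_ , ts) τ = Vec.lookup ts τ

  record Shows (c : Config) (p : ℕ) (b : Block) : Set where
    constructor shows-config
    field
      origin≡  : origin b ≡ (p ≡ᵇ 0)
      state≡   : state b ≡ proj₁ c
      scanned≡ : scanned b ≡ Vec.map Tape.current (proj₂ c)
      before≡  : ∀ τ → before b ! τ ≡ cellAt p (Tape.before (tapeAt c τ))
      behind≡  : ∀ τ → behind b ! τ ≡ cellAt p (Tape.after (tapeAt c τ))

  open Shows

  tape-successor : ∀ c {p b} τ → Shows c p b → tapeAt (successor c) τ ≡ act (action b τ) (tapeAt c τ)
  tape-successor (q , ts) τ sh rewrite state≡ sh | scanned≡ sh = Vec.lookup-zipWith act τ (proj₂ (next q (Vec.map Tape.current ts))) ts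

  module _ (c : Config) where

    private
      moved : ∀ {p b} τ d → Shows c p b → direction b τ ≡ d → tapeAt (successor c) τ ≡ act (written b τ , d) (tapeAt c τ)
      moved {b = b} τ d sh refl = tape-successor c τ sh

    before-step : ∀ {p b} τ → Shows c p b → ∀ i →
      (direction b τ ≡ right → cellAt (suc i) (Tape.before (tapeAt (successor c) τ)) ≡ cellAt i (Tape.before (tapeAt c τ)))
      × (direction b τ ≡ left → cellAt i (Tape.before (tapeAt (successor c) τ)) ≡ cellAt (suc i) (Tape.before (tapeAt c τ)))
      × (direction b τ ≡ stay → cellAt i (Tape.before (tapeAt (successor c) τ)) ≡ cellAt i (Tape.before (tapeAt c τ)))
      × (direction b τ ≡ right → cellAt 0 (Tape.before (tapeAt (successor c) τ)) ≡ written b τ)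
    before-step {b = b} τ sh i =
      (λ d → trans (cong (cellAt (suc i) ∘ Tape.before) (moved τ right sh d)) (right-before-suc i _ (tapeAt c τ))) ,
      (λ d → trans (cong (cellAt i ∘ Tape.before) (moved τ left sh d)) (left-before i _ (tapeAt c τ))) ,
      (λ d → cong (cellAt i ∘ Tape.before) (moved τ stay sh d)) ,
      (λ d → trans (cong (cellAt 0 ∘ Tape.before) (moved τ right sh d)) (right-before-zero _ (tapeAt c τ)))

    behind-step : ∀ {p b} τ → Shows c p b → ∀ i →
      (direction b τ ≡ right → cellAt i (Tape.after (tapeAt (successor c) τ)) ≡ cellAt (suc i) (Tape.after (tapeAt c τ)))
      × (direction b τ ≡ left → cellAt (suc i) (Tape.after (tapeAt (successor c) τ)) ≡ cellAt i (Tape.after (tapeAt c τ)))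
      × (direction b τ ≡ stay → cellAt i (Tape.after (tapeAt (successor c) τ)) ≡ cellAt i (Tape.after (tapeAt c τ)))
      × (direction b τ ≡ left → cellAt 0 (Tape.after (tapeAt (successor c) τ)) ≡ written b τ)
    behind-step {b = b} τ sh i =
      (λ d → trans (cong (cellAt i ∘ Tape.after) (moved τ right sh d)) (right-after i _ (tapeAt c τ))) ,
      (λ d → trans (cong (cellAt (suc i) ∘ Tape.after) (moved τ left sh d)) (left-after-suc i _ (tapeAt c τ))) ,
      (λ d → cong (cellAt i ∘ Tape.after) (moved τ stay sh d)) ,
      (λ d → trans (cong (cellAt 0 ∘ Tape.after) (moved τ left sh d)) (left-after-zero _ (tapeAt c τ)))

    current-step : ∀ {p b} τ → Shows c p b →
      (direction b τ ≡ right → Tape.current (tapeAt (successor c) τ) ≡ cellAt 0 (Tape.after (tapeAt c τ)))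
      × (direction b τ ≡ left → Tape.current (tapeAt (successor c) τ) ≡ cellAt 0 (Tape.before (tapeAt c τ)))
      × (direction b τ ≡ stay → Tape.current (tapeAt (successor c) τ) ≡ written b τ)
    current-step {b = b} τ sh =
      (λ d → trans (cong Tape.current (moved τ right sh d)) (right-current _ (tapeAt c τ))) ,
      (λ d → trans (cong Tape.current (moved τ left sh d)) (left-current _ (tapeAt c τ))) ,
      (λ d → cong Tape.current (moved τ stay sh d))

    state-step : ∀ {p b} → Shows c p b → proj₁ (next (state b) (scanned b)) ≡ proj₁ (successor c)
    state-step sh rewrite state≡ sh | scanned≡ sh = refl

    direction-at : ∀ {p b p′ b′} τ → Shows c p b → Shows c p′ b′ → direction b′ τ ≡ direction b τ
    direction-at τ sh sh′ rewrite state≡ sh | scanned≡ sh | state≡ sh′ | scanned≡ sh′ = refl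

  module Sound {w : Word} {T Y : ℕ} {β : ℕ → Block} (tableau : Tableau w T Y β) where
    open Tableau tableau

    -- Whatever the first row shows on tape 1 is taken as the certificate. The shape conditions make
    -- it a string of bits followed by blanks.
    guess : ℕ → Symbol
    guess zero    = scanned (β 0) ! suc zero
    guess (suc i) = behind (β i) ! suc zero

    certificate : Word
    certificate = readPrefix W guess

    0<W : 0 < W
    0<W = ℕ.≤-trans (s≤s z≤n) (ℕ.m≤n+m 2 T)

    certificate-symbol : ∀ i → i < W → symbolAt i certificate ≡ guess i
    certificate-symbol = readPrefix-symbol W guess closed′
      where
      closed′ : ∀ i → suc i < W → guess i ≡ blank → guess (suc i) ≡ blank
      closed′ zero    i< = proj₂ (proj₂ (proj₂ (start 0 0<W))) origin₀
      closed′ (suc i) i< h = subst (λ z → behind (β z) ! suc zero ≡ blank) (ℕ.+-comm i 1)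
        (shape₊ i (ℕ.≤-trans (s≤s (ℕ.≤-reflexive (ℕ.+-comm i 1))) (ℕ.<⇒≤ i<)) h)

    certificate-length : length certificate ≤ Y
    certificate-length = length-readPrefix W guess Y blanks
      where
      blanks : ∀ i → i < W → Y ≤ i → guess i ≡ blank
      blanks zero    i< Y≤ = short₀ 0 0<W Y≤
      blanks (suc i) i< Y≤ = short₊ i (ℕ.<⇒≤ i<) (ℕ.≤-trans Y≤ (ℕ.≤-reflexive (ℕ.+-comm 1 i)))

    config : ℕ → Config
    config t = after t (startConfig w certificate)

    config-suc : ∀ t → config (suc t) ≡ successor (config t)
    config-suc t = after-suc t (startConfig w certificate)

    first-row : ∀ p → p + 1 < W → Shows (config 0) p (β p)
    first-row p p< = shows-config (origin-case p p<W) (proj₁ (start p p<W))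
        (scanned-row p p<)
        (λ τ → trans (proj₁ (proj₂ (start p p<W)) τ) (sym (before-blank τ)))
        behind-case
      where
      p<W : p < W
      p<W = ℕ.≤-trans (ℕ.m≤m+n (suc p) 1) p<
      origin-case : ∀ p → p < W → origin (β p) ≡ (p ≡ᵇ 0)
      origin-case zero    _  = origin₀
      origin-case (suc p) p< = origin₊ (suc p) (s≤s z≤n) p<
      blankTape : ∀ τ → Vec.lookup (Vec.replicate workTapes (writeWord [])) τ ≡ writeWord []
      blankTape τ = Vec.lookup-replicate τ (writeWord [])
      before-blank : ∀ τ → cellAt p (Tape.before (tapeAt (config 0) τ)) ≡ blank
      before-blank zero          = before-writeWord p w
      before-blank (suc zero)    = before-writeWord p certificate
      before-blank (suc (suc τ)) = cong (cellAt p ∘ Tape.before) (blankTape τ)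
      behind-case : ∀ τ → behind (β p) ! τ ≡ cellAt p (Tape.after (tapeAt (config 0) τ))
      behind-case zero          = trans (input₊ p p<W) (sym (trans (after-writeWord p w) (cong (λ z → symbolAt z w) (ℕ.+-comm 1 p))))
      behind-case (suc zero)    = sym (trans (after-writeWord p certificate) (certificate-symbol (suc p) (ℕ.≤-trans (s≤s (ℕ.≤-reflexive (ℕ.+-comm 1 p))) p<)))
      behind-case (suc (suc τ)) = trans (proj₂ (proj₁ (proj₂ (proj₂ (start p p<W))) τ)) (sym (cong (cellAt p ∘ Tape.after) (blankTape τ)))
      same-symbols : ∀ (u v : Vec Symbol tapes) → (∀ τ → u ! τ ≡ v ! τ) → u ≡ v
      same-symbols u v h = trans (sym (Vec.tabulate∘lookup u)) (trans (Vec.tabulate-cong h) (Vec.tabulate∘lookup v))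
      first-scanned : scanned (β 0) ≡ Vec.map Tape.current (proj₂ (config 0))
      first-scanned = same-symbols _ _ λ τ → trans (symbol τ) (sym (Vec.lookup-map τ Tape.current (proj₂ (config 0))))
        where
        symbol : ∀ τ → scanned (β 0) ! τ ≡ Tape.current (tapeAt (config 0) τ)
        symbol zero          = trans (input₀ 0 0<W) (sym (current-writeWord w))
        symbol (suc zero)    = sym (trans (current-writeWord certificate) (certificate-symbol 0 0<W))
        symbol (suc (suc τ)) = trans (proj₁ (proj₁ (proj₂ (proj₂ (start 0 0<W))) τ)) (sym (cong Tape.current (blankTape τ)))
      scanned-row : ∀ p → p + 1 < W → scanned (β p) ≡ Vec.map Tape.current (proj₂ (config 0))
      scanned-row zero    _  = first-scanned
      scanned-row (suc p) p< = trans (subst (λ z → scanned (β z) ≡ scanned (β p)) (ℕ.+-comm p 1)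
          (proj₂ (control p (ℕ.≤-trans p+1< (ℕ.m≤m*n W W {{>-nonZero 0<W}})) (subst (λ z → origin (β z) ≡ false) (ℕ.+-comm 1 p) (origin₊ (suc p) (s≤s z≤n) (ℕ.≤-trans (ℕ.m≤m+n (suc (suc p)) 1) p<))))))
        (scanned-row p p+1<)
        where
        p+1< : p + 1 < W
        p+1< = ℕ.<⇒≤ p<

    same-vec : ∀ (u v : Vec Symbol tapes) → (∀ τ → u ! τ ≡ v ! τ) → u ≡ v
    same-vec u v h = trans (sym (Vec.tabulate∘lookup u)) (trans (Vec.tabulate-cong h) (Vec.tabulate∘lookup v))

    directions : ∀ {A : Set} d → (d ≡ right → A) → (d ≡ left → A) → (d ≡ stay → A) → A
    directions right r l s = r refl
    directions left  r l s = l refl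
    directions stay  r l s = s refl

    in-range : ∀ p t → p + suc t + 1 < W → p + t * W + W + 1 < N
    in-range p t h = begin-strict
      p + t * W + W + 1      ≡⟨ solve 3 (λ p x W → p :+ x :+ W :+ con 1 := (p :+ con 1) :+ (W :+ x)) refl p (t * W) W ⟩
      (p + 1) + suc t * W    <⟨ ℕ.+-monoˡ-< (suc t * W) (ℕ.≤-<-trans (ℕ.+-monoˡ-≤ 1 (ℕ.m≤m+n p (suc t))) h) ⟩
      W + suc t * W          ≤⟨ ℕ.*-monoˡ-≤ W (ℕ.≤-trans (s≤s (ℕ.m≤n+m (suc t) p)) (ℕ.≤-trans (ℕ.≤-reflexive (ℕ.+-comm 1 (p + suc t))) (ℕ.<⇒≤ h))) ⟩
      N                      ∎
      where
      open ℕ.≤-Reasoning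
      open ℕSolver.+-*-Solver

    above : ∀ p t → p + t * W + W ≡ p + suc t * W
    above p t = trans (ℕ.+-assoc p (t * W) W) (cong (λ z → p + z) (ℕ.+-comm (t * W) W))

    -- In row t only the first W - t - 1 blocks are known to be right, because arbitrary symbols may
    -- enter at the right end and travel one block per step. With W = T + 2 the origin is still
    -- right in row T.
    row : ∀ t p → p + t + 1 < W → Shows (config t) p (β (p + t * W))
    row zero    p h = subst (λ z → Shows (config 0) p (β z)) (sym (ℕ.+-identityʳ p)) (first-row p (subst (λ z → z + 1 < W) (ℕ.+-identityʳ p) h))
    row (suc t) p h = subst (λ c → Shows c p (β (p + suc t * W))) (sym (config-suc t)) (go p h)
      where
      c : Config
      c = config t
      previous : ∀ p → p + suc t + 1 < W → Shows c p (β (p + t * W))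
      previous p h = row t p (ℕ.≤-<-trans (ℕ.+-monoˡ-≤ 1 (ℕ.+-monoʳ-≤ p (ℕ.n≤1+n t))) h)
      previous-right : ∀ p → p + suc t + 1 < W → Shows c (suc p) (β (p + t * W + 1))
      previous-right p h = subst (λ z → Shows c (suc p) (β z)) (ℕ.+-comm 1 (p + t * W)) (row t (suc p) (subst (λ z → z + 1 < W) (ℕ.+-suc p t) h))
      here-step : ∀ p → p + suc t + 1 < W → StepHere (β (p + t * W)) (β (p + suc t * W))
      here-step p h = subst (λ z → StepHere (β (p + t * W)) (β z)) (above p t) (here′ (p + t * W) (in-range p t h))
      right-step : ∀ p → p + suc t + 1 < W → StepFromRight (β (p + t * W + 1)) (β (p + suc t * W))
      right-step p h = subst (λ z → StepFromRight (β (p + t * W + 1)) (β z)) (above p t) (fromRight (p + t * W) (in-range p t h))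
      left-step : ∀ p → suc p + suc t + 1 < W → StepFromLeft (β (p + t * W)) (β (suc p + suc t * W))
      left-step p h = subst (λ z → StepFromLeft (β (p + t * W)) (β z)) (trans (ℕ.+-comm _ 1) (cong suc (above p t))) (fromLeft (p + t * W) (in-range p t (ℕ.<⇒≤ h)))
      origin-at : ∀ p → p + suc t + 1 < W → origin (β (p + suc t * W)) ≡ (p ≡ᵇ 0)
      origin-at p h = trans (proj₁ (here-step p h)) (origin≡ (previous p h))
      before-at : ∀ p → p + suc t + 1 < W → ∀ τ → before (β (p + suc t * W)) ! τ ≡ cellAt p (Tape.before (tapeAt (successor c) τ))
      before-at p h τ = directions (direction b τ)
          (λ d → rightward p h d)
          (λ d → trans (proj₂ (right-step p h (origin≡ (previous-right p h)) τ) (trans (direction-at c τ (previous p h) (previous-right p h)) d))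
            (trans (before≡ (previous-right p h) τ) (sym (proj₁ (proj₂ (before-step c τ (previous p h) p)) d))))
          (λ d → trans (proj₁ (proj₁ (proj₂ (here-step p h)) τ d)) (trans (before≡ (previous p h) τ) (sym (proj₁ (proj₂ (proj₂ (before-step c τ (previous p h) p))) d))))
        where
        b : Block
        b = β (p + t * W)
        rightward : ∀ p (h : p + suc t + 1 < W) → direction (β (p + t * W)) τ ≡ right → before (β (p + suc t * W)) ! τ ≡ cellAt p (Tape.before (tapeAt (successor c) τ))
        rightward zero    h d = trans (proj₁ (proj₁ (proj₂ (proj₂ (proj₂ (here-step 0 h)) (origin≡ (previous 0 h))) τ) d)) (sym (proj₂ (proj₂ (proj₂ (before-step c τ (previous 0 h) 0))) d))
        rightward (suc p) h d = trans (proj₁ (left-step p h (origin-at (suc p) h) τ) d′) (trans (before≡ sh τ) (sym (proj₁ (before-step c τ sh p) d′)))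
          where
          sh = previous p (ℕ.<⇒≤ h)
          d′ = trans (sym (direction-at c τ sh (previous (suc p) h))) d
      behind-at : ∀ p → p + suc t + 1 < W → ∀ τ → behind (β (p + suc t * W)) ! τ ≡ cellAt p (Tape.after (tapeAt (successor c) τ))
      behind-at p h τ = directions (direction b τ)
          (λ d → trans (proj₁ (right-step p h (origin≡ (previous-right p h)) τ) (trans (direction-at c τ (previous p h) (previous-right p h)) d))
            (trans (behind≡ (previous-right p h) τ) (sym (proj₁ (behind-step c τ (previous p h) p) d))))
          (λ d → leftward p h d)
          (λ d → trans (proj₂ (proj₁ (proj₂ (here-step p h)) τ d)) (trans (behind≡ (previous p h) τ) (sym (proj₁ (proj₂ (proj₂ (behind-step c τ (previous p h) p))) d))))
        where
        b : Block
        b = β (p + t * W)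
        leftward : ∀ p (h : p + suc t + 1 < W) → direction (β (p + t * W)) τ ≡ left → behind (β (p + suc t * W)) ! τ ≡ cellAt p (Tape.after (tapeAt (successor c) τ))
        leftward zero    h d = trans (proj₁ (proj₁ (proj₂ (proj₂ (proj₂ (proj₂ (here-step 0 h)) (origin≡ (previous 0 h))) τ)) d)) (sym (proj₂ (proj₂ (proj₂ (behind-step c τ (previous 0 h) 0))) d))
        leftward (suc p) h d = trans (proj₂ (left-step p h (origin-at (suc p) h) τ) d′) (trans (behind≡ sh τ) (sym (proj₁ (proj₂ (behind-step c τ sh p)) d′)))
          where
          sh = previous p (ℕ.<⇒≤ h)
          d′ = trans (sym (direction-at c τ sh (previous (suc p) h))) d
      control-at : ∀ p → p + suc t + 1 < W → state (β (p + suc t * W)) ≡ proj₁ (successor c) × scanned (β (p + suc t * W)) ≡ Vec.map Tape.current (proj₂ (successor c))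
      control-at zero h = trans (proj₁ origin-step) (state-step c sh) , same-vec _ _ λ τ → trans (symbol τ) (sym (Vec.lookup-map τ Tape.current (proj₂ (successor c))))
        where
        sh = previous 0 h
        origin-step = proj₂ (proj₂ (here-step 0 h)) (origin≡ sh)
        symbol : ∀ τ → scanned (β (suc t * W)) ! τ ≡ Tape.current (tapeAt (successor c) τ)
        symbol τ = directions (direction (β (t * W)) τ)
          (λ d → trans (proj₂ (proj₁ (proj₂ origin-step τ) d)) (trans (behind≡ sh τ) (sym (proj₁ (current-step c τ sh) d))))
          (λ d → trans (proj₂ (proj₁ (proj₂ (proj₂ origin-step τ)) d)) (trans (before≡ sh τ) (sym (proj₁ (proj₂ (current-step c τ sh)) d))))
          (λ d → trans (proj₂ (proj₂ (proj₂ origin-step τ)) d) (sym (proj₂ (proj₂ (current-step c τ sh)) d)))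
      control-at (suc p) h = let (q≡ , s≡) = control-at p (ℕ.<⇒≤ h) in trans (proj₁ same) q≡ , trans (proj₂ same) s≡
        where
        s : ℕ
        s = p + suc t * W
        s+1≡ : s + 1 ≡ suc p + suc t * W
        s+1≡ = ℕ.+-comm s 1
        s+1< : s + 1 < N
        s+1< = subst (λ z → z + 1 < N) (above p t) (in-range p t (ℕ.<⇒≤ h))
        same : state (β (suc s)) ≡ state (β s) × scanned (β (suc s)) ≡ scanned (β s)
        same = subst (λ z → state (β z) ≡ state (β s) × scanned (β z) ≡ scanned (β s)) s+1≡
          (control s s+1< (subst (λ z → origin (β z) ≡ false) (sym s+1≡) (origin-at (suc p) h)))
      go : ∀ p → p + suc t + 1 < W → Shows (successor c) p (β (p + suc t * W))
      go p h = shows-config (origin-at p h) (proj₁ (control-at p h)) (proj₂ (control-at p h)) (before-at p h) (behind-at p h)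

    accepted : run V ⊥-elim T w certificate ≡ just true
    accepted = run-accepting T initial _ (subst Accepting (state≡ (row T 0 (ℕ.≤-reflexive (sym (ℕ.+-suc T 1))))) final)

  module Complete (w y : Word) (T Y : ℕ) (y≤ : length y ≤ Y) (accepts : run V ⊥-elim T w y ≡ just true) where

    W : ℕ
    W = T + 2

    instance
      W-nonZero : NonZero W
      W-nonZero = >-nonZero (ℕ.≤-trans (s≤s z≤n) (ℕ.m≤n+m 2 T))

    config : ℕ → Config
    config t = after t (startConfig w y)

    blockAt : ℕ → ℕ → Block
    blockAt t p = block (p ≡ᵇ 0) (proj₁ (config t)) (Vec.map Tape.current (proj₂ (config t)))
      (Vec.map (cellAt p ∘ Tape.before) (proj₂ (config t))) (Vec.map (cellAt p ∘ Tape.after) (proj₂ (config t)))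

    shown : ∀ t p → Shows (config t) p (blockAt t p)
    shown t p = shows-config refl refl refl (λ τ → Vec.lookup-map τ _ (proj₂ (config t))) (λ τ → Vec.lookup-map τ _ (proj₂ (config t)))

    β : ℕ → Block
    β s = blockAt (s / W) (s % W)

    β-at : ∀ t p → p < W → β (p + t * W) ≡ blockAt t p
    β-at t p p<W = cong₂ blockAt
      (trans (ℕ.+-distrib-/-∣ʳ p (ℕ.n∣m*n t)) (trans (cong₂ _+_ (ℕ.m<n⇒m/n≡0 p<W) (ℕ.m*n/n≡m t W)) refl))
      (trans (ℕ.[m+kn]%n≡m%n p t W) (ℕ.m<n⇒m%n≡m p<W))

    split : ∀ s → ∃[ p ] ∃[ t ] p < W × s ≡ p + t * W
    split s = s % W , s / W , ℕ.m%n<n s W , ℕ.m≡m%n+[m/n]*n s W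

    β-here : ∀ {s} p t → p < W → s ≡ p + t * W → β s ≡ blockAt t p
    β-here p t p< refl = β-at t p p<

    up-eq : ∀ {s p t} → s ≡ p + t * W → s + W ≡ p + suc t * W
    up-eq {p = p} {t} refl = trans (ℕ.+-assoc p (t * W) W) (cong (λ z → p + z) (ℕ.+-comm (t * W) W))

    -- The constraints also relate the last block of a row to the origin of the next one. In that
    -- second case they hold vacuously.
    next-block : ∀ {s} p t → p < W → s ≡ p + t * W → (suc p < W × β (s + 1) ≡ blockAt t (suc p)) ⊎ (β (s + 1) ≡ blockAt (suc t) 0)
    next-block {s} p t p< s≡ with suc p <? W
    ... | yes sp< = inj₁ (sp< , β-here (suc p) t sp< (trans (ℕ.+-comm s 1) (cong suc s≡)))
    ... | no sp≮  = inj₂ (β-here 0 (suc t) (>-nonZero⁻¹ W) (trans (ℕ.+-comm s 1) (trans (cong suc s≡) (cong (_+ t * W) (ℕ.≤-antisym p< (ℕ.≮⇒≥ sp≮))))))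

    stepped : ∀ t p → Shows (successor (config t)) p (blockAt (suc t) p)
    stepped t p = subst (λ c → Shows c p (blockAt (suc t) p)) (after-suc t (startConfig w y)) (shown (suc t) p)

    step-stay : ∀ t p τ → direction (blockAt t p) τ ≡ stay → before (blockAt (suc t) p) ! τ ≡ before (blockAt t p) ! τ × behind (blockAt (suc t) p) ! τ ≡ behind (blockAt t p) ! τ
    step-stay t p τ d = trans (before≡ (stepped t p) τ) (trans (proj₁ (proj₂ (proj₂ (before-step (config t) τ (shown t p) p))) d) (sym (before≡ (shown t p) τ))) ,
        trans (behind≡ (stepped t p) τ) (trans (proj₁ (proj₂ (proj₂ (behind-step (config t) τ (shown t p) p))) d) (sym (behind≡ (shown t p) τ)))

    step-here : ∀ t p → StepHere (blockAt t p) (blockAt (suc t) p)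
    step-here t zero = refl , step-stay t 0 , λ _ → state≡ (stepped t 0) , λ τ →
        (λ d → trans (before≡ (stepped t 0) τ) (proj₂ (proj₂ (proj₂ (before-step (config t) τ (shown t 0) 0))) d) ,
          trans (scanned-step τ) (trans (proj₁ (current-step (config t) τ (shown t 0)) d) (sym (behind≡ (shown t 0) τ)))) ,
        (λ d → trans (behind≡ (stepped t 0) τ) (proj₂ (proj₂ (proj₂ (behind-step (config t) τ (shown t 0) 0))) d) ,
          trans (scanned-step τ) (trans (proj₁ (proj₂ (current-step (config t) τ (shown t 0))) d) (sym (before≡ (shown t 0) τ)))) ,
        (λ d → trans (scanned-step τ) (proj₂ (proj₂ (current-step (config t) τ (shown t 0))) d))
      where
      scanned-step : ∀ τ → scanned (blockAt (suc t) 0) ! τ ≡ Tape.current (tapeAt (successor (config t)) τ)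
      scanned-step τ = trans (cong (_! τ) (scanned≡ (stepped t 0))) (Vec.lookup-map τ Tape.current (proj₂ (successor (config t))))
    step-here t (suc p) = refl , step-stay t (suc p) , λ ()

    step-from-right : ∀ t p → StepFromRight (blockAt t (suc p)) (blockAt (suc t) p)
    step-from-right t p _ τ =
      (λ d → trans (behind≡ (stepped t p) τ) (trans (proj₁ (behind-step (config t) τ (shown t (suc p)) p) d) (sym (behind≡ (shown t (suc p)) τ)))) ,
      (λ d → trans (before≡ (stepped t p) τ) (trans (proj₁ (proj₂ (before-step (config t) τ (shown t (suc p)) p)) d) (sym (before≡ (shown t (suc p)) τ))))

    step-from-left : ∀ t p → StepFromLeft (blockAt t p) (blockAt (suc t) (suc p))
    step-from-left t p _ τ =
      (λ d → trans (before≡ (stepped t (suc p)) τ) (trans (proj₁ (before-step (config t) τ (shown t p) p) d) (sym (before≡ (shown t p) τ)))) ,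
      (λ d → trans (behind≡ (stepped t (suc p)) τ) (trans (proj₁ (proj₂ (behind-step (config t) τ (shown t p) p)) d) (sym (behind≡ (shown t p) τ))))

    first : ∀ {s} → s < W → β s ≡ blockAt 0 s
    first {s} s< = β-here s 0 s< (sym (ℕ.+-identityʳ s))

    blankTape : ∀ {τ} → Vec.lookup (Vec.replicate workTapes (writeWord [])) τ ≡ writeWord []
    blankTape {τ} = Vec.lookup-replicate τ (writeWord [])

    behind-input : ∀ s → behind (blockAt 0 s) ! zero ≡ symbolAt (s + 1) w
    behind-input s = trans (after-writeWord s w) (cong (λ z → symbolAt z w) (ℕ.+-comm 1 s))

    behind-certificate : ∀ s → behind (blockAt 0 s) ! suc zero ≡ symbolAt (suc s) y
    behind-certificate s = after-writeWord s y

    initial-first : ∀ s → Initial (blockAt 0 s)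
    initial-first s = refl , (λ τ → trans (before≡ (shown 0 s) τ) (before-blank τ)) ,
      (λ τ → trans (Vec.lookup-map τ Tape.current (Vec.replicate workTapes (writeWord []))) (cong Tape.current (blankTape {τ})) , trans (behind≡ (shown 0 s) (suc (suc τ))) (cong (cellAt s ∘ Tape.after) (blankTape {τ}))) ,
      at-origin s
      where
      before-blank : ∀ τ → cellAt s (Tape.before (tapeAt (config 0) τ)) ≡ blank
      before-blank zero          = before-writeWord s w
      before-blank (suc zero)    = before-writeWord s y
      before-blank (suc (suc τ)) = cong (cellAt s ∘ Tape.before) (blankTape {τ})
      at-origin : ∀ s → (s ≡ᵇ 0) ≡ true → Tape.current (writeWord y) ≡ blank → behind (blockAt 0 s) ! suc zero ≡ blank
      at-origin zero _ h = trans (behind-certificate 0) (symbolAt-blank-suc 0 y (trans (sym (current-writeWord y)) h))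

    tableau : Tableau w T Y β
    tableau = record
      { control = λ s _ → [ (λ (_ , e) → subst (SameControl (β s)) (sym e) (λ _ → refl , refl)) , (λ e → subst (SameControl (β s)) (sym e) (λ ())) ]′ (adjacent s)
      ; here′ = λ s _ → subst (StepHere (β s)) (sym (up s)) (step-here (s / W) (s % W))
      ; fromRight = λ s _ → subst (StepFromRight (β (s + 1))) (sym (up s))
          ([ (λ (_ , e) → subst (λ b → StepFromRight b (blockAt (suc (s / W)) (s % W))) (sym e) (step-from-right (s / W) (s % W)))
           , (λ e → subst (λ b → StepFromRight b (blockAt (suc (s / W)) (s % W))) (sym e) (λ ())) ]′ (adjacent s))
      ; fromLeft = λ s _ → [ (λ (_ , e) → subst (StepFromLeft (β s)) (sym e) (step-from-left (s / W) (s % W))) , (λ e → subst (StepFromLeft (β s)) (sym e) (λ ())) ]′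
          (next-block (s % W) (suc (s / W)) (ℕ.m%n<n s W) (up-eq {s} {s % W} {s / W} (ℕ.m≡m%n+[m/n]*n s W)))
      ; start = λ s s< → subst Initial (sym (first s<)) (initial-first s)
      ; origin₀ = cong origin (first (>-nonZero⁻¹ W))
      ; origin₊ = λ { zero () _ ; (suc s) _ s< → cong origin (first s<) }
      ; input₀ = λ s s< → trans (cong (λ b → scanned b ! zero) (first s<)) (current-writeWord w)
      ; input₊ = λ s s< → trans (cong (λ b → behind b ! zero) (first s<)) (behind-input s)
      ; short₀ = λ s s< Y≤ → trans (cong (λ b → scanned b ! suc zero) (first s<)) (trans (current-writeWord y) (symbolAt-beyond 0 y (ℕ.≤-trans y≤ Y≤)))
      ; short₊ = λ s s< Y≤ → trans (cong (λ b → behind b ! suc zero) (first s<)) (trans (behind-certificate s)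
          (symbolAt-beyond (suc s) y (ℕ.≤-trans y≤ (ℕ.≤-trans Y≤ (ℕ.≤-reflexive (ℕ.+-comm s 1))))))
      ; shape₊ = λ s s+1< → subst₂ Shaped (sym (first (ℕ.≤-trans (ℕ.m≤m+n (suc s) 1) s+1<))) (sym (trans (cong β (ℕ.+-comm s 1)) (first (subst (_< W) (ℕ.+-comm s 1) s+1<))))
          (λ h → trans (behind-certificate (suc s)) (symbolAt-blank-suc (suc s) y (trans (sym (behind-certificate s)) h)))
      ; final = subst (Accepting ∘ state) (sym (β-here 0 T (>-nonZero⁻¹ W) refl)) (accepting-run T initial _ accepts)
      }
      where
      adjacent : ∀ s → (suc (s % W) < W × β (s + 1) ≡ blockAt (s / W) (suc (s % W))) ⊎ (β (s + 1) ≡ blockAt (suc (s / W)) 0)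
      adjacent s = next-block (s % W) (s / W) (ℕ.m%n<n s W) (ℕ.m≡m%n+[m/n]*n s W)
      up : ∀ s → β (s + W) ≡ blockAt (suc (s / W)) (s % W)
      up s = β-here (s % W) (suc (s / W)) (ℕ.m%n<n s W) (up-eq {s} {s % W} {s / W} (ℕ.m≡m%n+[m/n]*n s W))

-- Lists indexed from the end, and conditions as arithmetic.

fromEnd : ∀ {A : Set} → A → List A → ℕ → A
fromEnd d []       κ = d
fromEnd d (c ∷ cs) κ = if κ ≡ᵇ length cs then c else fromEnd d cs κ

fromEnd-last : ∀ {A : Set} d (c : A) cs → fromEnd d (c ∷ cs) (length cs) ≡ c
fromEnd-last d c cs with length cs ≡ᵇ length cs in eq
... | true  = refl
... | false = contradiction (trans (sym eq) (bool (length cs))) λ ()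
  where
  bool : ∀ n → (n ≡ᵇ n) ≡ true
  bool zero    = refl
  bool (suc n) = bool n

fromEnd-< : ∀ {A : Set} d (c : A) cs {κ} → κ < length cs → fromEnd d (c ∷ cs) κ ≡ fromEnd d cs κ
fromEnd-< d c cs {κ} κ< with κ ≡ᵇ length cs in eq
... | true  = contradiction (ℕ.≡ᵇ⇒≡ κ (length cs) (subst T (sym eq) tt)) (ℕ.<⇒≢ κ<)
... | false = refl

fromEnd∈ : ∀ {A : Set} d (cs : List A) κ → κ < length cs → fromEnd d cs κ ∈ cs
fromEnd∈ d (c ∷ cs) κ κ< with κ ≡ᵇ length cs in eq
... | true  = here refl
... | false = there (fromEnd∈ d cs κ (ℕ.≤∧≢⇒< (ℕ.≤-pred κ<) λ κ≡ → subst T eq (ℕ.≡⇒≡ᵇ κ (length cs) κ≡)))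

∈-fromEnd : ∀ {A : Set} d (cs : List A) {c} → c ∈ cs → ∃[ κ ] κ < length cs × fromEnd d cs κ ≡ c
∈-fromEnd d (c ∷ cs) (here refl) = length cs , ℕ.≤-refl , fromEnd-last d c cs
∈-fromEnd d (c ∷ cs) (there c∈) = let (κ , κ< , eq) = ∈-fromEnd d cs c∈ in κ , ℕ.m≤n⇒m≤1+n κ< , trans (fromEnd-< d c cs κ<) eq

loop-cong : ∀ {A : Set} n {f g : ℕ → List A} → (∀ i → i < n → f i ≡ g i) → loop n f ≡ loop n g
loop-cong zero    h = refl
loop-cong (suc n) h = cong₂ _++_ (h n ℕ.≤-refl) (loop-cong n λ i i< → h i (ℕ.m≤n⇒m≤1+n i<))

loop-fromEnd : ∀ {A B : Set} d (cs : List A) (g : A → List B) → loop (length cs) (g ∘ fromEnd d cs) ≡ concatMap g cs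
loop-fromEnd d []       g = refl
loop-fromEnd d (c ∷ cs) g = cong₂ _++_ (cong g (fromEnd-last d c cs))
  (trans (loop-cong (length cs) λ κ κ< → cong g (fromEnd-< d c cs κ<)) (loop-fromEnd d cs g))

loop-+ : ∀ {A : Set} m n (f : ℕ → List A) → loop (m + n) f ≡ loop n (λ i → f (m + i)) ++ loop m f
loop-+ m zero    f = cong (λ z → loop z f) (ℕ.+-identityʳ m)
loop-+ m (suc n) f = trans (cong (λ z → loop z f) (ℕ.+-suc m n)) (trans (cong (f (m + n) ++_) (loop-+ m n f)) (sym (List.++-assoc (f (m + n)) _ _)))

loop-* : ∀ {A : Set} n k (f : ℕ → List A) → loop (n * k) f ≡ loop n (λ s → loop k (λ κ → f (s * k + κ)))
loop-* zero    k f = refl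
loop-* (suc n) k f = trans (cong (λ z → loop z f) (ℕ.+-comm k (n * k))) (trans (loop-+ (n * k) k f) (cong (loop k (λ κ → f (n * k + κ)) ++_) (loop-* n k f)))

infix 5 _≺_
-- A condition is an expression that is positive exactly when it holds; conjunction is then
-- multiplication.
_≺_ : ∀ {n} → Expr n → Expr n → Expr n
e ≺ f = f ⊖ e

-- A conditional without branching: 1 ∸ (1 ∸ e) is 1 for every positive e, so exactly one of the two
-- products survives.
select : ∀ {n} → Expr n → Expr n → Expr n → Expr n
select e x y = ((num 1 ⊖ (num 1 ⊖ e)) ⊗ x) ⊕ ((num 1 ⊖ e) ⊗ y)

*-positive : ∀ {a b} → 0 < a → 0 < b → 0 < a * b
*-positive {suc a} {suc b} _ _ = s≤s z≤n

*-positive⁻ : ∀ a b → 0 < a * b → 0 < a × 0 < b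
*-positive⁻ (suc a) (suc b) _ = s≤s z≤n , s≤s z≤n
*-positive⁻ (suc a) zero h = contradiction h (subst (λ z → ¬ 0 < z) (sym (ℕ.*-zeroʳ a)) λ ())

∸-positive⁻ : ∀ {a b} → 0 < b ∸ a → a < b
∸-positive⁻ {a} {b} h = ℕ.≰⇒> λ b≤a → contradiction (subst (0 <_) (ℕ.m≤n⇒m∸n≡0 b≤a) h) λ ()

module _ (w : Word) where
  open Semantics w

  ≺⁺ : ∀ {n} (e f : Expr n) env {a b} → value e env ≡ a → value f env ≡ b → a < b → 0 < value (e ≺ f) env
  ≺⁺ e f env refl refl = ℕ.m<n⇒0<n∸m

  ≺⁻ : ∀ {n} (e f : Expr n) env {a b} → value e env ≡ a → value f env ≡ b → 0 < value (e ≺ f) env → a < b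
  ≺⁻ e f env refl refl = ∸-positive⁻

  select-positive : ∀ {n} (e x y : Expr n) env → 0 < value e env → value (select e x y) env ≡ value x env
  select-positive e x y env h with value e env
  ... | suc v rewrite ℕ.0∸n≡0 v = trans (ℕ.+-identityʳ _) (ℕ.*-identityˡ _)

  select-zero : ∀ {n} (e x y : Expr n) env → ¬ 0 < value e env → value (select e x y) env ≡ value y env
  select-zero e x y env h with value e env
  ... | zero  = ℕ.*-identityˡ _
  ... | suc v = contradiction (s≤s z≤n) h

-- Local constraints as clauses of unmixed sign.

record Constraint (A : Set) : Set₁ where
  field
    guard first second : Expr 1
    Rel  : A → A → Set
    rel? : ∀ a b → Dec (Rel a b)

open Constraint

-- Every position s < N carries one element of the enumeration; column s σ + a says that it is
-- element a. The value a = m is never allowed, so its column can serve in vacuous clauses.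
module Encoding {A : Set} (enum : List A) (index∈ : ∀ a → a ∈ enum) (constraints : List (Constraint A)) (positions : ∀ {n} → Expr n) where

  m σ : ℕ
  m = length enum
  σ = suc m

  column : Expr 1 → ℕ → Expr 1
  column p a = (p ⊗ num σ) ⊕ num a

  junk : Expr 1
  junk = column (var zero) m

  Clause : Set
  Clause = Expr 1 × Expr 1

  junkClause : Clause
  junkClause = junk , junk

  -- Where the guard fails or a position lies off the board, the clauses of a constraint must
  -- exclude nothing; they degenerate to the junk column. So each position has the same number of
  -- clauses and row numbers stay arithmetic.
  active : Constraint A → Expr 1
  active c = guard c ⊗ ((first c ≺ positions) ⊗ (second c ≺ positions))

  clause : Constraint A → Fin m × Fin m → Clause
  clause c (i , j) = select (active c) (column (first c) (toℕ i)) junk , select (active c) (column (second c) (toℕ j)) junk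

  Excluded : Constraint A → Fin m × Fin m → Set
  Excluded c (i , j) = ¬ Rel c (List.lookup enum i) (List.lookup enum j)

  excluded? : ∀ c ij → Dec (Excluded c ij)
  excluded? c (i , j) = ¬? (rel? c (List.lookup enum i) (List.lookup enum j))

  clausesOf : Constraint A → List Clause
  clausesOf c = map (clause c) (List.filter (excluded? c) (List.cartesianProduct (List.allFin m) (List.allFin m)))

  clauses : List Clause
  clauses = junkClause ∷ concatMap clausesOf constraints

  κ# : ℕ
  κ# = length clauses

  clauseAt : ℕ → Clause
  clauseAt = fromEnd junkClause clauses

  clause∈⁺ : ∀ {c} i j → c ∈ constraints → Excluded c (i , j) → clause c (i , j) ∈ clauses
  clause∈⁺ {c} i j c∈ ex = there (∈.∈-concatMap⁺ clausesOf {xs = constraints} (Any.map (λ { refl → ∈.∈-map⁺ (clause c)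
    (∈.∈-filter⁺ (excluded? c) (∈.∈-cartesianProduct⁺ (∈.∈-allFin i) (∈.∈-allFin j)) ex) }) c∈))

  clause∈⁻ : ∀ {x} → x ∈ clauses → x ≡ junkClause ⊎ ∃[ c ] c ∈ constraints × ∃[ ij ] Excluded c ij × x ≡ clause c ij
  clause∈⁻ (here refl) = inj₁ refl
  clause∈⁻ (there x∈) = inj₂ (lemma (∈.∈-concatMap⁻ clausesOf {xs = constraints} x∈))
    where
    lemma : ∀ {x cs} → Any (λ c → x ∈ clausesOf c) cs → ∃[ c ] c ∈ cs × ∃[ ij ] Excluded c ij × x ≡ clause c ij
    lemma {cs = c List.∷ _} (here x∈) = let (ij , ij∈ , eq) = ∈.∈-map⁻ (clause c) x∈ in
      c , here refl , ij , proj₂ (∈.∈-filter⁻ (excluded? c) {xs = List.cartesianProduct (List.allFin m) (List.allFin m)} ij∈) , eq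
    lemma (there x∈) = let (c , c∈ , r) = lemma x∈ in c , there c∈ , r

  module Rows (w : Word) (N : ℕ) (0<N : 0 < N) (positions≡ : ∀ env → Semantics.value w (positions {1}) env ≡ N) where
    open Semantics w

    at : Expr 1 → ℕ → ℕ
    at e s = value e (s ∷ [])

    positive : ℕ → List ℕ
    positive s = loop σ λ a → s * σ + a ∷ []

    -- The two columns can coincide, as in vacuous clauses, and a repeated literal would mean a
    -- repeated point.
    distinctPair : ℕ → ℕ → List ℕ
    distinctPair u v = u ∷ (if 0 <ᵇ (u ∸ v) + (v ∸ u) then v ∷ [] else [])

    negative : ℕ → ℕ → List ℕ
    negative s κ = distinctPair (at (proj₁ (clauseAt κ)) s) (at (proj₂ (clauseAt κ)) s)

    -- From N on, row numbers encode position and clause in mixed radix. The empty clause occurs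
    -- only for numbers beyond R, where it lets `literals<` hold without a range condition.
    literals : ℕ → List ℕ
    literals i = if i <ᵇ N then positive i else (if (i ∸ N) / κ# <ᵇ N then negative ((i ∸ N) / κ#) ((i ∸ N) % κ#) else [])

    R C : ℕ
    R = N + N * κ#
    C = N * σ

    split-if : ∀ {B : Set} i (x y : B) {P : B → Set} → (i < N → P x) → (¬ i < N → P y) → P (if i <ᵇ N then x else y)
    split-if i x y f g with i <ᵇ N in eq
    ... | true  = f (ℕ.<ᵇ⇒< i N (subst T (sym eq) tt))
    ... | false = g λ i< → subst T eq (ℕ.<⇒<ᵇ i<)

    if-true : ∀ {B : Set} i (x y : B) → i < N → (if i <ᵇ N then x else y) ≡ x
    if-true i x y i< = split-if i x y {_≡ x} (λ _ → refl) (λ i≮ → contradiction i< i≮)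

    if-false : ∀ {B : Set} i (x y : B) → ¬ i < N → (if i <ᵇ N then x else y) ≡ y
    if-false i x y i≮ = split-if i x y {_≡ y} (λ i< → contradiction i< i≮) (λ _ → refl)

    literals-positive : ∀ s → s < N → literals s ≡ positive s
    literals-positive s = if-true s _ _

    literals-negative : ∀ s κ → s < N → κ < κ# → literals (N + (s * κ# + κ)) ≡ negative s κ
    literals-negative s κ s< κ< = trans (if-false (N + (s * κ# + κ)) _ _ (ℕ.m+n≮m N (s * κ# + κ)))
      (trans (cong (λ z → if z / κ# <ᵇ N then negative (z / κ#) (z % κ#) else []) (trans (ℕ.m+n∸m≡n N (s * κ# + κ)) (ℕ.+-comm (s * κ#) κ)))
      (trans (cong₂ (λ t z → if t <ᵇ N then negative t z else []) quotient (trans (ℕ.[m+kn]%n≡m%n κ s κ#) (ℕ.m<n⇒m%n≡m κ<))) (if-true s _ _ s<)))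
      where
      quotient : (κ + s * κ#) / κ# ≡ s
      quotient = trans (ℕ.+-distrib-/-∣ʳ κ (ℕ.n∣m*n s)) (cong₂ _+_ (ℕ.m<n⇒m/n≡0 κ<) (ℕ.m*n/n≡m s κ#))

    unique-positive : ∀ s → Unique (positive s)
    unique-positive s = unique-loop σ (λ a → s * σ + a ∷ []) (_∸ s * σ) (λ _ _ → All.[] AllPairs.∷ AllPairs.[]) λ { a (here refl) → ℕ.m+n∸m≡n (s * σ) a }

    unique-distinctPair : ∀ u v → Unique (distinctPair u v)
    unique-distinctPair u v with (u ∸ v) + (v ∸ u) in eq
    ... | zero  = All.[] AllPairs.∷ AllPairs.[]
    ... | suc _ = ((λ { refl → contradiction (trans (sym eq) (cong₂ _+_ (ℕ.n∸n≡0 u) (ℕ.n∸n≡0 u))) λ () }) All.∷ All.[]) AllPairs.∷ All.[] AllPairs.∷ AllPairs.[]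

    literals-unique : ∀ i → Unique (literals i)
    literals-unique i = split-if i _ _ {Unique} (λ _ → unique-positive i)
      (λ _ → split-if ((i ∸ N) / κ#) _ _ {Unique} (λ _ → unique-distinctPair _ _) (λ _ → AllPairs.[]))

    column< : ∀ {p a} → p < N → a < σ → p * σ + a < C
    column< {p} {a} p< a< = ℕ.<-≤-trans (ℕ.+-monoʳ-< (p * σ) a<) (ℕ.≤-trans (ℕ.≤-reflexive (ℕ.+-comm (p * σ) σ)) (ℕ.*-monoˡ-≤ σ p<))

    Active : Constraint A → ℕ → Set
    Active c s = 0 < at (guard c) s × at (first c) s < N × at (second c) s < N

    active⁺ : ∀ c s → Active c s → 0 < at (active c) s
    active⁺ c s (g , p , q) = *-positive g (*-positive (ℕ.m<n⇒0<n∸m (subst (at (first c) s <_) (sym (positions≡ (s ∷ []))) p)) (ℕ.m<n⇒0<n∸m (subst (at (second c) s <_) (sym (positions≡ (s ∷ []))) q)))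

    active⁻ : ∀ c s → 0 < at (active c) s → Active c s
    active⁻ c s h = let (g , pq) = *-positive⁻ (at (guard c) s) _ h ; (p , q) = *-positive⁻ (value positions (s ∷ []) ∸ at (first c) s) _ pq in
      g , subst (at (first c) s <_) (positions≡ (s ∷ [])) (∸-positive⁻ p) , subst (at (second c) s <_) (positions≡ (s ∷ [])) (∸-positive⁻ q)

    data ColumnsOf (x : Clause) (s : ℕ) : Set₁ where
      vacuous : at (proj₁ x) s ≡ s * σ + m → at (proj₂ x) s ≡ s * σ + m → ColumnsOf x s
      excludes : ∀ c i j → c ∈ constraints → Excluded c (i , j) → Active c s →
        at (proj₁ x) s ≡ at (first c) s * σ + toℕ i → at (proj₂ x) s ≡ at (second c) s * σ + toℕ j → ColumnsOf x s

    columnsOf : ∀ {x} s → x ∈ clauses → ColumnsOf x s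
    columnsOf s x∈ with clause∈⁻ x∈
    ... | inj₁ refl = vacuous refl refl
    ... | inj₂ (c , c∈ , (i , j) , ex , refl) with 0 <? at (active c) s
    ...   | yes h = excludes c i j c∈ ex (active⁻ c s h) (select-positive w (active c) (column (first c) (toℕ i)) junk (s ∷ []) h) (select-positive w (active c) (column (second c) (toℕ j)) junk (s ∷ []) h)
    ...   | no h  = vacuous (select-zero w (active c) (column (first c) (toℕ i)) junk (s ∷ []) h) (select-zero w (active c) (column (second c) (toℕ j)) junk (s ∷ []) h)

    columns< : ∀ {x} s → s < N → ColumnsOf x s → at (proj₁ x) s < C × at (proj₂ x) s < C
    columns< s s< (vacuous p q) rewrite p | q = column< s< ℕ.≤-refl , column< s< ℕ.≤-refl
    columns< s s< (excludes c i j _ _ (_ , p< , q<) p q) rewrite p | q = column< p< (ℕ.m≤n⇒m≤1+n (Fin.toℕ<n i)) , column< q< (ℕ.m≤n⇒m≤1+n (Fin.toℕ<n j))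

    ∈-distinctPair : ∀ u v {j} → j ∈ distinctPair u v → j ≡ u ⊎ j ≡ v
    ∈-distinctPair u v (here eq) = inj₁ eq
    ∈-distinctPair u v (there j∈) with 0 <ᵇ (u ∸ v) + (v ∸ u)
    ∈-distinctPair u v (there (here eq)) | true = inj₂ eq

    second∈ : ∀ u v → v ∈ distinctPair u v
    second∈ u v with (u ∸ v) + (v ∸ u) in eq
    ... | zero  = here (ℕ.≤-antisym (ℕ.m∸n≡0⇒m≤n (ℕ.m+n≡0⇒n≡0 (u ∸ v) eq)) (ℕ.m∸n≡0⇒m≤n (ℕ.m+n≡0⇒m≡0 (u ∸ v) eq)))
    ... | suc _ = there (here refl)

    literals< : ∀ i {j} → j ∈ literals i → j < C
    literals< i {j} = split-if i (positive i) _ {λ l → j ∈ l → j < C} (λ i< → positive< i i<)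
      (λ _ → split-if ((i ∸ N) / κ#) (negative ((i ∸ N) / κ#) ((i ∸ N) % κ#)) [] {λ l → j ∈ l → j < C} (λ s< → negative< ((i ∸ N) / κ#) ((i ∸ N) % κ#) s< (ℕ.m%n<n (i ∸ N) κ#)) (λ _ ()))
      where
      positive< : ∀ s → s < N → j ∈ positive s → j < C
      positive< s s< j∈ with ∈-loop⁻ σ {λ a → s * σ + a ∷ []} j∈
      ... | a , a< , here refl = column< s< a<
      negative< : ∀ s κ → s < N → κ < κ# → j ∈ negative s κ → j < C
      negative< s κ s< κ< j∈ = let (u< , v<) = columns< s s< (columnsOf s (fromEnd∈ junkClause clauses κ κ<)) in
        [ (λ eq → subst (_< C) (sym eq) u<) , (λ eq → subst (_< C) (sym eq) v<) ]′ (∈-distinctPair (at (proj₁ (clauseAt κ)) s) (at (proj₂ (clauseAt κ)) s) j∈)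

    Holds : (ℕ → A) → Constraint A → Set
    Holds β c = ∀ s → s < N → Active c s → Rel c (β (at (first c) s)) (β (at (second c) s))

    module _ (k M S : ℕ) (M≡ : M ≡ 32 * (2 + (R + C))) (S≡ : S ≡ 32 * (M * M)) where
      satisfiable⇔small = Board.satisfiable⇔small k R C M S M≡ S≡ N literals literals-unique literals<
      instanceOf = Board.instanceOf k R C M S M≡ S≡ N literals literals-unique literals<
      quota = Board.quota k R C M S M≡ S≡ N literals literals-unique literals<

      module FromSatisfying {X : ℕ → Bool} (sat : Satisfies R N literals X) where
        open Satisfies sat

        not-both : ∀ {x} s → s < N → x ∈ clauses → X (at (proj₁ x) s) ≡ false ⊎ X (at (proj₂ x) s) ≡ false
        not-both s s< x∈ with ∈-fromEnd junkClause clauses x∈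
        ... | κ , κ< , refl with negatives (N + (s * κ# + κ)) row< (ℕ.m+n≮m N (s * κ# + κ))
          where
          row< : N + (s * κ# + κ) < R
          row< = ℕ.+-monoʳ-< N (ℕ.<-≤-trans (ℕ.+-monoʳ-< (s * κ#) κ<) (ℕ.≤-trans (ℕ.≤-reflexive (ℕ.+-comm (s * κ#) κ#)) (ℕ.*-monoˡ-≤ κ# s<)))
        ... | j , j∈ , Xj = [ (λ { refl → inj₁ Xj }) , (λ { refl → inj₂ Xj }) ]′
          (∈-distinctPair (at (proj₁ (clauseAt κ)) s) (at (proj₂ (clauseAt κ)) s) (subst (j ∈_) (literals-negative s κ s< κ<) j∈))

        chosen : ∀ s → s < N → ∃[ i ] X (s * σ + toℕ {m} i) ≡ true
        chosen s s< with positives s (ℕ.<-≤-trans s< (ℕ.m≤m+n N _)) s<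
        ... | j , j∈ , Xj with ∈-loop⁻ σ {λ a → s * σ + a ∷ []} (subst (j ∈_) (literals-positive s s<) j∈)
        ... | a , a< , here refl = Fin.fromℕ< a<m , trans (cong (λ z → X (s * σ + z)) (Fin.toℕ-fromℕ< a<m)) Xj
          where
          a<m : a < m
          -- The junk clause, present at every position, rules out the column m.
          a<m = ℕ.≤∧≢⇒< (ℕ.≤-pred a<) λ { refl → [ (λ e → contradiction (trans (sym Xj) e) λ ()) , (λ e → contradiction (trans (sym Xj) e) λ ()) ]′ (not-both s s< (here refl)) }

        -- Several columns of a position may be true. Any one of them will do, because the excluded
        -- pairs are forbidden among all true columns.
        choice : ℕ → Fin m
        choice s with s <? N
        ... | yes s< = proj₁ (chosen s s<)
        ... | no _   = proj₁ (chosen 0 0<N)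

        choice-true : ∀ s → s < N → X (s * σ + toℕ (choice s)) ≡ true
        choice-true s s< with s <? N
        ... | yes s<′ = proj₂ (chosen s s<′)
        ... | no s≮   = contradiction s< s≮

        β : ℕ → A
        β s = List.lookup enum (choice s)

        respects : ∀ c → c ∈ constraints → Holds β c
        respects c c∈ s s< act@(_ , p< , q<) with rel? c (β (at (first c) s)) (β (at (second c) s))
        ... | yes r = r
        ... | no ¬r = [ (λ e → contradiction (trans (sym (trans (cong X (select-positive w (active c) (column (first c) (toℕ (choice (at (first c) s)))) junk (s ∷ []) (active⁺ c s act))) (choice-true _ p<))) e) λ ())
                      , (λ e → contradiction (trans (sym (trans (cong X (select-positive w (active c) (column (second c) (toℕ (choice (at (second c) s)))) junk (s ∷ []) (active⁺ c s act))) (choice-true _ q<))) e) λ ()) ]′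
                      (not-both s s< (clause∈⁺ (choice (at (first c) s)) (choice (at (second c) s)) c∈ ¬r))

      module ToSatisfying (β : ℕ → A) (respects : ∀ c → c ∈ constraints → Holds β c) where

        element : A → Fin m
        element a = Any.index (index∈ a)

        lookup-code : ∀ a → List.lookup enum (element a) ≡ a
        lookup-code a = sym (AnyP.lookup-index (index∈ a))

        X : ℕ → Bool
        X j = does (j % σ ≟ toℕ (element (β (j / σ))))

        X-column : ∀ p a → a < σ → X (p * σ + a) ≡ does (a ≟ toℕ (element (β p)))
        X-column p a a< = trans (cong X (ℕ.+-comm (p * σ) a)) (cong₂ (λ r q → does (r ≟ toℕ (element (β q)))) (trans (ℕ.[m+kn]%n≡m%n a p σ) (ℕ.m<n⇒m%n≡m a<))
          (trans (ℕ.+-distrib-/-∣ʳ a (ℕ.n∣m*n p)) (cong₂ _+_ (ℕ.m<n⇒m/n≡0 a<) (ℕ.m*n/n≡m p σ))))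

        X-junk : ∀ s → X (s * σ + m) ≡ false
        X-junk s = trans (X-column s m ℕ.≤-refl) (Dec.dec-false (m ≟ _) λ eq → ℕ.<-irrefl (sym eq) (Fin.toℕ<n (element (β s))))

        X-true : ∀ s → X (s * σ + toℕ (element (β s))) ≡ true
        X-true s = trans (X-column s _ (ℕ.m≤n⇒m≤1+n (Fin.toℕ<n (element (β s))))) (Dec.dec-true (toℕ (element (β s)) ≟ _) refl)

        X-false : ∀ p i → i ≢ element (β p) → X (p * σ + toℕ i) ≡ false
        X-false p i i≢ = trans (X-column p _ (ℕ.m≤n⇒m≤1+n (Fin.toℕ<n i))) (Dec.dec-false (toℕ i ≟ _) (i≢ ∘ Fin.toℕ-injective))

        one-false : ∀ x s → s < N → ColumnsOf x s → X (at (proj₁ x) s) ≡ false ⊎ X (at (proj₂ x) s) ≡ false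
        one-false x s s< (vacuous p _) = inj₁ (trans (cong X p) (X-junk s))
        one-false x s s< (excludes c i j c∈ ex act p q) with i Fin.≟ element (β (at (first c) s)) | j Fin.≟ element (β (at (second c) s))
        ... | no i≢ | _ = inj₁ (trans (cong X p) (X-false _ i i≢))
        ... | yes _ | no j≢ = inj₂ (trans (cong X q) (X-false _ j j≢))
        ... | yes refl | yes refl = contradiction (subst₂ (Rel c) (sym (lookup-code _)) (sym (lookup-code _)) (respects c c∈ s s< act)) ex

        satisfied : Satisfies R N literals X
        satisfied = satisfies
          (λ s _ s< → s * σ + toℕ (element (β s)) , subst (s * σ + toℕ (element (β s)) ∈_) (sym (literals-positive s s<)) (∈-loop⁺ {n = σ} {λ a → s * σ + a ∷ []} (toℕ (element (β s))) (ℕ.m≤n⇒m≤1+n (Fin.toℕ<n (element (β s)))) (here refl)) , X-true s)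
          (λ i i< i≮ → subst (λ l → ∃[ j ] j ∈ l × X j ≡ false) (sym (trans (if-false i _ _ i≮) (if-true _ _ _ (row i i< i≮))))
            (witness ((i ∸ N) / κ#) ((i ∸ N) % κ#) (row i i< i≮) (ℕ.m%n<n (i ∸ N) κ#)))
          where
          row : ∀ i → i < R → ¬ i < N → (i ∸ N) / κ# < N
          row i i< i≮ = ℕ.m<n*o⇒m/o<n (ℕ.+-cancelˡ-< N _ _ (subst (_< R) (sym (ℕ.m+[n∸m]≡n (ℕ.≮⇒≥ i≮))) i<))
          witness : ∀ s κ → s < N → κ < κ# → ∃[ j ] j ∈ negative s κ × X j ≡ false
          witness s κ s< κ< = [ (λ e → _ , here refl , e) , (λ e → _ , second∈ (at (proj₁ (clauseAt κ)) s) (at (proj₂ (clauseAt κ)) s) , e) ]′ (one-false (clauseAt κ) s s< (columnsOf s (fromEnd∈ junkClause clauses κ κ<)))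

      encoded : ∀ Q → IsMinimumRegretSet instanceOf Q → (∃[ β ] ∀ c → c ∈ constraints → Holds β c) ⇔ (List⁺.length Q ≤ quota)
      encoded Q minimum = mk⇔
        (λ (β , respects) → Equivalence.to (satisfiable⇔small 0<N (ℕ.m≤m+n N _) Q minimum) (ToSatisfying.X β respects , ToSatisfying.satisfied β respects))
        (λ small → let (X , sat) = Equivalence.from (satisfiable⇔small 0<N (ℕ.m≤m+n N _) Q minimum) small in FromSatisfying.β sat , FromSatisfying.respects sat)

-- The tableau conditions as constraints of fixed number.

powerOf : ∀ {n} → Expr n → ℕ → Expr n
powerOf e zero    = num 1
powerOf e (suc c) = e ⊗ powerOf e c

infix 5 _≐_
_≐_ : ∀ {n} → Expr n → Expr n → Expr n
e ≐ f = (num 1 ⊖ (e ⊖ f)) ⊗ (num 1 ⊖ (f ⊖ e))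

value-power : ∀ w {n} (e : Expr n) c env → Semantics.value w (powerOf e c) env ≡ Semantics.value w e env ^ c
value-power w e zero    env = refl
value-power w e (suc c) env = cong (Semantics.value w e env *_) (value-power w e c env)

≐-refl : ∀ a → 0 < (1 ∸ (a ∸ a)) * (1 ∸ (a ∸ a))
≐-refl a rewrite ℕ.n∸n≡0 a = s≤s z≤n

≐-equal : ∀ a b → 0 < (1 ∸ (a ∸ b)) * (1 ∸ (b ∸ a)) → a ≡ b
≐-equal a b h = let (p , q) = *-positive⁻ (1 ∸ (a ∸ b)) _ h in ℕ.≤-antisym (below p) (below q)
  where
  below : ∀ {a b} → 0 < 1 ∸ (a ∸ b) → a ≤ b
  below {a} {b} p = ℕ.m∸n≡0⇒m≤n (ℕ.n≤0⇒n≡0 (ℕ.≤-pred (∸-positive⁻ p)))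

symbolValue-injective : ∀ s t → symbolValue s ≡ symbolValue t → s ≡ t
symbolValue-injective nothing      nothing      _ = refl
symbolValue-injective (just false) (just false) _ = refl
symbolValue-injective (just true)  (just true)  _ = refl
symbolValue-injective nothing      (just false) ()
symbolValue-injective nothing      (just true)  ()
symbolValue-injective (just false) nothing      ()
symbolValue-injective (just true)  nothing      ()
symbolValue-injective (just false) (just true)  ()
symbolValue-injective (just true)  (just false) ()

poly-mono : ∀ c {m n} → m ≤ n → poly c m ≤ poly c n
poly-mono c m≤n = ℕ.+-monoˡ-≤ c (ℕ.^-monoˡ-≤ c m≤n)

module Verification {L : Language} (np : NP L) where
  open NP np
  open Machine verifier using (states)
  open Tableaux verifier

  bools : List Bool
  bools = true ∷ false ∷ []

  bool∈ : ∀ b → b ∈ bools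
  bool∈ true  = here refl
  bool∈ false = there (here refl)

  symbols : List Symbol
  symbols = nothing ∷ just false ∷ just true ∷ []

  symbol∈ : ∀ s → s ∈ symbols
  symbol∈ nothing      = here refl
  symbol∈ (just false) = there (here refl)
  symbol∈ (just true)  = there (there (here refl))

  vectors : ∀ n → List (Vec Symbol n)
  vectors zero    = Vec.[] ∷ []
  vectors (suc n) = List.cartesianProductWith Vec._∷_ symbols (vectors n)

  vector∈ : ∀ {n} (v : Vec Symbol n) → v ∈ vectors n
  vector∈ Vec.[]      = here refl
  vector∈ (s Vec.∷ v) = ∈.∈-cartesianProductWith⁺ Vec._∷_ (symbol∈ s) (vector∈ v)

  assemble : Bool × Fin states → Vec Symbol tapes × Vec Symbol tapes × Vec Symbol tapes → Block
  assemble (o , q) (s , b , h) = block o q s b h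

  controls : List (Bool × Fin states)
  controls = List.cartesianProduct bools (List.allFin states)

  contents : List (Vec Symbol tapes × Vec Symbol tapes × Vec Symbol tapes)
  contents = List.cartesianProduct (vectors tapes) (List.cartesianProduct (vectors tapes) (vectors tapes))

  blocks : List Block
  blocks = List.cartesianProductWith assemble controls contents

  block∈ : ∀ b → b ∈ blocks
  block∈ (block o q s b h) = ∈.∈-cartesianProductWith⁺ assemble {xs = controls} {ys = contents} (∈.∈-cartesianProduct⁺ (bool∈ o) (∈.∈-allFin q))
    (∈.∈-cartesianProduct⁺ (vector∈ s) (∈.∈-cartesianProduct⁺ (vector∈ b) (vector∈ h)))

  -- The time is that for the longest admissible certificate. Shorter runs are extended to it by
  -- `run-mono`, so the board has one size for each input.
  certificateBound timeBound width positions : ∀ {n} → Expr n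
  certificateBound = powerOf len certExponent ⊕ num certExponent
  timeBound        = powerOf (len ⊕ certificateBound) timeExponent ⊕ num timeExponent
  width            = timeBound ⊕ num 2
  positions        = width ⊗ width

  constraint : (guard first second : Expr 1) {Rel : Block → Block → Set} → (∀ a b → Dec (Rel a b)) → Constraint Block
  constraint g e f {Rel} rel? = record { guard = g ; first = e ; second = f ; Rel = Rel ; rel? = rel? }

  unary : (guard position : Expr 1) {Property : Block → Set} → (∀ b → Dec (Property b)) → Constraint Block
  unary g e {Property} property? = constraint g e e {λ b _ → Property b} (λ b _ → property? b)

  s : Expr 1
  s = var zero

  inBoard inRow : Expr 1
  inBoard = (s ⊕ width) ⊕ num 1 ≺ positions
  inRow   = s ≺ width

  -- The relation of a constraint must not depend on the input word. The comparison with the word is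
  -- therefore moved into the guard, with one constraint for each of the three symbols.
  input₀-is input₊-is : Symbol → Constraint Block
  input₀-is v = unary (inRow ⊗ (bit (num 0) ≐ num (symbolValue v))) s (λ b → scanned b ! zero ≟ˢ v)
  input₊-is v = unary (inRow ⊗ (bit (s ⊕ num 1) ≐ num (symbolValue v))) s (λ b → behind b ! zero ≟ˢ v)

  constraints : List (Constraint Block)
  constraints
    = constraint (num 1) s (s ⊕ num 1) same-control?
    ∷ constraint inBoard s (s ⊕ width) step-here?
    ∷ constraint inBoard (s ⊕ num 1) (s ⊕ width) step-from-right?
    ∷ constraint inBoard s ((s ⊕ width) ⊕ num 1) step-from-left?
    ∷ unary inRow s initial?
    ∷ unary (num 1) (num 0) (λ b → origin b Bool.≟ true)
    ∷ unary (s ⊗ inRow) s (λ b → origin b Bool.≟ false)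
    ∷ unary (inRow ⊗ (certificateBound ≺ num 1)) s (λ b → scanned b ! suc zero ≟ˢ blank)
    -- `Y ≤ s + 1` written as a strict inequality.
    ∷ unary (inRow ⊗ (certificateBound ≺ s ⊕ num 2)) s (λ b → behind b ! suc zero ≟ˢ blank)
    ∷ constraint (s ⊕ num 1 ≺ width) s (s ⊕ num 1) shaped?
    ∷ unary (num 1) (timeBound ⊗ width) (λ b → accepting? (state b))
    ∷ input₀-is nothing ∷ input₀-is (just false) ∷ input₀-is (just true)
    ∷ input₊-is nothing ∷ input₊-is (just false) ∷ input₊-is (just true)
    ∷ []

  open Encoding blocks block∈ constraints positions using (module Rows)

  module _ (w : Word) where
    open Semantics w

    Y T₀ W N : ℕ
    Y  = poly certExponent (length w)
    T₀ = poly timeExponent (length w + Y)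
    W  = T₀ + 2
    N  = W * W

    certificateBound≡ : ∀ {n} env → value (certificateBound {n}) env ≡ Y
    certificateBound≡ env = cong (_+ certExponent) (value-power w len certExponent env)

    timeBound≡ : ∀ {n} env → value (timeBound {n}) env ≡ T₀
    timeBound≡ {n} env = cong (_+ timeExponent) (trans (value-power w (len ⊕ certificateBound {n}) timeExponent env)
      (cong (λ z → (length w + z) ^ timeExponent) (certificateBound≡ {n} env)))

    width≡ : ∀ {n} env → value (width {n}) env ≡ W
    width≡ {n} env = cong (_+ 2) (timeBound≡ {n} env)

    positions≡ : ∀ {n} env → value (positions {n}) env ≡ N
    positions≡ {n} env = cong₂ _*_ (width≡ {n} env) (width≡ {n} env)

    0<W : 0 < W
    0<W = ℕ.≤-trans (s≤s z≤n) (ℕ.m≤n+m 2 T₀)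

    0<N : 0 < N
    0<N = ℕ.*-mono-≤ 0<W 0<W

    W≤N : W ≤ N
    W≤N = ℕ.m≤m*n W W {{>-nonZero 0<W}}

    open Rows w N 0<N (positions≡ {1})

    at-width : ∀ p → at width p ≡ W
    at-width p = width≡ {1} (p ∷ [])

    Respects : (ℕ → Block) → Set₁
    Respects β = ∀ c → c ∈ constraints → Holds β c

    board⁺ : ∀ {p} → p + W + 1 < N → 0 < at inBoard p
    board⁺ {p} = ≺⁺ w ((s ⊕ width) ⊕ num 1) positions (p ∷ []) (cong (λ z → p + z + 1) (at-width p)) (positions≡ {1} (p ∷ []))

    board⁻ : ∀ {p} → 0 < at inBoard p → p + W + 1 < N
    board⁻ {p} = ≺⁻ w ((s ⊕ width) ⊕ num 1) positions (p ∷ []) (cong (λ z → p + z + 1) (at-width p)) (positions≡ {1} (p ∷ []))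

    row⁺ : ∀ {p} → p < W → 0 < at inRow p
    row⁺ {p} = ≺⁺ w s width (p ∷ []) refl (at-width p)

    row⁻ : ∀ {p} → 0 < at inRow p → p < W
    row⁻ {p} = ≺⁻ w s width (p ∷ []) refl (at-width p)

    module _ {β : ℕ → Block} (respects : Respects β) where

      respect : ∀ i → Holds β (List.lookup constraints i)
      respect i = respects (List.lookup constraints i) (∈.∈-lookup i)

      final-value : ∀ p → at (timeBound ⊗ width) p ≡ T₀ * W
      final-value p = cong₂ _*_ (timeBound≡ {1} (p ∷ [])) (at-width p)

      tableau-of : Tableau w T₀ Y β
      tableau-of = record
        { control   = λ p h → respect (# 0) p (earlier 1 h) (s≤s z≤n , earlier 1 h , h)
        ; here′     = λ p h → subst (λ z → StepHere (β p) (β (p + z))) (at-width p)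
            (respect (# 1) p (first< h) (board⁺ {p} h , first< h , subst (λ z → p + z < N) (sym (at-width p)) (earlier 1 h)))
        ; fromRight = λ p h → subst (λ z → StepFromRight (β (p + 1)) (β (p + z))) (at-width p)
            (respect (# 2) p (first< h) (board⁺ {p} h , ℕ.≤-<-trans (ℕ.+-monoˡ-≤ 1 (ℕ.m≤m+n p W)) h , subst (λ z → p + z < N) (sym (at-width p)) (earlier 1 h)))
        ; fromLeft  = λ p h → subst (λ z → StepFromLeft (β p) (β (p + z + 1))) (at-width p)
            (respect (# 3) p (first< h) (board⁺ {p} h , first< h , subst (λ z → p + z + 1 < N) (sym (at-width p)) h))
        ; start     = λ p h → respect (# 4) p (inside h) (row⁺ h , inside h , inside h)
        ; origin₀   = respect (# 5) 0 0<N (s≤s z≤n , 0<N , 0<N)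
        ; origin₊   = λ p 0<p h → respect (# 6) p (inside h) (*-positive 0<p (row⁺ h) , inside h , inside h)
        ; input₀    = λ p h → first-input p h (symbolAt 0 w) refl
        ; input₊    = λ p h → later-input p h (symbolAt (p + 1) w) refl
        ; short₀    = λ p h Y≤ → respect (# 7) p (inside h) (*-positive (row⁺ h) (≺⁺ w certificateBound (num 1) (p ∷ []) (certificateBound≡ {1} (p ∷ [])) refl (s≤s Y≤)) , inside h , inside h)
        ; short₊    = λ p h Y≤ → respect (# 8) p (inside h) (*-positive (row⁺ h) (≺⁺ w certificateBound (s ⊕ num 2) (p ∷ []) (certificateBound≡ {1} (p ∷ [])) refl
            (ℕ.≤-trans (s≤s Y≤) (ℕ.≤-reflexive (sym (ℕ.+-suc p 1))))) , inside h , inside h)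
        ; shape₊    = λ p h → respect (# 9) p (inside (earlier 1 h)) (≺⁺ w (s ⊕ num 1) width (p ∷ []) refl (at-width p) h , inside (earlier 1 h) , inside h)
        ; final     = subst (Accepting ∘ state ∘ β) (final-value 0) (respect (# 10) 0 0<N (s≤s z≤n , final< , final<))
        }
        where
        earlier : ∀ {a b} c → a + c < b → a < b
        earlier {a} c = ℕ.≤-<-trans (ℕ.m≤m+n a c)
        first< : ∀ {p} → p + W + 1 < N → p < N
        first< h = earlier W (earlier 1 h)
        inside : ∀ {p} → p < W → p < N
        inside h = ℕ.<-≤-trans h W≤N
        final< : at (timeBound ⊗ width) 0 < N
        final< = subst (_< N) (sym (final-value 0)) (ℕ.*-monoˡ-< W {{>-nonZero 0<W}} (ℕ.m<m+n T₀ (s≤s z≤n)))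
        guarded : ∀ i p v → symbolAt i w ≡ v → p < W → 0 < at inRow p * ((1 ∸ (symbolValue (symbolAt i w) ∸ symbolValue v)) * (1 ∸ (symbolValue v ∸ symbolValue (symbolAt i w))))
        guarded i p v refl h = *-positive (row⁺ h) (≐-refl (symbolValue (symbolAt i w)))
        first-input : ∀ p → p < W → ∀ v → symbolAt 0 w ≡ v → scanned (β p) ! zero ≡ v
        first-input p h nothing      eq = respect (# 11) p (inside h) (guarded 0 p _ eq h , inside h , inside h)
        first-input p h (just false) eq = respect (# 12) p (inside h) (guarded 0 p _ eq h , inside h , inside h)
        first-input p h (just true)  eq = respect (# 13) p (inside h) (guarded 0 p _ eq h , inside h , inside h)
        later-input : ∀ p → p < W → ∀ v → symbolAt (p + 1) w ≡ v → behind (β p) ! zero ≡ v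
        later-input p h nothing      eq = respect (# 14) p (inside h) (guarded (p + 1) p _ eq h , inside h , inside h)
        later-input p h (just false) eq = respect (# 15) p (inside h) (guarded (p + 1) p _ eq h , inside h , inside h)
        later-input p h (just true)  eq = respect (# 16) p (inside h) (guarded (p + 1) p _ eq h , inside h , inside h)

    module _ {β : ℕ → Block} (tableau : Tableau w T₀ Y β) where
      open Tableau tableau using (control; here′; fromRight; fromLeft; start; origin₀; origin₊; input₀; input₊; short₀; short₊; shape₊; final)

      respects-tableau : Respects β
      respects-tableau c = All.lookup {P = Holds β} {xs = constraints} (
          (λ p _ (_ , _ , h) → control p h)
        ∷ (λ p _ (g , _) → subst (λ z → StepHere (β p) (β (p + z))) (sym (at-width p)) (here′ p (board⁻ {p} g)))
        ∷ (λ p _ (g , _) → subst (λ z → StepFromRight (β (p + 1)) (β (p + z))) (sym (at-width p)) (fromRight p (board⁻ {p} g)))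
        ∷ (λ p _ (g , _) → subst (λ z → StepFromLeft (β p) (β (p + z + 1))) (sym (at-width p)) (fromLeft p (board⁻ {p} g)))
        ∷ (λ p _ (g , _) → start p (row⁻ {p} g))
        ∷ (λ _ _ _ → origin₀)
        ∷ (λ p _ (g , _) → origin₊ p (proj₁ (*-positive⁻ p _ g)) (row⁻ (proj₂ (*-positive⁻ p _ g))))
        ∷ (λ p _ (g , _) → short₀ p (row⁻ (proj₁ (both p g))) (ℕ.≤-pred (≺⁻ w certificateBound (num 1) (p ∷ []) (certificateBound≡ {1} (p ∷ [])) refl (proj₂ (both p g)))))
        ∷ (λ p _ (g , _) → short₊ p (row⁻ (proj₁ (both p g))) (ℕ.≤-pred (ℕ.≤-trans (≺⁻ w certificateBound (s ⊕ num 2) (p ∷ []) (certificateBound≡ {1} (p ∷ [])) refl (proj₂ (both p g)))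
            (ℕ.≤-reflexive (ℕ.+-suc p 1)))))
        ∷ (λ p _ (g , _) → shape₊ p (≺⁻ w (s ⊕ num 1) width (p ∷ []) refl (at-width p) g))
        ∷ (λ p _ _ → subst (Accepting ∘ state ∘ β) (sym (cong₂ _*_ (timeBound≡ {1} (p ∷ [])) (at-width p))) final)
        ∷ first-input nothing ∷ first-input (just false) ∷ first-input (just true)
        ∷ later-input nothing ∷ later-input (just false) ∷ later-input (just true)
        ∷ [])
        where
        both : ∀ p {b} → 0 < at inRow p * b → 0 < at inRow p × 0 < b
        both p = *-positive⁻ (at inRow p) _
        first-input : ∀ v → Holds β (input₀-is v)
        first-input v p _ (g , _) = trans (input₀ p (row⁻ (proj₁ (both p g)))) (symbolValue-injective (symbolAt 0 w) v (≐-equal (symbolValue (symbolAt 0 w)) _ (proj₂ (both p g))))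
        later-input : ∀ v → Holds β (input₊-is v)
        later-input v p _ (g , _) = trans (input₊ p (row⁻ (proj₁ (both p g)))) (symbolValue-injective (symbolAt (p + 1) w) v (≐-equal (symbolValue (symbolAt (p + 1) w)) _ (proj₂ (both p g))))

    accepted⇔tableau : L w ⇔ (∃[ β ] Respects β)
    accepted⇔tableau = mk⇔
      (λ l → let (y , y≤ , accepts) = Equivalence.to (correct w) l
                 module C = Complete w y T₀ Y y≤ (run-mono _ T₀ _ _ (poly-mono timeExponent (ℕ.+-monoʳ-≤ (length w) y≤)) accepts)
             in C.β , respects-tableau C.tableau)
      (λ (β , respects) → accepted-by {β} respects)
      where
      -- The tableau runs for the uniform time T₀, which may exceed the verifier's own bound for
      -- this y. The verifier halts within its bound, and extending that run to T₀ shows that its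
      -- answer was the accepting one.
      agree : ∀ y → length y ≤ Y → run verifier ⊥-elim T₀ w y ≡ just true → ∃[ b ] verdict w y ≡ just b → verdict w y ≡ just true
      agree y y≤ acc (b , eq) = trans eq (trans (sym (run-mono _ T₀ _ _ (poly-mono timeExponent (ℕ.+-monoʳ-≤ (length w) y≤)) eq)) acc)
      accepted-by : ∀ {β} → Respects β → L w
      accepted-by {β} respects = Equivalence.from (correct w) (S.certificate , S.certificate-length , agree S.certificate S.certificate-length S.accepted (halts w S.certificate))
        where module S = Sound (tableau-of {β} respects)

-- Printing the instance.

concatMap-loop : ∀ {A B : Set} (g : A → List B) n (f : ℕ → List A) → concatMap g (loop n f) ≡ loop n (concatMap g ∘ f)
concatMap-loop g zero    f = refl
concatMap-loop g (suc n) f = trans (List.concatMap-++ g (f n) (loop n f)) (cong (concatMap g (f n) ++_) (concatMap-loop g n f))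

concatMap-cong-∈ : ∀ {A B : Set} {f g : A → List B} xs → (∀ {x} → x ∈ xs → f x ≡ g x) → concatMap f xs ≡ concatMap g xs
concatMap-cong-∈ []       h = refl
concatMap-cong-∈ (x ∷ xs) h = cong₂ _++_ (h (here refl)) (concatMap-cong-∈ xs (h ∘ there))

encodeEntry : ∀ {d} → Vec ℚ d → Word
encodeEntry v = true ∷ encodeVec v

encodePoints-entries : ∀ {d} (vs : List (Vec ℚ d)) → encodePoints vs ≡ concatMap encodeEntry vs ++ false ∷ []
encodePoints-entries []       = refl
encodePoints-entries (v ∷ vs) = cong (true ∷_) (trans (cong (encodeVec v ++_) (encodePoints-entries vs)) (sym (List.++-assoc (encodeVec v) _ _)))

fractionWord : ℕ → ℕ → Word
fractionWord x t = (true ∷ printed x) ++ printed t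

zeros : ℕ → Word
zeros k = concatMap encodeℚ (Vec.toList (Vec.replicate k 0ℚ))

-- Opaque, like draw, because comparing the unfolded words is expensive.
opaque
  pointWord : ℕ → ℕ → ℕ → ℕ → Shape → Word
  pointWord k S X Y t = true ∷ (fractionWord (1 + S * X) (S * S ∸ 1) ++ (fractionWord (1 + S * Y) (S * S ∸ 1) ++
    (fractionWord (((S * S) * (S * S) + 3 + S * S * hp t) ∸ ((1 + S * X) * (1 + S * X) + (1 + S * Y) * (1 + S * Y) + S * S * hn t)) ((S * S) * (S * S) ∸ 1) ++ zeros k)))

-- Elements are counted from the end because loop runs downwards.
sequence : ∀ {A : Set} {n} → (ℕ → A → Code n) → List A → Code n
sequence g []       = emit []
sequence g (c ∷ cs) = g (length cs) c ▸ sequence g cs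

module _ (w : Word) where
  open Semantics w

  output-sequence : ∀ {A : Set} {n} d (g : ℕ → A → Code n) cs env → output (sequence g cs) env ≡ loop (length cs) λ κ → output (g κ (fromEnd d cs κ)) env
  output-sequence d g []       env = refl
  output-sequence d g (c ∷ cs) env = cong₂ _++_ (cong (λ z → output (g (length cs) z) env) (sym (fromEnd-last d c cs)))
    (trans (output-sequence d g cs env) (loop-cong (length cs) λ κ κ< → cong (λ z → output (g κ z) env) (sym (fromEnd-< d c cs κ<))))

  output-for : ∀ {n} (e : Expr n) (c : Code (suc n)) env {v} {f : ℕ → Word} → value e env ≡ v →
    (∀ i → i < v → output c (env ++ i ∷ []) ≡ f i) → output (for e c) env ≡ loop v f
  output-for e c env refl h = loop-cong (value e env) h

module Layout (k : ℕ) (rows cols : ∀ {n} → Expr n) where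

  size scale : ∀ {n} → Expr n
  size  = num 32 ⊗ (num 2 ⊕ (rows ⊕ cols))
  scale = num 32 ⊗ (size ⊗ size)

  numeratorOf : ∀ {n} → Expr n → Expr n
  numeratorOf x = num 1 ⊕ (scale ⊗ x)

  square fourth : ∀ {n} → Expr n
  square = scale ⊗ scale
  fourth = square ⊗ square

  fraction : ∀ {n} → Expr n → Expr n → Code n
  fraction x t = (emit (true ∷ []) ▸ print x) ▸ print t

  pointCode : ∀ {n} → Expr n → Expr n → Shape → Code n
  pointCode x y t = emit (true ∷ []) ▸ (fraction (numeratorOf x) (square ⊖ num 1) ▸ (fraction (numeratorOf y) (square ⊖ num 1) ▸
    (fraction (((fourth ⊕ num 3) ⊕ (square ⊗ num (hp t))) ⊖ (((numeratorOf x ⊗ numeratorOf x) ⊕ (numeratorOf y ⊗ numeratorOf y)) ⊕ (square ⊗ num (hn t)))) (fourth ⊖ num 1) ▸ emit (zeros k))))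

  opaque
    draw : ∀ {n} → Expr n → Expr n → Shape → Code n
    draw c r t = pointCode ((num 16 ⊗ c) ⊕ num (dx t)) ((num 16 ⊗ r) ⊕ num (dy t)) t

  ε-code : Code 0
  ε-code = fraction (num 1 ⊕ (scale ⊗ (num 220 ⊗ scale))) (fourth ⊖ num 1)

  odd even : ∀ {n} → Expr n → Expr n
  odd e  = num 1 ⊕ (num 2 ⊗ e)
  even e = num 2 ⊗ e

  i : Expr 1
  i = var zero

  i′ j : Expr 2
  i′ = var zero
  j  = var (suc zero)

  cellCode : Choice → Code 2
  cellCode c = draw (num 2 ⊕ even j) (odd i′) (choiceShape c)

  cellCodes : Code 2
  cellCodes = cellCode lp ▸ (cellCode ln ▸ (cellCode rp ▸ cellCode rn))

  cornersCode leftEndsCode rightEndsCode hgapsCode vgapsCode cellsCode : Code 0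
  cornersCode   = for (num 1 ⊕ rows) (for (num 1 ⊕ cols) (draw (odd j) (even i′) cornerShape))
  leftEndsCode  = for rows (draw (num 0) (odd i) leftShape)
  rightEndsCode = for rows (draw (num 2 ⊕ (num 2 ⊗ cols)) (odd i) rightShape)
  hgapsCode     = for rows (for (num 1 ⊕ cols) (draw (odd j) (odd i′) gapShape))
  vgapsCode     = for (rows ⊖ num 1) (for cols (draw (num 2 ⊕ even j) (num 2 ⊕ even i′) gapShape))
  cellsCode     = for rows (for cols cellCodes)

  axesWord : Word
  axesWord = concatMap encodeEntry (map axisVec (Axes.axes k))

  -- The sections appear in descending order, as in `loop 7 section`. `extras` stands for section 6,
  -- the only one that depends on the clauses.
  boardCode : Code 0 → Code 0
  boardCode extras = ((emit axesWord ▸ (extras ▸ (cellsCode ▸ (vgapsCode ▸ (hgapsCode ▸ (rightEndsCode ▸ (leftEndsCode ▸ cornersCode)))))))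
    ▸ emit (false ∷ [])) ▸ ε-code

  module _ (w : Word) (R C M S : ℕ) (M≡ : M ≡ 32 * (2 + (R + C))) (S≡ : S ≡ 32 * (M * M))
    (B : ℕ) (literals : ℕ → List ℕ) (literals-unique : ∀ i → Unique (literals i)) (literals< : ∀ i {j} → j ∈ literals i → j < C)
    (rows≡ : ∀ {n} env → Semantics.value w (rows {n}) env ≡ R) (cols≡ : ∀ {n} env → Semantics.value w (cols {n}) env ≡ C) where

    open Semantics w
    private
      col = Board.col k R C M S M≡ S≡ B literals literals-unique literals<
      row = Board.row k R C M S M≡ S≡ B literals literals-unique literals<
      posX = Board.posX k R C M S M≡ S≡ B literals literals-unique literals<
      posY = Board.posY k R C M S M≡ S≡ B literals literals-unique literals<
      heightNumerator = Board.heightNumerator k R C M S M≡ S≡ B literals literals-unique literals<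
      heightℚ = Board.heightℚ k R C M S M≡ S≡ B literals literals-unique literals<
      Bounded = Board.Bounded k R C M S M≡ S≡ B literals literals-unique literals<
      vec = Board.vec k R C M S M≡ S≡ B literals literals-unique literals<
      vec-def = Board.vec-def k R C M S M≡ S≡ B literals literals-unique literals<
      T₂ = Board.T₂ k R C M S M≡ S≡ B literals literals-unique literals<
      section = Board.section k R C M S M≡ S≡ B literals literals-unique literals<
      pts = Board.pts k R C M S M≡ S≡ B literals literals-unique literals<
      bounded-point = Board.bounded-point k R C M S M≡ S≡ B literals literals-unique literals<
      instanceOf = Board.instanceOf k R C M S M≡ S≡ B literals literals-unique literals<

    scale≡ : ∀ {n} env → value (scale {n}) env ≡ S
    scale≡ {n} env = trans (cong (λ z → 32 * (z * z)) (trans (cong (λ z → 32 * (2 + z)) (cong₂ _+_ (rows≡ {n} env) (cols≡ {n} env))) (sym M≡))) (sym S≡)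

    heightℚ-encoding : ∀ X Y t → Bounded X Y t → encodeℚ (heightℚ X Y t) ≡ fractionWord (heightNumerator X Y t) T₂
    heightℚ-encoding X Y t b with suc X ≤? M ×-dec suc Y ≤? M ×-dec hn t ≤? 64
    ... | yes _ = refl
    ... | no ¬b = contradiction b ¬b

    ptWord : Pt → Word
    ptWord p = pointWord k S (posX p) (posY p) (shapeOf p)

    opaque
      unfolding pointWord
      vec-encoding : ∀ p → Bounded (posX p) (posY p) (shapeOf p) → encodeEntry (vec p) ≡ ptWord p
      vec-encoding p b = trans (cong encodeEntry (vec-def p)) (cong (λ z → true ∷ (fractionWord (1 + S * posX p) (S * S ∸ 1) ++ (fractionWord (1 + S * posY p) (S * S ∸ 1) ++ (z ++ zeros k)))) (heightℚ-encoding (posX p) (posY p) (shapeOf p) b))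

    opaque
      unfolding pointWord draw
      output-draw : ∀ {n} (c r : Expr n) t env p → value c env ≡ col p → value r env ≡ row p → shapeOf p ≡ t → output (draw c r t) env ≡ ptWord p
      output-draw {n} c r t env p c≡ r≡ refl = trans (cong (λ z → pointWord k z (16 * value c env + dx t) (16 * value r env + dy t) t) (scale≡ {n} env))
        (cong₂ (λ x y → pointWord k S (16 * x + dx t) (16 * y + dy t) t) c≡ r≡)

    nested : ∀ {A B : Set} (g : A → List B) n n′ (h : ℕ → ℕ → List A) → concatMap g (loop n λ i → loop n′ (h i)) ≡ loop n λ i → loop n′ λ j → concatMap g (h i j)
    nested g n n′ h = trans (concatMap-loop g n _) (loop-cong n λ i _ → concatMap-loop g n′ (h i))

    output-grid : ∀ (e : Expr 0) (e′ : Expr 1) (c : Code 2) {v v′} {f : ℕ → ℕ → Word} → value e [] ≡ v → (∀ a → value e′ (a ∷ []) ≡ v′) →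
      (∀ a b → output c (a ∷ b ∷ []) ≡ f a b) → output (for e (for e′ c)) [] ≡ loop v λ a → loop v′ (f a)
    output-grid e e′ c e≡ e′≡ h = output-for w e (for e′ c) [] e≡ λ a _ → output-for w e′ c (a ∷ []) (e′≡ a) λ b _ → h a b

    single : ∀ {u v : Word} → u ≡ v → u ≡ v ++ []
    single eq = trans eq (sym (List.++-identityʳ _))

    corners-output : output cornersCode [] ≡ concatMap ptWord (section 0)
    corners-output = trans (output-grid (num 1 ⊕ rows) (num 1 ⊕ cols) (draw (odd j) (even i′) cornerShape) (cong suc (rows≡ {0} [])) (λ a → (cong suc (cols≡ {1} (a ∷ [])))) λ a b →
      single (output-draw (odd j) (even i′) cornerShape (a ∷ b ∷ []) (corner a b) refl refl refl)) (sym (nested ptWord (suc R) (suc C) λ a b → corner a b ∷ []))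

    leftEnds-output : output leftEndsCode [] ≡ concatMap ptWord (section 1)
    leftEnds-output = trans (output-for w rows (draw (num 0) (odd i) leftShape) [] (rows≡ {0} []) λ a _ → single (output-draw (num 0) (odd i) leftShape (a ∷ []) (leftEnd a) refl refl refl))
      (sym (concatMap-loop ptWord R λ a → leftEnd a ∷ []))

    rightEnds-output : output rightEndsCode [] ≡ concatMap ptWord (section 2)
    rightEnds-output = trans (output-for w rows (draw (num 2 ⊕ (num 2 ⊗ cols)) (odd i) rightShape) [] (rows≡ {0} []) λ a _ → single (output-draw (num 2 ⊕ (num 2 ⊗ cols)) (odd i) rightShape (a ∷ []) (rightEnd a)
      (cong (λ z → 2 + 2 * z) (cols≡ {1} (a ∷ []))) refl refl)) (sym (concatMap-loop ptWord R λ a → rightEnd a ∷ []))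

    hgaps-output : output hgapsCode [] ≡ concatMap ptWord (section 3)
    hgaps-output = trans (output-grid rows (num 1 ⊕ cols) (draw (odd j) (odd i′) gapShape) (rows≡ {0} []) (λ a → (cong suc (cols≡ {1} (a ∷ [])))) λ a b →
      single (output-draw (odd j) (odd i′) gapShape (a ∷ b ∷ []) (hgap a b) refl refl refl)) (sym (nested ptWord R (suc C) λ a b → hgap a b ∷ []))

    vgaps-output : output vgapsCode [] ≡ concatMap ptWord (section 4)
    vgaps-output = trans (output-grid (rows ⊖ num 1) cols (draw (num 2 ⊕ even j) (num 2 ⊕ even i′) gapShape) (cong (_∸ 1) (rows≡ {0} [])) (λ a → (cols≡ {1} (a ∷ []))) λ a b →
      single (output-draw (num 2 ⊕ even j) (num 2 ⊕ even i′) gapShape (a ∷ b ∷ []) (vgap a b) refl refl refl)) (sym (nested ptWord (R ∸ 1) C λ a b → vgap a b ∷ []))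

    cells-output : output cellsCode [] ≡ concatMap ptWord (section 5)
    cells-output = trans (output-grid rows cols cellCodes (rows≡ {0} []) (λ a → (cols≡ {1} (a ∷ []))) λ a b →
        cong₂ _++_ (cell-output a b lp) (cong₂ _++_ (cell-output a b ln) (cong₂ _++_ (cell-output a b rp) (single (cell-output a b rn)))))
      (sym (nested ptWord R C λ a b → cell a b lp ∷ cell a b ln ∷ cell a b rp ∷ cell a b rn ∷ []))
      where
      cell-output : ∀ a b c → output (draw (num 2 ⊕ even j) (odd i′) (choiceShape c)) (a ∷ b ∷ []) ≡ ptWord (cell a b c)
      cell-output a b c = output-draw (num 2 ⊕ even j) (odd i′) (choiceShape c) (a ∷ b ∷ []) (cell a b c) refl refl refl

    entries : List (Vec ℚ (3 + k)) → Word
    entries = concatMap encodeEntry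

    ptsWord : entries (map vec pts) ≡ concatMap ptWord pts
    ptsWord = trans (List.concatMap-map encodeEntry vec pts) (concatMap-cong-∈ pts λ {p} p∈ → vec-encoding p (bounded-point p (Board.inRange k R C M S M≡ S≡ B literals literals-unique literals< p∈)))

    board-output : ∀ extras → output extras [] ≡ concatMap ptWord (section 6) → output (boardCode extras) [] ≡ SearchProblem.encodeInstance (GRMR (3 + k)) instanceOf
    board-output extras extras≡ = cong₂ _++_ (sym (trans (encodePoints-entries (map axisVec (Axes.axes k) ++ map vec pts))
        (cong (_++ false ∷ []) (trans (List.concatMap-++ encodeEntry (map axisVec (Axes.axes k)) (map vec pts)) (cong (axesWord ++_) (trans ptsWord sections))))))
      (cong (λ z → fractionWord (1 + z * (220 * z)) ((z * z) * (z * z) ∸ 1)) (scale≡ {0} []))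
      where
      sections : concatMap ptWord pts ≡ output extras [] ++ (output cellsCode [] ++ (output vgapsCode [] ++ (output hgapsCode [] ++ (output rightEndsCode [] ++ (output leftEndsCode [] ++ output cornersCode [])))))
      sections = trans (concatMap-loop ptWord 7 section) (cong₂ _++_ (sym extras≡) (cong₂ _++_ (sym cells-output) (cong₂ _++_ (sym vgaps-output) (cong₂ _++_ (sym hgaps-output)
        (cong₂ _++_ (sym rightEnds-output) (cong₂ _++_ (sym leftEnds-output) (trans (List.++-identityʳ _) (sym corners-output))))))))

-- The reduction from an arbitrary language in NP.

module Reduction (k : ℕ) {L : Language} (np : NP L) where
  open Verification np
  open Encoding blocks block∈ constraints positions

  rows cols : ∀ {n} → Expr n
  rows = positions ⊕ (positions ⊗ num κ#)
  cols = positions ⊗ num σ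

  open Layout k rows cols

  -- The second literal is printed only if its column differs from the first, to agree with
  -- `distinctPair`. The columns depend on the position, so the comparison is made when the code
  -- runs.
  clauseCode : ℕ → Clause → Code 1
  clauseCode κ (u , v) = literal u ▸ ifNonzero ((u ⊖ v) ⊕ (v ⊖ u)) (literal v) (emit [])
    where
    literal : Expr 1 → Code 1
    literal e = draw (num 2 ⊕ even e) (odd (positions ⊕ ((var zero ⊗ num κ#) ⊕ num κ))) (choiceShape bn)

  valueCode : Code 2
  valueCode = draw (num 2 ⊕ even ((var zero ⊗ num σ) ⊕ var (suc zero))) (odd (var zero)) (choiceShape bp)

  -- The negative rows come first because they have the larger row numbers and `loop` descends.
  extrasCode : Code 0
  extrasCode = for positions (sequence clauseCode clauses) ▸ for positions (for (num σ) valueCode)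

  quotaExpr : Expr 0
  quotaExpr = num (length (Axes.axes k)) ⊕ ((rows ⊗ (cols ⊗ num 1)) ⊕ ((rows ⊗ num 1) ⊕ ((rows ⊗ num 1) ⊕ ((num 1 ⊕ rows) ⊗ ((num 1 ⊕ cols) ⊗ num 1)))))

  module _ (w : Word) where
    open Semantics w
    open Rows w (N w) (0<N w) (positions≡ w {1}) using (R; C; at; positive; negative; distinctPair; literals; literals-positive; literals-negative; literals-unique; literals<; encoded)

    rows≡ : ∀ {n} env → value (rows {n}) env ≡ R
    rows≡ {n} env = cong (λ z → z + z * κ#) (positions≡ w {n} env)

    cols≡ : ∀ {n} env → value (cols {n}) env ≡ C
    cols≡ {n} env = cong (_* σ) (positions≡ w {n} env)

    module Drawing (M S : ℕ) (M≡ : M ≡ 32 * (2 + (R + C))) (S≡ : S ≡ 32 * (M * M)) where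
      section = Board.section k R C M S M≡ S≡ (N w) literals literals-unique literals<
      both = Board.both k R C M S M≡ S≡ (N w) literals literals-unique literals<
      both-cases = Board.both-cases k R C M S M≡ S≡ (N w) literals literals-unique literals<
      instanceOf = Board.instanceOf k R C M S M≡ S≡ (N w) literals literals-unique literals<
      quota = Board.quota k R C M S M≡ S≡ (N w) literals literals-unique literals<

      word : Pt → Word
      word = ptWord w R C M S M≡ S≡ (N w) literals literals-unique literals< rows≡ cols≡

      drawn : ∀ {n} (c r : Expr n) t env p → _
      drawn {n} = output-draw w R C M S M≡ S≡ (N w) literals literals-unique literals< rows≡ cols≡ {n}

      both-positive : ∀ {i} → i < N w → both i ≡ bp
      both-positive {i} i< = [ proj₂ , (λ (i≮ , _) → contradiction i< i≮) ]′ (both-cases i)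

      both-negative : ∀ i → both (N w + i) ≡ bn
      both-negative i = [ (λ (i< , _) → contradiction i< (ℕ.m+n≮m (N w) i)) , proj₂ ]′ (both-cases (N w + i))

      row-word : ℕ → Word
      row-word i = concatMap word (map (λ l → cell i l (both i)) (literals i))

      words : ∀ {i ch ls} → both i ≡ ch → literals i ≡ ls → row-word i ≡ concatMap (λ l → word (cell i l ch)) ls
      words {i} {ls = ls} refl refl = List.concatMap-map word (λ l → cell i l (both i)) ls

      positive-word : ∀ s → s < N w → row-word s ≡ loop σ λ a → word (cell s (s * σ + a) bp)
      positive-word s s< = trans (words (both-positive s<) (literals-positive s s<)) (trans (concatMap-loop (λ l → word (cell s l bp)) σ λ a → s * σ + a ∷ [])
        (loop-cong σ λ a _ → List.++-identityʳ (word (cell s (s * σ + a) bp))))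

      negative-word : ∀ s κ → s < N w → κ < κ# → row-word (N w + (s * κ# + κ)) ≡ output (clauseCode κ (clauseAt κ)) (s ∷ [])
      negative-word s κ s< κ< = trans (words (both-negative (s * κ# + κ)) (literals-negative s κ s< κ<)) (pair (proj₁ (clauseAt κ)) (proj₂ (clauseAt κ)))
        where
        n : ℕ
        n = N w + (s * κ# + κ)
        literal-word : ∀ u → output (draw (num 2 ⊕ even u) (odd (positions ⊕ ((var zero ⊗ num κ#) ⊕ num κ))) (choiceShape bn)) (s ∷ []) ≡ word (cell n (at u s) bn)
        literal-word u = drawn {1} (num 2 ⊕ even u) (odd (positions ⊕ ((var zero ⊗ num κ#) ⊕ num κ))) (choiceShape bn) (s ∷ []) (cell n (at u s) bn) refl
          (cong (λ z → 1 + 2 * (z + (s * κ# + κ))) (positions≡ w {1} (s ∷ []))) refl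
        pair : ∀ u v → concatMap (λ l → word (cell n l bn)) (distinctPair (at u s) (at v s)) ≡ output (clauseCode κ (u , v)) (s ∷ [])
        pair u v = cong₂ _++_ (sym (literal-word u)) (rest (0 <ᵇ (at u s ∸ at v s) + (at v s ∸ at u s)))
          where
          rest : ∀ b → concatMap (λ l → word (cell n l bn)) (if b then at v s ∷ [] else []) ≡
            (if b then output (draw (num 2 ⊕ even v) (odd (positions ⊕ ((var zero ⊗ num κ#) ⊕ num κ))) (choiceShape bn)) (s ∷ []) else [])
          rest true  = trans (List.++-identityʳ _) (sym (literal-word v))
          rest false = refl

      extras-output : output extrasCode [] ≡ concatMap word (section 6)
      extras-output = sym (trans (concatMap-loop word R λ r → map (λ l → cell r l (both r)) (literals r)) (trans (loop-+ (N w) (N w * κ#) row-word) (cong₂ _++_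
        (trans (loop-* (N w) κ# λ r → row-word (N w + r)) (sym (output-for w positions (sequence clauseCode clauses) [] (positions≡ w {0} []) λ s s< →
          trans (output-sequence w junkClause clauseCode clauses (s ∷ [])) (loop-cong κ# λ κ κ< → sym (negative-word s κ s< κ<)))))
        (sym (output-for w positions (for (num σ) valueCode) [] (positions≡ w {0} []) λ s s< → trans
          (output-for w (num σ) valueCode (s ∷ []) refl λ a _ → drawn {2} (num 2 ⊕ even ((var zero ⊗ num σ) ⊕ var (suc zero))) (odd (var zero)) (choiceShape bp) (s ∷ a ∷ []) (cell s (s * σ + a) bp) refl refl refl)
          (sym (positive-word s s<)))))))

      encodes : output (boardCode extrasCode) [] ≡ SearchProblem.encodeInstance (GRMR (3 + k)) instanceOf
      encodes = board-output w R C M S M≡ S≡ (N w) literals literals-unique literals< rows≡ cols≡ extrasCode extras-output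

      quota≡ : value quotaExpr [] ≡ quota
      quota≡ = cong₂ (λ r c → length (Axes.axes k) + (r * (c * 1) + (r * 1 + (r * 1 + suc r * (suc c * 1))))) (rows≡ {0} []) (cols≡ {0} [])

      decides : ∀ Q → IsMinimumRegretSet instanceOf Q → L w ⇔ (List⁺.length Q ≤ value quotaExpr [])
      decides Q minimum = mk⇔
        (λ l → subst (List⁺.length Q ≤_) (sym quota≡) (Equivalence.to (encoded k M S M≡ S≡ Q minimum) (Equivalence.to (accepted⇔tableau w) l)))
        (λ small → Equivalence.from (accepted⇔tableau w) (Equivalence.from (encoded k M S M≡ S≡ Q minimum) (subst (List⁺.length Q ≤_) quota≡ small)))

    opaque
      -- The board uses only their two equations, so hiding the bodies costs nothing and keeps these
      -- numbers from being unfolded.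
      M₀ S₀ : ℕ
      M₀ = 32 * (2 + (R + C))
      S₀ = 32 * (M₀ * M₀)

      M₀≡ : M₀ ≡ 32 * (2 + (R + C))
      M₀≡ = refl

      S₀≡ : S₀ ≡ 32 * (M₀ * M₀)
      S₀≡ = refl

    board : GRMRInstance (3 + k)
    board = Board.instanceOf k R C M₀ S₀ M₀≡ S₀≡ (N w) literals literals-unique literals<

  reduction : L ≤ᵀ GRMR (3 + k)
  reduction = reduces L (boardCode extrasCode) quotaExpr board
    (λ w → Drawing.encodes w (M₀ w) (S₀ w) (M₀≡ w) (S₀≡ w))
    (λ w → Drawing.decides w (M₀ w) (S₀ w) (M₀≡ w) (S₀≡ w))

theorem1 : ∀ (d : ℕ) → 3 ≤ d → NPHard (GRMR d)
theorem1 (suc (suc (suc k))) (s≤s (s≤s (s≤s z≤n))) L np = Reduction.reduction k np
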